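{- Let $c \in \mathbb{Z} \setminus \{0,-1\}$, $r = 1/c$, and $f_r(x) = x^2 + r$. Then $f_r^n(x)$ is irreducible over $\mathbb{Q}$ for all $n \ge 1$ if $c$ satisfies one of the following conditions: (1) $-c$ is not the square of an integer and $c < 0$; (2) neither $-c$ nor $c+1$ is the square of an integer, and $c \equiv -1 \pmod p$ for some prime $p \equiv 3 \pmod 4$; (3) neither $-c$ nor $c+1$ is the square of an integer, and $c$ satisfies at least one of the following congruences: $c \equiv 1,2 \pmod 3$; $c \equiv 3 \pmod 4$; $c \equiv 2,3 \pmod 5$; $c \equiv 1,2,5,6 \pmod 7$; $c \equiv 1 \pmod 8$; $c \equiv 1,3,5,7,10 \pmod{11}$; $c \equiv 3,4,5,6,8,11 \pmod{13}$; $c \equiv 6,10,14,15 \pmod{17}$; $c \equiv 1,4,9,11,12,13,15,16,18 \pmod{19}$; $c \equiv 6,10,12,18,20,22 \pmod{23}$; $c \equiv 2,12,14,17,18,27 \pmod{29}$; $c \equiv 1,10,13,16,22,27,30 \pmod{31}$; $c \equiv 6,18,23,31,32,35 \pmod{37}$; $c \equiv 7,8,11,19,25,28,35,36 \pmod{41}$; $c \equiv 1,2,4,5,9,14,15,21,27,33,37,42 \pmod{43}$; $c \equiv 6,7,9,10,24,25,28,33,46 \pmod{47}$; $c \equiv 5,18,21,23,26,30,37,40,43,45,46,47 \pmod{53}$; $c \equiv 10,14,16,29,37,47,55,57,58 \pmod{59}$; $c \equiv 2,3,11,13,15,27,30,32,34,40,45,50 \pmod{61}$; $c \equiv 10,15,20,32,33,38,41,49,51,53,55,66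 \pmod{67}$; $c \equiv 4,10,49,51,53,61,70 \pmod{71}$; $c \equiv 1,3,35,43,44,50,51,71 \pmod{73}$; $c \equiv 3,12,25,32,36,58,78 \pmod{79}$; $c \equiv 15,16,19,23,25,29,31,37,41,44,51,56,59,68,71,82 \pmod{83}$; $c \equiv 13,25,49,63 \pmod{89}$; $c \equiv 3,9,21,53,59,79,89 \pmod{97}$; (4) $-c$ is not the square of an integer and $c$ is odd; (5) $-c$ is not the square of an integer, $c$ is not of the form $4m^2(m^2-1)$ with $m \in \mathbb{Z}$, and \[ \frac{\prod_{p : 2 \nmid v_p(c)} p^{v_p(c)}}{\prod_{p : 2 \mid v_p(c)} p^{v_p(c)}} > \frac{1.15}{|c|^{1/30}} \] (products over primes $p$); this holds in particular whenever $c$ is squarefree; (6) $c = k^2$ for some integer $k \ge 2$ and \[ \frac{\prod_{p : p \not\equiv 1 \bmod 4} p^{v_p(c)}}{\prod_{p : p \equiv 1 \bmod 4} p^{v_p(c)}} > \frac{1.15}{|c|^{1/30}} ; \] (7) $c$ is not of the form $4m^2(m^2-1)$ with $m \in \mathbb{Z}$, and $1 \le c \le 10^{1000}$.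
   Context: $f_r^n$ denotes the $n$-th iterate of $f_r$. Irreducibility is over $\mathbb{Q}$. $v_p$ denotes the $p$-adic valuation. -}

module Defs where

open import Data.Bool using (Bool; true; false; _∧_; if_then_else_; not)
open import Data.Nat as ℕ using (ℕ; zero; suc; _≡ᵇ_)
open import Data.Nat.Divisibility using (_∣?_)
open import Data.Nat.Primality using (Prime; prime?)
open import Data.Integer as ℤ using (ℤ; +_; -[1+_]; ∣_∣)
open import Data.Integer.Divisibility using () renaming (_∣_ to _∣ℤ_)
open import Data.Rational as ℚ using (ℚ; 0ℚ)
open import Data.List using (List; []; _∷_; map; upTo; [_])
open import Data.Nat.ListAction using (product)
open import Data.List.Relation.Unary.Any using (Any)
open import Data.Product using (Σ; ∃; _×_; _,_)
open import Data.Sum using (_⊎_)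
open import Relation.Nullary using (¬_; does; yes; no)
open import Relation.Binary.PropositionalEquality using (_≡_; _≢_)

-- Polynomials over ℚ as coefficient lists (constant term first).

Poly : Set
Poly = List ℚ

coeff : Poly → ℕ → ℚ
coeff []       _       = 0ℚ
coeff (a ∷ p)  zero    = a
coeff (a ∷ p)  (suc i) = coeff p i

-- equality of polynomials (coefficientwise; trailing zeros irrelevant)
_≈ₚ_ : Poly → Poly → Set
p ≈ₚ q = ∀ i → coeff p i ≡ coeff q i

addP : Poly → Poly → Poly
addP []      q       = q
addP p       []      = p
addP (a ∷ p) (b ∷ q) = (a ℚ.+ b) ∷ addP p q

mulP : Poly → Poly → Poly
mulP []      q = []
mulP (a ∷ p) q = addP (map (a ℚ.*_) q) (0ℚ ∷ mulP p q)

NonConstant : Poly → Set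
NonConstant p = Σ ℕ λ i → coeff p (suc i) ≢ 0ℚ

-- irreducible over the field ℚ: non-zero non-unit (i.e. non-constant),
-- and in every factorisation one factor is a unit (a constant).
Irreducible : Poly → Set
Irreducible f = NonConstant f
              × (∀ g h → f ≈ₚ mulP g h → ¬ NonConstant g ⊎ ¬ NonConstant h)

iterF : ℚ → ℕ → Poly
iterF r zero    = 0ℚ ∷ ℚ.1ℚ ∷ []
iterF r (suc n) = addP (mulP (iterF r n) (iterF r n)) [ r ]

-- r = 1/c  (value at c = 0 is irrelevant: c ≠ 0 is assumed)
recip : ℤ → ℚ
recip (+ zero)  = 0ℚ
recip (+ suc n) = (+ 1) ℚ./ suc n
recip -[1+ n ]  = ℚ.- ((+ 1) ℚ./ suc n)

IsSquare : ℤ → Set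
IsSquare z = ∃ λ (k : ℤ) → z ≡ k ℤ.* k

SpecialForm : ℤ → Set
SpecialForm c = ∃ λ (m : ℤ) → c ≡ (+ 4) ℤ.* (m ℤ.* m) ℤ.* (m ℤ.* m ℤ.- ℤ.1ℤ)

-- p-adic valuation.  valAux q f n = v_p(n) for p = q + 2, computed with
-- fuel f (fuel n suffices, since v_p(n) < n for n ≥ 1); v_p(0) := 0.

valAux : ℕ → ℕ → ℕ → ℕ
valAux q zero    n       = 0
valAux q (suc f) zero    = 0
valAux q (suc f) (suc m) with suc (suc q) ∣? suc m
... | yes _ = suc (valAux q f (suc m ℕ./ suc (suc q)))
... | no  _ = 0

-- v_p(n) for p ≥ 2 (v_0, v_1 are never used)
v : ℕ → ℕ → ℕ
v (suc (suc q)) n = valAux q n n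
v _             n = 0

-- ∏ over primes p with sel p (v_p n) of p^(v_p n).  Every prime p with
-- v_p(n) > 0 satisfies p ≤ n, so ranging p over 2 .. n+1 covers all
-- non-trivial factors (all other factors equal p^0 = 1).
primeProd : (ℕ → ℕ → Bool) → ℕ → ℕ
primeProd sel n = product (map factor (upTo n))
  where
  factor : ℕ → ℕ
  factor q = if does (prime? (suc (suc q))) ∧ sel (suc (suc q)) (v (suc (suc q)) n)
             then suc (suc q) ℕ.^ v (suc (suc q)) n else 1

oddV : ℕ → ℕ → Bool
oddV p e = e ℕ.% 2 ≡ᵇ 1

evenV : ℕ → ℕ → Bool
evenV p e = e ℕ.% 2 ≡ᵇ 0

not1mod4 : ℕ → ℕ → Bool
not1mod4 p e = not (p ℕ.% 4 ≡ᵇ 1)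

is1mod4 : ℕ → ℕ → Bool
is1mod4 p e = p ℕ.% 4 ≡ᵇ 1

-- A / B > 1.15 / |c|^(1/30)  with A, B, |c| > 0 is equivalent to
-- 115^30 * B^30 < 100^30 * A^30 * |c|   (raise to the 30th power).
RatioBound : ℕ → ℕ → ℕ → Set
RatioBound A B n = 115 ℕ.^ 30 ℕ.* B ℕ.^ 30 ℕ.< 100 ℕ.^ 30 ℕ.* A ℕ.^ 30 ℕ.* n

table : List (ℕ × List ℕ)
table =
    (3 , 1 ∷ 2 ∷ [])
  ∷ (4 , 3 ∷ [])
  ∷ (5 , 2 ∷ 3 ∷ [])
  ∷ (7 , 1 ∷ 2 ∷ 5 ∷ 6 ∷ [])
  ∷ (8 , 1 ∷ [])
  ∷ (11 , 1 ∷ 3 ∷ 5 ∷ 7 ∷ 10 ∷ [])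
  ∷ (13 , 3 ∷ 4 ∷ 5 ∷ 6 ∷ 8 ∷ 11 ∷ [])
  ∷ (17 , 6 ∷ 10 ∷ 14 ∷ 15 ∷ [])
  ∷ (19 , 1 ∷ 4 ∷ 9 ∷ 11 ∷ 12 ∷ 13 ∷ 15 ∷ 16 ∷ 18 ∷ [])
  ∷ (23 , 6 ∷ 10 ∷ 12 ∷ 18 ∷ 20 ∷ 22 ∷ [])
  ∷ (29 , 2 ∷ 12 ∷ 14 ∷ 17 ∷ 18 ∷ 27 ∷ [])
  ∷ (31 , 1 ∷ 10 ∷ 13 ∷ 16 ∷ 22 ∷ 27 ∷ 30 ∷ [])
  ∷ (37 , 6 ∷ 18 ∷ 23 ∷ 31 ∷ 32 ∷ 35 ∷ [])
  ∷ (41 , 7 ∷ 8 ∷ 11 ∷ 19 ∷ 25 ∷ 28 ∷ 35 ∷ 36 ∷ [])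
  ∷ (43 , 1 ∷ 2 ∷ 4 ∷ 5 ∷ 9 ∷ 14 ∷ 15 ∷ 21 ∷ 27 ∷ 33 ∷ 37 ∷ 42 ∷ [])
  ∷ (47 , 6 ∷ 7 ∷ 9 ∷ 10 ∷ 24 ∷ 25 ∷ 28 ∷ 33 ∷ 46 ∷ [])
  ∷ (53 , 5 ∷ 18 ∷ 21 ∷ 23 ∷ 26 ∷ 30 ∷ 37 ∷ 40 ∷ 43 ∷ 45 ∷ 46 ∷ 47 ∷ [])
  ∷ (59 , 10 ∷ 14 ∷ 16 ∷ 29 ∷ 37 ∷ 47 ∷ 55 ∷ 57 ∷ 58 ∷ [])
  ∷ (61 , 2 ∷ 3 ∷ 11 ∷ 13 ∷ 15 ∷ 27 ∷ 30 ∷ 32 ∷ 34 ∷ 40 ∷ 45 ∷ 50 ∷ [])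
  ∷ (67 , 10 ∷ 15 ∷ 20 ∷ 32 ∷ 33 ∷ 38 ∷ 41 ∷ 49 ∷ 51 ∷ 53 ∷ 55 ∷ 66 ∷ [])
  ∷ (71 , 4 ∷ 10 ∷ 49 ∷ 51 ∷ 53 ∷ 61 ∷ 70 ∷ [])
  ∷ (73 , 1 ∷ 3 ∷ 35 ∷ 43 ∷ 44 ∷ 50 ∷ 51 ∷ 71 ∷ [])
  ∷ (79 , 3 ∷ 12 ∷ 25 ∷ 32 ∷ 36 ∷ 58 ∷ 78 ∷ [])
  ∷ (83 , 15 ∷ 16 ∷ 19 ∷ 23 ∷ 25 ∷ 29 ∷ 31 ∷ 37 ∷ 41 ∷ 44 ∷ 51 ∷ 56 ∷ 59 ∷ 68 ∷ 71 ∷ 82 ∷ [])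
  ∷ (89 , 13 ∷ 25 ∷ 49 ∷ 63 ∷ [])
  ∷ (97 , 3 ∷ 9 ∷ 21 ∷ 53 ∷ 59 ∷ 79 ∷ 89 ∷ [])
  ∷ []

TableCongruence : ℤ → Set
TableCongruence c = Any (λ { (m , rs) → Any (λ a → (+ m) ∣ℤ (c ℤ.- (+ a))) rs }) table

Cond1 Cond2 Cond3 Cond4 Cond5 Cond6 Cond7 : ℤ → Set
Cond1 c = ¬ IsSquare (ℤ.- c) × c ℤ.< ℤ.0ℤ
Cond2 c = ¬ IsSquare (ℤ.- c) × ¬ IsSquare (c ℤ.+ ℤ.1ℤ)
        × (∃ λ p → Prime p × p ℕ.% 4 ≡ 3 × (+ p) ∣ℤ (c ℤ.+ ℤ.1ℤ))
Cond3 c = ¬ IsSquare (ℤ.- c) × ¬ IsSquare (c ℤ.+ ℤ.1ℤ) × TableCongruence c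
Cond4 c = ¬ IsSquare (ℤ.- c) × ¬ ((+ 2) ∣ℤ c)
Cond5 c = ¬ IsSquare (ℤ.- c) × ¬ SpecialForm c
        × RatioBound (primeProd oddV ∣ c ∣) (primeProd evenV ∣ c ∣) ∣ c ∣
Cond6 c = (∃ λ (k : ℤ) → (+ 2) ℤ.≤ k × c ≡ k ℤ.* k)
        × RatioBound (primeProd not1mod4 ∣ c ∣) (primeProd is1mod4 ∣ c ∣) ∣ c ∣
Cond7 c = ¬ SpecialForm c × ℤ.1ℤ ℤ.≤ c × c ℤ.≤ + (10 ℕ.^ 1000)

-- Write x₀ = 0 and let xₖ₊₁ be a square root of xₖ - r, so that xₙ is a root of fⁿ. Then fⁿ is irreducible as
-- soon as no xₖ - r with k < n is a square in ℚ(xₖ). Taking norms, a square root at a level k ≥ 2 yields one of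
-- fᵐ(0) - x₂ (or x₂ - r) in ℚ(x₂), and then a rational square fⁿ(0) with n ≥ 3. At level 1 the coordinates of a
-- square root give c = 4m²(m²-1).
--
-- For c < 0 the critical orbit is negative. For c > 0 write fⁿ(0) = aₙ / c^(2^(n-1)), where aₙ = aₙ₋₁² + c^N and
-- N = 2^(n-1) - 1. If aₙ = b², the coprime factors of c^N = (b - aₙ₋₁)(b + aₙ₋₁) are N-th powers up to powers of 2.
--   * c odd: the two N-th powers are too far apart.
--   * Since aₙ = a_d · t with t prime to a_d when d ∣ n, a square aₙ forces a square a_d for every d ∣ n.
--   * n = 3: this gives a coprime solution of A³ + B³ + 2C³ = 2ABC, impossible by a descent through ℤ[ω].
--   * The residue conditions exclude the remaining odd n, and even n reduces to a₂ = c + 1.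
--   * c ≤ 10^1000: c = uw with w^N = 4u^N ± 4aₙ₋₁, so w/u approximates 4^(1/N) with an error that is incompatible
--     with its continued fraction; it suffices to treat n = 4 and prime n < 1670.
--   * c > 10^1000: the coordinates of a square root of fᵐ(0) - x₂ are controlled by integers satisfying two quartic
--     equations, in which the selected prime powers of c must divide a quantity that is too small.
module Submission where

-- For large even c the term aₙ itself yields no contradiction here, so the descent by norms stops
-- at ℚ(x₂), where a square root has two rational coordinates worth keeping. Each is, after scaling
-- by a power of c, a root of a monic integral quartic, hence an integer. Let P be the product of
-- the selected prime powers of c, M = 2^(k+1) - 1 with k ≥ 1, and x the size of the first integer.
-- The quartics force P^(2M) to divide a number of size O(x²), and eliminating the auxiliary
-- quantities gives P^(16M) = O(c^(6M+5)). The hypothesis on the ratio gives P > c^(29/60), where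
-- 29/60 = (1 - 1/30)/2. The tight case is M = 3, where 29/60 has to exceed 23/48. The gap is
-- narrow, so the constants are beaten only beyond an explicit size of c, and the range below needs
-- the computation. Index 2 is the weak point of the reduction to divisors, since a₂ = c + 1 can be
-- a square. Hence conditions 2 and 3 exclude this by hypothesis, while the computation must treat
-- index 4 on its own. Index 3 is settled for all even c at once because its equation lies on one
-- fixed cubic, independent of c.

module Fields where

  open import Defs
  open import Algebra using (CommutativeRing)
  open import Algebra.Structures using (IsCommutativeRing)
  import Algebra.Properties.Ring as RingProperties
  import Algebra.Solver.Ring.NaturalCoefficients.Default as SemiringSolver
  import Data.Nat as ℕ
  import Data.Nat.Properties as ℕₚ
  open import Data.Product using (∃; _×_; _,_; proj₁)
  open import Data.Product.Properties using (≡-dec)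
  import Data.Rational as ℚ
  import Data.Rational.Properties as ℚₚ
  open import Data.Sum using (_⊎_; inj₁; inj₂)
  open import Level using (0ℓ)
  open import Relation.Binary using (DecidableEquality)
  open import Relation.Binary.PropositionalEquality
  open import Relation.Nullary using (¬_; yes; no)

  record Field : Set₁ where
    infixl 6 _+_
    infixl 7 _*_
    infix  8 -_
    field
      Carrier           : Set
      _+_ _*_           : Carrier → Carrier → Carrier
      -_                : Carrier → Carrier
      0# 1#             : Carrier
      isCommutativeRing : IsCommutativeRing _≡_ _+_ _*_ -_ 0# 1#
      _≟_               : DecidableEquality Carrier
      1≢0               : 1# ≢ 0#
      inverse           : ∀ x → x ≢ 0# → ∃ λ y → x * y ≡ 1#

    commutativeRing : CommutativeRing 0ℓ 0ℓ
    commutativeRing = record { isCommutativeRing = isCommutativeRing }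

    open CommutativeRing commutativeRing public
      using ( +-assoc; +-comm; +-identityˡ; +-identityʳ; -‿inverseˡ; -‿inverseʳ
            ; *-assoc; *-comm; *-identityˡ; *-identityʳ; zeroˡ; zeroʳ; distribˡ; distribʳ
            ; commutativeSemiring; ring)

    IsSquareIn : Carrier → Set
    IsSquareIn x = ∃ λ y → y * y ≡ x

    no-zero-divisors : ∀ x y → x * y ≡ 0# → x ≡ 0# ⊎ y ≡ 0#
    no-zero-divisors x y xy≡0 with x ≟ 0#
    ... | yes x≡0 = inj₁ x≡0
    ... | no  x≢0 with inverse x x≢0
    ...   | x⁻¹ , xx⁻¹≡1 = inj₂ (begin
      y               ≡⟨ *-identityˡ y ⟨
      1# * y          ≡⟨ cong (_* y) (trans (*-comm x⁻¹ x) xx⁻¹≡1) ⟨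
      x⁻¹ * x * y     ≡⟨ *-assoc x⁻¹ x y ⟩
      x⁻¹ * (x * y)   ≡⟨ cong (x⁻¹ *_) xy≡0 ⟩
      x⁻¹ * 0#        ≡⟨ zeroʳ x⁻¹ ⟩
      0#              ∎)
      where open ≡-Reasoning

    sub-unique : ∀ {x y z} → x + y ≡ z → x ≡ z + - y
    sub-unique {x} {y} {z} e = begin
      x               ≡⟨ +-identityʳ x ⟨
      x + 0#          ≡⟨ cong (x +_) (-‿inverseʳ y) ⟨
      x + (y + - y)   ≡⟨ +-assoc x y (- y) ⟨
      x + y + - y     ≡⟨ cong (_+ - y) e ⟩
      z + - y         ∎
      where open ≡-Reasoning

  -- Quadratic extensions of a field by the square root of a nonsquare

  module QuadraticExtension (F : Field) (d : Field.Carrier F) where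
    open Field F
    open SemiringSolver commutativeSemiring using (solve; _:+_; _:*_; _:=_; con)

    E : Set
    E = Carrier × Carrier

    infixl 6 _⊕_
    infixl 7 _⊗_
    _⊕_ _⊗_ : E → E → E
    (a , b) ⊕ (a′ , b′) = a + a′ , b + b′
    (a , b) ⊗ (a′ , b′) = a * a′ + d * (b * b′) , a * b′ + b * a′

    ⊖_ : E → E
    ⊖ (a , b) = - a , - b

    private
      pair : ∀ {a b a′ b′ : Carrier} → a ≡ a′ → b ≡ b′ → (a , b) ≡ (a′ , b′)
      pair = cong₂ _,_

      ⊗-assoc : ∀ x y z → (x ⊗ y) ⊗ z ≡ x ⊗ (y ⊗ z)
      ⊗-assoc (a , b) (a′ , b′) (a″ , b″) = pair
        (solve 7 (λ d a b a′ b′ a″ b″ →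
            (a :* a′ :+ d :* (b :* b′)) :* a″ :+ d :* ((a :* b′ :+ b :* a′) :* b″)
            := a :* (a′ :* a″ :+ d :* (b′ :* b″)) :+ d :* (b :* (a′ :* b″ :+ b′ :* a″)))
          refl d a b a′ b′ a″ b″)
        (solve 7 (λ d a b a′ b′ a″ b″ →
            (a :* a′ :+ d :* (b :* b′)) :* b″ :+ (a :* b′ :+ b :* a′) :* a″
            := a :* (a′ :* b″ :+ b′ :* a″) :+ b :* (a′ :* a″ :+ d :* (b′ :* b″)))
          refl d a b a′ b′ a″ b″)

      ⊗-comm : ∀ x y → x ⊗ y ≡ y ⊗ x
      ⊗-comm (a , b) (a′ , b′) = pair
        (solve 5 (λ d a b a′ b′ → a :* a′ :+ d :* (b :* b′) := a′ :* a :+ d :* (b′ :* b)) refl d a b a′ b′)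
        (solve 4 (λ a b a′ b′ → a :* b′ :+ b :* a′ := a′ :* b :+ b′ :* a) refl a b a′ b′)

      ⊗-identityˡ : ∀ x → (1# , 0#) ⊗ x ≡ x
      ⊗-identityˡ (a , b) = pair
        (solve 3 (λ d a b → con 1 :* a :+ d :* (con 0 :* b) := a) refl d a b)
        (solve 2 (λ a b → con 1 :* b :+ con 0 :* a := b) refl a b)

      distrib : ∀ x y z → x ⊗ (y ⊕ z) ≡ (x ⊗ y) ⊕ (x ⊗ z)
      distrib (a , b) (a′ , b′) (a″ , b″) = pair
        (solve 7 (λ d a b a′ b′ a″ b″ →
            a :* (a′ :+ a″) :+ d :* (b :* (b′ :+ b″))
            := (a :* a′ :+ d :* (b :* b′)) :+ (a :* a″ :+ d :* (b :* b″)))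
          refl d a b a′ b′ a″ b″)
        (solve 6 (λ a b a′ b′ a″ b″ →
            a :* (b′ :+ b″) :+ b :* (a′ :+ a″)
            := (a :* b′ :+ b :* a′) :+ (a :* b″ :+ b :* a″))
          refl a b a′ b′ a″ b″)

    isCommutativeRingᴱ : IsCommutativeRing _≡_ _⊕_ _⊗_ ⊖_ (0# , 0#) (1# , 0#)
    isCommutativeRingᴱ = record
      { isRing = record
        { +-isAbelianGroup = record
          { isGroup = record
            { isMonoid = record
              { isSemigroup = record
                { isMagma = isMagma _⊕_
                ; assoc   = λ { (a , b) (a′ , b′) (a″ , b″) → pair (+-assoc a a′ a″) (+-assoc b b′ b″) } }
              ; identity = (λ { (a , b) → pair (+-identityˡ a) (+-identityˡ b) })
                         , (λ { (a , b) → pair (+-identityʳ a) (+-identityʳ b) }) }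
            ; inverse = (λ { (a , b) → pair (-‿inverseˡ a) (-‿inverseˡ b) })
                      , (λ { (a , b) → pair (-‿inverseʳ a) (-‿inverseʳ b) })
            ; ⁻¹-cong = cong ⊖_ }
          ; comm = λ { (a , b) (a′ , b′) → pair (+-comm a a′) (+-comm b b′) } }
        ; *-cong     = cong₂ _⊗_
        ; *-assoc    = ⊗-assoc
        ; *-identity = ⊗-identityˡ , λ x → trans (⊗-comm x _) (⊗-identityˡ x)
        ; distrib    = distrib
                     , λ x y z → trans (⊗-comm _ x) (trans (distrib x y z) (cong₂ _⊕_ (⊗-comm x y) (⊗-comm x z))) }
      ; *-comm = ⊗-comm }

    norm : E → Carrier
    norm (a , b) = a * a + - (d * (b * b))

    -- The solver in use is for commutative semirings and does not see negation. This additive form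
    -- lets later identities treat the norm as an atom.
    norm-spec : ∀ a b → norm (a , b) + d * (b * b) ≡ a * a
    norm-spec a b = trans (+-assoc _ _ _) (trans (cong (a * a +_) (-‿inverseˡ _)) (+-identityʳ _))

    -- Taking norms of (a + b√d)² = t ± √d.
    norm-of-square-root : ∀ a b t → a * a + d * (b * b) ≡ t → (a * b + b * a) * (a * b + b * a) ≡ 1# →
                          norm (a , b) * norm (a , b) + d ≡ t * t
    norm-of-square-root a b t e₁ e₂ = begin
      n * n + d                     ≡⟨ cong (n * n +_) (*-identityʳ d) ⟨
      n * n + d * 1#                ≡⟨ cong (λ z → n * n + d * z) e₂ ⟨
      n * n + d * ((a * b + b * a) * (a * b + b * a))
        ≡⟨ solve 4 (λ n d a b → n :* n :+ d :* ((a :* b :+ b :* a) :* (a :* b :+ b :* a))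
                      := n :* n :+ (d :* (b :* b) :+ d :* (b :* b) :+ (d :* (b :* b) :+ d :* (b :* b))) :* (a :* a)) refl n d a b ⟩
      n * n + (s + s + (s + s)) * (a * a)
        ≡⟨ cong (λ z → n * n + (s + s + (s + s)) * z) (norm-spec a b) ⟨
      n * n + (s + s + (s + s)) * (n + s)
        ≡⟨ solve 2 (λ n s → n :* n :+ (s :+ s :+ (s :+ s)) :* (n :+ s) := (n :+ s :+ s) :* (n :+ s :+ s)) refl n s ⟩
      (n + d * (b * b) + d * (b * b)) * (n + d * (b * b) + d * (b * b))
        ≡⟨ cong (λ z → (z + d * (b * b)) * (z + d * (b * b))) (norm-spec a b) ⟩
      (a * a + d * (b * b)) * (a * a + d * (b * b)) ≡⟨ cong₂ _*_ e₁ e₁ ⟩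
      t * t                         ∎
      where
      open ≡-Reasoning
      n s : Carrier
      n = norm (a , b)
      s = d * (b * b)

    module _ (nonsquare : ¬ IsSquareIn d) where

      -- If a² = d b² with b ≠ 0, then d is the square of a/b; with b = 0 the equation gives a² = 0.
      norm≢0 : ∀ x → x ≢ (0# , 0#) → norm x ≢ 0#
      norm≢0 (a , b) x≢0 n≡0 with b ≟ 0#
      ... | yes refl with no-zero-divisors a a a²≡0
        where
        a²≡0 : a * a ≡ 0#
        a²≡0 = trans (sym (norm-spec a 0#)) (trans (cong₂ _+_ n≡0 (trans (cong (d *_) (zeroˡ 0#)) (zeroʳ d))) (+-identityˡ 0#))
      ...   | inj₁ a≡0 = x≢0 (cong (_, 0#) a≡0)
      ...   | inj₂ a≡0 = x≢0 (cong (_, 0#) a≡0)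
      norm≢0 (a , b) x≢0 n≡0 | no b≢0 with inverse b b≢0
      ... | b⁻¹ , bb⁻¹≡1 = nonsquare (a * b⁻¹ , (begin
        a * b⁻¹ * (a * b⁻¹)           ≡⟨ solve 2 (λ a i → a :* i :* (a :* i) := a :* a :* (i :* i)) refl a b⁻¹ ⟩
        a * a * (b⁻¹ * b⁻¹)           ≡⟨ cong (_* (b⁻¹ * b⁻¹)) (trans (sym (norm-spec a b)) (trans (cong (_+ d * (b * b)) n≡0) (+-identityˡ _))) ⟩
        d * (b * b) * (b⁻¹ * b⁻¹)     ≡⟨ solve 3 (λ d b i → d :* (b :* b) :* (i :* i) := d :* ((b :* i) :* (b :* i))) refl d b b⁻¹ ⟩
        d * ((b * b⁻¹) * (b * b⁻¹))   ≡⟨ cong (d *_) (trans (cong₂ _*_ bb⁻¹≡1 bb⁻¹≡1) (*-identityˡ 1#)) ⟩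
        d * 1#                        ≡⟨ *-identityʳ d ⟩
        d                             ∎))
        where open ≡-Reasoning

      -- The inverse is the conjugate divided by the norm.
      inverseᴱ : ∀ x → x ≢ (0# , 0#) → ∃ λ y → x ⊗ y ≡ (1# , 0#)
      inverseᴱ (a , b) x≢0 with inverse (norm (a , b)) (norm≢0 (a , b) x≢0)
      ... | i , ni≡1 = (a * i , - b * i) , pair first second
        where
        open ≡-Reasoning
        open RingProperties ring using (-‿distribˡ-*; -‿distribʳ-*)
        first : a * (a * i) + d * (b * (- b * i)) ≡ 1#
        first = begin
          a * (a * i) + d * (b * (- b * i))
            ≡⟨ solve 5 (λ a d b m i → a :* (a :* i) :+ d :* (b :* (m :* i)) := (a :* a :+ d :* (b :* m)) :* i) refl a d b (- b) i ⟩
          (a * a + d * (b * - b)) * i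
            ≡⟨ cong (λ z → (a * a + z) * i) (trans (cong (d *_) (sym (-‿distribʳ-* b b))) (sym (-‿distribʳ-* d (b * b)))) ⟩
          (a * a + - (d * (b * b))) * i  ≡⟨ ni≡1 ⟩
          1#                            ∎
        second : a * (- b * i) + b * (a * i) ≡ 0#
        second = begin
          a * (- b * i) + b * (a * i)
            ≡⟨ solve 4 (λ a b m i → a :* (m :* i) :+ b :* (a :* i) := (m :+ b) :* (a :* i)) refl a b (- b) i ⟩
          (- b + b) * (a * i)   ≡⟨ cong (_* (a * i)) (-‿inverseˡ b) ⟩
          0# * (a * i)          ≡⟨ zeroˡ _ ⟩
          0#                    ∎

      extension : Field
      extension = record
        { Carrier = E ; _+_ = _⊕_ ; _*_ = _⊗_ ; -_ = ⊖_ ; 0# = 0# , 0# ; 1# = 1# , 0#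
        ; isCommutativeRing = isCommutativeRingᴱ
        ; _≟_ = ≡-dec _≟_ _≟_
        ; 1≢0 = λ e → 1≢0 (cong proj₁ e)
        ; inverse = inverseᴱ }

-- Polynomials over ℚ, the tower of square roots, and irreducibility

module RootTower where

  open import Defs
  open Fields
  import Algebra.Properties.Ring as RingProperties
  import Algebra.Solver.Ring.NaturalCoefficients.Default as SemiringSolver
  open import Data.Empty using (⊥; ⊥-elim)
  open import Data.List using ([]; _∷_; map)
  open import Data.Nat as ℕ using (ℕ; zero; suc; z≤n; s≤s)
  import Data.Nat.Properties as ℕₚ
  open import Data.Product using (∃; _×_; _,_; proj₁; proj₂)
  open import Data.Rational as ℚ using (ℚ; 0ℚ; 1ℚ)
  import Data.Rational.Properties as ℚₚ
  open import Data.Sum using (_⊎_; inj₁; inj₂)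
  open import Relation.Binary.PropositionalEquality
  open import Relation.Nullary using (¬_; yes; no; contradiction)
  coeff-addP : ∀ p q i → coeff (addP p q) i ≡ coeff p i ℚ.+ coeff q i
  coeff-addP []      q       i       = sym (ℚₚ.+-identityˡ _)
  coeff-addP (a ∷ p) []      i       = sym (ℚₚ.+-identityʳ _)
  coeff-addP (a ∷ p) (b ∷ q) zero    = refl
  coeff-addP (a ∷ p) (b ∷ q) (suc i) = coeff-addP p q i

  coeff-scale : ∀ a p i → coeff (map (a ℚ.*_) p) i ≡ a ℚ.* coeff p i
  coeff-scale a []      i       = sym (ℚₚ.*-zeroʳ a)
  coeff-scale a (b ∷ p) zero    = refl
  coeff-scale a (b ∷ p) (suc i) = coeff-scale a p i

  -- Trailing zeros make the length of a list useless as a degree, so degrees are handled through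
  -- bounds: this is deg p < d.
  Below : Poly → ℕ → Set
  Below p d = ∀ i → d ℕ.≤ i → coeff p i ≡ 0ℚ

  below-tail : ∀ {a p d} → Below (a ∷ p) (suc d) → Below p d
  below-tail b i d≤i = b (suc i) (s≤s d≤i)

  coeff-mulP-suc : ∀ a p q i → coeff (mulP (a ∷ p) q) (suc i) ≡ a ℚ.* coeff q (suc i) ℚ.+ coeff (mulP p q) i
  coeff-mulP-suc a p q i = trans (coeff-addP (map (a ℚ.*_) q) _ (suc i)) (cong (ℚ._+ coeff (mulP p q) i) (coeff-scale a q (suc i)))

  a*0+x : ∀ a {b x y} → b ≡ 0ℚ → x ≡ y → a ℚ.* b ℚ.+ x ≡ y
  a*0+x a refl refl = trans (cong (ℚ._+ _) (ℚₚ.*-zeroʳ a)) (ℚₚ.+-identityˡ _)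

  mulP-zeroˡ : ∀ p q → Below p 0 → Below (mulP p q) 0
  mulP-zeroˡ []      q b i       _ = refl
  mulP-zeroˡ (a ∷ p) q b i       _ with b 0 z≤n
  mulP-zeroˡ (a ∷ p) q b zero    _ | refl =
    trans (coeff-addP (map (0ℚ ℚ.*_) q) _ 0) (trans (ℚₚ.+-identityʳ (coeff (map (0ℚ ℚ.*_) q) 0)) (trans (coeff-scale 0ℚ q 0) (ℚₚ.*-zeroˡ (coeff q 0))))
  mulP-zeroˡ (a ∷ p) q b (suc i) _ | refl =
    trans (coeff-mulP-suc 0ℚ p q i) (trans (cong (ℚ._+ coeff (mulP p q) i) (ℚₚ.*-zeroˡ (coeff q (suc i)))) (trans (ℚₚ.+-identityˡ (coeff (mulP p q) i)) (mulP-zeroˡ p q (λ j _ → b (suc j) z≤n) i z≤n)))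

  coeff-mulP-const : ∀ a p q i → Below p 0 → coeff (mulP (a ∷ p) q) i ≡ a ℚ.* coeff q i
  coeff-mulP-const a p q zero    b = trans (coeff-addP (map (a ℚ.*_) q) _ 0) (trans (ℚₚ.+-identityʳ _) (coeff-scale a q 0))
  coeff-mulP-const a p q (suc i) b = trans (coeff-mulP-suc a p q i) (trans (cong (a ℚ.* coeff q (suc i) ℚ.+_) (mulP-zeroˡ p q b i z≤n)) (ℚₚ.+-identityʳ (a ℚ.* coeff q (suc i))))

  below-mulP : ∀ p q d e → Below p (suc d) → Below q (suc e) → Below (mulP p q) (suc (d ℕ.+ e))
  below-mulP []      q d       e bp bq i       _       = refl
  below-mulP (a ∷ p) q zero    e bp bq i       le      =
    trans (coeff-mulP-const a p q i (below-tail bp)) (trans (cong (a ℚ.*_) (bq i le)) (ℚₚ.*-zeroʳ a))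
  below-mulP (a ∷ p) q (suc d) e bp bq (suc i) (s≤s le) =
    trans (coeff-mulP-suc a p q i)
      (a*0+x a (bq (suc i) (s≤s (ℕₚ.≤-trans (ℕₚ.m≤n+m e (suc d)) le)))
               (below-mulP p q d e (below-tail bp) bq i le))

  lead-mulP : ∀ p q d e → Below p (suc d) → Below q (suc e) → coeff (mulP p q) (d ℕ.+ e) ≡ coeff p d ℚ.* coeff q e
  lead-mulP []      q d       e bp bq = sym (ℚₚ.*-zeroˡ (coeff q e))
  lead-mulP (a ∷ p) q zero    e bp bq = coeff-mulP-const a p q e (below-tail bp)
  lead-mulP (a ∷ p) q (suc d) e bp bq =
    trans (coeff-mulP-suc a p q (d ℕ.+ e))
      (a*0+x a (bq (suc (d ℕ.+ e)) (s≤s (ℕₚ.m≤n+m e d))) (lead-mulP p q d e (below-tail bp) bq))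

  degree : ∀ p → Below p 0 ⊎ ∃ λ d → Below p (suc d) × coeff p d ≢ 0ℚ
  degree []      = inj₁ λ _ _ → refl
  degree (a ∷ p) with degree p
  ... | inj₂ (d , b , l) = inj₂ (suc d , (λ { (suc i) (s≤s le) → b i le }) , l)
  ... | inj₁ b with a ℚ.≟ 0ℚ
  ...   | yes a≡0 = inj₁ λ { zero _ → a≡0 ; (suc i) _ → b i z≤n }
  ...   | no  a≢0 = inj₂ (0 , (λ { (suc i) (s≤s le) → b i z≤n }) , a≢0)

  nonConstant? : ∀ p → ¬ NonConstant p ⊎ ∃ λ d → Below p (suc (suc d)) × coeff p (suc d) ≢ 0ℚ
  nonConstant? p with degree p
  ... | inj₁ b                = inj₁ λ { (i , nz) → nz (b (suc i) z≤n) }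
  ... | inj₂ (zero , b , _)   = inj₁ λ { (i , nz) → nz (b (suc i) (s≤s z≤n)) }
  ... | inj₂ (suc d , b , l)  = inj₂ (d , b , l)

  module _ (r : ℚ) where

    below-iterF : ∀ n → Below (iterF r n) (suc (2 ℕ.^ n))
    below-iterF zero    (suc (suc i)) _  = refl
    below-iterF zero    (suc zero)    (s≤s ())
    below-iterF (suc n) i             le with i
    ... | suc j = trans (coeff-addP (mulP (iterF r n) (iterF r n)) (r ∷ []) (suc j))
                   (trans (ℚₚ.+-identityʳ _)
                     (below-mulP (iterF r n) (iterF r n) _ _ (below-iterF n) (below-iterF n) (suc j)
                        (subst (ℕ._≤ suc j) (cong (λ z → suc (2 ℕ.^ n ℕ.+ z)) (ℕₚ.+-identityʳ (2 ℕ.^ n))) le)))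

    lead-iterF : ∀ n → coeff (iterF r n) (2 ℕ.^ n) ≡ 1ℚ
    lead-iterF zero    = refl
    lead-iterF (suc n) = begin
      coeff (iterF r (suc n)) (2 ℕ.^ n ℕ.+ (2 ℕ.^ n ℕ.+ 0)) ≡⟨ cong (λ z → coeff (iterF r (suc n)) (2 ℕ.^ n ℕ.+ z)) (ℕₚ.+-identityʳ _) ⟩
      coeff (iterF r (suc n)) (2 ℕ.^ n ℕ.+ 2 ℕ.^ n)         ≡⟨ coeff-addP (mulP g g) (r ∷ []) (2 ℕ.^ n ℕ.+ 2 ℕ.^ n) ⟩
      coeff (mulP g g) (2 ℕ.^ n ℕ.+ 2 ℕ.^ n) ℚ.+ coeff (r ∷ []) (2 ℕ.^ n ℕ.+ 2 ℕ.^ n)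
        ≡⟨ cong₂ ℚ._+_ (lead-mulP g g _ _ (below-iterF n) (below-iterF n)) (const-high (2 ℕ.^ n ℕ.+ 2 ℕ.^ n) (ℕₚ.≤-trans (ℕₚ.m^n>0 2 n) (ℕₚ.m≤m+n _ _))) ⟩
      coeff g (2 ℕ.^ n) ℚ.* coeff g (2 ℕ.^ n) ℚ.+ 0ℚ         ≡⟨ cong (λ z → z ℚ.* z ℚ.+ 0ℚ) (lead-iterF n) ⟩
      1ℚ                                                     ∎
      where
      open ≡-Reasoning
      g : Poly
      g = iterF r n
      const-high : ∀ i → 1 ℕ.≤ i → coeff (r ∷ []) i ≡ 0ℚ
      const-high (suc i) _ = refl
  -- The split by parity of exponents expresses p(√δ) by its two coordinates over the base field.
  evenPart oddPart : Poly → Poly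
  evenPart []      = []
  evenPart (a ∷ p) = a ∷ oddPart p
  oddPart  []      = []
  oddPart  (a ∷ p) = evenPart p

  coeff-evenPart : ∀ p i → coeff (evenPart p) i ≡ coeff p (i ℕ.+ i)
  coeff-oddPart  : ∀ p i → coeff (oddPart p) i ≡ coeff p (suc (i ℕ.+ i))
  coeff-evenPart []      i       = refl
  coeff-evenPart (a ∷ p) zero    = refl
  coeff-evenPart (a ∷ p) (suc i) = trans (coeff-oddPart p i) (cong (coeff p) (sym (ℕₚ.+-suc i i)))
  coeff-oddPart  []      i       = refl
  coeff-oddPart  (a ∷ p) i       = coeff-evenPart p i

  timesLinear : ℚ → Poly → Poly
  timesLinear t p = addP (map (t ℚ.*_) p) (0ℚ ∷ p)

  -- Composition with y + t, by Horner's rule. It is needed because the square of the next generator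
  -- is x - r and not x itself.
  translate : ℚ → Poly → Poly
  translate t []      = []
  translate t (a ∷ p) = addP (a ∷ []) (timesLinear t (translate t p))

  coeff-translate-suc : ∀ t a p i → coeff (translate t (a ∷ p)) (suc i)
                      ≡ t ℚ.* coeff (translate t p) (suc i) ℚ.+ coeff (translate t p) i
  coeff-translate-suc t a p i = begin
    coeff (addP (a ∷ []) (timesLinear t q)) (suc i)                ≡⟨ coeff-addP (a ∷ []) (timesLinear t q) (suc i) ⟩
    0ℚ ℚ.+ coeff (timesLinear t q) (suc i)                         ≡⟨ ℚₚ.+-identityˡ _ ⟩
    coeff (timesLinear t q) (suc i)                                ≡⟨ coeff-addP (map (t ℚ.*_) q) (0ℚ ∷ q) (suc i) ⟩
    coeff (map (t ℚ.*_) q) (suc i) ℚ.+ coeff q i                   ≡⟨ cong (ℚ._+ coeff q i) (coeff-scale t q (suc i)) ⟩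
    t ℚ.* coeff q (suc i) ℚ.+ coeff q i                            ∎
    where
    open ≡-Reasoning
    q : Poly
    q = translate t p

  coeff-translate-0 : ∀ t a p → coeff (translate t (a ∷ p)) 0 ≡ t ℚ.* coeff (translate t p) 0 ℚ.+ a
  coeff-translate-0 t a p = begin
    coeff (addP (a ∷ []) (timesLinear t q)) 0    ≡⟨ coeff-addP (a ∷ []) (timesLinear t q) 0 ⟩
    a ℚ.+ coeff (timesLinear t q) 0              ≡⟨ cong (a ℚ.+_) (coeff-addP (map (t ℚ.*_) q) (0ℚ ∷ q) 0) ⟩
    a ℚ.+ (coeff (map (t ℚ.*_) q) 0 ℚ.+ 0ℚ)      ≡⟨ cong (a ℚ.+_) (trans (ℚₚ.+-identityʳ _) (coeff-scale t q 0)) ⟩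
    a ℚ.+ t ℚ.* coeff q 0                        ≡⟨ ℚₚ.+-comm a _ ⟩
    t ℚ.* coeff q 0 ℚ.+ a                        ∎
    where
    open ≡-Reasoning
    q : Poly
    q = translate t p

  below-translate : ∀ t p d → Below p d → Below (translate t p) d
  below-translate t []      d       b i       le = refl
  below-translate t (a ∷ p) zero    b zero    le =
    trans (coeff-translate-0 t a p) (a*0+x t (below-translate t p 0 (λ j _ → b (suc j) z≤n) 0 z≤n) (b 0 z≤n))
  below-translate t (a ∷ p) zero    b (suc i) le =
    trans (coeff-translate-suc t a p i) (a*0+x t (below-translate t p 0 (λ j _ → b (suc j) z≤n) (suc i) z≤n)
                                                (below-translate t p 0 (λ j _ → b (suc j) z≤n) i z≤n))
  below-translate t (a ∷ p) (suc d) b (suc i) (s≤s le) =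
    trans (coeff-translate-suc t a p i) (a*0+x t (below-translate t p d (below-tail b) (suc i) (ℕₚ.m≤n⇒m≤1+n le))
                                                (below-translate t p d (below-tail b) i le))

  lead-translate : ∀ t p d → Below p (suc d) → coeff (translate t p) d ≡ coeff p d
  lead-translate t []      d       b = refl
  lead-translate t (a ∷ p) zero    b =
    trans (coeff-translate-0 t a p) (a*0+x t (below-translate t p 0 (below-tail b) 0 z≤n) refl)
  lead-translate t (a ∷ p) (suc d) b =
    trans (coeff-translate-suc t a p d) (a*0+x t (below-translate t p (suc d) (below-tail b) (suc d) ℕₚ.≤-refl)
                                                (lead-translate t p d (below-tail b)))
  record QAlgebra : Set₁ where
    field
      fld : Field
    open Field fld
    field
      ι   : ℚ → Carrier
      ι-0 : ι 0ℚ ≡ 0#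
      ι-1 : ι 1ℚ ≡ 1#
      ι-+ : ∀ p q → ι (p ℚ.+ q) ≡ ι p + ι q
      ι-* : ∀ p q → ι (p ℚ.* q) ≡ ι p * ι q

    eval : Poly → Carrier → Carrier
    eval []      y = 0#
    eval (a ∷ p) y = ι a + y * eval p y

    open SemiringSolver commutativeSemiring using (solve; _:+_; _:*_; _:=_; con)

    eval-addP : ∀ p q y → eval (addP p q) y ≡ eval p y + eval q y
    eval-addP []      q       y = sym (+-identityˡ _)
    eval-addP (a ∷ p) []      y = sym (+-identityʳ _)
    eval-addP (a ∷ p) (b ∷ q) y rewrite ι-+ a b | eval-addP p q y =
      solve 5 (λ a b y p q → a :+ b :+ y :* (p :+ q) := a :+ y :* p :+ (b :+ y :* q)) refl (ι a) (ι b) y (eval p y) (eval q y)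

    eval-scale : ∀ a p y → eval (map (a ℚ.*_) p) y ≡ ι a * eval p y
    eval-scale a []      y = sym (zeroʳ _)
    eval-scale a (b ∷ p) y rewrite ι-* a b | eval-scale a p y =
      solve 4 (λ a b y p → a :* b :+ y :* (a :* p) := a :* (b :+ y :* p)) refl (ι a) (ι b) y (eval p y)

    eval-mulP : ∀ p q y → eval (mulP p q) y ≡ eval p y * eval q y
    eval-mulP []      q y = sym (zeroˡ _)
    eval-mulP (a ∷ p) q y
      rewrite eval-addP (map (a ℚ.*_) q) (0ℚ ∷ mulP p q) y | eval-scale a q y | ι-0 | eval-mulP p q y =
      solve 4 (λ a q y p → a :* q :+ (con 0 :+ y :* (p :* q)) := (a :+ y :* p) :* q) refl (ι a) (eval q y) y (eval p y)

    eval-≈ : ∀ p q y → p ≈ₚ q → eval p y ≡ eval q y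
    eval-≈ []      []      y e = refl
    eval-≈ []      (b ∷ q) y e rewrite sym (e 0) | ι-0 | sym (eval-≈ [] q y (λ i → e (suc i))) =
      solve 1 (λ y → con 0 := con 0 :+ y :* con 0) refl y
    eval-≈ (a ∷ p) []      y e rewrite e 0 | ι-0 | eval-≈ p [] y (λ i → e (suc i)) =
      solve 1 (λ y → con 0 :+ y :* con 0 := con 0) refl y
    eval-≈ (a ∷ p) (b ∷ q) y e = cong₂ (λ u v → ι u + y * v) (e 0) (eval-≈ p q y (λ i → e (suc i)))

    eval-translate : ∀ t p y → eval (translate t p) y ≡ eval p (y + ι t)
    eval-translate t []      y = refl
    eval-translate t (a ∷ p) y
      rewrite eval-addP (a ∷ []) (timesLinear t (translate t p)) y
            | eval-addP (map (t ℚ.*_) (translate t p)) (0ℚ ∷ translate t p) y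
            | eval-scale t (translate t p) y | ι-0 | eval-translate t p y =
      solve 4 (λ a y t p → a :+ y :* con 0 :+ (t :* p :+ (con 0 :+ y :* p)) := a :+ (y :+ t) :* p)
        refl (ι a) y (ι t) (eval p (y + ι t))

    eval-parts : ∀ p y → eval p y ≡ eval (evenPart p) (y * y) + y * eval (oddPart p) (y * y)
    eval-parts []      y = solve 1 (λ y → con 0 := con 0 :+ y :* con 0) refl y
    eval-parts (a ∷ p) y rewrite eval-parts p y =
      solve 4 (λ a y u v → a :+ y :* (u :+ y :* v) := a :+ y :* y :* v :+ y :* u)
        refl (ι a) y (eval (evenPart p) (y * y)) (eval (oddPart p) (y * y))

    iter : ℚ → ℕ → Carrier → Carrier
    iter r zero    y = y
    iter r (suc n) y = iter r n y * iter r n y + ι r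

    iter-suc : ∀ r n y → iter r n (y * y + ι r) ≡ iter r (suc n) y
    iter-suc r zero    y = refl
    iter-suc r (suc n) y = cong (λ z → z * z + ι r) (iter-suc r n y)

    eval-iterF : ∀ r n y → eval (iterF r n) y ≡ iter r n y
    eval-iterF r zero    y rewrite ι-0 | ι-1 =
      solve 1 (λ y → con 0 :+ y :* (con 1 :+ y :* con 0) := y) refl y
    eval-iterF r (suc n) y
      rewrite eval-addP (mulP (iterF r n) (iterF r n)) (r ∷ []) y | eval-mulP (iterF r n) (iterF r n) y | eval-iterF r n y =
      cong (iter r n y * iter r n y +_) (trans (cong (ι r +_) (zeroʳ y)) (+-identityʳ _))

  double-cases : ∀ d → ∃ λ e → d ≡ e ℕ.+ e ⊎ d ≡ suc (e ℕ.+ e)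
  double-cases zero    = 0 , inj₁ refl
  double-cases (suc d) with double-cases d
  ... | e , inj₁ refl = e , inj₂ refl
  ... | e , inj₂ refl = suc e , inj₁ (cong suc (sym (ℕₚ.+-suc e e)))

  double-cancel-< : ∀ e k → e ℕ.+ e ℕ.< k ℕ.+ k → e ℕ.< k
  double-cancel-< e k lt with e ℕ.<? k
  ... | yes e<k = e<k
  ... | no  e≮k = contradiction lt (ℕₚ.≤⇒≯ (ℕₚ.+-mono-≤ (ℕₚ.≮⇒≥ e≮k) (ℕₚ.≮⇒≥ e≮k)))

  ℚ-field : Field
  ℚ-field = record
    { Carrier = ℚ ; _+_ = ℚ._+_ ; _*_ = ℚ._*_ ; -_ = ℚ.-_ ; 0# = 0ℚ ; 1# = 1ℚ
    ; isCommutativeRing = ℚₚ.+-*-isCommutativeRing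
    ; _≟_ = ℚ._≟_
    ; 1≢0 = λ ()
    ; inverse = λ x x≢0 → let instance nz = ℚ.≢-nonZero x≢0 in ℚ.1/ x , ℚₚ.*-inverseʳ x }

  ℚ-algebra : QAlgebra
  ℚ-algebra = record
    { fld = ℚ-field ; ι = λ q → q ; ι-0 = refl ; ι-1 = refl ; ι-+ = λ _ _ → refl ; ι-* = λ _ _ → refl }

  module Tower (r : ℚ) where
    orbit : ℕ → ℚ
    orbit zero    = 0ℚ
    orbit (suc m) = orbit m ℚ.* orbit m ℚ.+ r

    -- A field generated over ℚ by a point x with f^k(x) = 0, such that 1, x, …, x^(2^k - 1)
    -- are linearly independent.
    record Level (k : ℕ) : Set₁ where
      field
        alg : QAlgebra
      open QAlgebra alg public
      open Field fld public
      field
        x           : Carrier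
        root        : iter r k x ≡ 0#
        independent : ∀ p d → Below p (suc d) → coeff p d ≢ 0ℚ → d ℕ.< 2 ℕ.^ k → eval p x ≢ 0#

      NextSquare : Set
      NextSquare = IsSquareIn (x + - ι r)

      OrbitSquare : ℕ → Set
      OrbitSquare m = IsSquareIn (ι (orbit m) + - x)

    -- If g h = fⁿ with both factors non-constant, both have degree below 2^n, and the root x of fⁿ
    -- is a root of one of them, against independence.
    irreducible : ∀ {n} → Level n → Irreducible (iterF r n)
    irreducible {n} l = nonconstant n , split
      where
      open Level l
      nonconstant : ∀ n → NonConstant (iterF r n)
      nonconstant n with 2 ℕ.^ n in eq | lead-iterF r n | ℕₚ.m^n>0 2 n
      ... | suc i | lead | _ = i , λ e → contradiction (trans (sym lead) e) λ ()
      split : ∀ g h → iterF r n ≈ₚ mulP g h → ¬ NonConstant g ⊎ ¬ NonConstant h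
      split g h eq with nonConstant? g | nonConstant? h
      ... | inj₁ cg | _       = inj₁ cg
      ... | inj₂ _  | inj₁ ch = inj₂ ch
      ... | inj₂ (d , bg , lg) | inj₂ (e , bh , lh) = ⊥-elim bad
        where
        top : coeff (iterF r n) (suc d ℕ.+ suc e) ≢ 0ℚ
        top z with Field.no-zero-divisors ℚ-field (coeff g (suc d)) (coeff h (suc e))
                     (trans (sym (lead-mulP g h (suc d) (suc e) bg bh)) (trans (sym (eq (suc d ℕ.+ suc e))) z))
        ... | inj₁ a = lg a
        ... | inj₂ b = lh b
        d+e≤ : suc d ℕ.+ suc e ℕ.≤ 2 ℕ.^ n
        d+e≤ = ℕₚ.≮⇒≥ λ lt → top (below-iterF r n _ lt)
        bad : ⊥
        bad with no-zero-divisors (eval g x) (eval h x)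
                   (trans (sym (eval-mulP g h x)) (trans (sym (eval-≈ (iterF r n) (mulP g h) x eq)) (trans (eval-iterF r n x) root)))
        ... | inj₁ z = independent g (suc d) bg lg (ℕₚ.<-≤-trans (ℕₚ.m<m+n (suc d) (s≤s z≤n)) d+e≤) z
        ... | inj₂ z = independent h (suc e) bh lh (ℕₚ.<-≤-trans (ℕₚ.m<n+m (suc e) (s≤s z≤n)) d+e≤) z

    level₀ : Level 0
    level₀ = record { alg = ℚ-algebra ; x = 0ℚ ; root = refl ; independent = constants }
      where
      constants : ∀ p d → Below p (suc d) → coeff p d ≢ 0ℚ → d ℕ.< 1 → QAlgebra.eval ℚ-algebra p 0ℚ ≢ 0ℚ
      constants []      zero    b l lt e = l refl
      constants (a ∷ p) zero    b l lt e =
        l (trans (sym (trans (cong (a ℚ.+_) (ℚₚ.*-zeroˡ (QAlgebra.eval ℚ-algebra p 0ℚ))) (ℚₚ.+-identityʳ a))) e)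
      constants p       (suc d) b l (s≤s ())

    module _ {k} (l : Level k) (nonsquare : ¬ Level.NextSquare l) where
      open Level l
      open QuadraticExtension fld (x + - ι r) hiding (extension)
      open SemiringSolver commutativeSemiring using (solve; _:+_; _:*_; _:=_; con)

      private
        ext : Field
        ext = QuadraticExtension.extension fld (x + - ι r) nonsquare

        algᴱ : QAlgebra
        algᴱ = record
          { fld = ext ; ι = λ q → ι q , 0# ; ι-0 = cong (_, 0#) ι-0 ; ι-1 = cong (_, 0#) ι-1
          ; ι-+ = λ p q → cong₂ _,_ (ι-+ p q) (sym (+-identityˡ 0#))
          ; ι-* = λ p q → cong₂ _,_
              (trans (ι-* p q) (solve 3 (λ d p q → p :* q := p :* q :+ d :* (con 0 :* con 0)) refl (x + - ι r) (ι p) (ι q)))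
              (solve 2 (λ p q → con 0 := p :* con 0 :+ con 0 :* q) refl (ι p) (ι q)) }

        module ᴱ = QAlgebra algᴱ

        eval-base : ∀ p y → ᴱ.eval p (y , 0#) ≡ (eval p y , 0#)
        eval-base []      y = refl
        eval-base (a ∷ p) y rewrite eval-base p y = cong₂ _,_
          (solve 4 (λ d a y p → a :+ (y :* p :+ d :* (con 0 :* con 0)) := a :+ y :* p) refl (x + - ι r) (ι a) y (eval p y))
          (solve 2 (λ y p → con 0 :+ (y :* con 0 :+ con 0 :* p) := con 0) refl y (eval p y))

        x′ : E
        x′ = 0# , 1#

        x′² : x′ ⊗ x′ ≡ (x + - ι r , 0#)
        x′² = cong₂ _,_ (solve 1 (λ d → con 0 :* con 0 :+ d :* (con 1 :* con 1) := d) refl (x + - ι r))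
                        (solve 0 (con 0 :* con 1 :+ con 1 :* con 0 := con 0) refl)

        -r+r : ι (ℚ.- r) + ι r ≡ 0#
        -r+r = trans (sym (ι-+ (ℚ.- r) r)) (trans (cong ι (ℚₚ.+-inverseˡ r)) ι-0)

        ι-neg : ι (ℚ.- r) ≡ - ι r
        ι-neg = trans (sub-unique -r+r) (+-identityˡ _)

        x-r : x + - ι r ≡ x + ι (ℚ.- r)
        x-r = cong (x +_) (sym ι-neg)

        f-x′ : (x′ ⊗ x′) ⊕ (ι r , 0#) ≡ (x , 0#)
        f-x′ = trans (cong (_⊕ (ι r , 0#)) x′²) (cong₂ _,_
          (trans (+-assoc x (- ι r) (ι r)) (trans (cong (x +_) (-‿inverseˡ (ι r))) (+-identityʳ x))) (+-identityˡ 0#))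

        -- The square of x′ is x - r, so the coordinates of p(x′) are the even and the odd part of p
        -- at x - r; translating by -r makes them polynomials in x.
        eval-x′ : ∀ p → ᴱ.eval p x′ ≡ (eval (translate (ℚ.- r) (evenPart p)) x , eval (translate (ℚ.- r) (oddPart p)) x)
        eval-x′ p = begin
          ᴱ.eval p x′  ≡⟨ ᴱ.eval-parts p x′ ⟩
          ᴱ.eval (evenPart p) (x′ ⊗ x′) ⊕ (x′ ⊗ ᴱ.eval (oddPart p) (x′ ⊗ x′))
            ≡⟨ cong (λ z → ᴱ.eval (evenPart p) z ⊕ (x′ ⊗ ᴱ.eval (oddPart p) z)) x′² ⟩
          ᴱ.eval (evenPart p) (δ , 0#) ⊕ (x′ ⊗ ᴱ.eval (oddPart p) (δ , 0#))
            ≡⟨ cong₂ (λ u v → u ⊕ (x′ ⊗ v)) (eval-base (evenPart p) δ) (eval-base (oddPart p) δ) ⟩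
          (eval (evenPart p) δ , 0#) ⊕ (x′ ⊗ (eval (oddPart p) δ , 0#))
            ≡⟨ cong₂ _,_
                 (solve 3 (λ d u v → u :+ (con 0 :* v :+ d :* (con 1 :* con 0)) := u) refl δ (eval (evenPart p) δ) (eval (oddPart p) δ))
                 (solve 1 (λ v → con 0 :+ (con 0 :* con 0 :+ con 1 :* v) := v) refl (eval (oddPart p) δ)) ⟩
          (eval (evenPart p) δ , eval (oddPart p) δ)
            ≡⟨ cong (λ z → (eval (evenPart p) z , eval (oddPart p) z)) x-r ⟩
          (eval (evenPart p) (x + ι (ℚ.- r)) , eval (oddPart p) (x + ι (ℚ.- r)))
            ≡⟨ cong₂ _,_ (eval-translate (ℚ.- r) (evenPart p) x) (eval-translate (ℚ.- r) (oddPart p) x) ⟨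
          (eval (translate (ℚ.- r) (evenPart p)) x , eval (translate (ℚ.- r) (oddPart p)) x) ∎
          where
          open ≡-Reasoning
          δ : Carrier
          δ = x + - ι r

        iter-base : ∀ n y → ᴱ.iter r n (y , 0#) ≡ (iter r n y , 0#)
        iter-base zero    y = refl
        iter-base (suc n) y rewrite iter-base n y = cong₂ _,_
          (solve 3 (λ d y r → y :* y :+ d :* (con 0 :* con 0) :+ r := y :* y :+ r) refl (x + - ι r) (iter r n y) (ι r))
          (solve 1 (λ y → y :* con 0 :+ con 0 :* y :+ con 0 := con 0) refl (iter r n y))

        rootᴱ : ᴱ.iter r (suc k) x′ ≡ (0# , 0#)
        rootᴱ = trans (sym (ᴱ.iter-suc r k x′)) (trans (cong (ᴱ.iter r k) f-x′) (trans (iter-base k x) (cong (_, 0#) root)))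

        half< : ∀ {e d} → e ℕ.+ e ℕ.≤ d → d ℕ.< 2 ℕ.^ suc k → e ℕ.< 2 ℕ.^ k
        half< {e} {d} le lt = double-cancel-< e (2 ℕ.^ k)
          (ℕₚ.≤-<-trans le (subst (d ℕ.<_) (cong (2 ℕ.^ k ℕ.+_) (ℕₚ.+-identityʳ _)) lt))

        -- The leading coefficient of p, of degree 2e or 2e + 1, is the leading coefficient of the
        -- even or the odd part, in degree e < 2^k. That coordinate is nonzero by independence one
        -- level below.
        independentᴱ : ∀ p d → Below p (suc d) → coeff p d ≢ 0ℚ → d ℕ.< 2 ℕ.^ suc k → ᴱ.eval p x′ ≢ (0# , 0#)
        independentᴱ p d b nz lt z with double-cases d
        ... | e , inj₁ refl = independent (translate (ℚ.- r) (evenPart p)) e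
            (below-translate (ℚ.- r) (evenPart p) (suc e) bₑ)
            (λ c → nz (trans (sym (coeff-evenPart p e)) (trans (sym (lead-translate (ℚ.- r) (evenPart p) e bₑ)) c)))
            (half< ℕₚ.≤-refl lt) (cong proj₁ (trans (sym (eval-x′ p)) z))
          where
          bₑ : Below (evenPart p) (suc e)
          bₑ i le = trans (coeff-evenPart p i) (b (i ℕ.+ i) (ℕₚ.+-mono-<-≤ le (ℕₚ.<⇒≤ le)))
        ... | e , inj₂ refl = independent (translate (ℚ.- r) (oddPart p)) e
            (below-translate (ℚ.- r) (oddPart p) (suc e) bₒ)
            (λ c → nz (trans (sym (coeff-oddPart p e)) (trans (sym (lead-translate (ℚ.- r) (oddPart p) e bₒ)) c)))
            (half< (ℕₚ.n≤1+n _) lt) (cong proj₂ (trans (sym (eval-x′ p)) z))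
          where
          bₒ : Below (oddPart p) (suc e)
          bₒ i le = trans (coeff-oddPart p i) (b (suc (i ℕ.+ i)) (s≤s (ℕₚ.+-mono-<-≤ le (ℕₚ.<⇒≤ le))))

      next : Level (suc k)
      next = record { alg = algᴱ ; x = x′ ; root = rootᴱ ; independent = independentᴱ }

      private
        orbit-suc : ∀ m → ι (orbit m) * ι (orbit m) + - (x + - ι r) ≡ ι (orbit (suc m)) + - x
        orbit-suc m = sym (sub-unique (begin
          ι (orbit (suc m)) + - x + (x + - ι r)
            ≡⟨ cong (λ z → z + - x + (x + - ι r)) (trans (ι-+ _ r) (cong (_+ ι r) (ι-* (orbit m) (orbit m)))) ⟩
          o * o + ι r + - x + (x + - ι r)
            ≡⟨ solve 5 (λ o r s x y → o :+ r :+ y :+ (x :+ s) := o :+ (r :+ s :+ (y :+ x))) refl (o * o) (ι r) (- ι r) x (- x) ⟩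
          o * o + (ι r + - ι r + (- x + x))
            ≡⟨ cong (o * o +_) (trans (cong₂ _+_ (-‿inverseʳ (ι r)) (-‿inverseˡ x)) (+-identityˡ 0#)) ⟩
          o * o + 0#  ≡⟨ +-identityʳ _ ⟩
          o * o  ∎))
          where
          open ≡-Reasoning
          o : Carrier
          o = ι (orbit m)

        open RingProperties ring using (-‿distribˡ-*; -‿distribʳ-*; -0#≈0#; -‿involutive)

        neg-sq : ∀ z → - z * - z ≡ z * z
        neg-sq z = trans (sym (-‿distribˡ-* z (- z))) (trans (cong -_ (sym (-‿distribʳ-* z z))) (-‿involutive _))

      -- With o = f^m(0), the norm of o - x′ is o² - (x - r) = f^(m+1)(0) - x, and the norm of a
      -- square is a square.
      orbitSquare-down : ∀ m → Level.OrbitSquare next m → OrbitSquare (suc m)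
      orbitSquare-down m ((a , b) , e) = norm (a , b) , trans
        (sub-unique (norm-of-square-root a b (ι (orbit m))
          (trans (cong proj₁ e) (trans (cong (ι (orbit m) +_) -0#≈0#) (+-identityʳ _)))
          (trans (cong (λ z → z * z) (trans (cong proj₂ e) (+-identityˡ _))) (trans (neg-sq 1#) (*-identityˡ 1#)))))
        (orbit-suc m)

      -- The norm of x′ - r is r² - (x - r), and r² + r = f²(0).
      nextSquare-down : Level.NextSquare next → OrbitSquare 2
      nextSquare-down ((a , b) , e) = norm (a , b) , trans
        (sub-unique (norm-of-square-root a b (- ι r)
          (trans (cong proj₁ e) (+-identityˡ _))
          (trans (cong (λ z → z * z) (trans (cong proj₂ e) (trans (cong (1# +_) -0#≈0#) (+-identityʳ 1#)))) (*-identityˡ 1#))))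
        (trans (cong (_+ - (x + - ι r)) (trans (neg-sq (ι r)) (cong (λ z → z * z) (cong ι (sym (ℚₚ.+-identityˡ r)))))) (orbit-suc 1))

    orbitSquare-level₀ : ∀ m → Level.OrbitSquare level₀ m → ∃ λ (q : ℚ) → q ℚ.* q ≡ orbit m
    orbitSquare-level₀ m (q , e) = q , trans e (ℚₚ.+-identityʳ (orbit m))

    module _ (nsq₀ : ¬ Level.NextSquare level₀) where
      level₁ : Level 1
      level₁ = next level₀ nsq₀

      module _ (nsq₁ : ¬ Level.NextSquare level₁) where
        level₂ : Level 2
        level₂ = next level₁ nsq₁

        module _ (nsq₂ : ¬ Level.NextSquare level₂) (nsq : ∀ m → ¬ Level.OrbitSquare level₂ (suc (suc m))) where

          private
            record Above (j : ℕ) : Set₁ where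
              field
                level       : Level (suc (suc j))
                nextNsq     : ¬ Level.NextSquare level
                down        : ∀ m → Level.OrbitSquare level m → Level.OrbitSquare level₂ (j ℕ.+ m)

            above : ∀ j → Above j
            above zero    = record { level = level₂ ; nextNsq = nsq₂ ; down = λ m s → s }
            above (suc j) = record
              { level   = next level nextNsq
              -- One norm turns a square x - r of the new level into a square f²(0) - x of the
              -- previous one, and j further norms turn this into f^(j+2)(0) - x₂.
              ; nextNsq = λ s → nsq j (subst (Level.OrbitSquare level₂) (ℕₚ.+-comm j 2) (down 2 (nextSquare-down level nextNsq s)))
              ; down    = λ m s → subst (Level.OrbitSquare level₂) (ℕₚ.+-suc j m) (down (suc m) (orbitSquare-down level nextNsq m s)) }
              where open Above (above j)

          all-irreducible : ∀ n → Irreducible (iterF r n)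
          all-irreducible zero          = irreducible level₀
          all-irreducible (suc zero)    = irreducible level₁
          all-irreducible (suc (suc j)) = irreducible (Above.level (above j))

        orbitSquare-level₂-down : ∀ m → Level.OrbitSquare level₂ m → ∃ λ (q : ℚ) → q ℚ.* q ≡ orbit (suc (suc m))
        orbitSquare-level₂-down m s = orbitSquare-level₀ (suc (suc m)) (orbitSquare-down level₀ nsq₀ (suc m) (orbitSquare-down level₁ nsq₁ m s))

        nextSquare-level₂-down : Level.NextSquare level₂ → ∃ λ (q : ℚ) → q ℚ.* q ≡ orbit 3
        nextSquare-level₂-down s = orbitSquare-level₀ 3 (orbitSquare-down level₀ nsq₀ 2 (nextSquare-down level₁ nsq₁ s))

      nextSquare-level₁-down : Level.NextSquare level₁ → ∃ λ (q : ℚ) → q ℚ.* q ≡ orbit 2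
      nextSquare-level₁-down s = orbitSquare-level₀ 2 (nextSquare-down level₀ nsq₀ s)

-- The numerators of the critical orbit: sizes, divisibility, and the factorisation of c^N

module CriticalSequence where

  open import Data.Nat.Primality using (Prime)
  open import Data.Nat.Primality.Factorisation using (factorise)
  open import Data.Nat.ListAction using (product)
  open import Data.List using (_∷_; [])
  open import Data.List.Relation.Unary.All using (_∷_)
  open import Data.Nat
  open import Data.Nat.Properties
  open import Data.Nat.Divisibility
  open import Data.Nat.DivMod
  open import Data.Nat.GCD using (gcd; gcd[m,n]∣m; gcd[m,n]∣n; gcd[m,n]≢0)
  open import Data.Nat.Coprimality as Cop using (Coprime; coprime-divisor; coprime-/gcd)
  open import Data.Nat.Tactic.RingSolver using (solve-∀)
  open import Data.Product using (∃; ∃₂; _×_; _,_)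
  open import Data.Sum using (_⊎_; inj₁; inj₂)
  open import Function using (_∘_; case_of_)
  open import Relation.Binary.Definitions using (tri<; tri≈; tri>)
  open import Relation.Binary.PropositionalEquality
  open import Relation.Nullary using (¬_; yes; no; contradiction)

  coprime-∣ˡ : ∀ {a b c} → a ∣ b → Coprime b c → Coprime a c
  coprime-∣ˡ a∣b cop (d∣a , d∣c) = cop (∣-trans d∣a a∣b , d∣c)

  coprime-*ˡ : ∀ {a b c} → Coprime a c → Coprime b c → Coprime (a * b) c
  coprime-*ˡ {a} {b} {c} ca cb {d} (d∣ab , d∣c) =
    cb (coprime-divisor {m = d} {n = a} (λ { (i∣d , i∣a) → ca (i∣a , ∣-trans i∣d d∣c) }) d∣ab , d∣c)

  coprime-1ˡ : ∀ {c} → Coprime 1 c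
  coprime-1ˡ (d∣1 , _) = ∣1⇒≡1 d∣1

  coprime-^ˡ : ∀ {a c} n → Coprime a c → Coprime (a ^ n) c
  coprime-^ˡ zero    ca = coprime-1ˡ
  coprime-^ˡ (suc n) ca = coprime-*ˡ ca (coprime-^ˡ n ca)

  coprime-^ʳ : ∀ {a c} n → Coprime a c → Coprime a (c ^ n)
  coprime-^ʳ n ca = Cop.sym (coprime-^ˡ n (Cop.sym ca))

  ∣-^ : ∀ {m c} n .{{_ : NonZero n}} → m ∣ c → m ∣ c ^ n
  ∣-^ {c = c} (suc n) m∣c = ∣m⇒∣m*n (c ^ n) m∣c

  ^-mono-∣ : ∀ {a b} n → a ∣ b → a ^ n ∣ b ^ n
  ^-mono-∣ zero    a∣b = ∣-refl
  ^-mono-∣ (suc n) a∣b = *-pres-∣ a∣b (^-mono-∣ n a∣b)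

  *-^-comm : ∀ a b n → (a * b) ^ n ≡ a ^ n * b ^ n
  *-^-comm a b zero    = refl
  *-^-comm a b (suc n) rewrite *-^-comm a b n = lemma a b (a ^ n) (b ^ n)
    where
    lemma : ∀ a b x y → a * b * (x * y) ≡ a * x * (b * y)
    lemma = solve-∀

  ^-injectiveˡ : ∀ {a b} n .{{_ : NonZero n}} → a ^ n ≡ b ^ n → a ≡ b
  ^-injectiveˡ {a} {b} n e with <-cmp a b
  ... | tri< a<b _ _ = contradiction e (<⇒≢ (^-monoˡ-< n a<b))
  ... | tri≈ _ a≡b _ = a≡b
  ... | tri> _ _ b<a = contradiction (sym e) (<⇒≢ (^-monoˡ-< n b<a))

  record GcdSplit (a b : ℕ) : Set where
    constructor gcdSplit
    field
      g a′ b′ : ℕ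
      a≡      : a ≡ g * a′
      b≡      : b ≡ g * b′
      coprime : Coprime a′ b′
      g∣a     : g ∣ a
      g∣b     : g ∣ b
      g>0     : NonZero g

  gcd-split : ∀ a b → NonZero a ⊎ NonZero b → GcdSplit a b
  gcd-split a b nz = gcdSplit (gcd a b) (a / gcd a b) (b / gcd a b)
      (sym (trans (*-comm (gcd a b) _) (m/n*n≡m (gcd[m,n]∣m a b))))
      (sym (trans (*-comm (gcd a b) _) (m/n*n≡m (gcd[m,n]∣n a b))))
      (coprime-/gcd a b) (gcd[m,n]∣m a b) (gcd[m,n]∣n a b) g≢0
    where
    instance
      g≢0 : NonZero (gcd a b)
      g≢0 = ≢-nonZero (gcd[m,n]≢0 a b (Data.Sum.map (λ z → ≢-nonZero⁻¹ a {{z}}) (λ z → ≢-nonZero⁻¹ b {{z}}) nz))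

  -- The base is g = gcd(x, z). Its n-th power divides x y and is prime to y, so it divides x.
  -- Conversely x/g is prime to z/g and divides g^(n-1) (z/g)^n, hence divides g^(n-1).
  coprime-power : ∀ x y z n .{{_ : NonZero n}} → NonZero x → Coprime x y → x * y ≡ z ^ n → ∃ λ g → x ≡ g ^ n × g ∣ z
  coprime-power x y z (suc n) nz cop e = g , ∣-antisym x∣gⁿ gⁿ∣x , g∣b
    where
    open GcdSplit (gcd-split x z (inj₁ nz))
    instance _ = g>0
    gⁿ∣x : g ^ suc n ∣ x
    gⁿ∣x = coprime-divisor {n = y} (coprime-^ˡ (suc n) (coprime-∣ˡ g∣a cop))
             (subst (g ^ suc n ∣_) (trans (sym e) (*-comm x y)) (^-mono-∣ (suc n) g∣b))
    e′ : g * (a′ * y) ≡ g * (g ^ n * b′ ^ suc n)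
    e′ = begin
      g * (a′ * y)              ≡⟨ *-assoc g a′ y ⟨
      g * a′ * y                ≡⟨ cong (_* y) a≡ ⟨
      x * y                     ≡⟨ e ⟩
      z ^ suc n                 ≡⟨ cong (_^ suc n) b≡ ⟩
      (g * b′) ^ suc n          ≡⟨ *-^-comm g b′ (suc n) ⟩
      g * g ^ n * b′ ^ suc n    ≡⟨ *-assoc g (g ^ n) _ ⟩
      g * (g ^ n * b′ ^ suc n)  ∎
      where open ≡-Reasoning
    a′∣gⁿ : a′ ∣ g ^ n
    a′∣gⁿ = coprime-divisor (coprime-^ʳ (suc n) coprime)
              (subst (a′ ∣_) (trans (*-cancelˡ-≡ _ _ g e′) (*-comm (g ^ n) _)) (m∣m*n y))
    x∣gⁿ : x ∣ g ^ suc n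
    x∣gⁿ = subst (_∣ g ^ suc n) (sym a≡) (*-monoʳ-∣ g a′∣gⁿ)

  square-∣ : ∀ a b → a * a ∣ b * b → a ∣ b
  square-∣ zero    b aa∣bb with m*n≡0⇒m≡0∨n≡0 b (0∣⇒≡0 aa∣bb)
  ... | inj₁ refl = ∣-refl
  ... | inj₂ refl = ∣-refl
  square-∣ a@(suc _) b aa∣bb = subst₂ _∣_ (sym a≡) (sym b≡) (*-monoʳ-∣ g a′∣b′)
    where
    open GcdSplit (gcd-split a b (inj₁ _))
    instance _ = g>0
    instance gg>0 : NonZero (g * g)
             gg>0 = m*n≢0 g g
    sq : ∀ g x → g * x * (g * x) ≡ g * g * (x * x)
    sq = solve-∀
    a′a′∣b′b′ : a′ * a′ ∣ b′ * b′
    a′a′∣b′b′ = *-cancelˡ-∣ (g * g) (subst₂ _∣_ (trans (cong (λ z → z * z) a≡) (sq g a′)) (trans (cong (λ z → z * z) b≡) (sq g b′)) aa∣bb)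
    a′∣b′ : a′ ∣ b′
    a′∣b′ = coprime-divisor coprime (∣-trans (m∣m*n a′) a′a′∣b′b′)

  -- The sequence aₙ with f^n(0) = aₙ / c^(2^(n-1)), shifted so that A c k = a₍ₖ₊₁₎;
  -- E k = 2^(k+1) - 1.

  E : ℕ → ℕ
  E zero    = 1
  E (suc k) = suc (E k + E k)

  instance
    E-nonZero : ∀ {k} → NonZero (E k)
    E-nonZero {zero}  = _
    E-nonZero {suc k} = _

  A : ℕ → ℕ → ℕ
  A c zero    = 1
  A c (suc k) = A c k * A c k + c ^ E k

  IsSq : ℕ → Set
  IsSq m = ∃ λ b → m ≡ b * b

  2^suc≡E : ∀ k → 2 ^ suc k ≡ suc (E k)
  2^suc≡E zero    = refl
  2^suc≡E (suc k) rewrite 2^suc≡E k = lemma (E k)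
    where
    lemma : ∀ e → 2 * suc e ≡ suc (suc (e + e))
    lemma = solve-∀

  ^-E-suc : ∀ c k → c ^ E (suc k) ≡ c * (c ^ E k * c ^ E k)
  ^-E-suc c k = cong (c *_) (^-distribˡ-+-* c (E k) (E k))

  A>0 : ∀ c k → 0 < A c k
  A>0 c zero    = s≤s z≤n
  A>0 c (suc k) = ≤-trans (*-mono-≤ (A>0 c k) (A>0 c k)) (m≤m+n _ _)

  A-coprime : ∀ c k → Coprime (A c k) c
  A-coprime c zero    = coprime-1ˡ
  A-coprime c (suc k) {d} (d∣A , d∣c) =
    coprime-*ˡ (A-coprime c k) (A-coprime c k) (∣m+n∣m⇒∣n (subst (d ∣_) (+-comm (A c k * A c k) _) d∣A) (∣-^ (E k) d∣c) , d∣c)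

  A-mod-c : ∀ c k → ∃ λ t → A c k ≡ 1 + c * t
  A-mod-c c zero    = 0 , sym (cong suc (*-zeroʳ c))
  A-mod-c c (suc k) with A-mod-c c k | ∣-^ (E k) (∣-refl {c})
  ... | t , e | divides q e′ = t + t + c * t * t + q , trans (cong₂ _+_ (cong (λ z → z * z) e) e′) (lemma c t q)
    where
    lemma : ∀ c t q → (1 + c * t) * (1 + c * t) + q * c ≡ 1 + c * (t + t + c * t * t + q)
    lemma = solve-∀

  A-lower : ∀ c k → c ^ E k ≤ A c (suc k)
  A-lower c k = m≤n+m (c ^ E k) (A c k * A c k)

  -- In the induction the square of the previous term is at most 4 c^(2 E k), which for c ≥ 4 does
  -- not exceed the new summand c^(E (suc k)).
  A-upper : ∀ c k → 4 ≤ c → A c (suc k) ≤ 2 * c ^ E k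
  A-upper c zero    4≤c = begin
    1 * 1 + c * 1    ≤⟨ +-monoˡ-≤ (c * 1) (≤-trans (s≤s (z≤n {3})) (≤-trans 4≤c (≤-reflexive (sym (*-identityʳ c))))) ⟩
    c * 1 + c * 1    ≡⟨ cong (c * 1 +_) (+-identityʳ (c * 1)) ⟨
    2 * (c * 1)      ∎
    where open ≤-Reasoning
  A-upper c (suc k) 4≤c = begin
    A c (suc k) * A c (suc k) + c ^ E (suc k)        ≤⟨ +-monoˡ-≤ _ (*-mono-≤ (A-upper c k 4≤c) (A-upper c k 4≤c)) ⟩
    2 * p * (2 * p) + c ^ E (suc k)                  ≡⟨ cong (_+ c ^ E (suc k)) (sq p) ⟩
    4 * (p * p) + c ^ E (suc k)                      ≤⟨ +-monoˡ-≤ _ (*-monoˡ-≤ (p * p) 4≤c) ⟩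
    c * (p * p) + c ^ E (suc k)                      ≡⟨ cong (_+ c ^ E (suc k)) (^-E-suc c k) ⟨
    c ^ E (suc k) + c ^ E (suc k)                    ≡⟨ cong (c ^ E (suc k) +_) (+-identityʳ _) ⟨
    2 * c ^ E (suc k)                                ∎
    where
    open ≤-Reasoning
    p : ℕ
    p = c ^ E k
    sq : ∀ p → 2 * p * (2 * p) ≡ 4 * (p * p)
    sq = solve-∀

  -- The sharper bound by (1 + 2/c) c^(E k) is what later gives a relative error O(1/c). The
  -- induction closes because (1 + 2/c)² ≤ 2 for c ≥ 5.
  A-upper′ : ∀ c k → 5 ≤ c → c * A c (suc k) ≤ (2 + c) * c ^ E k
  A-upper′ c zero    5≤c = ≤-trans (≤-reflexive (l c)) (≤-trans (m≤m+n _ c) (≤-reflexive (r c)))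
    where
    l : ∀ c → c * (1 * 1 + c * 1) ≡ c + c * c
    l = solve-∀
    r : ∀ c → c + c * c + c ≡ (2 + c) * (c * 1)
    r = solve-∀
  A-upper′ c (suc k) 5≤c = *-cancelˡ-≤ c {{>-nonZero (≤-trans (s≤s z≤n) 5≤c)}} (begin
    c * (c * (a * a + c ^ E (suc k)))               ≡⟨ l c a (c ^ E (suc k)) ⟩
    c * a * (c * a) + c * (c * c ^ E (suc k))       ≤⟨ +-monoˡ-≤ _ (*-mono-≤ (A-upper′ c k 5≤c) (A-upper′ c k 5≤c)) ⟩
    (2 + c) * p * ((2 + c) * p) + c * (c * c ^ E (suc k))
       ≡⟨ cong (_+ c * (c * c ^ E (suc k))) (m c p) ⟩
    (2 + c) * (2 + c) * (p * p) + c * (c * c ^ E (suc k))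
       ≤⟨ +-monoˡ-≤ _ (*-monoˡ-≤ (p * p) key) ⟩
    2 * (c * c) * (p * p) + c * (c * c ^ E (suc k))
       ≡⟨ cong (λ z → 2 * (c * c) * (p * p) + c * (c * z)) (^-E-suc c k) ⟩
    2 * (c * c) * (p * p) + c * (c * (c * (p * p)))   ≡⟨ r c (p * p) ⟩
    c * ((2 + c) * (c * (p * p)))                     ≡⟨ cong (λ z → c * ((2 + c) * z)) (^-E-suc c k) ⟨
    c * ((2 + c) * c ^ E (suc k))                     ∎)
    where
    open ≤-Reasoning
    a p : ℕ
    a = A c (suc k)
    p = c ^ E k
    l : ∀ c a e → c * (c * (a * a + e)) ≡ c * a * (c * a) + c * (c * e)
    l = solve-∀
    m : ∀ c p → (2 + c) * p * ((2 + c) * p) ≡ (2 + c) * (2 + c) * (p * p)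
    m = solve-∀
    r : ∀ c q → 2 * (c * c) * q + c * (c * (c * q)) ≡ c * ((2 + c) * (c * q))
    r = solve-∀
    key : (2 + c) * (2 + c) ≤ 2 * (c * c)
    key with m≤n⇒∃[o]m+o≡n 5≤c
    ... | d , refl = ≤-trans (m≤m+n _ _) (≤-reflexive (eq d))
      where
      eq : ∀ d → (2 + (5 + d)) * (2 + (5 + d)) + (1 + 6 * d + d * d) ≡ 2 * ((5 + d) * (5 + d))
      eq = solve-∀
  module _ (c k : ℕ) where

    private
      e : ℕ → ℕ
      e zero    = E k
      e (suc j) = e j + e j

      E-e : ∀ j → E (suc (k + j)) ≡ e j + e j + E j
      E-e zero    rewrite +-identityʳ k = sym (trans (+-comm (E k + E k) 1) refl)
      E-e (suc j) = trans (cong (E ∘ suc) (+-suc k j)) (trans (cong (λ z → suc (z + z)) (E-e j)) (lemma (e j) (E j)))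
        where
        lemma : ∀ x y → suc (x + x + y + (x + x + y)) ≡ x + x + (x + x) + suc (y + y)
        lemma = solve-∀

    -- Modulo the square of a = A c k the sequence starts over: of a² + c^(E k) only c^(E k)
    -- remains, and from there the recursion is the one from the beginning, scaled by powers of c.
    -- Here e j = 2^j E k.
    A-periodic : ∀ j → ∃ λ t → A c (suc (k + j)) ≡ c ^ e j * A c j + A c k * A c k * t
    A-periodic zero    = 1 , trans (cong (A c ∘ suc) (+-identityʳ k)) (lemma (A c k * A c k) (c ^ E k))
      where
      lemma : ∀ x y → x + y ≡ y * 1 + x * 1
      lemma = solve-∀
    A-periodic (suc j) with A-periodic j
    ... | t , eq = 2 * (q * A c j * t) + K * t * t , (begin
      A c (suc (k + suc j))                     ≡⟨ cong (A c ∘ suc) (+-suc k j) ⟩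
      B * B + c ^ E (suc (k + j))               ≡⟨ cong₂ _+_ (cong (λ z → z * z) eq) split ⟩
      (q * A c j + K * t) * (q * A c j + K * t) + q * q * c ^ E j                  ≡⟨ lemma q (A c j) K t (c ^ E j) ⟩
      q * q * A c (suc j) + K * (2 * (q * A c j * t) + K * t * t)                  ≡⟨ cong (λ z → z * A c (suc j) + K * (2 * (q * A c j * t) + K * t * t)) (^-distribˡ-+-* c (e j) (e j)) ⟨
      c ^ e (suc j) * A c (suc j) + K * (2 * (q * A c j * t) + K * t * t)          ∎)
      where
      open ≡-Reasoning
      B K q : ℕ
      B = A c (suc (k + j))
      K = A c k * A c k
      q = c ^ e j
      split : c ^ E (suc (k + j)) ≡ q * q * c ^ E j
      split = trans (cong (c ^_) (E-e j)) (trans (^-distribˡ-+-* c (e j + e j) (E j)) (cong (_* c ^ E j) (^-distribˡ-+-* c (e j) (e j))))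
      lemma : ∀ q a K t x → (q * a + K * t) * (q * a + K * t) + q * q * x ≡ q * q * (a * a + x) + K * (2 * (q * a * t) + K * t * t)
      lemma = solve-∀

    -- Because of the shift, k + q * suc k is the index of the multiple (q + 1)(k + 1). Modulo A c k
    -- each new cofactor is a power of c times the previous one, and c is prime to A c k.
    A-multiple : ∀ q → ∃ λ t → A c (k + q * suc k) ≡ A c k * t × Coprime t (A c k)
    A-multiple zero    = 1 , trans (cong (A c) (+-identityʳ k)) (sym (*-identityʳ _)) , coprime-1ˡ
    A-multiple (suc q) with A-multiple q
    ... | t , eq , cop with A-periodic (k + q * suc k)
    ...   | s , eq′ = p * t + A c k * s , (begin
        A c (k + (suc k + q * suc k))          ≡⟨ cong (A c) (trans (+-suc k (k + q * suc k)) refl) ⟩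
        A c (suc (k + (k + q * suc k)))        ≡⟨ eq′ ⟩
        p * A c (k + q * suc k) + A c k * A c k * s  ≡⟨ cong (λ z → p * z + A c k * A c k * s) eq ⟩
        p * (A c k * t) + A c k * A c k * s    ≡⟨ lemma p (A c k) t s ⟩
        A c k * (p * t + A c k * s)            ∎)
      , cop′
      where
      open ≡-Reasoning
      p : ℕ
      p = c ^ e (k + q * suc k)
      cop′ : Coprime (p * t + A c k * s) (A c k)
      cop′ {d} (d∣t′ , d∣A) = coprime-*ˡ (coprime-^ˡ (e (k + q * suc k)) (Cop.sym (A-coprime c k))) cop
        (∣m+n∣m⇒∣n (subst (d ∣_) (+-comm (p * t) _) d∣t′) (∣m⇒∣m*n s d∣A) , d∣A)
      lemma : ∀ p a t s → p * (a * t) + a * a * s ≡ a * (p * t + a * s)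
      lemma = solve-∀

    square-descends : ∀ q → IsSq (A c (k + q * suc k)) → IsSq (A c k)
    square-descends q (b , eq) = go (A-multiple q)
      where
      unwrap : (∃ λ g → A c k ≡ g ^ 2 × g ∣ b) → IsSq (A c k)
      unwrap (g , e′ , _) = g , trans e′ (cong (g *_) (*-identityʳ g))
      go : (∃ λ t → A c (k + q * suc k) ≡ A c k * t × Coprime t (A c k)) → IsSq (A c k)
      go (t , eq′ , cop) = unwrap (coprime-power (A c k) t b 2 (>-nonZero (A>0 c k)) (Cop.sym cop)
                                    (trans (sym eq′) (trans eq (cong (b *_) (sym (*-identityʳ b))))))

  odd-or-even : ∀ n → ∃ λ h → n ≡ h + h ⊎ n ≡ suc (h + h)
  odd-or-even zero    = 0 , inj₁ refl
  odd-or-even (suc n) with odd-or-even n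
  ... | h , inj₁ e = h , inj₂ (cong suc e)
  ... | h , inj₂ e = suc h , inj₁ (cong suc (trans e (sym (+-suc h h))))

  2∣double : ∀ h → 2 ∣ h + h
  2∣double h = divides h (trans (cong (h +_) (sym (+-identityʳ h))) (*-comm 2 h))

  odd-coprime-2 : ∀ h → Coprime (suc (h + h)) 2
  odd-coprime-2 h (d∣o , d∣2) with ∣⇒≤ d∣2
  odd-coprime-2 h {zero}  (d∣o , d∣2) | _ = contradiction (0∣⇒≡0 d∣2) λ ()
  odd-coprime-2 h {suc zero} _        | _ = refl
  odd-coprime-2 h {suc (suc zero)} (d∣o , _) | _ = contradiction (∣m+n∣m⇒∣n (subst (2 ∣_) (+-comm 1 (h + h)) d∣o) (2∣double h)) λ 2∣1 → case ∣1⇒≡1 2∣1 of λ ()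
  odd-coprime-2 h {suc (suc (suc _))} _ | s≤s (s≤s ())

  2∣∧2∤ : ∀ h → ¬ 2 ∣ suc (h + h)
  2∣∧2∤ h 2∣o = case odd-coprime-2 h (2∣o , ∣-refl) of λ ()

  2∣² : ∀ b → 2 ∣ b * b → 2 ∣ b
  2∣² b 2∣bb with odd-or-even b
  ... | h , inj₁ refl = 2∣double h
  ... | h , inj₂ refl = contradiction (coprime-divisor (Cop.sym (odd-coprime-2 h)) 2∣bb) (2∣∧2∤ h)

  record SquareRoot (a C : ℕ) : Set where
    field
      e  : ℕ
      eq : C ≡ e * (e + 2 * a)

  square-difference : ∀ a C b → a * a + C ≡ b * b → SquareRoot a C
  square-difference a C b eq with a ≤? b
  ... | no a≰b = contradiction eq (>⇒≢ (<-≤-trans (*-mono-< (≰⇒> a≰b) (≰⇒> a≰b)) (m≤m+n (a * a) C)))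
  ... | yes a≤b with m≤n⇒∃[o]m+o≡n a≤b
  ...   | e , refl = record { e = e ; eq = +-cancelˡ-≡ (a * a) C _ (trans eq (lemma a e)) }
    where
    lemma : ∀ a e → (a + e) * (a + e) ≡ a * a + e * (e + 2 * a)
    lemma = solve-∀

  -- If a² + c^N = b² and b - a = 2 b₁, then c^N = 4 b₁ (b₁ + a) with b₁ prime to b₁ + a. As a is
  -- odd, exactly one of these two is even; the factor 4 joins it to form w^N, and the odd one is
  -- u^N. The alternative in `eq` records which is which.
  record EvenSplit (c a N : ℕ) : Set where
    field
      u w     : ℕ
      c≡      : c ≡ u * w
      coprime : Coprime u w
      2∣w     : 2 ∣ w
      eq      : w ^ N ≡ 4 * u ^ N + 4 * a ⊎ w ^ N + 4 * a ≡ 4 * u ^ N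

  private
    coprime-bases : ∀ {u w n} .{{_ : NonZero n}} → Coprime (u ^ n) (w ^ n) → Coprime u w
    coprime-bases {n = n} cop (d∣u , d∣w) = cop (∣-^ n d∣u , ∣-^ n d∣w)

    even-base : ∀ {w} n → 2 ∣ w ^ n → 2 ∣ w
    even-base {w} n 2∣wⁿ with odd-or-even w
    ... | h , inj₁ refl = 2∣double h
    ... | h , inj₂ refl = contradiction (coprime-^ˡ n (odd-coprime-2 h) (2∣wⁿ , ∣-refl)) λ ()

  even-split : ∀ c a N .{{_ : NonZero N}} → 2 ∣ c → 0 < c → Coprime a c → IsSq (a * a + c ^ N) → EvenSplit c a N
  even-split c a N 2∣c 0<c cop (b , eq) = go
    where
    open SquareRoot (square-difference a (c ^ N) b eq) renaming (e to e₀; eq to eq₀)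
    instance
      c≢0 = >-nonZero 0<c
      cN≢0 = m^n≢0 c N
    2∣e : 2 ∣ e₀
    2∣e = 2∣² e₀ (∣m+n∣m⇒∣n (subst (2 ∣_) (trans eq₀ (trans (*-distribˡ-+ e₀ e₀ (2 * a)) (+-comm (e₀ * e₀) _))) (∣-^ N 2∣c))
                            (∣n⇒∣m*n e₀ (m∣m*n a)))
    b₁ : ℕ
    b₁ = quotient 2∣e
    eq₁ : 4 * (b₁ * (b₁ + a)) ≡ c ^ N
    eq₁ = sym (trans eq₀ (trans (cong (λ z → z * (z + 2 * a)) (m∣n⇒n≡quotient*m 2∣e)) (lemma b₁ a)))
      where
      lemma : ∀ b a → b * 2 * (b * 2 + 2 * a) ≡ 4 * (b * (b + a))
      lemma = solve-∀
    a-odd : Coprime a 2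
    a-odd (d∣a , d∣2) = cop (d∣a , ∣-trans d∣2 2∣c)
    cop₁ : Coprime b₁ (b₁ + a)
    cop₁ {d} (d∣b , d∣b+a) = coprime-^ʳ N cop
      (∣m+n∣m⇒∣n d∣b+a d∣b , subst (d ∣_) eq₁ (∣n⇒∣m*n 4 (∣m⇒∣m*n (b₁ + a) d∣b)))
    build : ∀ x y → Coprime x y → x * y ≡ c ^ N → 2 ∣ y →
            (∀ u w → x ≡ u ^ N → y ≡ w ^ N → w ^ N ≡ 4 * u ^ N + 4 * a ⊎ w ^ N + 4 * a ≡ 4 * u ^ N) → EvenSplit c a N
    build x y copxy xy 2∣y k
      with coprime-power x y c N (m*n≢0⇒m≢0 x {{subst NonZero (sym xy) cN≢0}}) copxy xy
         | coprime-power y x c N (m*n≢0⇒n≢0 x {{subst NonZero (sym xy) cN≢0}}) (Cop.sym copxy) (trans (*-comm y x) xy)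
    ... | u , refl , _ | w , refl , _ = record
      { u = u ; w = w
      ; c≡ = ^-injectiveˡ N (trans (sym xy) (sym (*-^-comm u w N)))
      ; coprime = coprime-bases {n = N} copxy
      ; 2∣w = even-base N 2∣y
      ; eq = k u w refl refl }
    go : EvenSplit c a N
    go with odd-or-even b₁
    ... | h , inj₁ b≡ = build (b₁ + a) (4 * b₁)
            (Cop.sym (coprime-*ˡ (coprime-*ˡ {2} {2} 2⊥ 2⊥) cop₁))
            (trans (lemma b₁ a) eq₁) (∣m⇒∣m*n b₁ (divides 2 refl))
            (λ u w e₁ e₂ → inj₂ (trans (cong (_+ 4 * a) (sym e₂)) (trans (sym (*-distribˡ-+ 4 b₁ a)) (cong (4 *_) e₁))))
      where
      lemma : ∀ b a → (b + a) * (4 * b) ≡ 4 * (b * (b + a))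
      lemma = solve-∀
      2⊥ : Coprime 2 (b₁ + a)
      2⊥ {d} (d∣2 , d∣) = a-odd (∣m+n∣m⇒∣n d∣ (∣-trans d∣2 (subst (2 ∣_) (sym b≡) (2∣double h))) , d∣2)
    ... | h , inj₂ b≡ = build b₁ (4 * (b₁ + a))
            (Cop.sym (coprime-*ˡ (coprime-*ˡ {2} {2} 2⊥ 2⊥) (Cop.sym cop₁)))
            (trans (lemma b₁ a) eq₁) (∣m⇒∣m*n (b₁ + a) (divides 2 refl))
            (λ u w e₁ e₂ → inj₁ (trans (sym e₂) (trans (*-distribˡ-+ 4 b₁ a) (cong (λ z → 4 * z + 4 * a) e₁))))
      where
      lemma : ∀ b a → b * (4 * (b + a)) ≡ 4 * (b * (b + a))
      lemma = solve-∀
      2⊥ : Coprime 2 b₁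
      2⊥ rewrite b≡ = Cop.sym (odd-coprime-2 h)

  -- For odd c the factors b - a and b + a of c^N are coprime without any adjustment at 2.
  odd-split : ∀ c a N .{{_ : NonZero N}} → ¬ 2 ∣ c → Coprime a c → IsSq (a * a + c ^ N) →
              ∃₂ λ x y → c ≡ x * y × y ^ N ≡ x ^ N + 2 * a
  odd-split c a N 2∤c cop (b , eq) with odd-or-even c
  ... | h , inj₁ refl = contradiction (2∣double h) 2∤c
  ... | h , inj₂ refl = go
    where
    open SquareRoot (square-difference a (c ^ N) b eq) renaming (e to e₀; eq to eq₀)
    instance cN≢0 = m^n≢0 c N
    cop₁ : Coprime e₀ (e₀ + 2 * a)
    cop₁ {d} (d∣e , d∣s) = cop (coprime-divisor (λ { (i∣d , i∣2) → coprime-^ˡ N (odd-coprime-2 h) (∣-trans i∣d d∣cN , i∣2) }) (∣m+n∣m⇒∣n d∣s d∣e) , d∣c)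
      where
      d∣cN : d ∣ c ^ N
      d∣cN = subst (d ∣_) (sym eq₀) (∣m⇒∣m*n _ d∣e)
      d∣a : d ∣ a
      d∣a = coprime-divisor (λ { (i∣d , i∣2) → coprime-^ˡ N (odd-coprime-2 h) (∣-trans i∣d d∣cN , i∣2) }) (∣m+n∣m⇒∣n d∣s d∣e)
      d∣c : d ∣ c
      d∣c = subst (_∣ c) (sym (coprime-^ʳ N cop (d∣a , d∣cN))) (1∣ c)
    go : ∃₂ λ x y → c ≡ x * y × y ^ N ≡ x ^ N + 2 * a
    go with coprime-power e₀ (e₀ + 2 * a) c N (m*n≢0⇒m≢0 e₀ {{subst NonZero eq₀ cN≢0}}) cop₁ (sym eq₀)
          | coprime-power (e₀ + 2 * a) e₀ c N (m*n≢0⇒n≢0 e₀ {{subst NonZero eq₀ cN≢0}}) (Cop.sym cop₁) (trans (*-comm _ e₀) (sym eq₀))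
    ... | x , e₁ , _ | y , e₂ , _ = x , y , ^-injectiveˡ N (trans eq₀ (trans (cong₂ _*_ e₁ e₂) (sym (*-^-comm x y N))))
                                          , trans (sym e₂) (cong (_+ 2 * a) e₁)

  prime-divisor : ∀ n → 2 ≤ n → ∃ λ p → Prime p × p ∣ n
  prime-divisor (suc zero) (s≤s ())
  prime-divisor n@(suc (suc _)) _ with factorise n
  ... | record { factors = p ∷ ps ; isFactorisation = e ; factorsPrime = pr ∷ _ } = p , pr , divides (product ps) (trans e (*-comm p (product ps)))
  ... | record { factors = [] ; isFactorisation = () }

-- Differences of N-th powers, and odd c

module OddParameter where

  open CriticalSequence
  open import Data.Nat
  open import Data.Nat.Properties
  open import Data.Nat.Divisibility
  open import Data.Nat.DivMod
  import Data.Nat.Coprimality as Cop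
  open import Data.Nat.Tactic.RingSolver using (solve-∀)
  open import Data.Empty using (⊥)
  open import Data.Product using (Σ; _,_)
  open import Data.Sum using (_⊎_; inj₁; inj₂)
  open import Function using (case_of_)
  open import Relation.Binary.PropositionalEquality
  open import Relation.Nullary using (¬_; yes; no; contradiction)
  ≤-by : ∀ {m n} d → m + d ≡ n → m ≤ n
  ≤-by d e = ≤-trans (m≤m+n _ d) (≤-reflexive e)

  2ab≤a²+b² : ∀ a b → 2 * (a * b) ≤ a * a + b * b
  2ab≤a²+b² a b with ≤-total a b
  ... | inj₁ a≤b with m≤n⇒∃[o]m+o≡n a≤b
  ...   | d , refl = ≤-by (d * d) (lemma a d)
    where
    lemma : ∀ a d → 2 * (a * (a + d)) + d * d ≡ a * a + (a + d) * (a + d)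
    lemma = solve-∀
  2ab≤a²+b² a b | inj₂ b≤a with m≤n⇒∃[o]m+o≡n b≤a
  ...   | d , refl = ≤-by (d * d) (lemma b d)
    where
    lemma : ∀ b d → 2 * ((b + d) * b) + d * d ≡ (b + d) * (b + d) + b * b
    lemma = solve-∀

  -- geometric X Y M = Σ Xⁱ Y²ᴹ⁻ⁱ, so that (X - Y) · geometric X Y M = X²ᴹ⁺¹ - Y²ᴹ⁺¹.
  geometric : ℕ → ℕ → ℕ → ℕ
  geometric X Y zero    = 1
  geometric X Y (suc M) = X ^ suc M * X ^ suc M + Y ^ suc M * Y ^ suc M + X * Y * geometric X Y M

  geometric-factor : ∀ Y t M → t * geometric (Y + t) Y M + Y * (Y ^ M * Y ^ M) ≡ (Y + t) * ((Y + t) ^ M * (Y + t) ^ M)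
  geometric-factor Y t zero    = lemma Y t
    where
    lemma : ∀ Y t → t * 1 + Y * (1 * 1) ≡ (Y + t) * (1 * 1)
    lemma = solve-∀
  geometric-factor Y t (suc M) = +-cancelʳ-≡ (X * Y * (Y * (y * y))) _ _ (begin
    t * (X * x * (X * x) + Y * y * (Y * y) + X * Y * S) + Y * (Y * y * (Y * y)) + X * Y * (Y * (y * y))
      ≡⟨ l₁ X Y t S x y ⟩
    t * (X * x * (X * x)) + t * (Y * y * (Y * y)) + Y * (Y * y * (Y * y)) + X * Y * (t * S + Y * (y * y))
      ≡⟨ cong (λ z → t * (X * x * (X * x)) + t * (Y * y * (Y * y)) + Y * (Y * y * (Y * y)) + X * Y * z) (geometric-factor Y t M) ⟩
    t * (X * x * (X * x)) + t * (Y * y * (Y * y)) + Y * (Y * y * (Y * y)) + X * Y * (X * (x * x))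
      ≡⟨ l₂ Y t x y ⟩
    X * (X * x * (X * x)) + X * Y * (Y * (y * y)) ∎)
    where
    open ≡-Reasoning
    X x y S : ℕ
    X = Y + t
    x = X ^ M
    y = Y ^ M
    S = geometric X Y M
    l₁ : ∀ X Y t S x y → t * (X * x * (X * x) + Y * y * (Y * y) + X * Y * S) + Y * (Y * y * (Y * y)) + X * Y * (Y * (y * y))
         ≡ t * (X * x * (X * x)) + t * (Y * y * (Y * y)) + Y * (Y * y * (Y * y)) + X * Y * (t * S + Y * (y * y))
    l₁ = solve-∀
    l₂ : ∀ Y t x y → t * ((Y + t) * x * ((Y + t) * x)) + t * (Y * y * (Y * y)) + Y * (Y * y * (Y * y)) + (Y + t) * Y * ((Y + t) * (x * x))
         ≡ (Y + t) * ((Y + t) * x * ((Y + t) * x)) + (Y + t) * Y * (Y * (y * y))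
    l₂ = solve-∀

  -- Outer terms are paired: X^(2M) + Y^(2M) is at least 2 (XY)^M, and the inner terms are XY times
  -- the sum for M - 1.
  geometric-lower : ∀ X Y M → suc (M + M) * (X ^ M * Y ^ M) ≤ geometric X Y M
  geometric-lower X Y zero    = ≤-refl
  geometric-lower X Y (suc M) = begin
    suc (suc M + suc M) * (X * x * (Y * y))                             ≡⟨ l X Y M x y ⟩
    2 * (X * x * (Y * y)) + X * Y * (suc (M + M) * (x * y))             ≤⟨ +-mono-≤ (2ab≤a²+b² (X * x) (Y * y)) (*-monoʳ-≤ (X * Y) (geometric-lower X Y M)) ⟩
    X * x * (X * x) + Y * y * (Y * y) + X * Y * geometric X Y M         ∎
    where
    open ≤-Reasoning
    x y : ℕ
    x = X ^ M
    y = Y ^ M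
    l : ∀ X Y M x y → suc (suc M + suc M) * (X * x * (Y * y)) ≡ 2 * (X * x * (Y * y)) + X * Y * (suc (M + M) * (x * y))
    l = solve-∀

  -- Each pair of mirror terms is at most X^(2M) + Y^(2M), the outer one.
  geometric-upper : ∀ Y t M → 2 * geometric (Y + t) Y M ≤ suc (M + M) * ((Y + t) ^ M * (Y + t) ^ M + Y ^ M * Y ^ M)
  geometric-upper Y t zero    = ≤-refl
  geometric-upper Y t (suc M) with m≤n⇒∃[o]m+o≡n (*-mono-≤ (^-monoˡ-≤ M (m≤m+n Y t)) (^-monoˡ-≤ M (m≤m+n Y t)))
  ... | s , e = begin
    2 * (X * x * (X * x) + Y * y * (Y * y) + X * Y * S)                  ≡⟨ l₁ X Y S x y ⟩
    2 * (X * x * (X * x) + Y * y * (Y * y)) + X * Y * (2 * S)            ≤⟨ +-monoʳ-≤ _ (*-monoʳ-≤ (X * Y) (geometric-upper Y t M)) ⟩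
    2 * (X * x * (X * x) + Y * y * (Y * y)) + X * Y * (suc (M + M) * (x * x + y * y))
      ≡⟨ cong (2 * (X * x * (X * x) + Y * y * (Y * y)) +_) (l₂ X Y M (x * x) (y * y)) ⟩
    2 * (X * x * (X * x) + Y * y * (Y * y)) + suc (M + M) * (X * Y * (x * x + y * y))
      ≤⟨ +-monoʳ-≤ (2 * (X * x * (X * x) + Y * y * (Y * y))) (*-monoʳ-≤ (suc (M + M)) mid) ⟩
    2 * (X * x * (X * x) + Y * y * (Y * y)) + suc (M + M) * (X * x * (X * x) + Y * y * (Y * y))
      ≡⟨ l₃ M (X * x * (X * x) + Y * y * (Y * y)) ⟩
    suc (suc M + suc M) * (X * x * (X * x) + Y * y * (Y * y))            ∎
    where
    open ≤-Reasoning
    X x y S : ℕ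
    X = Y + t
    x = X ^ M
    y = Y ^ M
    S = geometric X Y M
    l₁ : ∀ X Y S x y → 2 * (X * x * (X * x) + Y * y * (Y * y) + X * Y * S) ≡ 2 * (X * x * (X * x) + Y * y * (Y * y)) + X * Y * (2 * S)
    l₁ = solve-∀
    l₂ : ∀ X Y M p q → X * Y * (suc (M + M) * (p + q)) ≡ suc (M + M) * (X * Y * (p + q))
    l₂ = solve-∀
    l₃ : ∀ M z → 2 * z + suc (M + M) * z ≡ suc (suc M + suc M) * z
    l₃ = solve-∀
    mid : X * Y * (x * x + y * y) ≤ X * x * (X * x) + Y * y * (Y * y)
    mid = begin
      X * Y * (x * x + y * y)          ≡⟨ cong (λ z → X * Y * (z + y * y)) (sym e) ⟩
      X * Y * (y * y + s + y * y)      ≤⟨ ≤-by (Y * t * s + t * t * (y * y) + t * t * s) (l₄ Y t (y * y) s) ⟩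
      X * X * (y * y + s) + Y * Y * (y * y)  ≡⟨ cong (λ z → X * X * z + Y * Y * (y * y)) e ⟩
      X * X * (x * x) + Y * Y * (y * y)      ≡⟨ cong₂ _+_ (sq X x) (sq Y y) ⟩
      X * x * (X * x) + Y * y * (Y * y)      ∎
      where
      l₄ : ∀ Y t q s → (Y + t) * Y * (q + s + q) + (Y * t * s + t * t * q + t * t * s) ≡ (Y + t) * (Y + t) * (q + s) + Y * Y * q
      l₄ = solve-∀
      sq : ∀ a b → a * a * (b * b) ≡ a * b * (a * b)
      sq = solve-∀

  odd-power : ∀ X M → X ^ suc (M + M) ≡ X * (X ^ M * X ^ M)
  odd-power X M = cong (X *_) (^-distribˡ-+-* X M M)

  -- Two-sided bounds for X - Y in terms of X²ᴹ⁺¹ - Y²ᴹ⁺¹ and X Y.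
  module PowerDifference (Y t M Δ : ℕ) (e : Y ^ suc (M + M) + Δ ≡ (Y + t) ^ suc (M + M)) where
    private
      X N : ℕ
      X = Y + t
      N = suc (M + M)

    Δ≡ : Δ ≡ t * geometric X Y M
    Δ≡ = +-cancelˡ-≡ (Y ^ N) _ _ (begin
      Y ^ N + Δ                                   ≡⟨ e ⟩
      X ^ N                                       ≡⟨ odd-power X M ⟩
      X * (X ^ M * X ^ M)                         ≡⟨ geometric-factor Y t M ⟨
      t * geometric X Y M + Y * (Y ^ M * Y ^ M)   ≡⟨ +-comm (t * geometric X Y M) _ ⟩
      Y * (Y ^ M * Y ^ M) + t * geometric X Y M   ≡⟨ cong (_+ t * geometric X Y M) (odd-power Y M) ⟨
      Y ^ N + t * geometric X Y M                 ∎)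
      where open ≡-Reasoning

    difference-upper : N * t * (X * Y) ^ M ≤ Δ
    difference-upper = begin
      N * t * (X * Y) ^ M          ≡⟨ cong (N * t *_) (*-^-comm X Y M) ⟩
      N * t * (X ^ M * Y ^ M)      ≡⟨ l N t (X ^ M * Y ^ M) ⟩
      t * (N * (X ^ M * Y ^ M))    ≤⟨ *-monoʳ-≤ t (geometric-lower X Y M) ⟩
      t * geometric X Y M          ≡⟨ Δ≡ ⟨
      Δ                            ∎
      where
      open ≤-Reasoning
      l : ∀ N t z → N * t * z ≡ t * (N * z)
      l = solve-∀

    -- The upper bound for `geometric` involves P + Q = X^(2M) + Y^(2M). It is expressed through Δ
    -- and XY alone by XY (P + Q)² ≤ (XP + YQ)² = (X^N + Y^N)² = Δ² + 4 (XY)^N.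
    difference-lower : 4 * (X * Y) * (Δ * Δ) ≤ N * t * (N * t) * (Δ * Δ + 4 * (X * Y) ^ N)
    difference-lower = begin
      4 * (X * Y) * (Δ * Δ)                            ≡⟨ l₁ (X * Y) Δ ⟩
      X * Y * (2 * Δ * (2 * Δ))                        ≤⟨ *-monoʳ-≤ (X * Y) (*-mono-≤ 2Δ≤ 2Δ≤) ⟩
      X * Y * (N * t * (P + Q) * (N * t * (P + Q)))    ≡⟨ l₂ (X * Y) (N * t) (P + Q) ⟩
      N * t * (N * t) * (X * Y * ((P + Q) * (P + Q)))  ≤⟨ *-monoʳ-≤ (N * t * (N * t)) sq≤ ⟩
      N * t * (N * t) * ((X * P + Y * Q) * (X * P + Y * Q))
        ≡⟨ cong (λ z → N * t * (N * t) * z) (trans (cong₂ (λ u v → (u + v) * (u + v)) (trans (sym (odd-power X M)) (sym e)) (sym (odd-power Y M))) (l₃ (Y ^ N) Δ)) ⟩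
      N * t * (N * t) * (Δ * Δ + 4 * ((Y ^ N + Δ) * Y ^ N))
        ≡⟨ cong (λ z → N * t * (N * t) * (Δ * Δ + 4 * z)) (trans (cong (_* Y ^ N) e) (sym (*-^-comm X Y N))) ⟩
      N * t * (N * t) * (Δ * Δ + 4 * (X * Y) ^ N)      ∎
      where
      open ≤-Reasoning
      P Q : ℕ
      P = X ^ M * X ^ M
      Q = Y ^ M * Y ^ M
      l₁ : ∀ z d → 4 * z * (d * d) ≡ z * (2 * d * (2 * d))
      l₁ = solve-∀
      l₂ : ∀ z n p → z * (n * p * (n * p)) ≡ n * n * (z * (p * p))
      l₂ = solve-∀
      l₃ : ∀ y d → (y + d + y) * (y + d + y) ≡ d * d + 4 * ((y + d) * y)
      l₃ = solve-∀
      2Δ≤ : 2 * Δ ≤ N * t * (P + Q)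
      2Δ≤ = begin
        2 * Δ                       ≡⟨ cong (2 *_) Δ≡ ⟩
        2 * (t * geometric X Y M)   ≡⟨ l t (geometric X Y M) ⟩
        t * (2 * geometric X Y M)   ≤⟨ *-monoʳ-≤ t (geometric-upper Y t M) ⟩
        t * (N * (P + Q))           ≡⟨ l′ t N (P + Q) ⟩
        N * t * (P + Q)             ∎
        where
        l : ∀ t g → 2 * (t * g) ≡ t * (2 * g)
        l = solve-∀
        l′ : ∀ t n z → t * (n * z) ≡ n * t * z
        l′ = solve-∀
      sq≤ : X * Y * ((P + Q) * (P + Q)) ≤ (X * P + Y * Q) * (X * P + Y * Q)
      sq≤ with m≤n⇒∃[o]m+o≡n (*-mono-≤ (^-monoˡ-≤ M (m≤m+n Y t)) (^-monoˡ-≤ M (m≤m+n Y t)))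
      ... | s , e′ = subst (λ z → X * Y * ((z + Q) * (z + Q)) ≤ (X * z + Y * Q) * (X * z + Y * Q)) e′
                      (≤-by (t * (Y * (2 * Q * s + s * s) + t * ((Q + s) * (Q + s)))) (l₄ Y t Q s))
        where
        l₄ : ∀ Y t q s → (Y + t) * Y * ((q + s + q) * (q + s + q)) + t * (Y * (2 * q * s + s * s) + t * ((q + s) * (q + s)))
             ≡ ((Y + t) * (q + s) + Y * q) * ((Y + t) * (q + s) + Y * q)
        l₄ = solve-∀
  -- This serves the parameter c = 3, which lies below the range of the size argument.
  A3-mod4 : ∀ k → A 3 (suc k) % 4 ≡ 0 ⊎ A 3 (suc k) % 4 ≡ 3
  A3-mod4 k = go k
    where
    3^odd : ∀ m → 3 ^ suc (m + m) % 4 ≡ 3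
    3^odd zero    = refl
    3^odd (suc m) = begin
      3 ^ suc (suc m + suc m) % 4    ≡⟨ cong (λ z → 3 ^ suc (suc z) % 4) (+-suc m m) ⟩
      3 * (3 * 3 ^ suc (m + m)) % 4  ≡⟨ cong (_% 4) (sym (*-assoc 3 3 (3 ^ suc (m + m)))) ⟩
      9 * 3 ^ suc (m + m) % 4        ≡⟨ %-distribˡ-* 9 (3 ^ suc (m + m)) 4 ⟩
      1 * (3 ^ suc (m + m) % 4) % 4  ≡⟨ cong (λ z → 1 * z % 4) (3^odd m) ⟩
      3                              ∎
      where open ≡-Reasoning
    next : ∀ k → A 3 (suc (suc k)) % 4 ≡ (A 3 (suc k) % 4 * (A 3 (suc k) % 4) % 4 + 3) % 4
    next k = trans (%-distribˡ-+ (A 3 (suc k) * A 3 (suc k)) (3 ^ E (suc k)) 4)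
               (cong₂ (λ u v → (u + v) % 4) (%-distribˡ-* (A 3 (suc k)) (A 3 (suc k)) 4) (3^odd (E k)))
    go : ∀ k → A 3 (suc k) % 4 ≡ 0 ⊎ A 3 (suc k) % 4 ≡ 3
    go zero    = inj₁ refl
    go (suc k) with go k
    ... | inj₁ e = inj₂ (trans (next k) (cong (λ z → (z * z % 4 + 3) % 4) e))
    ... | inj₂ e = inj₁ (trans (next k) (cong (λ z → (z * z % 4 + 3) % 4) e))

  3^odd-mod8 : ∀ m → 3 ^ suc (m + m) % 8 ≡ 3
  3^odd-mod8 zero    = refl
  3^odd-mod8 (suc m) = begin
    3 ^ suc (suc m + suc m) % 8    ≡⟨ cong (λ z → 3 ^ suc (suc z) % 8) (+-suc m m) ⟩
    3 * (3 * 3 ^ suc (m + m)) % 8  ≡⟨ cong (_% 8) (sym (*-assoc 3 3 (3 ^ suc (m + m)))) ⟩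
    9 * 3 ^ suc (m + m) % 8        ≡⟨ %-distribˡ-* 9 (3 ^ suc (m + m)) 8 ⟩
    1 * (3 ^ suc (m + m) % 8) % 8  ≡⟨ cong (λ z → 1 * z % 8) (3^odd-mod8 m) ⟩
    3                              ∎
    where open ≡-Reasoning

  -- Here c = xy and y^N - x^N = 2a ≤ 4 c^M. If y - x ≥ 2, the difference of powers is at least 2N
  -- c^M ≥ 6 c^M; if y = x + 1, then c is even. Below 4 only c = 3 with x = 1, y = 3 remains, and
  -- there 3^N = 1 + 2a fails modulo 8.
  odd-nonsquare : ∀ c k → ¬ 2 ∣ c → ¬ IsSq (A c (suc (suc k)))
  odd-nonsquare c k 2∤c sq with odd-split c (A c (suc k)) (E (suc k)) 2∤c (A-coprime c (suc k)) sq
  ... | x , y , refl , eq = bad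
    where
    N M a : ℕ
    N = E (suc k)
    M = E k
    a = A c (suc k)
    x<y : x < y
    x<y = ≰⇒> λ y≤x → <⇒≱ (m<m+n (x ^ N) (≤-trans (A>0 c (suc k)) (m≤m+n a _))) (≤-trans (≤-reflexive (sym eq)) (^-monoˡ-≤ N y≤x))
    large : 4 ≤ c → ⊥
    large 4≤c with m≤n⇒∃[o]m+o≡n (<⇒≤ x<y)
    ... | zero , e = <⇒≢ x<y (trans (sym (+-identityʳ x)) e)
    ... | suc zero , refl = 2∤c (even-product x)
      where
      even-product : ∀ x → 2 ∣ x * (x + 1)
      even-product x with odd-or-even x
      ... | h , inj₁ refl = ∣m⇒∣m*n _ (2∣double h)
      ... | h , inj₂ refl = ∣n⇒∣m*n (suc (h + h)) (subst (2 ∣_) (l h) (2∣double (suc h)))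
        where
        l : ∀ h → suc h + suc h ≡ suc (h + h) + 1
        l = solve-∀
    ... | suc (suc t) , refl = <⇒≱ small big
      where
      open PowerDifference x (suc (suc t)) M (2 * a) (sym eq)
      instance
        xy≢0 : NonZero (x * (x + suc (suc t)))
        xy≢0 = >-nonZero (≤-trans (s≤s z≤n) 4≤c)
        p≢0 : NonZero ((x * (x + suc (suc t))) ^ M)
        p≢0 = m^n≢0 (x * (x + suc (suc t))) M
      p : ℕ
      p = (x * (x + suc (suc t))) ^ M
      big : 6 * p ≤ 2 * a
      big = ≤-trans (*-monoˡ-≤ p 6≤) (≤-trans (≤-reflexive (cong (λ z → N * suc (suc t) * z ^ M) (*-comm x _))) difference-upper)
        where
        6≤ : 6 ≤ N * suc (suc t)
        6≤ = *-mono-≤ {3} {N} {2} 3≤N (s≤s (s≤s z≤n))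
          where
          3≤N : 3 ≤ N
          3≤N = s≤s (+-mono-≤ (>-nonZero⁻¹ (E k)) (>-nonZero⁻¹ (E k)))
      small : 2 * a < 6 * p
      small = ≤-<-trans (*-monoʳ-≤ 2 (A-upper c k 4≤c)) (≤-trans (m<m+n _ {2 * p} (≤-trans (>-nonZero⁻¹ p) (m≤m+n p _))) (≤-reflexive (l p)))
        where
        l : ∀ p → 2 * (2 * p) + 2 * p ≡ 6 * p
        l = solve-∀
    three : x ≡ 1 → y ≡ 3 → ⊥
    three refl refl = case A3-mod4 k of λ where
        (inj₁ e) → absurd 0 e (λ ())
        (inj₂ e) → absurd 3 e (λ ())
      where
      2a%8 : ∀ r → A 3 (suc k) % 4 ≡ r → (1 + 2 * A 3 (suc k)) % 8 ≡ (1 + 2 * r) % 8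
      2a%8 r e = trans (cong (λ z → (1 + 2 * z) % 8) (trans (m≡m%n+[m/n]*n (A 3 (suc k)) 4) (cong (_+ A 3 (suc k) / 4 * 4) e)))
                   (trans (cong (_% 8) (l r (A 3 (suc k) / 4))) ([m+kn]%n≡m%n (1 + 2 * r) (A 3 (suc k) / 4) 8))
        where
        l : ∀ r q → 1 + 2 * (r + q * 4) ≡ 1 + 2 * r + q * 8
        l = solve-∀
      absurd : ∀ r → A 3 (suc k) % 4 ≡ r → (1 + 2 * r) % 8 ≢ 3 → ⊥
      absurd r e ne = ne (trans (sym (2a%8 r e)) (trans (cong (λ z → (z + 2 * A 3 (suc k)) % 8) (sym (^-zeroˡ N))) (trans (cong (_% 8) (sym eq)) (3^odd-mod8 (E k)))))
    bad : ⊥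
    bad with 4 ≤? c
    ... | yes 4≤c = large 4≤c
    ... | no  4≰c = tiny x y refl refl x<y (≤-pred (≰⇒> 4≰c))
      where
      tiny : ∀ x′ y′ → x ≡ x′ → y ≡ y′ → x′ < y′ → x′ * y′ ≤ 3 → ⊥
      tiny zero          y′ e e′ _  _  = 2∤c (subst (λ z → 2 ∣ z * y) (sym e) (2 ∣0))
      tiny (suc zero)    0  e e′ () _
      tiny (suc zero)    1  e e′ (s≤s ()) _
      tiny (suc zero)    2  e e′ _  _  = 2∤c (subst₂ (λ z z′ → 2 ∣ z * z′) (sym e) (sym e′) ∣-refl)
      tiny (suc zero)    3  e e′ _  _  = three e e′
      tiny (suc zero)    (suc (suc (suc (suc z)))) e e′ _ (s≤s (s≤s (s≤s ())))
      tiny (suc (suc z)) y′ e e′ lt le = contradiction le (<⇒≱ (≤-trans (s≤s (s≤s (s≤s (s≤s z≤n))))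
        (*-mono-≤ {2} {suc (suc z)} {3} {y′} (s≤s (s≤s z≤n)) (≤-trans (s≤s (s≤s (s≤s z≤n))) lt))))

-- How far w is from 4^(1/N) u, and what a good rational approximation excludes

module DeviationBounds where

  open CriticalSequence
  open OddParameter
  open import Data.Nat
  open import Data.Nat.Properties
  open import Data.Nat.DivMod
  open import Data.Nat.Tactic.RingSolver using (solve-∀)
  open import Data.Bool using (T)
  open import Data.Empty using (⊥)
  open import Data.Product using (∃; _×_; _,_)
  open import Data.Sum using (_⊎_; inj₁; inj₂)
  open import Relation.Binary.PropositionalEquality

  square-cancel-≤ : ∀ {x y} → x * x ≤ y * y → x ≤ y
  square-cancel-≤ le = ≮⇒≥ λ y<x → <⇒≱ (*-mono-< y<x y<x) le

  -- With τ = Nt, `difference-lower` reads (4cZ - τ²) Δ² ≤ 4 τ² (cZ)^N. Unless 4cZ ≤ τ² already, Δ²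
  -- may be replaced by its lower bound 4a² Z^N; then Z^N cancels, and c^N = c (c^M)² ≤ c a² leaves
  -- 4cZ ≤ τ² (1 + c).
  lower-bound : ∀ M Y t Δ c a Z G → Y ^ suc (M + M) + Δ ≡ (Y + t) ^ suc (M + M) → (Y + t) * Y ≡ c * Z →
                4 * (a * a) * Z ^ suc (M + M) ≤ Δ * Δ → c ^ M ≤ a → 0 < a → 0 < Z → G * G ≤ Z →
                2 * c * G ≤ (1 + c) * (suc (M + M) * t)
  lower-bound M Y t Δ c a Z G e XY cond cM≤a 0<a 0<Z G²≤Z = square-cancel-≤ (begin
      2 * c * G * (2 * c * G)                   ≡⟨ l₁ c G ⟩
      c * (4 * (c * (G * G)))                   ≤⟨ *-monoʳ-≤ c (*-monoʳ-≤ 4 (*-monoʳ-≤ c G²≤Z)) ⟩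
      c * (4 * (c * Z))                         ≤⟨ *-mono-≤ (n≤1+n c) 4cZ≤ ⟩
      (1 + c) * (τ * τ * (1 + c))               ≡⟨ l₂ c τ ⟩
      (1 + c) * τ * ((1 + c) * τ)               ∎)
    where
    open ≤-Reasoning
    open PowerDifference Y t M Δ e
    instance
      a²≢0 : NonZero (a * a)
      a²≢0 = m*n≢0 a a {{>-nonZero 0<a}} {{>-nonZero 0<a}}
      ZN≢0 : NonZero (Z ^ suc (M + M))
      ZN≢0 = m^n≢0 Z (suc (M + M)) {{>-nonZero 0<Z}}
    N τ : ℕ
    N = suc (M + M)
    τ = N * t
    l₁ : ∀ c G → 2 * c * G * (2 * c * G) ≡ c * (4 * (c * (G * G)))
    l₁ = solve-∀
    l₂ : ∀ c τ → (1 + c) * (τ * τ * (1 + c)) ≡ (1 + c) * τ * ((1 + c) * τ)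
    l₂ = solve-∀
    main : 4 * (c * Z) * (a * a) ≤ τ * τ * (a * a + c ^ N)
    main with ≤-total (4 * (c * Z)) (τ * τ)
    ... | inj₁ le = ≤-trans (*-monoˡ-≤ (a * a) le) (*-monoʳ-≤ (τ * τ) (m≤m+n (a * a) (c ^ N)))
    ... | inj₂ ge with m≤n⇒∃[o]m+o≡n ge
    ...   | s , eq = begin
      4 * (c * Z) * (a * a)                 ≡⟨ cong (_* (a * a)) (sym eq) ⟩
      (τ * τ + s) * (a * a)                 ≡⟨ *-distribʳ-+ (a * a) (τ * τ) s ⟩
      τ * τ * (a * a) + s * (a * a)         ≤⟨ +-monoʳ-≤ (τ * τ * (a * a)) sa²≤ ⟩
      τ * τ * (a * a) + τ * τ * c ^ N       ≡⟨ *-distribˡ-+ (τ * τ) (a * a) (c ^ N) ⟨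
      τ * τ * (a * a + c ^ N)               ∎
      where
      sΔ²≤ : s * (Δ * Δ) ≤ 4 * (τ * τ * (c ^ N * Z ^ N))
      sΔ²≤ = +-cancelˡ-≤ (τ * τ * (Δ * Δ)) _ _ (begin
        τ * τ * (Δ * Δ) + s * (Δ * Δ)            ≡⟨ *-distribʳ-+ (Δ * Δ) (τ * τ) s ⟨
        (τ * τ + s) * (Δ * Δ)                    ≡⟨ cong (_* (Δ * Δ)) eq ⟩
        4 * (c * Z) * (Δ * Δ)                    ≡⟨ cong (λ z → 4 * z * (Δ * Δ)) XY ⟨
        4 * ((Y + t) * Y) * (Δ * Δ)              ≤⟨ difference-lower ⟩
        τ * τ * (Δ * Δ + 4 * ((Y + t) * Y) ^ N)  ≡⟨ cong (λ z → τ * τ * (Δ * Δ + 4 * z)) (trans (cong (_^ N) XY) (*-^-comm c Z N)) ⟩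
        τ * τ * (Δ * Δ + 4 * (c ^ N * Z ^ N))    ≡⟨ l (τ * τ) (Δ * Δ) (c ^ N * Z ^ N) ⟩
        τ * τ * (Δ * Δ) + 4 * (τ * τ * (c ^ N * Z ^ N)) ∎)
        where
        l : ∀ x y z → x * (y + 4 * z) ≡ x * y + 4 * (x * z)
        l = solve-∀
      sa²≤ : s * (a * a) ≤ τ * τ * c ^ N
      sa²≤ = *-cancelʳ-≤ _ _ (4 * Z ^ N) {{m*n≢0 4 (Z ^ N)}} (begin
        s * (a * a) * (4 * Z ^ N)            ≡⟨ l s (a * a) (Z ^ N) ⟩
        s * (4 * (a * a) * Z ^ N)            ≤⟨ *-monoʳ-≤ s cond ⟩
        s * (Δ * Δ)                          ≤⟨ sΔ²≤ ⟩
        4 * (τ * τ * (c ^ N * Z ^ N))        ≡⟨ l′ (τ * τ) (c ^ N) (Z ^ N) ⟩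
        τ * τ * c ^ N * (4 * Z ^ N)          ∎)
        where
        l : ∀ s a z → s * a * (4 * z) ≡ s * (4 * a * z)
        l = solve-∀
        l′ : ∀ x y z → 4 * (x * (y * z)) ≡ x * y * (4 * z)
        l′ = solve-∀
    4cZ≤ : 4 * (c * Z) ≤ τ * τ * (1 + c)
    4cZ≤ = *-cancelʳ-≤ _ _ (a * a) (begin
      4 * (c * Z) * (a * a)             ≤⟨ main ⟩
      τ * τ * (a * a + c ^ N)           ≡⟨ cong (λ z → τ * τ * (a * a + z)) (odd-power c M) ⟩
      τ * τ * (a * a + c * (c ^ M * c ^ M))  ≤⟨ *-monoʳ-≤ (τ * τ) (+-monoʳ-≤ (a * a) (*-monoʳ-≤ c (*-mono-≤ cM≤a cM≤a))) ⟩
      τ * τ * (a * a + c * (a * a))     ≡⟨ l (τ * τ) (a * a) c ⟩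
      τ * τ * (1 + c) * (a * a)         ∎)
      where
      l : ∀ x y c → x * (y + c * y) ≡ x * (1 + c) * y
      l = solve-∀

  -- From τ (cZ)^M ≤ Δ and Δ² ≤ 4a² Z^N the powers of Z cancel down to one factor Z, and a is
  -- removed by its bound (1 + 2/c) c^M.
  upper-bound : ∀ M Y t Δ c a Z G → Y ^ suc (M + M) + Δ ≡ (Y + t) ^ suc (M + M) → (Y + t) * Y ≡ c * Z →
                Δ * Δ ≤ 4 * (a * a) * Z ^ suc (M + M) → c * a ≤ (2 + c) * c ^ M → 0 < c → 0 < Z → Z ≤ G * G →
                suc (M + M) * t * c ≤ 2 * (2 + c) * G
  upper-bound M Y t Δ c a Z G e XY cond ca≤ 0<c 0<Z Z≤G² = *-cancelʳ-≤ _ _ (c ^ M) (square-cancel-≤ (begin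
      τ * c * c ^ M * (τ * c * c ^ M)               ≡⟨ l₁ τ c (c ^ M) ⟩
      c * c * (τ * c ^ M * (τ * c ^ M))             ≤⟨ *-monoʳ-≤ (c * c) step ⟩
      c * c * (4 * (a * a) * Z)                     ≡⟨ l₂ c a Z ⟩
      4 * (c * a * (c * a)) * Z                     ≤⟨ *-mono-≤ (*-monoʳ-≤ 4 (*-mono-≤ ca≤ ca≤)) Z≤G² ⟩
      4 * ((2 + c) * c ^ M * ((2 + c) * c ^ M)) * (G * G)  ≡⟨ l₃ (2 + c) (c ^ M) G ⟩
      2 * (2 + c) * G * c ^ M * (2 * (2 + c) * G * c ^ M)  ∎))
    where
    open ≤-Reasoning
    open PowerDifference Y t M Δ e
    N τ : ℕ
    N = suc (M + M)
    τ = N * t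
    instance
      c≢0 = >-nonZero 0<c
      cM≢0 : NonZero (c ^ M)
      cM≢0 = m^n≢0 c M
      ZM≢0 : NonZero (Z ^ M)
      ZM≢0 = m^n≢0 Z M {{>-nonZero 0<Z}}
    l₁ : ∀ τ c p → τ * c * p * (τ * c * p) ≡ c * c * (τ * p * (τ * p))
    l₁ = solve-∀
    l₂ : ∀ c a Z → c * c * (4 * (a * a) * Z) ≡ 4 * (c * a * (c * a)) * Z
    l₂ = solve-∀
    l₃ : ∀ d p G → 4 * (d * p * (d * p)) * (G * G) ≡ 2 * d * G * p * (2 * d * G * p)
    l₃ = solve-∀
    step : τ * c ^ M * (τ * c ^ M) ≤ 4 * (a * a) * Z
    step = *-cancelʳ-≤ _ _ (Z ^ M * Z ^ M) {{m*n≢0 (Z ^ M) (Z ^ M)}} (begin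
      τ * c ^ M * (τ * c ^ M) * (Z ^ M * Z ^ M)   ≡⟨ l τ (c ^ M) (Z ^ M) ⟩
      τ * (c ^ M * Z ^ M) * (τ * (c ^ M * Z ^ M)) ≡⟨ cong (λ z → τ * z * (τ * z)) (trans (sym (*-^-comm c Z M)) (cong (_^ M) (sym XY))) ⟩
      τ * ((Y + t) * Y) ^ M * (τ * ((Y + t) * Y) ^ M)  ≤⟨ *-mono-≤ difference-upper difference-upper ⟩
      Δ * Δ                                       ≤⟨ cond ⟩
      4 * (a * a) * Z ^ N                         ≡⟨ cong (4 * (a * a) *_) (odd-power Z M) ⟩
      4 * (a * a) * (Z * (Z ^ M * Z ^ M))         ≡⟨ *-assoc (4 * (a * a)) Z _ ⟨
      4 * (a * a) * Z * (Z ^ M * Z ^ M)           ∎)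
      where
      l : ∀ τ p z → τ * p * (τ * p) * (z * z) ≡ τ * (p * z) * (τ * (p * z))
      l = solve-∀

  -- A solution of w^N = 4u^N ± 4a with the size information on a = a₍ₙ₋₁₎.
  record Solution (M : ℕ) : Set where
    field
      u w a   : ℕ
      u<w     : u < w
      0<u     : 0 < u
      lower   : (u * w) ^ M ≤ a
      upper   : u * w * a ≤ (2 + u * w) * (u * w) ^ M
      eq      : w ^ suc (M + M) ≡ 4 * u ^ suc (M + M) + 4 * a ⊎ w ^ suc (M + M) + 4 * a ≡ 4 * u ^ suc (M + M)

  -- For α = 4^(1/N) bracketed by A₁/D and (A₁+h)/D, and √α by G₁/D and G₂/D, the deviation w - αu
  -- is ±2√α/N up to a relative error O(1/c).
  module Deviation (M D A₁ h G₁ G₂ : ℕ) (0<D : 0 < D) (0<A₁ : 0 < A₁)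
                   (lo : A₁ ^ suc (M + M) ≤ 4 * D ^ suc (M + M)) (hi : 4 * D ^ suc (M + M) ≤ (A₁ + h) ^ suc (M + M))
                   (g₁ : G₁ * G₁ ≤ D * A₁) (g₂ : D * (A₁ + h) ≤ G₂ * G₂) where

    N A₂ F : ℕ
    N = suc (M + M)
    A₂ = A₁ + h
    F = D ^ N

    module _ (s : Solution M) where
      open Solution s
      c : ℕ
      c = u * w

      private
        0<c : 0 < c
        0<c = *-mono-< 0<u (<-trans 0<u u<w)
        0<a : 0 < a
        0<a = ≤-trans (m^n>0 c {{>-nonZero 0<c}} M) lower
        0<A₂ : 0 < A₂
        0<A₂ = ≤-trans 0<A₁ (m≤m+n A₁ h)
        0<DA₁ : 0 < D * A₁
        0<DA₁ = *-mono-< 0<D 0<A₁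
        0<DA₂ : 0 < D * A₂
        0<DA₂ = *-mono-< 0<D 0<A₂
        0<F : 0 < F
        0<F = m^n>0 D {{>-nonZero 0<D}} N
        rearr : ∀ u w D A → w * D * (A * u) ≡ u * w * (D * A)
        rearr = solve-∀

      -- The two bounds say that Nt is 2√α D up to a factor 1 + O(1/c) and the width of the bracket.
      record Plus : Set where
        field
          t      : ℕ
          eq₁    : w * D ≡ A₁ * u + t
          t-low  : 2 * c * G₁ ≤ (1 + c) * (N * t)
          t-high : N * t * c ≤ 2 * (2 + c) * G₂ + N * (h * u) * c

      record Minus : Set where
        field
          t      : ℕ
          eq₁    : w * D + t ≡ A₁ * u + h * u
          t-low  : 2 * c * G₁ ≤ (1 + c) * (N * t)
          t-high : N * t * c ≤ 2 * (2 + c) * G₂ + N * (h * u) * c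

      -- The lower endpoint A₁/D makes the difference of N-th powers larger than 4aF, as the lower
      -- bound for t requires. The upper bound uses the other endpoint, which shortens t by hu.
      plus : w ^ N ≡ 4 * u ^ N + 4 * a → Plus
      plus e with m≤n⇒∃[o]m+o≡n Y≤X
        where
        Y≤X : A₁ * u ≤ w * D
        Y≤X = ≮⇒≥ λ X<Y → <⇒≱ (^-monoˡ-< N X<Y) (begin
          (A₁ * u) ^ N          ≡⟨ *-^-comm A₁ u N ⟩
          A₁ ^ N * u ^ N        ≤⟨ *-monoˡ-≤ (u ^ N) lo ⟩
          4 * F * u ^ N         ≡⟨ l F (u ^ N) ⟩
          4 * u ^ N * F         ≤⟨ *-monoˡ-≤ F (m≤m+n (4 * u ^ N) (4 * a)) ⟩
          (4 * u ^ N + 4 * a) * F  ≡⟨ cong (_* F) e ⟨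
          w ^ N * F             ≡⟨ *-^-comm w D N ⟨
          (w * D) ^ N           ∎)
          where
          open ≤-Reasoning
          l : ∀ F x → 4 * F * x ≡ 4 * x * F
          l = solve-∀
      ... | t , et = record { t = t ; eq₁ = sym et ; t-low = low ; t-high = high }
        where
        open ≤-Reasoning
        XN : (w * D) ^ N ≡ 4 * a * F + 4 * F * u ^ N
        XN = trans (*-^-comm w D N) (trans (cong (_* F) e) (l (u ^ N) a F))
          where
          l : ∀ x a F → (4 * x + 4 * a) * F ≡ 4 * a * F + 4 * F * x
          l = solve-∀
        low : 2 * c * G₁ ≤ (1 + c) * (N * t)
        low with m≤n⇒∃[o]m+o≡n lo
        ... | g , eg = lower-bound M (A₁ * u) t (4 * a * F + g * u ^ N) c a (D * A₁) G₁ eΔ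
                         (trans (cong (_* (A₁ * u)) et) (rearr u w D A₁)) cond lower 0<a 0<DA₁ g₁
          where
          eΔ : (A₁ * u) ^ N + (4 * a * F + g * u ^ N) ≡ (A₁ * u + t) ^ N
          eΔ = trans (cong (_+ (4 * a * F + g * u ^ N)) (*-^-comm A₁ u N)) (trans (l (A₁ ^ N) (u ^ N) (4 * a * F) g)
                 (trans (cong (λ z → 4 * a * F + z * u ^ N) eg) (trans (sym XN) (cong (_^ N) (sym et)))))
            where
            l : ∀ E x y g → E * x + (y + g * x) ≡ y + (E + g) * x
            l = solve-∀
          cond : 4 * (a * a) * (D * A₁) ^ N ≤ (4 * a * F + g * u ^ N) * (4 * a * F + g * u ^ N)
          cond = begin
            4 * (a * a) * (D * A₁) ^ N      ≡⟨ cong (4 * (a * a) *_) (*-^-comm D A₁ N) ⟩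
            4 * (a * a) * (F * A₁ ^ N)      ≤⟨ *-monoʳ-≤ (4 * (a * a)) (*-monoʳ-≤ F lo) ⟩
            4 * (a * a) * (F * (4 * F))     ≡⟨ l a F ⟩
            4 * a * F * (4 * a * F)         ≤⟨ *-mono-≤ (m≤m+n (4 * a * F) (g * u ^ N)) (m≤m+n (4 * a * F) (g * u ^ N)) ⟩
            (4 * a * F + g * u ^ N) * (4 * a * F + g * u ^ N) ∎
            where
            l : ∀ a F → 4 * (a * a) * (F * (4 * F)) ≡ 4 * a * F * (4 * a * F)
            l = solve-∀
        high : N * t * c ≤ 2 * (2 + c) * G₂ + N * (h * u) * c
        high with ≤-total t (h * u)
        ... | inj₁ t≤ = ≤-trans (*-monoˡ-≤ c (*-monoʳ-≤ N t≤)) (m≤n+m (N * (h * u) * c) (2 * (2 + c) * G₂))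
        ... | inj₂ t≥ with m≤n⇒∃[o]m+o≡n t≥
        ...   | t₂ , et₂ = begin
          N * t * c                     ≡⟨ cong (λ z → N * z * c) et₂ ⟨
          N * (h * u + t₂) * c          ≡⟨ l N (h * u) t₂ c ⟩
          N * t₂ * c + N * (h * u) * c  ≤⟨ +-monoˡ-≤ (N * (h * u) * c) bound ⟩
          2 * (2 + c) * G₂ + N * (h * u) * c ∎
          where
          l : ∀ N x y c → N * (x + y) * c ≡ N * y * c + N * x * c
          l = solve-∀
          XY : A₂ * u + t₂ ≡ w * D
          XY = trans (l′ A₁ h u t₂) (trans (cong (A₁ * u +_) et₂) et)
            where
            l′ : ∀ A h u t → (A + h) * u + t ≡ A * u + (h * u + t)
            l′ = solve-∀
          Δ≤ : ∃ λ Δ → (A₂ * u) ^ N + Δ ≡ (A₂ * u + t₂) ^ N × Δ ≤ 4 * a * F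
          Δ≤ with m≤n⇒∃[o]m+o≡n (^-monoˡ-≤ N (m≤m+n (A₂ * u) t₂))
          ... | Δ , eΔ = Δ , eΔ , +-cancelʳ-≤ (4 * F * u ^ N) _ _ (begin
            Δ + 4 * F * u ^ N         ≤⟨ +-monoʳ-≤ Δ (*-monoˡ-≤ (u ^ N) hi) ⟩
            Δ + A₂ ^ N * u ^ N        ≡⟨ cong (Δ +_) (*-^-comm A₂ u N) ⟨
            Δ + (A₂ * u) ^ N          ≡⟨ +-comm Δ _ ⟩
            (A₂ * u) ^ N + Δ          ≡⟨ eΔ ⟩
            (A₂ * u + t₂) ^ N         ≡⟨ cong (_^ N) XY ⟩
            (w * D) ^ N               ≡⟨ XN ⟩
            4 * a * F + 4 * F * u ^ N ∎)
          bound : N * t₂ * c ≤ 2 * (2 + c) * G₂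
          bound with Δ≤
          ... | Δ , eΔ , le = upper-bound M (A₂ * u) t₂ Δ c a (D * A₂) G₂ eΔ
                                (trans (cong (_* (A₂ * u)) XY) (rearr u w D A₂)) cond upper 0<c 0<DA₂ g₂
            where
            cond : Δ * Δ ≤ 4 * (a * a) * (D * A₂) ^ N
            cond = begin
              Δ * Δ                         ≤⟨ *-mono-≤ le le ⟩
              4 * a * F * (4 * a * F)       ≡⟨ l″ a F ⟩
              4 * (a * a) * (F * (4 * F))   ≤⟨ *-monoʳ-≤ (4 * (a * a)) (*-monoʳ-≤ F hi) ⟩
              4 * (a * a) * (F * A₂ ^ N)    ≡⟨ cong (4 * (a * a) *_) (*-^-comm D A₂ N) ⟨
              4 * (a * a) * (D * A₂) ^ N    ∎
              where
              l″ : ∀ a F → 4 * a * F * (4 * a * F) ≡ 4 * (a * a) * (F * (4 * F))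
              l″ = solve-∀

      minus : w ^ N + 4 * a ≡ 4 * u ^ N → Minus
      minus e with m≤n⇒∃[o]m+o≡n Y≤X
        where
        Y≤X : w * D ≤ A₂ * u
        Y≤X = ≮⇒≥ λ X<Y → <⇒≱ (^-monoˡ-< N X<Y) (begin
          (w * D) ^ N           ≡⟨ *-^-comm w D N ⟩
          w ^ N * F             ≤⟨ *-monoˡ-≤ F (≤-trans (m≤m+n (w ^ N) (4 * a)) (≤-reflexive e)) ⟩
          4 * u ^ N * F         ≡⟨ l F (u ^ N) ⟩
          4 * F * u ^ N         ≤⟨ *-monoˡ-≤ (u ^ N) hi ⟩
          A₂ ^ N * u ^ N        ≡⟨ *-^-comm A₂ u N ⟨
          (A₂ * u) ^ N          ∎)
          where
          open ≤-Reasoning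
          l : ∀ F x → 4 * x * F ≡ 4 * F * x
          l = solve-∀
      ... | t , et = record { t = t ; eq₁ = trans et (*-distribʳ-+ u A₁ h) ; t-low = low ; t-high = high }
        where
        open ≤-Reasoning
        -- In this sign the error g of the bracket occurs once with the factor a and once with u^N;
        -- this inequality reconciles the two.
        a≤uN : a ≤ u ^ N
        a≤uN = *-cancelˡ-≤ 4 (≤-trans (m≤n+m (4 * a) (w ^ N)) (≤-reflexive e))
        rearr′ : ∀ u w D A → A * u * (w * D) ≡ u * w * (D * A)
        rearr′ = solve-∀
        YN : (w * D) ^ N + 4 * a * F ≡ 4 * F * u ^ N
        YN = trans (cong (_+ 4 * a * F) (*-^-comm w D N)) (trans (sym (*-distribʳ-+ F (w ^ N) (4 * a))) (trans (cong (_* F) e) (l (u ^ N) F)))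
          where
          l : ∀ x F → 4 * x * F ≡ 4 * F * x
          l = solve-∀
        low : 2 * c * G₁ ≤ (1 + c) * (N * t)
        low with m≤n⇒∃[o]m+o≡n hi
        ... | g , eg = lower-bound M (w * D) t (4 * a * F + g * u ^ N) c a (D * A₂) G₁ eΔ
                         (trans (cong (_* (w * D)) et) (rearr′ u w D A₂)) cond lower 0<a 0<DA₂
                         (≤-trans g₁ (*-monoʳ-≤ D (m≤m+n A₁ h)))
          where
          eΔ : (w * D) ^ N + (4 * a * F + g * u ^ N) ≡ (w * D + t) ^ N
          eΔ = trans (sym (+-assoc ((w * D) ^ N) (4 * a * F) (g * u ^ N))) (trans (cong (_+ g * u ^ N) YN)
                 (trans (sym (*-distribʳ-+ (u ^ N) (4 * F) g)) (trans (cong (_* u ^ N) eg) (trans (sym (*-^-comm A₂ u N)) (cong (_^ N) (sym et))))))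
          cond : 4 * (a * a) * (D * A₂) ^ N ≤ (4 * a * F + g * u ^ N) * (4 * a * F + g * u ^ N)
          cond = begin
            4 * (a * a) * (D * A₂) ^ N      ≡⟨ cong (4 * (a * a) *_) (trans (*-^-comm D A₂ N) (cong (F *_) (sym eg))) ⟩
            4 * (a * a) * (F * (4 * F + g)) ≡⟨ l a F g ⟩
            4 * a * F * (4 * a * F) + 4 * F * g * a * a         ≤⟨ +-monoʳ-≤ (4 * a * F * (4 * a * F)) (*-monoʳ-≤ (4 * F * g * a) a≤uN) ⟩
            4 * a * F * (4 * a * F) + 4 * F * g * a * u ^ N     ≤⟨ ≤-by (4 * F * g * a * u ^ N + g * u ^ N * (g * u ^ N)) (l′ a F g (u ^ N)) ⟩
            (4 * a * F + g * u ^ N) * (4 * a * F + g * u ^ N)   ∎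
            where
            l : ∀ a F g → 4 * (a * a) * (F * (4 * F + g)) ≡ 4 * a * F * (4 * a * F) + 4 * F * g * a * a
            l = solve-∀
            l′ : ∀ a F g x → 4 * a * F * (4 * a * F) + 4 * F * g * a * x + (4 * F * g * a * x + g * x * (g * x)) ≡ (4 * a * F + g * x) * (4 * a * F + g * x)
            l′ = solve-∀
        high : N * t * c ≤ 2 * (2 + c) * G₂ + N * (h * u) * c
        high with ≤-total t (h * u)
        ... | inj₁ t≤ = ≤-trans (*-monoˡ-≤ c (*-monoʳ-≤ N t≤)) (m≤n+m (N * (h * u) * c) (2 * (2 + c) * G₂))
        ... | inj₂ t≥ with m≤n⇒∃[o]m+o≡n t≥
        ...   | t₁ , et₁ = begin
          N * t * c                     ≡⟨ cong (λ z → N * z * c) et₁ ⟨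
          N * (h * u + t₁) * c          ≡⟨ l N (h * u) t₁ c ⟩
          N * t₁ * c + N * (h * u) * c  ≤⟨ +-monoˡ-≤ (N * (h * u) * c) bound ⟩
          2 * (2 + c) * G₂ + N * (h * u) * c ∎
          where
          l : ∀ N x y c → N * (x + y) * c ≡ N * y * c + N * x * c
          l = solve-∀
          XY : w * D + t₁ ≡ A₁ * u
          XY = +-cancelʳ-≡ (h * u) _ _ (trans (l′ (w * D) t₁ (h * u)) (trans (cong (w * D +_) et₁) (trans et (*-distribʳ-+ u A₁ h))))
            where
            l′ : ∀ x y z → x + y + z ≡ x + (z + y)
            l′ = solve-∀
          bound : N * t₁ * c ≤ 2 * (2 + c) * G₂
          bound with m≤n⇒∃[o]m+o≡n (^-monoˡ-≤ N (m≤m+n (w * D) t₁)) | m≤n⇒∃[o]m+o≡n lo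
          ... | Δ , eΔ | g , eg = upper-bound M (w * D) t₁ Δ c a (D * A₁) G₂ eΔ
                                (trans (cong (_* (w * D)) XY) (rearr′ u w D A₁)) cond upper 0<c 0<DA₁
                                (≤-trans (*-monoʳ-≤ D (m≤m+n A₁ h)) g₂)
            where
            x : ℕ
            x = u ^ N
            Δ+ : Δ + g * x ≡ 4 * a * F
            Δ+ = +-cancelˡ-≡ ((w * D) ^ N) _ _ (trans (sym (+-assoc _ Δ (g * x))) (trans (cong (_+ g * x) (trans eΔ (trans (cong (_^ N) XY) (*-^-comm A₁ u N))))
                   (trans (sym (*-distribʳ-+ x (A₁ ^ N) g)) (trans (cong (_* x) eg) (sym YN)))))
            cond : Δ * Δ ≤ 4 * (a * a) * (D * A₁) ^ N
            cond = +-cancelʳ-≤ (4 * F * g * (a * a)) _ _ (begin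
              Δ * Δ + 4 * F * g * (a * a)           ≡⟨ cong (Δ * Δ +_) (l₁ a F g) ⟩
              Δ * Δ + g * a * (4 * a * F)           ≡⟨ cong (λ z → Δ * Δ + g * a * z) Δ+ ⟨
              Δ * Δ + g * a * (Δ + g * x)           ≤⟨ +-monoʳ-≤ (Δ * Δ) (*-monoˡ-≤ (Δ + g * x) (*-monoʳ-≤ g a≤uN)) ⟩
              Δ * Δ + g * x * (Δ + g * x)           ≤⟨ ≤-by (Δ * (g * x)) (l₂ Δ (g * x)) ⟩
              (Δ + g * x) * (Δ + g * x)             ≡⟨ cong (λ z → z * z) Δ+ ⟩
              4 * a * F * (4 * a * F)               ≡⟨ l₃ a F ⟩
              4 * (a * a) * (F * (4 * F))           ≡⟨ cong (λ z → 4 * (a * a) * (F * z)) eg ⟨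
              4 * (a * a) * (F * (A₁ ^ N + g))      ≡⟨ l₄ (a * a) F (A₁ ^ N) g ⟩
              4 * (a * a) * (F * A₁ ^ N) + 4 * F * g * (a * a)  ≡⟨ cong (λ z → 4 * (a * a) * z + 4 * F * g * (a * a)) (*-^-comm D A₁ N) ⟨
              4 * (a * a) * (D * A₁) ^ N + 4 * F * g * (a * a)  ∎)
              where
              l₁ : ∀ a F g → 4 * F * g * (a * a) ≡ g * a * (4 * a * F)
              l₁ = solve-∀
              l₂ : ∀ d y → d * d + y * (d + y) + d * y ≡ (d + y) * (d + y)
              l₂ = solve-∀
              l₃ : ∀ a F → 4 * a * F * (4 * a * F) ≡ 4 * (a * a) * (F * (4 * F))
              l₃ = solve-∀
              l₄ : ∀ b F E g → 4 * b * (F * (E + g)) ≡ 4 * b * (F * E) + 4 * F * g * b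
              l₄ = solve-∀

      -- A rational p/q close to α shows that u cannot lie in [ul , uh]: modulo small errors, u p - w q is
      -- the non-integer ∓2q√α/N.
      module _ (p q ul uh σ E R ρ κ : ℕ) (ul≤u : ul ≤ u) (u≤uh : u ≤ uh)
               (pD≤ : p * D ≤ q * A₁ + E) (qA≤ : q * A₁ ≤ p * D + E)
               (σ-big : 4 * G₂ ≤ ul * ul * σ)
               (ρ≡ : 2 * q * G₁ ≡ ρ + κ * (D * N))
               (R≡ : uh * (N * (E + (h + h) * q)) + q * (σ + 2 * (G₂ ∸ G₁)) ≤ R)
               (R<ρ : R < ρ) (R+ρ<m : R + ρ < D * N) (G₁≤G₂ : G₁ ≤ G₂) where

        private
          m : ℕ
          m = D * N
          ul²≤c : ul * ul ≤ c
          ul²≤c = *-mono-≤ ul≤u (≤-trans ul≤u (<⇒≤ u<w))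
          4G₂≤ : 4 * G₂ ≤ c * σ
          4G₂≤ = ≤-trans σ-big (*-monoˡ-≤ σ ul²≤c)

          -- The hypotheses put (Q - P) m strictly between 0 and m.
          separated : ∀ P Q → P * m + ρ ≤ Q * m + R → Q * m ≤ P * m + (ρ + R) → ⊥
          separated P Q le₁ le₂ = <⇒≱ (≤-<-trans le₂ (+-monoʳ-< (P * m) (subst (_< m) (+-comm R ρ) R+ρ<m)))
                                      (≤-trans (≤-reflexive (+-comm (P * m) m)) (*-monoˡ-≤ m P<Q))
            where
            Pm<Qm : P * m < Q * m
            Pm<Qm = +-cancelʳ-< R _ _ (<-≤-trans (+-monoʳ-< (P * m) R<ρ) le₁)
            P<Q : P < Q
            P<Q = *-cancelʳ-< m P Q Pm<Qm

          -- Since c ≥ ul², one additive error σ with 4 G₂ ≤ cσ replaces both factors c/(1 + c) and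
          -- (2 + c)/c.
          module Slack (t : ℕ) (t-low : 2 * c * G₁ ≤ (1 + c) * (N * t)) (t-high : N * t * c ≤ 2 * (2 + c) * G₂ + N * (h * u) * c) where
            open ≤-Reasoning
            lo′ : 2 * G₁ ≤ N * t + σ
            lo′ = *-cancelˡ-≤ (1 + c) (begin
              (1 + c) * (2 * G₁)              ≡⟨ l c G₁ ⟩
              2 * c * G₁ + 2 * G₁             ≤⟨ +-mono-≤ t-low (≤-trans (*-mono-≤ {2} {4} (s≤s (s≤s z≤n)) G₁≤G₂) (≤-trans 4G₂≤ (*-monoˡ-≤ σ (n≤1+n c)))) ⟩
              (1 + c) * (N * t) + (1 + c) * σ ≡⟨ *-distribˡ-+ (1 + c) (N * t) σ ⟨
              (1 + c) * (N * t + σ)           ∎)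
              where
              l : ∀ c g → (1 + c) * (2 * g) ≡ 2 * c * g + 2 * g
              l = solve-∀
            hi′ : N * t ≤ 2 * G₁ + (σ + 2 * (G₂ ∸ G₁) + N * (h * u))
            hi′ = *-cancelʳ-≤ _ _ c {{>-nonZero 0<c}} (begin
              N * t * c                                   ≤⟨ t-high ⟩
              2 * (2 + c) * G₂ + N * (h * u) * c          ≡⟨ l c G₂ (N * (h * u)) ⟩
              4 * G₂ + (2 * G₂ + N * (h * u)) * c         ≤⟨ +-monoˡ-≤ _ 4G₂≤ ⟩
              c * σ + (2 * G₂ + N * (h * u)) * c          ≡⟨ cong (λ z → c * σ + (2 * z + N * (h * u)) * c) (m+[n∸m]≡n G₁≤G₂) ⟨
              c * σ + (2 * (G₁ + (G₂ ∸ G₁)) + N * (h * u)) * c  ≡⟨ l′ c σ G₁ (G₂ ∸ G₁) (N * (h * u)) ⟩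
              (2 * G₁ + (σ + 2 * (G₂ ∸ G₁) + N * (h * u))) * c  ∎)
              where
              l : ∀ c g x → 2 * (2 + c) * g + x * c ≡ 4 * g + (2 * g + x) * c
              l = solve-∀
              l′ : ∀ c σ g d x → c * σ + (2 * (g + d) + x) * c ≡ (2 * g + (σ + 2 * d + x)) * c
              l′ = solve-∀

          R-bound : u * (N * E) + q * (σ + 2 * (G₂ ∸ G₁) + N * (h * u) + N * (h * u)) ≤ R
          R-bound = ≤-trans (≤-reflexive (l u N E q (σ + 2 * (G₂ ∸ G₁)) h)) (≤-trans (+-monoˡ-≤ _ (*-monoˡ-≤ (N * (E + (h + h) * q)) u≤uh)) R≡)
            where
            l : ∀ u N E q s h → u * (N * E) + q * (s + N * (h * u) + N * (h * u)) ≡ u * (N * (E + (h + h) * q)) + q * s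
            l = solve-∀

          upD≤ : u * p * m ≤ q * (N * (A₁ * u)) + u * (N * E)
          upD≤ = ≤-trans (≤-reflexive (l u p D N)) (≤-trans (*-monoʳ-≤ (u * N) pD≤) (≤-reflexive (l′ u N q A₁ E)))
            where
            l : ∀ u p D N → u * p * (D * N) ≡ u * N * (p * D)
            l = solve-∀
            l′ : ∀ u N q A E → u * N * (q * A + E) ≡ q * (N * (A * u)) + u * (N * E)
            l′ = solve-∀
          qAu≤ : q * (N * (A₁ * u)) ≤ u * p * m + u * (N * E)
          qAu≤ = ≤-trans (≤-reflexive (l u N q A₁)) (≤-trans (*-monoʳ-≤ (u * N) qA≤) (≤-reflexive (l′ u N p D E)))
            where
            l : ∀ u N q A → q * (N * (A * u)) ≡ u * N * (q * A)
            l = solve-∀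
            l′ : ∀ u N p D E → u * N * (p * D + E) ≡ u * p * (D * N) + u * (N * E)
            l′ = solve-∀

          -- With m = DN one has (wq - up) m = q N t + u N (q A₁ - p D). The first term is about 2 q
          -- G₁ = κ m + ρ and the second is small, so an integer multiple of m would lie within R of
          -- κ m + ρ.
          plus-absurd : Plus → ⊥
          plus-absurd pl = separated (u * p + κ) (w * q) le₁ le₂
            where
            open Plus pl
            open Slack t t-low t-high
            open ≤-Reasoning
            Qm : w * q * m ≡ q * (N * (A₁ * u)) + q * (N * t)
            Qm = trans (l w q D N) (trans (cong (λ z → q * (N * z)) eq₁) (l′ q N (A₁ * u) t))
              where
              l : ∀ w q D N → w * q * (D * N) ≡ q * (N * (w * D))
              l = solve-∀
              l′ : ∀ q N x t → q * (N * (x + t)) ≡ q * (N * x) + q * (N * t)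
              l′ = solve-∀
            le₁ : (u * p + κ) * m + ρ ≤ w * q * m + R
            le₁ = begin
              (u * p + κ) * m + ρ               ≡⟨ l (u * p) κ m ρ ⟩
              u * p * m + (ρ + κ * m)           ≡⟨ cong (u * p * m +_) (trans (sym ρ≡) (l′ q G₁)) ⟩
              u * p * m + q * (2 * G₁)          ≤⟨ +-mono-≤ upD≤ (*-monoʳ-≤ q lo′) ⟩
              q * (N * (A₁ * u)) + u * (N * E) + q * (N * t + σ)  ≤⟨ ≤-by (q * (2 * (G₂ ∸ G₁) + N * (h * u) + N * (h * u))) (l″ (q * (N * (A₁ * u))) (u * (N * E)) q (N * t) σ (2 * (G₂ ∸ G₁)) (N * (h * u))) ⟩
              q * (N * (A₁ * u)) + q * (N * t) + (u * (N * E) + q * (σ + 2 * (G₂ ∸ G₁) + N * (h * u) + N * (h * u)))  ≤⟨ +-mono-≤ (≤-reflexive (sym Qm)) R-bound ⟩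
              w * q * m + R ∎
              where
              l : ∀ x k m r → (x + k) * m + r ≡ x * m + (r + k * m)
              l = solve-∀
              l′ : ∀ q g → 2 * q * g ≡ q * (2 * g)
              l′ = solve-∀
              l″ : ∀ x y q T s d e → x + y + q * (T + s) + q * (d + e + e) ≡ x + q * T + (y + q * (s + d + e + e))
              l″ = solve-∀
            le₂ : w * q * m ≤ (u * p + κ) * m + (ρ + R)
            le₂ = begin
              w * q * m                               ≡⟨ Qm ⟩
              q * (N * (A₁ * u)) + q * (N * t)        ≤⟨ +-mono-≤ qAu≤ (*-monoʳ-≤ q hi′) ⟩
              u * p * m + u * (N * E) + q * (2 * G₁ + (σ + 2 * (G₂ ∸ G₁) + N * (h * u)))
                ≤⟨ ≤-by (q * (N * (h * u))) (l (u * p * m) (u * (N * E)) q G₁ (σ + 2 * (G₂ ∸ G₁)) (N * (h * u))) ⟩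
              u * p * m + 2 * q * G₁ + (u * (N * E) + q * (σ + 2 * (G₂ ∸ G₁) + N * (h * u) + N * (h * u)))  ≤⟨ +-mono-≤ (≤-reflexive (cong (u * p * m +_) ρ≡)) R-bound ⟩
              u * p * m + (ρ + κ * m) + R             ≡⟨ l′ (u * p) κ m ρ R ⟩
              (u * p + κ) * m + (ρ + R) ∎
              where
              l : ∀ x y q g s e → x + y + q * (2 * g + (s + e)) + q * e ≡ x + 2 * q * g + (y + q * (s + e + e))
              l = solve-∀
              l′ : ∀ x k m r R → x * m + (r + k * m) + R ≡ (x + k) * m + (r + R)
              l′ = solve-∀

          minus-absurd : Minus → ⊥
          minus-absurd mi = separated (w * q + κ) (u * p) le₁ le₂
            where
            open Minus mi
            open Slack t t-low t-high
            open ≤-Reasoning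
            Qm : w * q * m + q * (N * t) ≡ q * (N * (A₁ * u)) + q * (N * (h * u))
            Qm = trans (l w q D N t) (trans (cong (λ z → q * (N * z)) eq₁) (l′ q N (A₁ * u) (h * u)))
              where
              l : ∀ w q D N t → w * q * (D * N) + q * (N * t) ≡ q * (N * (w * D + t))
              l = solve-∀
              l′ : ∀ q N x t → q * (N * (x + t)) ≡ q * (N * x) + q * (N * t)
              l′ = solve-∀
            le₁ : (w * q + κ) * m + ρ ≤ u * p * m + R
            le₁ = begin
              (w * q + κ) * m + ρ                     ≡⟨ l (w * q) κ m ρ ⟩
              w * q * m + (ρ + κ * m)                 ≡⟨ cong (w * q * m +_) (trans (sym ρ≡) (l′ q G₁)) ⟩
              w * q * m + q * (2 * G₁)                ≤⟨ +-monoʳ-≤ (w * q * m) (*-monoʳ-≤ q lo′) ⟩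
              w * q * m + q * (N * t + σ)             ≡⟨ l″ (w * q * m) q (N * t) σ ⟩
              w * q * m + q * (N * t) + q * σ         ≡⟨ cong (_+ q * σ) Qm ⟩
              q * (N * (A₁ * u)) + q * (N * (h * u)) + q * σ   ≤⟨ +-monoˡ-≤ (q * σ) (+-monoˡ-≤ (q * (N * (h * u))) qAu≤) ⟩
              u * p * m + u * (N * E) + q * (N * (h * u)) + q * σ  ≤⟨ ≤-by (q * (2 * (G₂ ∸ G₁) + N * (h * u))) (l‴ (u * p * m) (u * (N * E)) q (N * (h * u)) σ (2 * (G₂ ∸ G₁))) ⟩
              u * p * m + (u * (N * E) + q * (σ + 2 * (G₂ ∸ G₁) + N * (h * u) + N * (h * u))) ≤⟨ +-monoʳ-≤ (u * p * m) R-bound ⟩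
              u * p * m + R ∎
              where
              l : ∀ x k m r → (x + k) * m + r ≡ x * m + (r + k * m)
              l = solve-∀
              l′ : ∀ q g → 2 * q * g ≡ q * (2 * g)
              l′ = solve-∀
              l″ : ∀ x q T s → x + q * (T + s) ≡ x + q * T + q * s
              l″ = solve-∀
              l‴ : ∀ x y q e s d → x + y + q * e + q * s + q * (d + e) ≡ x + (y + q * (s + d + e + e))
              l‴ = solve-∀
            le₂ : u * p * m ≤ (w * q + κ) * m + (ρ + R)
            le₂ = begin
              u * p * m                                ≤⟨ upD≤ ⟩
              q * (N * (A₁ * u)) + u * (N * E)         ≤⟨ +-monoˡ-≤ (u * (N * E)) (≤-trans (m≤m+n _ (q * (N * (h * u)))) (≤-reflexive (sym Qm))) ⟩
              w * q * m + q * (N * t) + u * (N * E)    ≤⟨ +-monoˡ-≤ (u * (N * E)) (+-monoʳ-≤ (w * q * m) (*-monoʳ-≤ q hi′)) ⟩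
              w * q * m + q * (2 * G₁ + (σ + 2 * (G₂ ∸ G₁) + N * (h * u))) + u * (N * E)
                ≤⟨ ≤-by (q * (N * (h * u))) (l (w * q * m) (u * (N * E)) q G₁ (σ + 2 * (G₂ ∸ G₁)) (N * (h * u))) ⟩
              w * q * m + 2 * q * G₁ + (u * (N * E) + q * (σ + 2 * (G₂ ∸ G₁) + N * (h * u) + N * (h * u)))  ≤⟨ +-mono-≤ (≤-reflexive (cong (w * q * m +_) ρ≡)) R-bound ⟩
              w * q * m + (ρ + κ * m) + R              ≡⟨ l′ (w * q) κ m ρ R ⟩
              (w * q + κ) * m + (ρ + R) ∎
              where
              l : ∀ x y q g s e → x + q * (2 * g + (s + e)) + y + q * e ≡ x + 2 * q * g + (y + q * (s + e + e))
              l = solve-∀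
              l′ : ∀ x k m r R → x * m + (r + k * m) + R ≡ (x + k) * m + (r + R)
              l′ = solve-∀

        excluded : ⊥
        excluded with eq
        ... | inj₁ e = plus-absurd (plus e)
        ... | inj₂ e = minus-absurd (minus e)

-- The verified continued fraction computation

module DeviationChecker where

  open CriticalSequence
  open OddParameter
  open DeviationBounds
  open import Data.Nat
  open import Data.Nat.Properties
  open import Data.Nat.DivMod
  open import Data.Nat.Tactic.RingSolver using (solve-∀)
  open import Data.Bool using (Bool; true; false; if_then_else_; _∧_; _∨_; T)
  open import Data.List using (List; []; _∷_)
  open import Data.Empty using (⊥)
  open import Data.Unit using (tt)
  open import Relation.Binary.PropositionalEquality
  open import Relation.Nullary using (yes; no)

  quo rem : ℕ → ℕ → ℕ
  quo m zero    = 0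
  quo m (suc d) = m / suc d
  rem m zero    = m
  rem m (suc d) = m % suc d

  quo-rem : ∀ m d → m ≡ rem m d + quo m d * d
  quo-rem m zero    = sym (+-identityʳ m)
  quo-rem m (suc d) = m≡m%n+[m/n]*n m (suc d)

  <-suc-quo : ∀ m d → 0 < d → m < suc (quo m d) * d
  <-suc-quo m (suc d) _ = subst (_< suc (m / suc d) * suc d) (sym (m≡m%n+[m/n]*n m (suc d))) (+-monoˡ-< (m / suc d * suc d) (m%n<n m (suc d)))

  quo-*-≤ : ∀ m d → quo m d * d ≤ m
  quo-*-≤ m d = ≤-trans (m≤n+m (quo m d * d) (rem m d)) (≤-reflexive (sym (quo-rem m d)))

  ≡true⇒T : ∀ {x} → x ≡ true → T x
  ≡true⇒T refl = tt

  T-∧ˡ : ∀ {x y} → T (x ∧ y) → T x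
  T-∧ˡ {true} _ = tt

  T-∧ʳ : ∀ {x y} → T (x ∧ y) → T y
  T-∧ʳ {true} t = t

  -- Fixed-point bounds for 2^i-th powers: y / D ↦ (y / D)^(2^i)

  powLo powHi : ℕ → ℕ → ℕ → ℕ
  powLo D zero    y = y
  powLo D (suc i) y = powLo D i (quo (y * y) D)
  powHi D zero    y = y
  powHi D (suc i) y = powHi D i (suc (quo (y * y) D))

  ^-2^suc : ∀ y i → y ^ 2 ^ suc i ≡ (y * y) ^ 2 ^ i
  ^-2^suc y i = trans (cong (y ^_) (cong (2 ^ i +_) (+-identityʳ (2 ^ i)))) (trans (^-distribˡ-+-* y (2 ^ i) (2 ^ i)) (sym (*-^-comm y y (2 ^ i))))

  powHi-sound : ∀ D i y → 0 < D → y ^ 2 ^ i * D ≤ powHi D i y * D ^ 2 ^ i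
  powHi-sound D zero    y 0<D = ≤-reflexive (cong₂ _*_ (*-identityʳ y) (sym (*-identityʳ D)))
  powHi-sound D (suc i) y 0<D = begin
    y ^ 2 ^ suc i * D                          ≡⟨ cong (_* D) (^-2^suc y i) ⟩
    (y * y) ^ 2 ^ i * D                        ≤⟨ *-monoˡ-≤ D (^-monoˡ-≤ (2 ^ i) (<⇒≤ (<-suc-quo (y * y) D 0<D))) ⟩
    (z * D) ^ 2 ^ i * D                        ≡⟨ cong (_* D) (*-^-comm z D (2 ^ i)) ⟩
    z ^ 2 ^ i * D ^ 2 ^ i * D                  ≡⟨ l (z ^ 2 ^ i) (D ^ 2 ^ i) D ⟩
    z ^ 2 ^ i * D * D ^ 2 ^ i                  ≤⟨ *-monoˡ-≤ (D ^ 2 ^ i) (powHi-sound D i z 0<D) ⟩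
    powHi D i z * D ^ 2 ^ i * D ^ 2 ^ i        ≡⟨ *-assoc (powHi D i z) (D ^ 2 ^ i) (D ^ 2 ^ i) ⟩
    powHi D i z * (D ^ 2 ^ i * D ^ 2 ^ i)      ≡⟨ cong (powHi D i z *_) (trans (sym (*-^-comm D D (2 ^ i))) (sym (^-2^suc D i))) ⟩
    powHi D i z * D ^ 2 ^ suc i                ∎
    where
    open ≤-Reasoning
    z : ℕ
    z = suc (quo (y * y) D)
    l : ∀ a b c → a * b * c ≡ a * c * b
    l = solve-∀

  powLo-sound : ∀ D i y → powLo D i y * D ^ 2 ^ i ≤ y ^ 2 ^ i * D
  powLo-sound D zero    y = ≤-reflexive (cong₂ _*_ (sym (*-identityʳ y)) (*-identityʳ D))
  powLo-sound D (suc i) y = begin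
    powLo D i z * D ^ 2 ^ suc i                ≡⟨ cong (powLo D i z *_) (trans (^-2^suc D i) (*-^-comm D D (2 ^ i))) ⟩
    powLo D i z * (D ^ 2 ^ i * D ^ 2 ^ i)      ≡⟨ *-assoc (powLo D i z) (D ^ 2 ^ i) (D ^ 2 ^ i) ⟨
    powLo D i z * D ^ 2 ^ i * D ^ 2 ^ i        ≤⟨ *-monoˡ-≤ (D ^ 2 ^ i) (powLo-sound D i z) ⟩
    z ^ 2 ^ i * D * D ^ 2 ^ i                  ≡⟨ l (z ^ 2 ^ i) D (D ^ 2 ^ i) ⟩
    z ^ 2 ^ i * D ^ 2 ^ i * D                  ≡⟨ cong (_* D) (*-^-comm z D (2 ^ i)) ⟨
    (z * D) ^ 2 ^ i * D                        ≤⟨ *-monoˡ-≤ D (^-monoˡ-≤ (2 ^ i) (quo-*-≤ (y * y) D)) ⟩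
    (y * y) ^ 2 ^ i * D                        ≡⟨ cong (_* D) (^-2^suc y i) ⟨
    y ^ 2 ^ suc i * D                          ∎
    where
    open ≤-Reasoning
    z : ℕ
    z = quo (y * y) D
    l : ∀ a b c → a * b * c ≡ a * c * b
    l = solve-∀

  -- As N + 1 = 2^(k+1), the comparison of y^N with 4 D^N is multiplied by y, so that the power is
  -- reached by squarings alone.
  root-low : ∀ k D y → 0 < D → 0 < y → powHi D (suc k) y ≤ 4 * y → y ^ E k ≤ 4 * D ^ E k
  root-low k D y 0<D 0<y le = *-cancelʳ-≤ _ _ (y * D) {{m*n≢0 y D {{>-nonZero 0<y}} {{>-nonZero 0<D}}}} (begin
    y ^ E k * (y * D)              ≡⟨ l (y ^ E k) y D ⟩
    y ^ suc (E k) * D              ≡⟨ cong (λ z → y ^ z * D) (2^suc≡E k) ⟨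
    y ^ 2 ^ suc k * D              ≤⟨ powHi-sound D (suc k) y 0<D ⟩
    powHi D (suc k) y * D ^ 2 ^ suc k   ≤⟨ *-monoˡ-≤ (D ^ 2 ^ suc k) le ⟩
    4 * y * D ^ 2 ^ suc k          ≡⟨ cong (λ z → 4 * y * D ^ z) (2^suc≡E k) ⟩
    4 * y * D ^ suc (E k)          ≡⟨ l′ y D (D ^ E k) ⟩
    4 * D ^ E k * (y * D)          ∎)
    where
    open ≤-Reasoning
    l : ∀ p y D → p * (y * D) ≡ y * p * D
    l = solve-∀
    l′ : ∀ y D p → 4 * y * (D * p) ≡ 4 * p * (y * D)
    l′ = solve-∀

  root-high : ∀ k D y → 0 < D → 0 < y → 4 * y ≤ powLo D (suc k) y → 4 * D ^ E k ≤ y ^ E k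
  root-high k D y 0<D 0<y le = *-cancelʳ-≤ _ _ (y * D) {{m*n≢0 y D {{>-nonZero 0<y}} {{>-nonZero 0<D}}}} (begin
    4 * D ^ E k * (y * D)          ≡⟨ l′ y D (D ^ E k) ⟩
    4 * y * D ^ suc (E k)          ≡⟨ cong (λ z → 4 * y * D ^ z) (2^suc≡E k) ⟨
    4 * y * D ^ 2 ^ suc k          ≤⟨ *-monoˡ-≤ (D ^ 2 ^ suc k) le ⟩
    powLo D (suc k) y * D ^ 2 ^ suc k   ≤⟨ powLo-sound D (suc k) y ⟩
    y ^ 2 ^ suc k * D              ≡⟨ cong (λ z → y ^ z * D) (2^suc≡E k) ⟩
    y ^ suc (E k) * D              ≡⟨ l (y ^ E k) y D ⟩
    y ^ E k * (y * D)              ∎)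
    where
    open ≤-Reasoning
    l : ∀ p y D → y * p * D ≡ p * (y * D)
    l = solve-∀
    l′ : ∀ y D p → 4 * p * (y * D) ≡ 4 * y * (D * p)
    l′ = solve-∀

  -- Intermediate results are passed as arguments (not bound by where) so that evaluation shares them.

  advance₁ : (cov uh R ρ m : ℕ) → ℕ
  advance₁ cov uh R ρ m = if (R <ᵇ ρ) ∧ (R + ρ <ᵇ m) then (if cov ≤ᵇ uh then suc uh else cov) else cov

  advance₂ : (cov den sub ρ m uh : ℕ) → ℕ
  advance₂ cov den sub ρ m uh = advance₁ cov uh (uh * den + sub) ρ m

  -- The trial value is the largest uh with uh den + sub < min(ρ, m - ρ), `pred` making the
  -- inequality strict. Soundness rests on the test in `advance₁`, which repeats the comparison for
  -- the value found.
  advance₃ : (cov den sub ρ m : ℕ) → ℕ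
  advance₃ cov den sub ρ m = advance₂ cov den sub ρ m (quo (pred ((if ρ ≤ᵇ m ∸ ρ then ρ else m ∸ ρ) ∸ sub)) den)

  -- The two large arguments are the coefficients in the error R of the exclusion argument, with
  -- bracket width 64 (whence 128) and with cov as lower end of the range of u.
  advance₄ : (N G₁ G₂ m q pD qA cov : ℕ) → ℕ
  advance₄ N G₁ G₂ m q pD qA cov =
    advance₃ cov (N * ((pD ∸ qA) + (qA ∸ pD) + 128 * q)) (q * (suc (quo (4 * G₂) (cov * cov)) + 2 * (G₂ ∸ G₁))) (rem (2 * q * G₁) m) m

  -- The next bound up to which u is excluded by the convergent p / q.
  advance : (D N A₁ G₁ G₂ m p q cov : ℕ) → ℕ
  advance D N A₁ G₁ G₂ m p q cov = advance₄ N G₁ G₂ m q (p * D) (q * A₁) cov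

  record Parameters : Set where
    constructor parameters
    field
      UB D N A₁ G₁ G₂ m : ℕ

  -- p / q runs through the convergents of a / b; all u < cov are excluded. Convergents with q < thr would
  -- not raise cov by much.
  loop : ℕ → Parameters → (a b p p₋ q q₋ cov thr : ℕ) → Bool
  next : ℕ → Parameters → (a b p p₋ q q₋ cov thr t : ℕ) → Bool
  try  : Bool → ℕ → Parameters → (a b p p₋ q q₋ cov thr : ℕ) → Bool
  stop : Bool → ℕ → Parameters → (a b p p₋ q q₋ cov : ℕ) → Bool
  tried : ℕ → Parameters → (a b p p₋ q q₋ cov : ℕ) → Bool
  loop zero    π a b p p₋ q q₋ cov thr = false
  loop (suc f) π a b p p₋ q q₋ cov thr = next f π a b p p₋ q q₋ cov thr (quo a b)
  next f π a b p p₋ q q₋ cov thr t = try (thr ≤ᵇ t * q + q₋) f π b (a ∸ t * b) (t * p + p₋) p (t * q + q₋) q cov thr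
  try false f π a b p p₋ q q₋ cov thr = loop f π a b p p₋ q q₋ cov thr
  try true  f π@(parameters UB D N A₁ G₁ G₂ m) a b p p₋ q q₋ cov thr =
    tried f π a b p p₋ q q₋ (advance D N A₁ G₁ G₂ m p q cov)
  tried f π a b p p₋ q q₋ cov = stop (Parameters.UB π ≤ᵇ cov) f π a b p p₋ q q₋ cov
  stop true  f π a b p p₋ q q₋ cov = true
  stop false f π@(parameters UB D N A₁ G₁ G₂ m) a b p p₋ q q₋ cov =
    loop f π a b p p₋ q q₋ cov (if UB * 65536 ≤ᵇ cov * cov * N then UB else quo (cov * cov * N) 65536)

  module _ (M D A₁ G₁ G₂ : ℕ) (0<D : 0 < D) (0<A₁ : 0 < A₁)
           (lo : A₁ ^ suc (M + M) ≤ 4 * D ^ suc (M + M)) (hi : 4 * D ^ suc (M + M) ≤ (A₁ + 64) ^ suc (M + M))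
           (g₁ : G₁ * G₁ ≤ D * A₁) (g₂ : D * (A₁ + 64) ≤ G₂ * G₂) (G₁≤G₂ : G₁ ≤ G₂) where

    private
      N m : ℕ
      N = suc (M + M)
      m = D * N

    advance-sound : ∀ p q cov (s : Solution M) → 0 < cov → cov ≤ Solution.u s →
                    Solution.u s < advance D N A₁ G₁ G₂ m p q cov → ⊥
    advance-sound p q cov s 0<cov cov≤u = go (quo (pred ((if ρ ≤ᵇ m ∸ ρ then ρ else m ∸ ρ) ∸ sub)) den)
      where
      open Solution s
      x y dif den σ sub ρ κ : ℕ
      x = p * D
      y = q * A₁
      dif = (x ∸ y) + (y ∸ x)
      den = N * (dif + 128 * q)
      σ = suc (quo (4 * G₂) (cov * cov))
      sub = q * (σ + 2 * (G₂ ∸ G₁))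
      ρ = rem (2 * q * G₁) m
      κ = quo (2 * q * G₁) m
      bound : ∀ uh → T ((uh * den + sub <ᵇ ρ) ∧ (uh * den + sub + ρ <ᵇ m)) → u ≤ uh → ⊥
      bound uh t u≤uh = Deviation.excluded M D A₁ 64 G₁ G₂ 0<D 0<A₁ lo hi g₁ g₂ s p q cov uh σ dif (uh * den + sub) ρ κ
        cov≤u u≤uh
        (≤-trans (m≤n+m∸n x y) (+-monoʳ-≤ y (m≤m+n (x ∸ y) (y ∸ x))))
        (≤-trans (m≤n+m∸n y x) (+-monoʳ-≤ x (m≤n+m (y ∸ x) (x ∸ y))))
        (≤-trans (<⇒≤ (<-suc-quo (4 * G₂) (cov * cov) (*-mono-< 0<cov 0<cov))) (≤-reflexive (*-comm σ (cov * cov))))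
        (quo-rem (2 * q * G₁) m) ≤-refl
        (<ᵇ⇒< (uh * den + sub) ρ (T-∧ˡ t)) (<ᵇ⇒< (uh * den + sub + ρ) m (T-∧ʳ {uh * den + sub <ᵇ ρ} t)) G₁≤G₂
      go : ∀ uh → u < advance₂ cov den sub ρ m uh → ⊥
      go uh lt with ((uh * den + sub <ᵇ ρ) ∧ (uh * den + sub + ρ <ᵇ m)) in eq
      ... | false = <⇒≱ lt cov≤u
      ... | true with cov ≤ᵇ uh
      ...   | false = <⇒≱ lt cov≤u
      ...   | true  = bound uh (subst T (sym eq) tt) (≤-pred lt)

    cov≤advance : ∀ p q cov → cov ≤ advance D N A₁ G₁ G₂ m p q cov
    cov≤advance p q cov = go (N * ((p * D ∸ q * A₁) + (q * A₁ ∸ p * D) + 128 * q))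
        (q * (suc (quo (4 * G₂) (cov * cov)) + 2 * (G₂ ∸ G₁))) (rem (2 * q * G₁) m)
      where
      step : ∀ den sub ρ uh → cov ≤ advance₂ cov den sub ρ m uh
      step den sub ρ uh with ((uh * den + sub <ᵇ ρ) ∧ (uh * den + sub + ρ <ᵇ m))
      ... | false = ≤-refl
      ... | true with cov ≤ᵇ uh in eq
      ...   | false = ≤-refl
      ...   | true  = m≤n⇒m≤1+n (≤ᵇ⇒≤ cov uh (subst T (sym eq) tt))
      go : ∀ den sub ρ → cov ≤ advance₃ cov den sub ρ m
      go den sub ρ = step den sub ρ (quo (pred ((if ρ ≤ᵇ m ∸ ρ then ρ else m ∸ ρ) ∸ sub)) den)

    loop-sound : ∀ f UB a b p p₋ q q₋ cov thr → T (loop f (parameters UB D N A₁ G₁ G₂ m) a b p p₋ q q₋ cov thr) →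
                 (s : Solution M) → 0 < cov → cov ≤ Solution.u s → Solution.u s < UB → ⊥
    loop-sound (suc f) UB a b p p₋ q q₋ cov thr t s 0<cov cov≤u u<UB = at-try (thr ≤ᵇ quo a b * q + q₋) t
      where
      π : Parameters
      π = parameters UB D N A₁ G₁ G₂ m
      b′ p′ q′ : ℕ
      b′ = a ∸ quo a b * b
      p′ = quo a b * p + p₋
      q′ = quo a b * q + q₋
      at-stop : ∀ cov′ → 0 < cov′ → cov′ ≤ Solution.u s → T (tried f π b b′ p′ p q′ q cov′) → ⊥
      at-stop cov′ 0<cov′ cov′≤u t′ with UB ≤ᵇ cov′ in eq
      ... | true  = <⇒≱ u<UB (≤-trans (≤ᵇ⇒≤ UB cov′ (subst T (sym eq) tt)) cov′≤u)
      ... | false = loop-sound f UB b b′ p′ p q′ q cov′ _ t′ s 0<cov′ cov′≤u u<UB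
      at-try : ∀ x → T (try x f π b b′ p′ p q′ q cov thr) → ⊥
      at-try false t′ = loop-sound f UB b b′ p′ p q′ q cov thr t′ s 0<cov cov≤u u<UB
      at-try true  t′ with Solution.u s <? advance D N A₁ G₁ G₂ m p′ q′ cov
      ... | yes lt = advance-sound p′ q′ cov s 0<cov cov≤u lt
      ... | no  ge = at-stop (advance D N A₁ G₁ G₂ m p′ q′ cov) (≤-trans 0<cov (cov≤advance p′ q′ cov)) (≮⇒≥ ge) t′

    tried-sound : ∀ f UB a b p p₋ q q₋ cov → T (tried f (parameters UB D N A₁ G₁ G₂ m) a b p p₋ q q₋ cov) →
                  (s : Solution M) → 0 < cov → cov ≤ Solution.u s → Solution.u s < UB → ⊥
    tried-sound f UB a b p p₋ q q₋ cov t s 0<cov cov≤u u<UB with UB ≤ᵇ cov in eq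
    ... | true  = <⇒≱ u<UB (≤-trans (≤ᵇ⇒≤ UB cov (subst T (sym eq) tt)) cov≤u)
    ... | false = loop-sound f UB a b p p₋ q q₋ cov _ t s 0<cov cov≤u u<UB

  -- Newton iteration for 2^(1/N) with doubling precision; its output is validated by checkWith.

  newtonStep : (D N i x z : ℕ) → ℕ
  newtonStep D N i x z = (x + quo (x * (2 * D ∸ z)) (2 * D * N)) ∸ quo (x * (z ∸ 2 * D)) (2 * D * N)

  -- With 2^i = N + 1, the N-th power of x/D is obtained from i squarings and one division.
  newton : (D N i x : ℕ) → ℕ
  newton D N i x = newtonStep D N i x (quo (powLo D i x * D) x)

  halfPrecision : ℕ → ℕ → ℕ
  halfPrecision i k = quo (k + i) 2 + 8

  refine : (f N i k : ℕ) → ℕ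
  -- 0.6931 is log 2: the starting value is 2^(1/N) ≈ 1 + (log 2)/N.
  refine zero    N i k = 2 ^ k + quo (2 ^ k * 6931) (10000 * N)
  refine (suc f) N i k = newton (2 ^ k) N i (refine f N i (halfPrecision i k) * 2 ^ (k ∸ halfPrecision i k))

  checkWith : (k D N cov S A₁ G₁ G₂ : ℕ) → Bool
  checkWith k D N cov S A₁ G₁ G₂ =
    (0 <ᵇ A₁) ∧ ((powHi D (suc k) A₁ ≤ᵇ 4 * A₁) ∧ ((4 * (A₁ + 64) ≤ᵇ powLo D (suc k) (A₁ + 64)) ∧
    ((G₁ * G₁ ≤ᵇ D * A₁) ∧ ((D * (A₁ + 64) ≤ᵇ G₂ * G₂) ∧
    -- 4000 is fuel for the number of convergents, 10^500 bounds u because u² < c ≤ 10^1000, and 1 0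
    -- 0 1 starts the recursion of the convergents.
    tried 4000 (parameters (10 ^ 500) D N A₁ G₁ G₂ (D * N)) A₁ D 1 0 0 1 cov))))

  -- S/D approximates 2^(1/N) = √α, so S²/D approximates αD. The margins 16 and 64 absorb the
  -- rounding in S, and `checkWith` certifies the resulting brackets.
  checkRoot : (k D N cov S : ℕ) → Bool
  checkRoot k D N cov S = checkWith k D N cov S (quo (S * S) D ∸ 16) (S ∸ 64) (S + 64)

  -- The bracket contributes an error proportional to uq/D. A convergent that is useful near u =
  -- 10^500 has q of at least that order, so D has to exceed 10^1000, a number of 3322 bits, with
  -- some margin.
  check : (k cov : ℕ) → Bool
  check k cov = checkRoot k (2 ^ (k + 3402)) (pred (2 ^ suc k)) cov (refine 10 (pred (2 ^ suc k)) (suc k) (k + 3402))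

  check-sound : ∀ k cov → check (suc k) cov ≡ true → (s : Solution (E k)) → 0 < cov → cov ≤ Solution.u s → Solution.u s < 10 ^ 500 → ⊥
  check-sound k cov t s 0<cov = main (2 ^ (suc k + 3402)) (m^n>0 2 (suc k + 3402))
      (refine 10 (pred (2 ^ suc (suc k))) (suc (suc k)) (suc k + 3402)) (pred (2 ^ suc (suc k))) (cong pred (2^suc≡E (suc k))) (≡true⇒T t)
    where
    main : ∀ D → 0 < D → ∀ S N → N ≡ E (suc k) → T (checkRoot (suc k) D N cov S) → cov ≤ Solution.u s → Solution.u s < 10 ^ 500 → ⊥
    main D 0<D S .(E (suc k)) refl t₀ = tried-sound (E k) D A₁ (S ∸ 64) (S + 64) 0<D 0<A₁
        (root-low (suc k) D A₁ 0<D 0<A₁ (≤ᵇ⇒≤ _ _ (T-∧ˡ t₁)))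
        (root-high (suc k) D (A₁ + 64) 0<D (≤-trans 0<A₁ (m≤m+n A₁ 64)) (≤ᵇ⇒≤ _ _ (T-∧ˡ t₂)))
        (≤ᵇ⇒≤ _ _ (T-∧ˡ t₃)) (≤ᵇ⇒≤ _ _ (T-∧ˡ t₄)) (≤-trans (m∸n≤m S 64) (m≤m+n S 64))
        4000 (10 ^ 500) A₁ D 1 0 0 1 cov (T-∧ʳ {D * (A₁ + 64) ≤ᵇ (S + 64) * (S + 64)} t₄) s 0<cov
      where
      A₁ : ℕ
      A₁ = quo (S * S) D ∸ 16
      0<A₁ : 0 < A₁
      0<A₁ = <ᵇ⇒< 0 A₁ (T-∧ˡ t₀)
      t₁ = T-∧ʳ {0 <ᵇ A₁} t₀
      t₂ = T-∧ʳ {powHi D (suc (suc k)) A₁ ≤ᵇ 4 * A₁} t₁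
      t₃ = T-∧ʳ {4 * (A₁ + 64) ≤ᵇ powLo D (suc (suc k)) (A₁ + 64)} t₂
      t₄ = T-∧ʳ {(S ∸ 64) * (S ∸ 64) ≤ᵇ D * A₁} t₃

  -- Since 41² = 1681 is larger than every index k + 2 under test, these primes detect all composite
  -- indices, which reduce to smaller ones.
  smallPrimes : List ℕ
  smallPrimes = 2 ∷ 3 ∷ 5 ∷ 7 ∷ 11 ∷ 13 ∷ 17 ∷ 19 ∷ 23 ∷ 29 ∷ 31 ∷ 37 ∷ []

  hasProperFactor : ℕ → List ℕ → Bool
  hasProperFactor n []       = false
  hasProperFactor n (q ∷ qs) = ((1 <ᵇ q) ∧ ((q <ᵇ n) ∧ (rem n q ≡ᵇ 0))) ∨ hasProperFactor n qs
  -- Smaller u are excluded otherwise: by direct search for k = 2 and k = 3, by N < 30u for larger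
  -- k.
  start : ℕ → ℕ
  start 2 = 33
  start 3 = 5
  start k = suc (quo (pred (2 ^ suc k)) 30)

  testAt : ℕ → Bool
  testAt k = hasProperFactor (k + 2) smallPrimes ∨ check k (start k)

  allFrom : ℕ → ℕ → (ℕ → Bool) → Bool
  allFrom zero    n p = true
  allFrom (suc f) n p = p n ∧ allFrom f (suc n) p

-- Residue conditions: squares modulo p ≡ 3 mod 4 and orbits modulo the table entries

module QuadraticResidues where

  open CriticalSequence
  open import Defs using (table)
  open import Data.Nat
  open import Data.Nat.Properties
  open import Data.Nat.Divisibility
  open import Data.Nat.DivMod
  open import Data.Nat.Coprimality as Cop using (Coprime; coprime-Bézout)
  open import Data.Nat.GCD using (module Bézout)
  open import Data.Nat.Induction using (<-wellFounded)
  open import Data.Nat.Primality using (Prime; prime⇒irreducible)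
  open import Data.Nat.Tactic.RingSolver using (solve-∀)
  open import Data.Bool using (Bool; true; false; T; _∧_; _∨_; not)
  open import Data.Empty using (⊥; ⊥-elim)
  open import Data.List using (List; []; _∷_)
  open import Data.List.Relation.Unary.Any using (Any; here; there)
  open import Data.Product using (∃; _×_; _,_; proj₁; proj₂)
  open import Data.Sum using (_⊎_; inj₁; inj₂; [_,_]′)
  open import Function using (case_of_; _∘_)
  open import Induction.WellFounded using (Acc; acc)
  open import Relation.Binary.PropositionalEquality
  open import Relation.Nullary using (¬_; yes; no; contradiction)

  ∧-true : ∀ {x y} → x ∧ y ≡ true → x ≡ true × y ≡ true
  ∧-true {true} e = refl , e

  square-descends-∣ : ∀ c k n → suc k ∣ suc n → IsSq (A c n) → IsSq (A c k)
  square-descends-∣ c k n (divides (suc q) e) sq = square-descends c k q (subst (λ z → IsSq (A c z)) (suc-injective e) sq)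
  even-consecutive : ∀ h → ∃ λ t → h * suc h ≡ t + t
  even-consecutive zero    = 0 , refl
  even-consecutive (suc h) with even-consecutive h
  ... | t , e = suc h + t , trans (l h) (trans (cong (λ z → suc h + suc h + z) e) (l′ h t))
    where
    l : ∀ h → suc h * suc (suc h) ≡ suc h + suc h + h * suc h
    l = solve-∀
    l′ : ∀ h t → suc h + suc h + (t + t) ≡ suc h + t + (suc h + t)
    l′ = solve-∀

  cofactor-mod-4 : ∀ m n s → n % 4 ≡ 3 → m * n ≡ 1 + s * 4 → m % 4 ≡ 3
  cofactor-mod-4 m n s n≡3 e = go (m % 4) (m%n<n m 4) (begin
    (m % 4 * 3) % 4        ≡⟨ cong (λ z → (m % 4 * z) % 4) (sym n≡3) ⟩
    (m % 4 * (n % 4)) % 4  ≡⟨ sym (%-distribˡ-* m n 4) ⟩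
    (m * n) % 4            ≡⟨ cong (_% 4) e ⟩
    (1 + s * 4) % 4        ≡⟨ [m+kn]%n≡m%n 1 s 4 ⟩
    1                      ∎)
    where
    open ≡-Reasoning
    go : ∀ j → j < 4 → (j * 3) % 4 ≡ 1 → j ≡ 3
    go 3 _ _ = refl
    go (suc (suc (suc (suc _)))) (s≤s (s≤s (s≤s (s≤s ())))) _

  cofactor-even : ∀ m n s → n % 4 ≡ 3 → m * n ≡ s + s → 2 ∣ m
  cofactor-even m n s n≡3 e with odd-or-even m | odd-or-even n
  ... | h , inj₁ refl | _ = 2∣double h
  ... | h , inj₂ refl | h′ , inj₂ refl = contradiction (subst (2 ∣_) (trans (sym e) (l h h′)) (2∣double s)) (2∣∧2∤ (h * h′ + h + h * h′ + h′))
    where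
    l : ∀ h h′ → suc (h + h) * suc (h′ + h′) ≡ suc (h * h′ + h + h * h′ + h′ + (h * h′ + h + h * h′ + h′))
    l = solve-∀
  ... | _ | h′ , inj₁ refl = ⊥-elim (even≢3 (h′ + h′) (2∣double h′) n≡3)
    where
    even≢3 : ∀ z → 2 ∣ z → z % 4 ≡ 3 → ⊥
    even≢3 z d e = 2∣∧2∤ (1 + (z / 4 + z / 4)) (subst (2 ∣_) (trans (m≡m%n+[m/n]*n z 4) (trans (cong (_+ z / 4 * 4) e) (l (z / 4)))) d)
      where
      l : ∀ q → 3 + q * 4 ≡ suc (1 + (q + q) + (1 + (q + q)))
      l = solve-∀

  -- n ∣ x² + 1 with x < n leaves a cofactor smaller than n which is again 3 mod 4, up to a factor 2.
  -1-nonresidue : ∀ n → Acc _<_ n → n % 4 ≡ 3 → ∀ x → ¬ n ∣ x * x + 1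
  -1-nonresidue 0 _ ()
  -1-nonresidue 1 _ ()
  -1-nonresidue n@(suc (suc n₀)) (acc rs) n≡3 x n∣ = reduced n∣r
    where
    r : ℕ
    r = x % n
    n∣r : n ∣ r * r + 1
    n∣r = ∣m+n∣m⇒∣n (subst (n ∣_) (trans (cong (λ z → z * z + 1) (m≡m%n+[m/n]*n x n)) (l r (x / n) n)) n∣) (divides (2 * (r * (x / n)) + x / n * (x / n) * n) refl)
      where
      l : ∀ r q n → (r + q * n) * (r + q * n) + 1 ≡ (2 * (r * q) + q * q * n) * n + (r * r + 1)
      l = solve-∀
    reduced : n ∣ r * r + 1 → ⊥
    reduced (divides m e) with odd-or-even r
    ... | h , inj₁ r≡ = -1-nonresidue m (rs m<n) (cofactor-mod-4 m n (h * h) n≡3 (trans (sym e) (trans (cong (λ z → z * z + 1) r≡) (l h)))) r (divides n (trans e (*-comm m n)))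
      where
      l : ∀ h → (h + h) * (h + h) + 1 ≡ 1 + h * h * 4
      l = solve-∀
      m<n : m < n
      m<n = *-cancelʳ-< n m n (subst (_< n * n) e (bound r (m%n<n x n)))
        where
        bound : ∀ r → r < n → r * r + 1 < n * n
        bound r (s≤s r≤) = ≤-trans (s≤s (+-monoˡ-≤ 1 (*-mono-≤ r≤ r≤))) (≤-trans (m≤m+n _ (suc (n₀ + n₀))) (≤-reflexive (eq n₀)))
          where
          eq : ∀ n → suc (suc n * suc n + 1) + suc (n + n) ≡ suc (suc n) * suc (suc n)
          eq = solve-∀
    ... | h , inj₂ r≡ with even-consecutive h | cofactor-even m n (2 * (h * suc h) + 1) n≡3 (trans (sym e) (trans (cong (λ z → z * z + 1) r≡) (l h)))
      where
      l : ∀ h → suc (h + h) * suc (h + h) + 1 ≡ 2 * (h * suc h) + 1 + (2 * (h * suc h) + 1)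
      l = solve-∀
    ...   | t , et | divides m′ em = -1-nonresidue m′ (rs m′<n) (cofactor-mod-4 m′ n t n≡3 m′n) r (divides (2 * n) (trans e (trans (cong (_* n) em) (l₃ m′ n))))
      where
      l₁ : ∀ m n → 2 * (m * n) ≡ m * 2 * n
      l₁ = solve-∀
      l₂ : ∀ h → suc (h + h) * suc (h + h) + 1 ≡ 2 * (1 + 2 * (h * suc h))
      l₂ = solve-∀
      l₃ : ∀ m n → m * 2 * n ≡ 2 * n * m
      l₃ = solve-∀
      l₄ : ∀ t → 1 + 2 * (t + t) ≡ 1 + t * 4
      l₄ = solve-∀
      m′n : m′ * n ≡ 1 + t * 4
      m′n = trans (*-cancelˡ-≡ _ _ 2 (trans (l₁ m′ n) (trans (cong (_* n) (sym em)) (trans (sym e) (trans (cong (λ z → z * z + 1) r≡) (l₂ h)))))) (trans (cong (λ z → 1 + 2 * z) et) (l₄ t))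
      bound : ∀ r → r < n → r * r + 1 < n * n
      bound r (s≤s r≤) = ≤-trans (s≤s (+-monoˡ-≤ 1 (*-mono-≤ r≤ r≤))) (≤-trans (m≤m+n _ (suc (n₀ + n₀))) (≤-reflexive (eq n₀)))
        where
        eq : ∀ n → suc (suc n * suc n + 1) + suc (n + n) ≡ suc (suc n) * suc (suc n)
        eq = solve-∀
      m′<n : m′ < n
      m′<n = ≤-<-trans (≤-trans (m≤m*n m′ 2) (≤-reflexive (sym em))) (*-cancelʳ-< n m n (subst (_< n * n) e (bound r (m%n<n x n))))

  prime∤⇒coprime : ∀ {p x} → Prime p → ¬ p ∣ x → Coprime x p
  prime∤⇒coprime pr p∤x (d∣x , d∣p) = [ (λ e → e) , (λ { refl → ⊥-elim (p∤x d∣x) }) ]′ (prime⇒irreducible pr d∣p)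

  -- If y were invertible modulo p, then (x/y)² + 1 would be divisible by p.
  3mod4-∣-sum : ∀ p x y → Prime p → p % 4 ≡ 3 → p ∣ x * x + y * y → p ∣ y
  3mod4-∣-sum p x y pr p≡3 d with p ∣? y
  ... | yes p∣y = p∣y
  ... | no  p∤y with coprime-Bézout (prime∤⇒coprime pr p∤y)
  ...   | Bézout.+- i j e = ⊥-elim (-1-nonresidue p (<-wellFounded p) p≡3 (x * i) (∣m+n∣m⇒∣n
          (subst (p ∣_) (trans (l x y i) (trans (cong (λ z → x * i * (x * i) + z * z) (sym e)) (l′ (x * i) j p))) (∣m⇒∣m*n (i * i) d))
          (divides (2 * j + j * j * p) refl)))
    where
    l : ∀ x y i → (x * x + y * y) * (i * i) ≡ x * i * (x * i) + i * y * (i * y)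
    l = solve-∀
    l′ : ∀ z j p → z * z + (1 + j * p) * (1 + j * p) ≡ (2 * j + j * j * p) * p + (z * z + 1)
    l′ = solve-∀
  ...   | Bézout.-+ i j e = ⊥-elim (-1-nonresidue p (<-wellFounded p) p≡3 (x * i) (∣m+n∣m⇒∣n {m = suc (i * y) * (i * y)}
          (subst (p ∣_) (l x y i) (∣m∣n⇒∣m+n (∣m⇒∣m*n (i * i) d) (divides j e)))
          (∣m⇒∣m*n (i * y) (divides j e))))
    where
    l : ∀ x y i → (x * x + y * y) * (i * i) + suc (i * y) ≡ suc (i * y) * (i * y) + (x * i * (x * i) + 1)
    l = solve-∀

  -- c ≡ -1 modulo p and the exponent is odd.
  E-odd-power : ∀ {p} c → p ∣ c + 1 → ∀ k → p ∣ c ^ E k + 1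
  E-odd-power {p} c d zero    = subst (λ z → p ∣ z + 1) (sym (*-identityʳ c)) d
  E-odd-power {p} c d (suc k) = ∣m+n∣m⇒∣n {m = c * (c ^ E k + 1)} (subst (p ∣_) (trans (l c (c ^ E k)) (cong (λ z → c * (c ^ E k + 1) + (z + 1)) (sym (^-E-suc c k))))
     (∣m∣n⇒∣m+n (∣n⇒∣m*n (c * c ^ E k) (E-odd-power c d k)) d)) (∣n⇒∣m*n c (E-odd-power c d k))
    where
    l : ∀ c x → c * x * (x + 1) + (c + 1) ≡ c * (x + 1) + (c * (x * x) + 1)
    l = solve-∀

  -- A square aₙ with n even gives the square a₂. For n odd, p divides a₂ = c + 1, which divides
  -- aₙ₋₁, so aₙ is congruent to an odd power of c, that is to -1, modulo p.
  residue₂-nonsquare : ∀ c p → ¬ IsSq (A c 1) → p % 4 ≡ 3 → p ∣ c + 1 → ∀ n → ¬ IsSq (A c (2 + n))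
  residue₂-nonsquare c p nsq p≡3 p∣c+1 n sq@(b , eb) with odd-or-even n
  ... | h , inj₂ refl = nsq (square-descends-∣ c 1 (3 + (h + h)) (divides (2 + h) (l h)) sq)
    where
    l : ∀ h → 4 + (h + h) ≡ (2 + h) * 2
    l = solve-∀
  ... | h , inj₁ refl with A-multiple c 1 h
  ...   | t , et , _ = -1-nonresidue p (<-wellFounded p) p≡3 b
          (subst (p ∣_) (trans (sym (+-assoc (a * a) _ 1)) (cong (_+ 1) eb)) (∣m∣n⇒∣m+n (∣n⇒∣m*n a p∣a) (E-odd-power c p∣c+1 (1 + (h + h)))))
    where
    a : ℕ
    a = A c (1 + (h + h))
    l : ∀ h → 1 + h * 2 ≡ 1 + (h + h)
    l = solve-∀
    p∣a : p ∣ a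
    p∣a = subst (λ z → p ∣ A c z) (l h) (subst (p ∣_) (sym et) (∣m⇒∣m*n t (subst (p ∣_) (trans (+-comm c 1) (cong suc (sym (*-identityʳ c)))) p∣c+1)))
  -- suc k is the index before the shift. Multiples of 2 and of 3 reduce to a₂ and a₃; what remains
  -- is 1 or 5 modulo 6.
  index-classes : ∀ k → 2 ∣ suc k ⊎ 3 ∣ suc k ⊎ (∃ λ i → k ≡ i * 6) ⊎ (∃ λ i → k ≡ 4 + i * 6)
  index-classes 0 = inj₂ (inj₂ (inj₁ (0 , refl)))
  index-classes 1 = inj₁ (divides 1 refl)
  index-classes 2 = inj₂ (inj₁ (divides 1 refl))
  index-classes 3 = inj₁ (divides 2 refl)
  index-classes 4 = inj₂ (inj₂ (inj₂ (0 , refl)))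
  index-classes 5 = inj₁ (divides 3 refl)
  index-classes (suc (suc (suc (suc (suc (suc k)))))) with index-classes k
  ... | inj₁ (divides q e)                    = inj₁ (divides (3 + q) (cong (6 +_) e))
  ... | inj₂ (inj₁ (divides q e))             = inj₂ (inj₁ (divides (2 + q) (cong (6 +_) e)))
  ... | inj₂ (inj₂ (inj₁ (i , e)))            = inj₂ (inj₂ (inj₁ (suc i , cong (6 +_) e)))
  ... | inj₂ (inj₂ (inj₂ (i , e)))            = inj₂ (inj₂ (inj₂ (suc i , cong (6 +_) e)))

  -- A data type rather than a pair, so that evaluation shares the two components.
  data State : Set where
    _▹_ : ℕ → ℕ → State

  -- The initial state is kept variable: with a concrete one, conversion checking would unfold the orbit.
  module Residues (m₀ a : ℕ) (s₀ : State) where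

    m : ℕ
    m = suc m₀

    -- The state is the pair of A c k and c^(E k) modulo m, and c^(E (suc k)) is c times the square
    -- of c^(E k).
    step : State → State
    step (x ▹ e) = ((x * x + e) % m) ▹ ((a * (e * e)) % m)

    state : ℕ → State
    state zero    = s₀
    state (suc k) = step (state k)

    nonresidueBelow : ℕ → ℕ → Bool
    nonresidueBelow zero    x = true
    nonresidueBelow (suc b) x = not ((b * b) % m ≡ᵇ x) ∧ nonresidueBelow b x

    good : State → Bool
    good (x ▹ _) = nonresidueBelow m x

    _≡ᵇ²_ : State → State → Bool
    (x ▹ e) ≡ᵇ² (x′ ▹ e′) = (x ≡ᵇ x′) ∧ (e ≡ᵇ e′)

    step⁴ step⁶ : State → State
    step⁴ s = step (step (step (step s)))
    step⁶ s = step (step (step⁴ s))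

    -- States 0 to 17 are left for a possible preperiod and tested singly. From state 18 on, the
    -- walk goes in steps of six, testing offsets 0 and 4, until state 18 recurs; 25 such rounds are
    -- allowed.
    cycle : ℕ → State → Bool
    cycle zero    s = false
    cycle (suc f) s = good s ∧ (good (step⁴ s) ∧ ((step⁶ s ≡ᵇ² state 18) ∨ cycle f (step⁶ s)))

    check : Bool
    check = good (state 4) ∧ (good (state 6) ∧ (good (state 10) ∧ (good (state 12) ∧ (good (state 16) ∧ cycle 25 (state 18)))))

    private
      ≡ᵇ-sound : ∀ x y → (x ≡ᵇ y) ≡ true → x ≡ y
      ≡ᵇ-sound x y e = ≡ᵇ⇒≡ x y (subst T (sym e) _)

      ≡ᵇ²-sound : ∀ s s′ → (s ≡ᵇ² s′) ≡ true → s ≡ s′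
      ≡ᵇ²-sound (x ▹ e) (x′ ▹ e′) t = cong₂ _▹_ (≡ᵇ-sound x x′ (proj₁ (∧-true t))) (≡ᵇ-sound e e′ (proj₂ (∧-true {x ≡ᵇ x′} t)))

      ∨-true : ∀ {x y} → x ∨ y ≡ true → x ≡ true ⊎ y ≡ true
      ∨-true {true}  e = inj₁ refl
      ∨-true {false} e = inj₂ e

      Cycle : State → Set
      Cycle s = ∃ λ f → cycle f s ≡ true

      cycle-good : ∀ s → Cycle s → good s ≡ true × good (step⁴ s) ≡ true
      cycle-good s (suc f , t) = proj₁ (∧-true t) , proj₁ (∧-true (proj₂ (∧-true {good s} t)))

      cycle-step : ∀ s → Cycle (state 18) → Cycle s → Cycle (step⁶ s)
      cycle-step s c₀ (suc f , t) = [ (λ e → subst Cycle (sym (≡ᵇ²-sound _ _ e)) c₀) , (λ e → f , e) ]′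
        (∨-true {step⁶ s ≡ᵇ² state 18} (proj₂ (∧-true {good (step⁴ s)} (proj₂ (∧-true {good s} t)))))

      orbit-cycle : Cycle (state 18) → ∀ i → Cycle (state ((3 + i) * 6))
      orbit-cycle c₀ zero    = c₀
      orbit-cycle c₀ (suc i) = cycle-step (state ((3 + i) * 6)) c₀ (orbit-cycle c₀ i)

    module _ (ok : check ≡ true) where

      private
        r₁ = ∧-true {good (state 4)} ok
        r₂ = ∧-true {good (state 6)} (proj₂ r₁)
        r₃ = ∧-true {good (state 10)} (proj₂ r₂)
        r₄ = ∧-true {good (state 12)} (proj₂ r₃)
        r₅ = ∧-true {good (state 16)} (proj₂ r₄)

      good-0 : ∀ i → good (state (suc i * 6)) ≡ true
      good-0 zero          = proj₁ r₂
      good-0 (suc zero)    = proj₁ r₄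
      good-0 (suc (suc i)) = proj₁ (cycle-good _ (orbit-cycle (25 , proj₂ r₅) i))

      good-4 : ∀ i → good (state (4 + i * 6)) ≡ true
      good-4 zero                = proj₁ r₁
      good-4 (suc zero)          = proj₁ r₃
      good-4 (suc (suc zero))    = proj₁ r₅
      good-4 (suc (suc (suc i))) = proj₂ (cycle-good _ (orbit-cycle (25 , proj₂ r₅) i))

    nonresidue-sound : ∀ b x → nonresidueBelow b x ≡ true → ∀ y → y < b → (y * y) % m ≢ x
    nonresidue-sound (suc b) x t y y<b with m≤n⇒m<n∨m≡n y<b
    ... | inj₁ (s≤s y<b′) = nonresidue-sound b x (proj₂ (∧-true {not ((b * b) % m ≡ᵇ x)} t)) y y<b′
    ... | inj₂ refl = λ { refl → absurd (proj₁ (∧-true {not ((y * y) % m ≡ᵇ (y * y) % m)} t)) }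
      where
      self : ∀ n → (n ≡ᵇ n) ≡ true
      self zero    = refl
      self (suc n) = self n
      absurd : not ((y * y) % m ≡ᵇ (y * y) % m) ≡ true → ⊥
      absurd e rewrite self ((y * y) % m) = case e of λ ()

    good⇒nonsquare : ∀ x e → good ((x % m) ▹ e) ≡ true → ¬ IsSq x
    good⇒nonsquare x e t (b , refl) = nonresidue-sound m _ t (b % m) (m%n<n b m) (sym (%-distribˡ-* b b m))

    module _ (c : ℕ) (c≡a : c % m ≡ a % m) (s₀≡ : s₀ ≡ (1 % m) ▹ (a % m)) where

      state-A : ∀ k → state k ≡ (A c k % m) ▹ (c ^ E k % m)
      state-A zero    = trans s₀≡ (cong ((1 % m) ▹_) (trans (sym c≡a) (cong (_% m) (sym (*-identityʳ c)))))
      state-A (suc k) = trans (cong step (state-A k)) (cong₂ _▹_ first second)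
        where
        open ≡-Reasoning
        x e : ℕ
        x = A c k
        e = c ^ E k
        first : (x % m * (x % m) + e % m) % m ≡ (x * x + e) % m
        first = begin
          (x % m * (x % m) + e % m) % m              ≡⟨ %-distribˡ-+ (x % m * (x % m)) (e % m) m ⟩
          ((x % m * (x % m)) % m + e % m % m) % m    ≡⟨ cong₂ (λ u v → (u + v) % m) (sym (%-distribˡ-* x x m)) (m%n%n≡m%n e m) ⟩
          ((x * x) % m + e % m) % m                  ≡⟨ sym (%-distribˡ-+ (x * x) e m) ⟩
          (x * x + e) % m                            ∎
        second : (a * (e % m * (e % m))) % m ≡ c ^ E (suc k) % m
        second = begin
          (a * (e % m * (e % m))) % m                ≡⟨ %-distribˡ-* a (e % m * (e % m)) m ⟩
          (a % m * ((e % m * (e % m)) % m)) % m      ≡⟨ cong₂ (λ u v → (u * v) % m) (sym c≡a) (sym (%-distribˡ-* e e m)) ⟩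
          (c % m * ((e * e) % m)) % m                ≡⟨ sym (%-distribˡ-* c (e * e) m) ⟩
          (c * (e * e)) % m                          ≡⟨ cong (_% m) (sym (^-E-suc c k)) ⟩
          c ^ E (suc k) % m                          ∎

      good-index : ∀ k → good (state k) ≡ true → ¬ IsSq (A c k)
      good-index k t = good⇒nonsquare (A c k) (c ^ E k % m) (subst (λ s → good s ≡ true) (state-A k) t)

      orbit-nonsquare : ¬ IsSq (A c 1) → ¬ IsSq (A c 2) → check ≡ true → ∀ n → ¬ IsSq (A c (2 + n))
      orbit-nonsquare nsq₁ nsq₂ ok n sq =
        [ (λ d → nsq₁ (square-descends-∣ c 1 (2 + n) d sq))
        , [ (λ d → nsq₂ (square-descends-∣ c 2 (2 + n) d sq)) , [ class₀ , class₄ ]′ ]′ ]′ (index-classes (2 + n))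
        where
        class₀ : ¬ (∃ λ i → 2 + n ≡ i * 6)
        class₀ (suc i , e) = good-index (suc i * 6) (good-0 ok i) (subst (IsSq ∘ A c) e sq)
        class₄ : ¬ (∃ λ i → 2 + n ≡ 4 + i * 6)
        class₄ (i , e) = good-index (4 + i * 6) (good-4 ok i) (subst (IsSq ∘ A c) e sq)

  start : ℕ → ℕ → State
  start zero     a = 0 ▹ 0
  start (suc m₀) a = (1 % suc m₀) ▹ (a % suc m₀)

  checkFrom : ℕ → ℕ → State → Bool
  checkFrom zero     a s = false
  checkFrom (suc m₀) a s = Residues.check m₀ a s

  checkEntry : ℕ → ℕ → Bool
  checkEntry m a = checkFrom m a (start m a)

  module _ (c : ℕ) (nsq₁ : ¬ IsSq (A c 1)) (nsq₂ : ¬ IsSq (A c 2)) where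

    private
      from-state : ∀ m a s → s ≡ start m a → checkFrom m a s ≡ true → (.{{_ : NonZero m}} → c % m ≡ a % m) → ∀ n → ¬ IsSq (A c (2 + n))
      from-state (suc m₀) a s e ok c≡a = Residues.orbit-nonsquare m₀ a s c c≡a e nsq₁ nsq₂ ok

    residue₃-nonsquare : ∀ m a → checkEntry m a ≡ true → (.{{_ : NonZero m}} → c % m ≡ a % m) → ∀ n → ¬ IsSq (A c (2 + n))
    residue₃-nonsquare m a = from-state m a (start m a) refl

  checkResidues : ℕ → List ℕ → Bool
  checkResidues m []       = true
  checkResidues m (a ∷ as) = checkEntry m a ∧ checkResidues m as

  checkTable : List (ℕ × List ℕ) → Bool
  checkTable []             = true
  checkTable ((m , as) ∷ t) = checkResidues m as ∧ checkTable t

  table-checked : checkTable table ≡ true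
  table-checked = refl

  any-residue : ∀ {P : ℕ → Set} m as → checkResidues m as ≡ true → Any P as → ∃ λ a → checkEntry m a ≡ true × P a
  any-residue m (a ∷ as) ok (here p)  = a , proj₁ (∧-true {checkEntry m a} ok) , p
  any-residue m (a ∷ as) ok (there h) = any-residue m as (proj₂ (∧-true {checkEntry m a} ok)) h

-- Even c from 6 up to 10^1000

module BoundedRange where

  open CriticalSequence
  open QuadraticResidues using (∧-true; square-descends-∣)
  open OddParameter
  open DeviationBounds
  open DeviationChecker
  open import Data.Nat
  open import Data.Nat.Properties
  open import Data.Nat.Divisibility
  open import Data.Nat.DivMod
  open import Data.Nat.Primality using (Prime; composite-≢; prime⇒¬composite; ¬prime[0]; ¬prime[1])
  import Data.Nat.Coprimality as Cop
  open import Data.Nat.Tactic.RingSolver using (solve-∀)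
  open import Data.Bool using (Bool; true; false; _∧_; _∨_; not; T)
  open import Data.List.Relation.Unary.All using (_∷_)
  open import Data.Empty using (⊥; ⊥-elim)
  open import Data.List using (_∷_)
  open import Data.Product using (∃; _×_; _,_; proj₁; proj₂)
  open import Data.Sum using (_⊎_; inj₁; inj₂; [_,_]′)
  open import Data.Unit using (tt)
  open import Relation.Binary.PropositionalEquality
  open import Relation.Nullary using (¬_; yes; no; contradiction)

  T-∨ : ∀ {x y} → T (x ∨ y) → T x ⊎ T y
  T-∨ {true}  t = inj₁ t
  T-∨ {false} t = inj₂ t

  ∨-true : ∀ {x y} → x ∨ y ≡ true → x ≡ true ⊎ y ≡ true
  ∨-true {true}  e = inj₁ refl
  ∨-true {false} e = inj₂ e

  allFrom-sound : ∀ f n p → allFrom f n p ≡ true → ∀ m → n ≤ m → m < f + n → p m ≡ true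
  allFrom-sound zero    n p t m n≤m m<n = contradiction n≤m (<⇒≱ m<n)
  allFrom-sound (suc f) n p t m n≤m m<f with m≤n⇒m<n∨m≡n n≤m
  ... | inj₂ refl = proj₁ (∧-true t)
  ... | inj₁ n<m  = allFrom-sound f (suc n) p (proj₂ (∧-true {p n} t)) m n<m (subst (m <_) (sym (+-suc f n)) m<f)

  prime-no-factor : ∀ {n} qs → Prime n → ¬ T (hasProperFactor n qs)
  prime-no-factor {n} (q ∷ qs) pr t with T-∨ {(1 <ᵇ q) ∧ ((q <ᵇ n) ∧ (rem n q ≡ᵇ 0))} t
  ... | inj₂ t′ = prime-no-factor qs pr t′
  ... | inj₁ t′ = factor q t′
    where
    factor : ∀ q → ¬ T ((1 <ᵇ q) ∧ ((q <ᵇ n) ∧ (rem n q ≡ᵇ 0)))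
    factor (suc (suc q)) t″ = prime⇒¬composite pr (composite-≢ (2 + q) {{_}} {{n≢0}} (<⇒≢ q<n)
        (m%n≡0⇒n∣m n (2 + q) (≡ᵇ⇒≡ (n % (2 + q)) 0 (T-∧ʳ {2 + q <ᵇ n} t″))))
      where
      q<n : 2 + q < n
      q<n = <ᵇ⇒< (2 + q) n (T-∧ˡ t″)
      n≢0 : NonZero n
      n≢0 = >-nonZero (≤-trans (s≤s z≤n) q<n)
  isSolution : ℕ → ℕ → ℕ → Bool
  isSolution k u w = (w ^ E k ≡ᵇ 4 * u ^ E k + 4 * A (u * w) k) ∨ (w ^ E k + 4 * A (u * w) k ≡ᵇ 4 * u ^ E k)

  noSmall : (k ub : ℕ) → Bool
  noSmall k ub = allFrom ub 0 (λ u → allFrom (ub + ub) (suc u) (λ w → not (isSolution k u w)))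

  noSmall-sound : ∀ k ub u w → noSmall k ub ≡ true → u < ub → u < w → w < u + u →
                  ¬ (w ^ E k ≡ 4 * u ^ E k + 4 * A (u * w) k ⊎ w ^ E k + 4 * A (u * w) k ≡ 4 * u ^ E k)
  noSmall-sound k ub u w t u<ub u<w w<2u sol = refute (isSolution k u w)
      (allFrom-sound (ub + ub) (suc u) (λ w → not (isSolution k u w))
        (allFrom-sound ub 0 (λ u → allFrom (ub + ub) (suc u) (λ w → not (isSolution k u w))) t u z≤n (subst (u <_) (sym (+-identityʳ ub)) u<ub))
        w u<w (<-≤-trans w<2u (≤-trans (+-mono-≤ (<⇒≤ u<ub) (<⇒≤ u<ub)) (m≤m+n (ub + ub) (suc u)))))
      (hit sol)
    where
    refute : ∀ b → not b ≡ true → T b → ⊥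
    refute false _ ()
    refute true  ()
    hit : w ^ E k ≡ 4 * u ^ E k + 4 * A (u * w) k ⊎ w ^ E k + 4 * A (u * w) k ≡ 4 * u ^ E k → T (isSolution k u w)
    hit (inj₁ e) with w ^ E k ≡ᵇ 4 * u ^ E k + 4 * A (u * w) k | ≡⇒≡ᵇ (w ^ E k) (4 * u ^ E k + 4 * A (u * w) k) e
    ... | true | _ = tt
    hit (inj₂ e) with w ^ E k ≡ᵇ 4 * u ^ E k + 4 * A (u * w) k
    ... | true  = tt
    ... | false = ≡⇒≡ᵇ (w ^ E k + 4 * A (u * w) k) (4 * u ^ E k) e

  computation₂ : check 2 33 ≡ true
  computation₂ = refl

  -- The range 3 ≤ k < 1665 is enough: from k = 1665 on, N < 30u contradicts u < 10^500.
  computation : allFrom 1662 3 testAt ≡ true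
  computation = refl

  computation₃ : check 3 5 ≡ true
  computation₃ = refl

  small₂ : noSmall 2 33 ≡ true
  small₂ = refl

  small₃ : noSmall 3 5 ≡ true
  small₃ = refl

  bernoulli : ∀ u m → u ^ suc m + suc m * u ^ m ≤ suc u ^ suc m
  bernoulli u zero    = ≤-reflexive (l u)
    where
    l : ∀ u → u * 1 + 1 ≡ suc u * 1
    l = solve-∀
  bernoulli u (suc m) = ≤-trans (≤-by (suc m * u ^ m) (l u m (u ^ m))) (*-monoʳ-≤ (suc u) (bernoulli u m))
    where
    l : ∀ u m p → u * (u * p) + suc (suc m) * (u * p) + suc m * p ≡ suc u * (u * p + suc m * p)
    l = solve-∀

  module _ (c k : ℕ) (2∣c : 2 ∣ c) (6≤c : 6 ≤ c) (split : EvenSplit c (A c (suc (suc k))) (E (suc (suc k)))) where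
    open EvenSplit split

    private
      M N a : ℕ
      M = E (suc k)
      N = E (suc (suc k))
      a = A c (suc (suc k))
      0<c : 0 < c
      0<c = ≤-trans (s≤s z≤n) 6≤c
      0<u : 0 < u
      0<u = n≢0⇒n>0 λ { refl → <⇒≢ 0<c (sym c≡) }
      0<w : 0 < w
      0<w = n≢0⇒n>0 λ { refl → <⇒≢ 0<c (sym (trans c≡ (*-zeroʳ u))) }
      1<w : 1 < w
      1<w = ∣⇒≤ {{>-nonZero 0<w}} 2∣w
      u≢w : u ≢ w
      u≢w refl = <⇒≢ 1<w (sym (coprime (∣-refl , ∣-refl)))
      a≤ : a ≤ 2 * (u ^ M * w ^ M)
      a≤ = ≤-trans (A-upper c (suc k) (≤-trans (s≤s (s≤s (s≤s (s≤s z≤n)))) 6≤c)) (*-monoʳ-≤ 2 (≤-reflexive (trans (cong (_^ M) c≡) (*-^-comm u w M))))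

    -- If w < u, the first alternative is impossible by size. The second gives 3u^N ≤ 4a ≤ 8u^(2M),
    -- so 3u ≤ 8, whereas u > w ≥ 2.
    u<w : u < w
    u<w = ≰⇒> λ w≤u → bad (≤∧≢⇒< w≤u (λ e → u≢w (sym e))) eq
      where
      open ≤-Reasoning
      bad : w < u → w ^ N ≡ 4 * u ^ N + 4 * a ⊎ w ^ N + 4 * a ≡ 4 * u ^ N → ⊥
      bad w<u (inj₁ e) = <⇒≱ (^-monoˡ-< N w<u) (≤-trans (m≤m+n (u ^ N) _) (≤-trans (m≤m+n (4 * u ^ N) (4 * a)) (≤-reflexive (sym e))))
      bad w<u (inj₂ e) = <⇒≱ 8<3u (*-cancelʳ-≤ (3 * u) 8 (u ^ M * u ^ M) {{m*n≢0 (u ^ M) (u ^ M) {{uM}} {{uM}}}} (begin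
        3 * u * (u ^ M * u ^ M)     ≡⟨ trans (*-assoc 3 u _) (cong (3 *_) (sym (odd-power u M))) ⟩
        3 * u ^ N                   ≤⟨ +-cancelʳ-≤ (u ^ N) _ _ (begin
            3 * u ^ N + u ^ N         ≡⟨ l (u ^ N) ⟩
            4 * u ^ N                 ≡⟨ e ⟨
            w ^ N + 4 * a             ≤⟨ +-monoˡ-≤ (4 * a) (^-monoˡ-≤ N (<⇒≤ w<u)) ⟩
            u ^ N + 4 * a             ≡⟨ +-comm (u ^ N) (4 * a) ⟩
            4 * a + u ^ N             ∎) ⟩
        4 * a                       ≤⟨ *-monoʳ-≤ 4 a≤ ⟩
        4 * (2 * (u ^ M * w ^ M))   ≤⟨ *-monoʳ-≤ 4 (*-monoʳ-≤ 2 (*-monoʳ-≤ (u ^ M) (^-monoˡ-≤ M (<⇒≤ w<u)))) ⟩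
        4 * (2 * (u ^ M * u ^ M))   ≡⟨ *-assoc 4 2 (u ^ M * u ^ M) ⟨
        8 * (u ^ M * u ^ M)         ∎))
        where
        uM : NonZero (u ^ M)
        uM = m^n≢0 u M {{>-nonZero 0<u}}
        8<3u : 8 < 3 * u
        8<3u = *-monoʳ-≤ 3 (≤-trans (s≤s 1<w) w<u)
        l : ∀ x → 3 * x + x ≡ 4 * x
        l = solve-∀

    private
      w^≤ : w ^ N ≤ 12 * (u ^ suc M * w ^ M)
      w^≤ = begin
        w ^ N                                     ≤⟨ one-sided eq ⟩
        4 * u ^ N + 4 * a                         ≤⟨ +-mono-≤ (*-monoʳ-≤ 4 first) (*-monoʳ-≤ 4 (≤-trans a≤ (*-monoʳ-≤ 2 (*-monoˡ-≤ (w ^ M) (m≤n*m (u ^ M) u {{>-nonZero 0<u}}))))) ⟩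
        4 * (u ^ suc M * w ^ M) + 4 * (2 * (u ^ suc M * w ^ M))  ≡⟨ l (u ^ suc M * w ^ M) ⟩
        12 * (u ^ suc M * w ^ M)                  ∎
        where
        open ≤-Reasoning
        one-sided : w ^ N ≡ 4 * u ^ N + 4 * a ⊎ w ^ N + 4 * a ≡ 4 * u ^ N → w ^ N ≤ 4 * u ^ N + 4 * a
        one-sided (inj₁ e) = ≤-reflexive e
        one-sided (inj₂ e) = ≤-trans (m≤m+n (w ^ N) (4 * a)) (≤-trans (≤-reflexive e) (m≤m+n _ _))
        first : u ^ N ≤ u ^ suc M * w ^ M
        first = ≤-trans (≤-reflexive (^-distribˡ-+-* u (suc M) M)) (*-monoʳ-≤ (u ^ suc M) (^-monoˡ-≤ M (<⇒≤ u<w)))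
        l : ∀ x → 4 * x + 4 * (2 * x) ≡ 12 * x
        l = solve-∀

      -- From w^N ≤ 4u^N + 4a, a ≤ 2(uw)^M and u < w, the power w^(M+1) is at most 12 u^(M+1).
      w<16u : w ^ suc M < 16 * u ^ suc M
      w<16u = ≰⇒> λ le → <⇒≱ (begin-strict
        12 * (u ^ suc M * w ^ M)   <⟨ *-monoˡ-< (u ^ suc M * w ^ M) {{m*n≢0 (u ^ suc M) (w ^ M) {{m^n≢0 u (suc M) {{>-nonZero 0<u}}}} {{m^n≢0 w M {{>-nonZero 0<w}}}}}} (<ᵇ⇒< 12 16 tt) ⟩
        16 * (u ^ suc M * w ^ M)   ≡⟨ *-assoc 16 (u ^ suc M) (w ^ M) ⟨
        16 * u ^ suc M * w ^ M     ≤⟨ *-monoˡ-≤ (w ^ M) le ⟩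
        w ^ suc M * w ^ M          ≡⟨ ^-distribˡ-+-* w (suc M) M ⟨
        w ^ N                      ∎) w^≤
        where open ≤-Reasoning

    -- M ≥ 3, so already 2^(M+1) reaches 16.
    w<2u : w < u + u
    w<2u = ≰⇒> λ 2u≤w → <⇒≱ w<16u (begin
      16 * u ^ suc M          ≤⟨ *-monoˡ-≤ (u ^ suc M) (^-monoʳ-≤ 2 {4} {suc M} (s≤s (s≤s (+-mono-≤ (>-nonZero⁻¹ (E k)) (>-nonZero⁻¹ (E k)))))) ⟩
      2 ^ suc M * u ^ suc M   ≡⟨ *-^-comm 2 u (suc M) ⟨
      (2 * u) ^ suc M         ≡⟨ cong (λ z → (u + z) ^ suc M) (+-identityʳ u) ⟩
      (u + u) ^ suc M         ≤⟨ ^-monoˡ-≤ (suc M) 2u≤w ⟩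
      w ^ suc M               ∎)
      where open ≤-Reasoning

    -- By Bernoulli's inequality and w ≥ u + 1, 1 + (M + 1)/u ≤ (w/u)^(M+1) < 16.
    N<30u : N < 30 * u
    N<30u = begin-strict
      suc (M + M)             <⟨ ≤-reflexive (l M) ⟩
      2 * suc M               ≤⟨ *-monoʳ-≤ 2 (<⇒≤ m<15u) ⟩
      2 * (15 * u)            ≡⟨ *-assoc 2 15 u ⟨
      30 * u                  ∎
      where
      open ≤-Reasoning
      l : ∀ M → suc (suc (M + M)) ≡ 2 * suc M
      l = solve-∀
      m<15u : suc M < 15 * u
      m<15u = *-cancelʳ-< (u ^ M) (suc M) (15 * u) (+-cancelˡ-< (u ^ suc M) _ _ (begin-strict
        u ^ suc M + suc M * u ^ M     ≤⟨ bernoulli u M ⟩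
        suc u ^ suc M                 ≤⟨ ^-monoˡ-≤ (suc M) u<w ⟩
        w ^ suc M                     <⟨ w<16u ⟩
        16 * u ^ suc M                ≡⟨ l′ u (u ^ M) ⟩
        u ^ suc M + 15 * u * u ^ M    ∎))
        where
        l′ : ∀ u p → 16 * (u * p) ≡ u * p + 15 * u * p
        l′ = solve-∀

    solution : Solution M
    solution = record
      { u = u ; w = w ; a = a ; u<w = u<w ; 0<u = 0<u
      ; lower = subst (λ z → z ^ M ≤ a) c≡ (A-lower c (suc k))
      ; upper = subst (λ z → z * a ≤ (2 + z) * z ^ M) c≡ (A-upper′ c (suc k) (≤-trans (s≤s (s≤s (s≤s (s≤s (s≤s z≤n))))) 6≤c))
      ; eq = eq }

    u<10^500 : c ≤ 10 ^ 1000 → u < 10 ^ 500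
    u<10^500 c≤ = ≰⇒> λ big → <⇒≱ (begin-strict
      10 ^ 500 * 10 ^ 500  ≤⟨ *-mono-≤ big big ⟩
      u * u                <⟨ *-monoʳ-< u {{>-nonZero 0<u}} u<w ⟩
      u * w                ≡⟨ c≡ ⟨
      c                    ∎) (≤-trans c≤ (≤-reflexive refl))
      where open ≤-Reasoning

  tests : ∀ k → 3 ≤ k → k < 1665 → testAt k ≡ true
  tests = allFrom-sound 1662 3 testAt computation

  prime-check : ∀ k → 3 ≤ k → k < 1665 → Prime (k + 2) → check k (start k) ≡ true
  prime-check k 3≤k k<1665 pr = [ (λ t → ⊥-elim (prime-no-factor smallPrimes pr (≡true⇒T t))) , (λ t → t) ]′ (∨-true (tests k 3≤k k<1665))

  2^1666-large : 30 * 10 ^ 500 ≤ 2 ^ 1666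
  2^1666-large = ≤ᵇ⇒≤ (30 * 10 ^ 500) (2 ^ 1666) tt

  module _ (c j : ℕ) (2∣c : 2 ∣ c) (6≤c : 6 ≤ c) (c≤ : c ≤ 10 ^ 1000) (sq : IsSq (A c (suc (suc (suc j))))) where
    private
      split : EvenSplit c (A c (suc (suc j))) (E (suc (suc j)))
      split = even-split c (A c (suc (suc j))) (E (suc (suc j))) 2∣c (≤-trans (s≤s z≤n) 6≤c) (A-coprime c (suc (suc j))) sq
      open EvenSplit split
      s : Solution (E (suc j))
      s = solution c j 2∣c 6≤c split
      u-upper : u < 10 ^ 500
      u-upper = u<10^500 c j 2∣c 6≤c split c≤

    excluded-by-check : ∀ cov → check (suc (suc j)) cov ≡ true → 0 < cov →
                        (u < cov → ⊥) → ⊥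
    excluded-by-check cov t 0<cov small = [ small , (λ le → check-sound (suc j) cov t s 0<cov le u-upper) ]′ (<-≤-connex u cov)

    excluded-small : ∀ ub → noSmall (suc (suc j)) ub ≡ true → u < ub → ⊥
    excluded-small ub t u<ub = noSmall-sound (suc (suc j)) ub u w t u<ub (u<w c j 2∣c 6≤c split) (w<2u c j 2∣c 6≤c split)
      (subst (λ z → w ^ E (suc (suc j)) ≡ 4 * u ^ E (suc (suc j)) + 4 * A z (suc (suc j)) ⊎ w ^ E (suc (suc j)) + 4 * A z (suc (suc j)) ≡ 4 * u ^ E (suc (suc j))) c≡ eq)

    excluded-start : u < suc (quo (pred (2 ^ suc (suc (suc j)))) 30) → ⊥
    excluded-start lt = <⇒≱ lt (*-cancelʳ-< 30 _ u (≤-<-trans (quo-*-≤ (pred (2 ^ suc (suc (suc j)))) 30)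
        (subst₂ _<_ (sym (cong pred (2^suc≡E (suc (suc j))))) (*-comm 30 u) (N<30u c j 2∣c 6≤c split))))

    excluded-large : 1665 ≤ suc (suc j) → ⊥
    excluded-large le = <⇒≱ (begin-strict
      30 * 10 ^ 500               ≤⟨ 2^1666-large ⟩
      2 ^ 1666                    ≤⟨ ^-monoʳ-≤ 2 (s≤s le) ⟩
      2 ^ suc (suc (suc j))       ≡⟨ 2^suc≡E (suc (suc j)) ⟩
      suc (E (suc (suc j)))       ≤⟨ N<30u c j 2∣c 6≤c split ⟩
      30 * u                      <⟨ *-monoʳ-< 30 u-upper ⟩
      30 * 10 ^ 500               ∎) ≤-refl
      where open ≤-Reasoning

  fourth-nonsquare : ∀ c → 2 ∣ c → 6 ≤ c → c ≤ 10 ^ 1000 → ¬ IsSq (A c 3)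
  fourth-nonsquare c 2∣c 6≤c c≤ sq = excluded-by-check c 0 2∣c 6≤c c≤ sq 33 computation₂ (s≤s z≤n) (excluded-small c 0 2∣c 6≤c c≤ sq 33 small₂)

  fifth-nonsquare : ∀ c → 2 ∣ c → 6 ≤ c → c ≤ 10 ^ 1000 → ¬ IsSq (A c 4)
  fifth-nonsquare c 2∣c 6≤c c≤ sq = excluded-by-check c 1 2∣c 6≤c c≤ sq 5 computation₃ (s≤s z≤n) (excluded-small c 1 2∣c 6≤c c≤ sq 5 small₃)

  check-nonsquare : ∀ c j → 2 ∣ c → 6 ≤ c → c ≤ 10 ^ 1000 → check (4 + j) (start (4 + j)) ≡ true → ¬ IsSq (A c (5 + j))
  check-nonsquare c j 2∣c 6≤c c≤ t sq =
    excluded-by-check c (2 + j) 2∣c 6≤c c≤ sq (start (4 + j)) t (s≤s z≤n) (excluded-start c (2 + j) 2∣c 6≤c c≤ sq)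

  prime-nonsquare : ∀ c j → 2 ∣ c → 6 ≤ c → c ≤ 10 ^ 1000 → Prime (4 + j + 2) → ¬ IsSq (A c (5 + j))
  prime-nonsquare c j 2∣c 6≤c c≤ pr sq =
    [ (λ lt → check-nonsquare c j 2∣c 6≤c c≤ (prime-check (4 + j) (s≤s (s≤s (s≤s z≤n))) lt pr) sq)
    , excluded-large c (2 + j) 2∣c 6≤c c≤ sq ]′ (<-≤-connex (4 + j) 1665)

  large-prime : ∀ p → Prime p → ¬ 2 ∣ p → ¬ 3 ∣ p → ∃ λ j → p ≡ 3 + j + 2
  large-prime 0 pr _ _ = contradiction pr ¬prime[0]
  large-prime 1 pr _ _ = contradiction pr ¬prime[1]
  large-prime 2 pr 2∤ _ = contradiction ∣-refl 2∤
  large-prime 3 pr _ 3∤ = contradiction ∣-refl 3∤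
  large-prime 4 pr 2∤ _ = contradiction (divides 2 refl) 2∤
  large-prime (suc (suc (suc (suc (suc j))))) pr _ _ = j , cong (3 +_) (+-comm 2 j)

  -- The divisor 2 must be avoided because a₂ may be a square, so powers of 2 are represented by 4.
  good-divisor : ∀ n → 3 ≤ n → 3 ∣ n ⊎ 4 ∣ n ⊎ (∃ λ j → Prime (3 + j + 2) × 3 + j + 2 ∣ n)
  good-divisor n 3≤n with 3 ∣? n | 4 ∣? n
  ... | yes 3∣n | _       = inj₁ 3∣n
  ... | no  _   | yes 4∣n = inj₂ (inj₁ 4∣n)
  ... | no  3∤n | no  4∤n = inj₂ (inj₂ (go (odd-or-even n)))
    where
    from-odd : ∀ m → 2 ≤ m → m ∣ n → ¬ 2 ∣ m → ∃ λ j → Prime (3 + j + 2) × 3 + j + 2 ∣ n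
    from-odd m 2≤m m∣n 2∤m with prime-divisor m 2≤m
    ... | p , pr , p∣m with large-prime p pr (λ 2∣p → 2∤m (∣-trans 2∣p p∣m)) (λ 3∣p → 3∤n (∣-trans 3∣p (∣-trans p∣m m∣n)))
    ...   | j , refl = j , pr , ∣-trans p∣m m∣n
    go : (∃ λ h → n ≡ h + h ⊎ n ≡ suc (h + h)) → ∃ λ j → Prime (3 + j + 2) × 3 + j + 2 ∣ n
    go (h , inj₂ refl) = from-odd n (≤-trans (s≤s (s≤s z≤n)) 3≤n) ∣-refl (2∣∧2∤ h)
    go (h , inj₁ refl) = from-odd h 2≤h (divides 2 (cong (h +_) (sym (+-identityʳ h)))) 2∤h
      where
      2≤h : 2 ≤ h
      2≤h = ≰⇒> λ h≤1 → <⇒≱ 3≤n (+-mono-≤ h≤1 h≤1)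
      2∤h : ¬ 2 ∣ h
      2∤h (divides q refl) = 4∤n (divides q (l q))
        where
        l : ∀ q → q * 2 + q * 2 ≡ q * 4
        l = solve-∀

  bounded-nonsquare : ∀ c → 2 ∣ c → 6 ≤ c → c ≤ 10 ^ 1000 → ¬ IsSq (A c 2) → ∀ n → ¬ IsSq (A c (2 + n))
  bounded-nonsquare c 2∣c 6≤c c≤ third n sq =
    [ (λ 3∣ → third (square-descends-∣ c 2 (2 + n) 3∣ sq))
    , [ (λ 4∣ → fourth-nonsquare c 2∣c 6≤c c≤ (square-descends-∣ c 3 (2 + n) 4∣ sq)) , (λ { (j , pr , p∣) → prime-case j pr p∣ }) ]′
    ]′ (good-divisor (3 + n) (s≤s (s≤s (s≤s z≤n))))
    where
    prime-case : ∀ j → Prime (3 + j + 2) → 3 + j + 2 ∣ 3 + n → ⊥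
    prime-case zero    pr p∣ = fifth-nonsquare c 2∣c 6≤c c≤ (square-descends-∣ c 4 (2 + n) p∣ sq)
    prime-case (suc j) pr p∣ = prime-nonsquare c j 2∣c 6≤c c≤ pr
      (square-descends-∣ c (5 + j) (2 + n) (subst (_∣ 3 + n) (cong (4 +_) (+-comm j 2)) p∣) sq)

-- Divisibility, coprimality and cubes in ℤ

module IntegerDivisibility where

  open CriticalSequence using (prime-divisor; coprime-power; coprime-∣ˡ; IsSq; E; A; EvenSplit; even-split; A-coprime; *-^-comm; ^-injectiveˡ)
  import Algebra.Solver.Ring.NaturalCoefficients.Default as SemiringSolver
  open import Data.Empty using (⊥; ⊥-elim)
  open import Data.Integer hiding (suc)
  open import Data.Integer.Properties
  open import Data.Integer.Divisibility.Signed renaming (_∣_ to infix 4 _∣ᶻ_) hiding (divides)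
  import Data.Integer.DivMod as DM
  open import Data.Integer.Tactic.RingSolver using (solve-∀)
  open import Data.Nat as ℕ using (ℕ; zero; suc; z≤n; s≤s)
  import Data.Nat.Properties as ℕₚ
  import Data.Nat.Divisibility as ℕ∣
  open import Data.Nat.Coprimality as Cop using (Coprime)
  open import Data.Nat.GCD using (module Bézout)
  open import Data.Nat.Primality using (Prime; euclidsLemma; ¬prime[1]; prime[2])
  open import Data.Product using (∃; ∃₂; _×_; _,_)
  open import Data.Sum using (_⊎_; inj₁; inj₂; [_,_]′)
  open import Function using (_∘_)
  open import Relation.Binary.PropositionalEquality
  CoprimeZ : ℤ → ℤ → Set
  CoprimeZ x y = Coprime ∣ x ∣ ∣ y ∣

  abs-∣ : ∀ {p x} → (+ p) ∣ᶻ x → p ℕ∣.∣ ∣ x ∣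
  abs-∣ d = ∣⇒∣ᵤ d

  ∣-abs : ∀ {p x} → p ℕ∣.∣ ∣ x ∣ → (+ p) ∣ᶻ x
  ∣-abs d = ∣ᵤ⇒∣ d

  euclid : ∀ {p} x y → Prime p → (+ p) ∣ᶻ x * y → (+ p) ∣ᶻ x ⊎ (+ p) ∣ᶻ y
  euclid x y pr d with euclidsLemma ∣ x ∣ ∣ y ∣ pr (subst (_ ℕ∣.∣_) (abs-* x y) (abs-∣ d))
  ... | inj₁ e = inj₁ (∣-abs e)
  ... | inj₂ e = inj₂ (∣-abs e)

  euclid-sq : ∀ {p} x → Prime p → (+ p) ∣ᶻ x * x → (+ p) ∣ᶻ x
  euclid-sq x pr d = [ (λ e → e) , (λ e → e) ]′ (euclid x x pr d)

  euclid-cube : ∀ {p} x → Prime p → (+ p) ∣ᶻ x * x * x → (+ p) ∣ᶻ x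
  euclid-cube x pr d = [ euclid-sq x pr , (λ e → e) ]′ (euclid (x * x) x pr d)

  coprime-by-primes : ∀ x y → (∀ p → Prime p → (+ p) ∣ᶻ x → (+ p) ∣ᶻ y → ⊥) → CoprimeZ x y
  -- A common divisor 0 means x = y = 0, and then the prime 2 divides both.
  coprime-by-primes x y h {0} (d∣x , d∣y) = ⊥-elim (h 2 prime[2] (∣-abs (ℕ∣.∣-trans (2 ℕ∣.∣0) d∣x)) (∣-abs (ℕ∣.∣-trans (2 ℕ∣.∣0) d∣y)))
  coprime-by-primes x y h {1}  _ = refl
  coprime-by-primes x y h {d@(suc (suc _))} (d∣x , d∣y) with prime-divisor d (s≤s (s≤s z≤n))
  ... | p , pr , p∣d = ⊥-elim (h p pr (∣-abs (ℕ∣.∣-trans p∣d d∣x)) (∣-abs (ℕ∣.∣-trans p∣d d∣y)))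

  coprime-prime : ∀ {x y p} → CoprimeZ x y → Prime p → (+ p) ∣ᶻ x → (+ p) ∣ᶻ y → ⊥
  coprime-prime cop pr a b with cop (abs-∣ a , abs-∣ b)
  ... | refl = ¬prime[1] pr

  bezoutZ : ∀ x y → CoprimeZ x y → ∃₂ λ i j → i * x + j * y ≡ + 1
  bezoutZ x y cop with Cop.coprime-Bézout cop | abs-sign x | abs-sign y
    where
    abs-sign : ∀ z → ∃ λ s → + ∣ z ∣ ≡ s * z
    abs-sign (+ n)     = + 1 , sym (*-identityˡ (+ n))
    abs-sign (-[1+ n ]) = - (+ 1) , sym (-1*i≡-i -[1+ n ])
  ... | Bézout.+- i j e | s , es | t , et = + i * s , - (+ j * t) , (begin
      + i * s * x + - (+ j * t) * y        ≡⟨ l (+ i) s x (+ j) t y ⟩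
      + i * (s * x) - + j * (t * y)        ≡⟨ cong₂ (λ u v → + i * u - + j * v) (sym es) (sym et) ⟩
      + i * + ∣ x ∣ - + j * + ∣ y ∣        ≡⟨ cong₂ _-_ (sym (pos-* i ∣ x ∣)) (sym (pos-* j ∣ y ∣)) ⟩
      + (i ℕ.* ∣ x ∣) - + (j ℕ.* ∣ y ∣)    ≡⟨ cong (λ z → + z - + (j ℕ.* ∣ y ∣)) (sym e) ⟩
      + (1 ℕ.+ j ℕ.* ∣ y ∣) - + (j ℕ.* ∣ y ∣) ≡⟨ l′ (+ (j ℕ.* ∣ y ∣)) ⟩
      + 1 ∎)
    where
    open ≡-Reasoning
    l : ∀ i s x j t y → i * s * x + - (j * t) * y ≡ i * (s * x) - j * (t * y)
    l = solve-∀
    l′ : ∀ z → + 1 + z - z ≡ + 1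
    l′ = solve-∀
  ... | Bézout.-+ i j e | s , es | t , et = - (+ i * s) , + j * t , (begin
      - (+ i * s) * x + + j * t * y        ≡⟨ l (+ i) s x (+ j) t y ⟩
      + j * (t * y) - + i * (s * x)        ≡⟨ cong₂ (λ u v → + j * u - + i * v) (sym et) (sym es) ⟩
      + j * + ∣ y ∣ - + i * + ∣ x ∣        ≡⟨ cong₂ _-_ (sym (pos-* j ∣ y ∣)) (sym (pos-* i ∣ x ∣)) ⟩
      + (j ℕ.* ∣ y ∣) - + (i ℕ.* ∣ x ∣)    ≡⟨ cong (λ z → + z - + (i ℕ.* ∣ x ∣)) (sym e) ⟩
      + (1 ℕ.+ i ℕ.* ∣ x ∣) - + (i ℕ.* ∣ x ∣) ≡⟨ l′ (+ (i ℕ.* ∣ x ∣)) ⟩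
      + 1 ∎)
    where
    open ≡-Reasoning
    l : ∀ i s x j t y → - (i * s) * x + j * t * y ≡ j * (t * y) - i * (s * x)
    l = solve-∀
    l′ : ∀ z → + 1 + z - z ≡ + 1
    l′ = solve-∀

  cube : ℤ → ℤ
  cube x = x * x * x

  abs-cube : ∀ x → ∣ cube x ∣ ≡ ∣ x ∣ ℕ.^ 3
  abs-cube x = trans (abs-* (x * x) x) (trans (cong (ℕ._* ∣ x ∣) (abs-* x x)) (l ∣ x ∣))
    where
    open import Data.Nat.Tactic.RingSolver renaming (solve-∀ to solveℕ)
    l : ∀ n → n ℕ.* n ℕ.* n ≡ n ℕ.* (n ℕ.* (n ℕ.* 1))
    l = solveℕ

  cube-neg : ∀ x → cube (- x) ≡ - cube x
  cube-neg = l
    where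
    l : ∀ x → - x * - x * - x ≡ - (x * x * x)
    l = solve-∀

  cube-injective : ∀ x y → cube x ≡ cube y → x ≡ y
  cube-injective x y e with ∣i∣≡∣j∣⇒ x y (^-injectiveˡ 3 (trans (sym (abs-cube x)) (trans (cong ∣_∣ e) (abs-cube y))))
    where
    ∣i∣≡∣j∣⇒ : ∀ i j → ∣ i ∣ ≡ ∣ j ∣ → i ≡ j ⊎ i ≡ - j
    ∣i∣≡∣j∣⇒ (+ m)     (+ n)     e = inj₁ (cong +_ e)
    ∣i∣≡∣j∣⇒ (+ m)     -[1+ n ]  e = inj₂ (cong +_ e)
    ∣i∣≡∣j∣⇒ -[1+ m ]  (+ suc n) e = inj₂ (cong -[1+_] (ℕₚ.suc-injective e))
    ∣i∣≡∣j∣⇒ -[1+ m ]  -[1+ n ]  e = inj₁ (cong -[1+_] (ℕₚ.suc-injective e))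
  ... | inj₁ x≡y = x≡y
  ... | inj₂ refl = trans (cong -_ y≡0) (sym y≡0)
    where
    2y³ : cube y + cube y ≡ + 0
    2y³ = trans (cong (_+ cube y) (trans (sym e) (cube-neg y))) (+-inverseˡ (cube y))
    zero-double : ∀ z → z + z ≡ + 0 → z ≡ + 0
    zero-double (+ zero) _ = refl
    zero-double (+ suc n) ()
    zero-double -[1+ n ] ()
    y≡0 : y ≡ + 0
    y≡0 = ∣i∣≡0⇒i≡0 (ℕₚ.m^n≡0⇒m≡0 ∣ y ∣ 3 (trans (sym (abs-cube y)) (cong ∣_∣ (zero-double (cube y) 2y³))))

  pos-cube : ∀ g → + (g ℕ.^ 3) ≡ cube (+ g)
  pos-cube g = trans (cong +_ (l g)) (trans (pos-* (g ℕ.* g) g) (cong (_* + g) (pos-* g g)))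
    where
    open import Data.Nat.Tactic.RingSolver renaming (solve-∀ to solveℕ)
    l : ∀ n → n ℕ.* (n ℕ.* (n ℕ.* 1)) ≡ n ℕ.* n ℕ.* n
    l = solveℕ

  -- The statement for absolute values carries over because -1 is a cube.
  cube-of-coprime : ∀ x y z → x ≢ + 0 → CoprimeZ x y → x * y ≡ cube z → ∃ λ g → x ≡ cube g
  cube-of-coprime x y z x≢0 cop e = go (coprime-power (∣ x ∣) (∣ y ∣) (∣ z ∣) 3 (ℕ.≢-nonZero (x≢0 ∘ ∣i∣≡0⇒i≡0)) cop
                                         (trans (sym (abs-* x y)) (trans (cong ∣_∣ e) (abs-cube z)))) (+∣i∣≡i⊎+∣i∣≡-i x)
    where
    go : (∃ λ g → (∣ x ∣ ≡ g ℕ.^ 3) × (g ℕ∣.∣ ∣ z ∣)) → (+ ∣ x ∣ ≡ x) ⊎ (+ ∣ x ∣ ≡ - x) → ∃ λ g → x ≡ cube g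
    go (g , eg , _) (inj₁ pos) = + g , trans (sym pos) (trans (cong +_ eg) (pos-cube g))
    go (g , eg , _) (inj₂ neg) = - + g , trans (sym (neg-involutive x)) (trans (cong -_ (trans (sym neg) (trans (cong +_ eg) (pos-cube g)))) (sym (cube-neg (+ g))))

-- The Eisenstein integers as a Euclidean ring

module Eisenstein where

  open CriticalSequence using (prime-divisor; coprime-power; coprime-∣ˡ; IsSq; E; A; EvenSplit; even-split; A-coprime; *-^-comm; ^-injectiveˡ)
  open import Algebra using (CommutativeRing; CommutativeSemiring)
  open import Algebra.Structures using (IsCommutativeRing; IsCommutativeSemiring)
  import Algebra.Solver.Ring.NaturalCoefficients.Default as SemiringSolver
  open import Data.Integer hiding (suc)
  open import Data.Integer.Properties
  open import Data.Integer.Divisibility.Signed renaming (_∣_ to infix 4 _∣ᶻ_) hiding (divides)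
  import Data.Integer.DivMod as DM
  open import Data.Integer.Tactic.RingSolver using (solve-∀)
  open import Data.Nat as ℕ using (ℕ; zero; suc)
  import Data.Nat.Properties as ℕₚ
  import Data.Nat.Divisibility as ℕ∣
  import Data.Nat.Coprimality as Cop
  open import Data.Nat.GCD using (module Bézout; gcd)
  open import Data.Nat.Induction using (<-wellFounded)
  open import Data.Product using (∃; ∃₂; _×_; _,_)
  open import Data.Sum using ([_,_]′)
  open import Function using (case_of_)
  open import Induction.WellFounded using (Acc; acc)
  open import Level using (0ℓ)
  open import Relation.Binary.PropositionalEquality
  open import Relation.Nullary using (¬_; yes; no)
  open import Relation.Nullary.Decidable using (toSum)

  open IntegerDivisibility

  -- Stated over an abstract semiring so that the solver does not unfold the operations of ℤ[ω].
  module CoprimeCubes {C : Set} {_⊞_ _⊠_ : C → C → C} {0# 1# : C} (isSemiring : IsCommutativeSemiring _≡_ _⊞_ _⊠_ 0# 1#) where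

    private
      infixl 6 _⊕_
      infixl 7 _⊗_
      _⊕_ _⊗_ : C → C → C
      _⊕_ = _⊞_
      _⊗_ = _⊠_

      R : CommutativeSemiring 0ℓ 0ℓ
      R = record { isCommutativeSemiring = isSemiring }

    open SemiringSolver R using (solve; _:+_; _:*_; _:=_; con)

    combine-zero : ∀ a → a ≡ 1# ⊗ a ⊕ 0# ⊗ 0#
    combine-zero = solve 1 (λ a → a := con 1 :* a :+ con 0 :* con 0) refl

    zero-multiple : ∀ a → 0# ≡ 0# ⊗ a
    zero-multiple = solve 1 (λ a → con 0 := con 0 :* a) refl

    common-factor : ∀ q s t g → q ⊗ (s ⊗ g) ⊕ t ⊗ g ≡ (q ⊗ s ⊕ t) ⊗ g
    common-factor = solve 4 (λ q s t g → q :* (s :* g) :+ t :* g := (q :* s :+ t) :* g) refl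

    cube-product : ∀ z g → z ⊗ g ⊗ (z ⊗ g) ⊗ (z ⊗ g) ≡ z ⊗ z ⊗ z ⊗ (g ⊗ g ⊗ g)
    cube-product = solve 2 (λ z g → z :* g :* (z :* g) :* (z :* g) := z :* z :* z :* (g :* g :* g)) refl

    cube-binomial : ∀ α x β z → (α ⊗ x ⊕ β ⊗ z) ⊗ (α ⊗ x ⊕ β ⊗ z) ⊗ (α ⊗ x ⊕ β ⊗ z)
      ≡ (α ⊗ α ⊗ α ⊗ x ⊗ x ⊕ (α ⊗ α ⊗ β ⊗ x ⊗ z ⊕ α ⊗ α ⊗ β ⊗ x ⊗ z ⊕ α ⊗ α ⊗ β ⊗ x ⊗ z)
         ⊕ (α ⊗ β ⊗ β ⊗ z ⊗ z ⊕ α ⊗ β ⊗ β ⊗ z ⊗ z ⊕ α ⊗ β ⊗ β ⊗ z ⊗ z)) ⊗ x ⊕ β ⊗ β ⊗ β ⊗ (z ⊗ z ⊗ z)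
    cube-binomial = solve 4 (λ α x β z → (α :* x :+ β :* z) :* (α :* x :+ β :* z) :* (α :* x :+ β :* z)
          := (α :* α :* α :* x :* x :+ (α :* α :* β :* x :* z :+ α :* α :* β :* x :* z :+ α :* α :* β :* x :* z)
              :+ (α :* β :* β :* z :* z :+ α :* β :* β :* z :* z :+ α :* β :* β :* z :* z)) :* x :+ β :* β :* β :* (z :* z :* z)) refl

    collect : ∀ t x β y → t ⊗ x ⊕ β ⊗ (x ⊗ y) ≡ (t ⊕ β ⊗ y) ⊗ x
    collect = solve 4 (λ t x β y → t :* x :+ β :* (x :* y) := (t :+ β :* y) :* x) refl

    ones : ∀ x → 1# ⊗ x ≡ 1# ⊗ 1# ⊗ 1# ⊗ x
    ones = solve 1 (λ x → con 1 :* x := con 1 :* con 1 :* con 1 :* x) refl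

    cube-multiple : ∀ e x f y → (e ⊗ x ⊕ f ⊗ y) ⊗ (e ⊗ x ⊕ f ⊗ y) ⊗ (e ⊗ x ⊕ f ⊗ y) ⊗ x
      ≡ (e ⊗ e ⊗ e ⊗ x ⊕ (e ⊗ e ⊗ f ⊗ y ⊕ e ⊗ e ⊗ f ⊗ y ⊕ e ⊗ e ⊗ f ⊗ y)) ⊗ (x ⊗ x ⊗ x)
        ⊕ (e ⊗ f ⊗ f ⊗ x ⊗ y ⊕ e ⊗ f ⊗ f ⊗ x ⊗ y ⊕ e ⊗ f ⊗ f ⊗ x ⊗ y ⊕ f ⊗ f ⊗ f ⊗ y ⊗ y) ⊗ (x ⊗ y)
    cube-multiple = solve 4 (λ e x f y → (e :* x :+ f :* y) :* (e :* x :+ f :* y) :* (e :* x :+ f :* y) :* x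
             := (e :* e :* e :* x :+ (e :* e :* f :* y :+ e :* e :* f :* y :+ e :* e :* f :* y)) :* (x :* x :* x)
                :+ (e :* f :* f :* x :* y :+ e :* f :* f :* x :* y :+ e :* f :* f :* x :* y :+ f :* f :* f :* y :* y) :* (x :* y)) refl

    collect₂ : ∀ a b c d g → a ⊗ (b ⊗ g) ⊕ c ⊗ (d ⊗ g) ≡ (a ⊗ b ⊕ c ⊗ d) ⊗ g
    collect₂ = solve 5 (λ a b c d g → a :* (b :* g) :+ c :* (d :* g) := (a :* b :+ c :* d) :* g) refl

    one : ∀ x → 1# ⊗ x ≡ x
    one = solve 1 (λ x → con 1 :* x := x) refl

    cubed : C → C
    cubed a = a ⊗ a ⊗ a

    -- Applied to g = gcd(x , z), for which g³ and x divide each other.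
    associate-of-cube : ∀ x y z e f → e ⊗ x ⊕ f ⊗ y ≡ 1# → x ⊗ y ≡ cubed z →
      ∀ g α β x′ z′ → g ≡ α ⊗ x ⊕ β ⊗ z → x ≡ x′ ⊗ g → z ≡ z′ ⊗ g → ∃₂ λ s t → x ≡ s ⊗ cubed g × cubed g ≡ t ⊗ x
    associate-of-cube x y z e f cop xy g α β x′ z′ eq ex ez = s , t , x≡ , g³≡
      where
      open ≡-Reasoning
      xy′ : x ⊗ y ≡ cubed z′ ⊗ cubed g
      xy′ = trans xy (trans (cong cubed ez) (cube-product z′ g))
      t : C
      t = α ⊗ α ⊗ α ⊗ x ⊗ x ⊕ (α ⊗ α ⊗ β ⊗ x ⊗ z ⊕ α ⊗ α ⊗ β ⊗ x ⊗ z ⊕ α ⊗ α ⊗ β ⊗ x ⊗ z)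
          ⊕ (α ⊗ β ⊗ β ⊗ z ⊗ z ⊕ α ⊗ β ⊗ β ⊗ z ⊗ z ⊕ α ⊗ β ⊗ β ⊗ z ⊗ z) ⊕ β ⊗ β ⊗ β ⊗ y
      g³≡ : cubed g ≡ t ⊗ x
      g³≡ = begin
        cubed g                  ≡⟨ cong cubed eq ⟩
        cubed (α ⊗ x ⊕ β ⊗ z)    ≡⟨ cube-binomial α x β z ⟩
        t₀ ⊗ x ⊕ β ⊗ β ⊗ β ⊗ cubed z  ≡⟨ cong (λ w → t₀ ⊗ x ⊕ β ⊗ β ⊗ β ⊗ w) xy ⟨
        t₀ ⊗ x ⊕ β ⊗ β ⊗ β ⊗ (x ⊗ y)  ≡⟨ collect t₀ x (β ⊗ β ⊗ β) y ⟩
        t ⊗ x                    ∎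
        where
        t₀ : C
        t₀ = α ⊗ α ⊗ α ⊗ x ⊗ x ⊕ (α ⊗ α ⊗ β ⊗ x ⊗ z ⊕ α ⊗ α ⊗ β ⊗ x ⊗ z ⊕ α ⊗ α ⊗ β ⊗ x ⊗ z)
          ⊕ (α ⊗ β ⊗ β ⊗ z ⊗ z ⊕ α ⊗ β ⊗ β ⊗ z ⊗ z ⊕ α ⊗ β ⊗ β ⊗ z ⊗ z)
      c₀ c₁ c₂ : C
      c₀ = e ⊗ e ⊗ e ⊗ x ⊕ (e ⊗ e ⊗ f ⊗ y ⊕ e ⊗ e ⊗ f ⊗ y ⊕ e ⊗ e ⊗ f ⊗ y)
      c₁ = e ⊗ f ⊗ f ⊗ x ⊗ y ⊕ e ⊗ f ⊗ f ⊗ x ⊗ y ⊕ e ⊗ f ⊗ f ⊗ x ⊗ y ⊕ f ⊗ f ⊗ f ⊗ y ⊗ y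
      c₂ = cubed x′
      s : C
      s = c₀ ⊗ c₂ ⊕ c₁ ⊗ cubed z′
      x≡ : x ≡ s ⊗ cubed g
      x≡ = begin
        x                                 ≡⟨ one x ⟨
        1# ⊗ x                            ≡⟨ ones x ⟩
        1# ⊗ 1# ⊗ 1# ⊗ x                  ≡⟨ cong (λ w → w ⊗ w ⊗ w ⊗ x) cop ⟨
        (e ⊗ x ⊕ f ⊗ y) ⊗ (e ⊗ x ⊕ f ⊗ y) ⊗ (e ⊗ x ⊕ f ⊗ y) ⊗ x
          ≡⟨ cube-multiple e x f y ⟩
        c₀ ⊗ cubed x ⊕ c₁ ⊗ (x ⊗ y)       ≡⟨ cong₂ (λ u v → c₀ ⊗ u ⊕ c₁ ⊗ v) (trans (cong cubed ex) (cube-product x′ g)) xy′ ⟩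
        c₀ ⊗ (c₂ ⊗ cubed g) ⊕ c₁ ⊗ (cubed z′ ⊗ cubed g)
          ≡⟨ collect₂ c₀ c₂ c₁ (cubed z′) (cubed g) ⟩
        s ⊗ cubed g                       ∎

  -- ⟨ x , y ⟩ stands for the Eisenstein integer x + yω.  A data type without eta keeps products of variables from unfolding.

  data ℤω : Set where
    ⟨_,_⟩ : ℤ → ℤ → ℤω

  re im : ℤω → ℤ
  re ⟨ x , y ⟩ = x
  im ⟨ x , y ⟩ = y

  infixl 6 _⊕_
  infixl 7 _⊗_
  _⊕_ _⊗_ : ℤω → ℤω → ℤω
  ⟨ x , y ⟩ ⊕ ⟨ x′ , y′ ⟩ = ⟨ x + x′ , y + y′ ⟩
  ⟨ x , y ⟩ ⊗ ⟨ x′ , y′ ⟩ = ⟨ x * x′ - y * y′ , x * y′ + y * x′ - y * y′ ⟩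

  negω : ℤω → ℤω
  negω ⟨ x , y ⟩ = ⟨ - x , - y ⟩

  conj : ℤω → ℤω
  conj ⟨ x , y ⟩ = ⟨ x - y , - y ⟩

  norm : ℤω → ℤ
  norm ⟨ x , y ⟩ = x * x - x * y + y * y

  0ω 1ω : ℤω
  0ω = ⟨ + 0 , + 0 ⟩
  1ω = ⟨ + 1 , + 0 ⟩

  ⊗-assoc : ∀ a b c → (a ⊗ b) ⊗ c ≡ a ⊗ (b ⊗ c)
  ⊗-assoc ⟨ a , a′ ⟩ ⟨ b , b′ ⟩ ⟨ c , c′ ⟩ = cong₂ ⟨_,_⟩ (l a a′ b b′ c c′) (l′ a a′ b b′ c c′)
    where
    l : ∀ a a′ b b′ c c′ → (a * b - a′ * b′) * c - (a * b′ + a′ * b - a′ * b′) * c′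
        ≡ a * (b * c - b′ * c′) - a′ * (b * c′ + b′ * c - b′ * c′)
    l = solve-∀
    l′ : ∀ a a′ b b′ c c′ → (a * b - a′ * b′) * c′ + (a * b′ + a′ * b - a′ * b′) * c - (a * b′ + a′ * b - a′ * b′) * c′
         ≡ a * (b * c′ + b′ * c - b′ * c′) + a′ * (b * c - b′ * c′) - a′ * (b * c′ + b′ * c - b′ * c′)
    l′ = solve-∀

  ⊗-comm : ∀ a b → a ⊗ b ≡ b ⊗ a
  ⊗-comm ⟨ a , a′ ⟩ ⟨ b , b′ ⟩ = cong₂ ⟨_,_⟩ (l a a′ b b′) (l′ a a′ b b′)
    where
    l : ∀ a a′ b b′ → a * b - a′ * b′ ≡ b * a - b′ * a′
    l = solve-∀
    l′ : ∀ a a′ b b′ → a * b′ + a′ * b - a′ * b′ ≡ b * a′ + b′ * a - b′ * a′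
    l′ = solve-∀

  ⊗-distribˡ : ∀ a b c → a ⊗ (b ⊕ c) ≡ (a ⊗ b) ⊕ (a ⊗ c)
  ⊗-distribˡ ⟨ a , a′ ⟩ ⟨ b , b′ ⟩ ⟨ c , c′ ⟩ = cong₂ ⟨_,_⟩ (l a a′ b b′ c c′) (l′ a a′ b b′ c c′)
    where
    l : ∀ a a′ b b′ c c′ → a * (b + c) - a′ * (b′ + c′) ≡ a * b - a′ * b′ + (a * c - a′ * c′)
    l = solve-∀
    l′ : ∀ a a′ b b′ c c′ → a * (b′ + c′) + a′ * (b + c) - a′ * (b′ + c′) ≡ a * b′ + a′ * b - a′ * b′ + (a * c′ + a′ * c - a′ * c′)
    l′ = solve-∀

  ⊗-identityˡ : ∀ a → 1ω ⊗ a ≡ a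
  ⊗-identityˡ ⟨ a , a′ ⟩ = cong₂ ⟨_,_⟩ (l a a′) (l′ a a′)
    where
    l : ∀ a a′ → + 1 * a - + 0 * a′ ≡ a
    l = solve-∀
    l′ : ∀ a a′ → + 1 * a′ + + 0 * a - + 0 * a′ ≡ a′
    l′ = solve-∀

  ω-isCommutativeRing : IsCommutativeRing _≡_ _⊕_ _⊗_ negω 0ω 1ω
  ω-isCommutativeRing = record
    { isRing = record
      { +-isAbelianGroup = record
        { isGroup = record
          { isMonoid = record
            { isSemigroup = record
              { isMagma = isMagma _⊕_
              ; assoc   = λ { ⟨ a , b ⟩ ⟨ a′ , b′ ⟩ ⟨ a″ , b″ ⟩ → cong₂ ⟨_,_⟩ (+-assoc a a′ a″) (+-assoc b b′ b″) } }
            ; identity = (λ { ⟨ a , b ⟩ → cong₂ ⟨_,_⟩ (+-identityˡ a) (+-identityˡ b) })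
                       , (λ { ⟨ a , b ⟩ → cong₂ ⟨_,_⟩ (+-identityʳ a) (+-identityʳ b) }) }
          ; inverse = (λ { ⟨ a , b ⟩ → cong₂ ⟨_,_⟩ (+-inverseˡ a) (+-inverseˡ b) })
                    , (λ { ⟨ a , b ⟩ → cong₂ ⟨_,_⟩ (+-inverseʳ a) (+-inverseʳ b) })
          ; ⁻¹-cong = cong negω }
        ; comm = λ { ⟨ a , b ⟩ ⟨ a′ , b′ ⟩ → cong₂ ⟨_,_⟩ (+-comm a a′) (+-comm b b′) } }
      ; *-cong     = cong₂ _⊗_
      ; *-assoc    = ⊗-assoc
      ; *-identity = ⊗-identityˡ , λ x → trans (⊗-comm x _) (⊗-identityˡ x)
      ; distrib    = ⊗-distribˡ
                   , λ x y z → trans (⊗-comm _ x) (trans (⊗-distribˡ x y z) (cong₂ _⊕_ (⊗-comm x y) (⊗-comm x z))) }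
    ; *-comm = ⊗-comm }

  ω-commutativeRing : CommutativeRing 0ℓ 0ℓ
  ω-commutativeRing = record { isCommutativeRing = ω-isCommutativeRing }

  open CoprimeCubes (CommutativeRing.isCommutativeSemiring ω-commutativeRing)

  norm-⊗ : ∀ a b → norm (a ⊗ b) ≡ norm a * norm b
  norm-⊗ ⟨ a , a′ ⟩ ⟨ b , b′ ⟩ = l a a′ b b′
    where
    l : ∀ a a′ b b′ → (a * b - a′ * b′) * (a * b - a′ * b′) - (a * b - a′ * b′) * (a * b′ + a′ * b - a′ * b′) + (a * b′ + a′ * b - a′ * b′) * (a * b′ + a′ * b - a′ * b′)
        ≡ (a * a - a * a′ + a′ * a′) * (b * b - b * b′ + b′ * b′)
    l = solve-∀

  norm-conj : ∀ a → a ⊗ conj a ≡ ⟨ norm a , + 0 ⟩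
  norm-conj ⟨ a , a′ ⟩ = cong₂ ⟨_,_⟩ (l a a′) (l′ a a′)
    where
    l : ∀ a a′ → a * (a - a′) - a′ * - a′ ≡ a * a - a * a′ + a′ * a′
    l = solve-∀
    l′ : ∀ a a′ → a * - a′ + a′ * (a - a′) - a′ * - a′ ≡ + 0
    l′ = solve-∀

  4norm : ∀ x y → + 4 * norm ⟨ x , y ⟩ ≡ (+ 2 * x - y) * (+ 2 * x - y) + + 3 * (y * y)
  4norm = l
    where
    l : ∀ x y → + 4 * (x * x - x * y + y * y) ≡ (+ 2 * x - y) * (+ 2 * x - y) + + 3 * (y * y)
    l = solve-∀

  square≥0 : ∀ z → ∃ λ n → z * z ≡ + (n ℕ.* n) × ∣ z ∣ ≡ n
  square≥0 (+ n)    = n , sym (pos-* n n) , refl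
  square≥0 -[1+ n ] = suc n , refl , refl

  4norm-abs : ∀ x y → 4 ℕ.* ∣ norm ⟨ x , y ⟩ ∣ ≡ ∣ + 2 * x - y ∣ ℕ.* ∣ + 2 * x - y ∣ ℕ.+ 3 ℕ.* (∣ y ∣ ℕ.* ∣ y ∣)
  4norm-abs x y with square≥0 (+ 2 * x - y) | square≥0 y
  ... | m , em , am | n , en , an = begin
    4 ℕ.* ∣ norm ⟨ x , y ⟩ ∣                                       ≡⟨ abs-* (+ 4) (norm ⟨ x , y ⟩) ⟨
    ∣ + 4 * norm ⟨ x , y ⟩ ∣                                       ≡⟨ cong ∣_∣ (4norm x y) ⟩
    ∣ (+ 2 * x - y) * (+ 2 * x - y) + + 3 * (y * y) ∣            ≡⟨ cong₂ (λ u v → ∣ u + + 3 * v ∣) em en ⟩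
    ∣ + (m ℕ.* m) + + 3 * + (n ℕ.* n) ∣                          ≡⟨ cong (λ z → ∣ + (m ℕ.* m) + z ∣) (pos-* 3 (n ℕ.* n)) ⟨
    m ℕ.* m ℕ.+ 3 ℕ.* (n ℕ.* n)                                  ≡⟨ cong₂ (λ u v → u ℕ.* u ℕ.+ 3 ℕ.* (v ℕ.* v)) am an ⟨
    ∣ + 2 * x - y ∣ ℕ.* ∣ + 2 * x - y ∣ ℕ.+ 3 ℕ.* (∣ y ∣ ℕ.* ∣ y ∣) ∎
    where open ≡-Reasoning

  norm-swap : ∀ x y → norm ⟨ x , y ⟩ ≡ norm ⟨ y , x ⟩
  norm-swap = l
    where
    l : ∀ x y → x * x - x * y + y * y ≡ y * y - y * x + x * x
    l = solve-∀

  norm-bound : ∀ x y → 3 ℕ.* (∣ y ∣ ℕ.* ∣ y ∣) ℕ.≤ 4 ℕ.* ∣ norm ⟨ x , y ⟩ ∣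
  norm-bound x y = ℕₚ.≤-trans (ℕₚ.m≤n+m _ (∣ + 2 * x - y ∣ ℕ.* ∣ + 2 * x - y ∣)) (ℕₚ.≤-reflexive (sym (4norm-abs x y)))

  norm≡0 : ∀ a → ∣ norm a ∣ ≡ 0 → a ≡ 0ω
  norm≡0 ⟨ x , y ⟩ e = cong₂ ⟨_,_⟩ (zero-of x (subst (λ z → 3 ℕ.* (∣ x ∣ ℕ.* ∣ x ∣) ℕ.≤ 4 ℕ.* z) (trans (cong ∣_∣ (norm-swap y x)) e) (norm-bound y x)))
                               (zero-of y (subst (λ z → 3 ℕ.* (∣ y ∣ ℕ.* ∣ y ∣) ℕ.≤ 4 ℕ.* z) e (norm-bound x y)))
    where
    zero-of : ∀ z → 3 ℕ.* (∣ z ∣ ℕ.* ∣ z ∣) ℕ.≤ 0 → z ≡ + 0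
    zero-of (+ zero) _ = refl

  record _∣ω_ (a b : ℤω) : Set where
    constructor dividesω
    field
      q  : ℤω
      eq : b ≡ q ⊗ a

  nearest : ∀ p n .{{_ : ℕ.NonZero n}} → ∃₂ λ q r → p ≡ q * + n + r × 2 ℕ.* ∣ r ∣ ℕ.≤ n
  nearest p n with 2 ℕ.* r ℕ.≤? n
    where
    r : ℕ
    r = p DM.%ℕ n
  ... | yes le = p DM./ℕ n , + (p DM.%ℕ n) , trans (DM.a≡a%ℕn+[a/ℕn]*n p n) (+-comm (+ (p DM.%ℕ n)) (p DM./ℕ n * + n)) , le
  ... | no  gt = p DM./ℕ n + + 1 , + (p DM.%ℕ n) - + n , trans (DM.a≡a%ℕn+[a/ℕn]*n p n) (l (p DM./ℕ n) (+ (p DM.%ℕ n)) (+ n))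
                  , subst (λ z → 2 ℕ.* z ℕ.≤ n) (sym abs≡) small
    where
    l : ∀ q r n → r + q * n ≡ (q + + 1) * n + (r - n)
    l = solve-∀
    r : ℕ
    r = p DM.%ℕ n
    r<n : r ℕ.< n
    r<n = DM.n%ℕd<d p n
    abs≡ : ∣ + r - + n ∣ ≡ n ℕ.∸ r
    abs≡ = trans (cong ∣_∣ (m-n≡m⊖n r n)) (∣⊖∣-≤ (ℕₚ.<⇒≤ r<n))
    small : 2 ℕ.* (n ℕ.∸ r) ℕ.≤ n
    small = ℕₚ.+-cancelʳ-≤ (2 ℕ.* r) _ _ (ℕₚ.≤-trans (ℕₚ.≤-reflexive (trans (sym (ℕₚ.*-distribˡ-+ 2 (n ℕ.∸ r) r)) (cong (2 ℕ.*_) (ℕₚ.m∸n+n≡m (ℕₚ.<⇒≤ r<n)))))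
              (ℕₚ.≤-trans (ℕₚ.≤-reflexive (cong (n ℕ.+_) (ℕₚ.+-identityʳ n))) (ℕₚ.+-monoʳ-≤ n (ℕₚ.<⇒≤ (ℕₚ.≰⇒> gt)))))

  -- With both coordinates at most n/2 the norm is at most 3n²/4; this is why ℤ[ω] is Euclidean.
  norm-small : ∀ p q n → 2 ℕ.* ∣ p ∣ ℕ.≤ n → 2 ℕ.* ∣ q ∣ ℕ.≤ n → 0 ℕ.< n → ∣ norm ⟨ p , q ⟩ ∣ ℕ.< n ℕ.* n
  norm-small p q n hp hq 0<n = ℕₚ.*-cancelˡ-< 4 _ _ (begin-strict
    4 ℕ.* ∣ norm ⟨ p , q ⟩ ∣     ≤⟨ ℕₚ.*-monoʳ-≤ 4 tri ⟩
    4 ℕ.* (P ℕ.* P ℕ.+ P ℕ.* Q ℕ.+ Q ℕ.* Q)   ≡⟨ l P Q ⟩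
    2 ℕ.* P ℕ.* (2 ℕ.* P) ℕ.+ 2 ℕ.* P ℕ.* (2 ℕ.* Q) ℕ.+ 2 ℕ.* Q ℕ.* (2 ℕ.* Q)
                               ≤⟨ ℕₚ.+-mono-≤ (ℕₚ.+-mono-≤ (ℕₚ.*-mono-≤ hp hp) (ℕₚ.*-mono-≤ hp hq)) (ℕₚ.*-mono-≤ hq hq) ⟩
    n ℕ.* n ℕ.+ n ℕ.* n ℕ.+ n ℕ.* n  <⟨ ℕₚ.m<m+n _ (ℕₚ.*-mono-< 0<n 0<n) ⟩
    n ℕ.* n ℕ.+ n ℕ.* n ℕ.+ n ℕ.* n ℕ.+ n ℕ.* n   ≡⟨ l′ (n ℕ.* n) ⟩
    4 ℕ.* (n ℕ.* n)            ∎)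
    where
    open ℕₚ.≤-Reasoning
    open import Data.Nat.Tactic.RingSolver renaming (solve-∀ to solveℕ)
    P Q : ℕ
    P = ∣ p ∣
    Q = ∣ q ∣
    tri : ∣ norm ⟨ p , q ⟩ ∣ ℕ.≤ P ℕ.* P ℕ.+ P ℕ.* Q ℕ.+ Q ℕ.* Q
    tri = ℕₚ.≤-trans (∣i+j∣≤∣i∣+∣j∣ (p * p - p * q) (q * q)) (ℕₚ.+-mono-≤
            (ℕₚ.≤-trans (∣i-j∣≤∣i∣+∣j∣ (p * p) (p * q)) (ℕₚ.≤-reflexive (cong₂ ℕ._+_ (abs-* p p) (abs-* p q)))) (ℕₚ.≤-reflexive (abs-* q q)))
    l : ∀ P Q → 4 ℕ.* (P ℕ.* P ℕ.+ P ℕ.* Q ℕ.+ Q ℕ.* Q) ≡ 2 ℕ.* P ℕ.* (2 ℕ.* P) ℕ.+ 2 ℕ.* P ℕ.* (2 ℕ.* Q) ℕ.+ 2 ℕ.* Q ℕ.* (2 ℕ.* Q)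
    l = solveℕ
    l′ : ∀ z → z ℕ.+ z ℕ.+ z ℕ.+ z ≡ 4 ℕ.* z
    l′ = solveℕ

  norm≥0 : ∀ a → norm a ≡ + ∣ norm a ∣
  norm≥0 ⟨ x , y ⟩ = nonneg (norm ⟨ x , y ⟩) (subst (λ z → + 4 * norm ⟨ x , y ⟩ ≡ + z) refl sum)
    where
    sum : + 4 * norm ⟨ x , y ⟩ ≡ + (∣ + 2 * x - y ∣ ℕ.* ∣ + 2 * x - y ∣ ℕ.+ 3 ℕ.* (∣ y ∣ ℕ.* ∣ y ∣))
    sum with square≥0 (+ 2 * x - y) | square≥0 y
    ... | m , em , am | n , en , an = trans (4norm x y) (trans (cong₂ (λ u v → u + + 3 * v) em en)
          (trans (cong (_+_ (+ (m ℕ.* m))) (sym (pos-* 3 (n ℕ.* n)))) (cong₂ (λ u v → + (u ℕ.* u ℕ.+ 3 ℕ.* (v ℕ.* v))) (sym am) (sym an))))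
    nonneg : ∀ z {n} → + 4 * z ≡ + n → z ≡ + ∣ z ∣
    nonneg (+ n) _ = refl
    nonneg -[1+ n ] ()

  sub-distrib : ∀ a c d → (a ⊕ negω c) ⊗ d ≡ (a ⊗ d) ⊕ negω (c ⊗ d)
  sub-distrib ⟨ a , a′ ⟩ ⟨ c , c′ ⟩ ⟨ d , d′ ⟩ = cong₂ ⟨_,_⟩ (d₁ a a′ c c′ d d′) (d₂ a a′ c c′ d d′)
    where
    d₁ : ∀ a a′ c c′ d d′ → (a + - c) * d - (a′ + - c′) * d′ ≡ a * d - a′ * d′ + - (c * d - c′ * d′)
    d₁ = solve-∀
    d₂ : ∀ a a′ c c′ d d′ → (a + - c) * d′ + (a′ + - c′) * d - (a′ + - c′) * d′ ≡ a * d′ + a′ * d - a′ * d′ + - (c * d′ + c′ * d - c′ * d′)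
    d₂ = solve-∀

  sub-add : ∀ a c → a ≡ c ⊕ (a ⊕ negω c)
  sub-add ⟨ a , a′ ⟩ ⟨ c , c′ ⟩ = cong₂ ⟨_,_⟩ (l a c) (l a′ c′)
    where
    l : ∀ x y → x ≡ y + (x + - y)
    l = solve-∀

  conj-norm : ∀ b → norm (conj b) ≡ norm b
  conj-norm ⟨ x , y ⟩ = l x y
    where
    l : ∀ x y → (x - y) * (x - y) - (x - y) * - y + - y * - y ≡ x * x - x * y + y * y
    l = solve-∀

  remainder : ∀ z q₁ q₂ r₁ r₂ n → re z ≡ q₁ * n + r₁ → im z ≡ q₂ * n + r₂ →
              z ⊕ negω (⟨ q₁ , q₂ ⟩ ⊗ ⟨ n , + 0 ⟩) ≡ ⟨ r₁ , r₂ ⟩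
  remainder ⟨ _ , _ ⟩ q₁ q₂ r₁ r₂ n refl refl = cong₂ ⟨_,_⟩ (m₁ q₁ q₂ r₁ n) (m₂ q₁ q₂ r₂ n)
    where
    m₁ : ∀ q q′ r n → q * n + r + - (q * n - q′ * + 0) ≡ r
    m₁ = solve-∀
    m₂ : ∀ q q′ r n → q′ * n + r + - (q * + 0 + q′ * n - q′ * + 0) ≡ r
    m₂ = solve-∀

  -- The quotient rounds both coordinates of a b̄ / N(b). Then r b̄ has coordinates at most N(b)/2,
  -- and its norm is N(r) N(b).
  divMod-ω : ∀ a b → b ≢ 0ω → ∃₂ λ q r → a ≡ q ⊗ b ⊕ r × ∣ norm r ∣ ℕ.< ∣ norm b ∣
  divMod-ω a b b≢0 = go (nearest (re (a ⊗ conj b)) n) (nearest (im (a ⊗ conj b)) n)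
    where
    n : ℕ
    n = ∣ norm b ∣
    n≢0 : n ≢ 0
    n≢0 e = b≢0 (norm≡0 b e)
    instance nz = ℕ.≢-nonZero n≢0
    0<n : 0 ℕ.< n
    0<n = ℕₚ.n≢0⇒n>0 n≢0
    go : (∃₂ λ q r → re (a ⊗ conj b) ≡ q * + n + r × 2 ℕ.* ∣ r ∣ ℕ.≤ n) →
         (∃₂ λ q r → im (a ⊗ conj b) ≡ q * + n + r × 2 ℕ.* ∣ r ∣ ℕ.≤ n) →
         ∃₂ λ q r → a ≡ q ⊗ b ⊕ r × ∣ norm r ∣ ℕ.< ∣ norm b ∣
    go (q₁ , r₁ , e₁ , h₁) (q₂ , r₂ , e₂ , h₂) = q , r , sub-add a (q ⊗ b) , ℕₚ.*-cancelʳ-< n (∣ norm r ∣) n lt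
      where
      q r ρ : ℤω
      q = ⟨ q₁ , q₂ ⟩
      r = a ⊕ negω (q ⊗ b)
      ρ = ⟨ r₁ , r₂ ⟩
      r·b̄ : r ⊗ conj b ≡ ρ
      r·b̄ = begin
        r ⊗ conj b                                 ≡⟨ sub-distrib a (q ⊗ b) (conj b) ⟩
        (a ⊗ conj b) ⊕ negω ((q ⊗ b) ⊗ conj b)     ≡⟨ cong (λ z → (a ⊗ conj b) ⊕ negω z) (trans (⊗-assoc q b (conj b)) (cong (q ⊗_) (trans (norm-conj b) (cong (λ z → ⟨ z , + 0 ⟩) (norm≥0 b))))) ⟩
        (a ⊗ conj b) ⊕ negω (q ⊗ ⟨ + n , + 0 ⟩)    ≡⟨ remainder (a ⊗ conj b) q₁ q₂ r₁ r₂ (+ n) e₁ e₂ ⟩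
        ρ ∎
        where open ≡-Reasoning
      lt : ∣ norm r ∣ ℕ.* n ℕ.< n ℕ.* n
      lt = subst (ℕ._< n ℕ.* n) (sym (trans (sym (abs-* (norm r) (norm b))) (cong ∣_∣ (trans (cong (norm r *_) (sym (conj-norm b))) (trans (sym (norm-⊗ r (conj b))) (cong norm r·b̄))))))
             (norm-small r₁ r₂ n h₁ h₂ 0<n)

  record Bezoutω (a b : ℤω) : Set where
    field
      g α β : ℤω
      eq    : g ≡ α ⊗ a ⊕ β ⊗ b
      g∣a   : g ∣ω a
      g∣b   : g ∣ω b

  bezout-step : ∀ a b q r → a ≡ q ⊗ b ⊕ r → ∀ α β → β ⊗ a ⊕ (α ⊕ negω (β ⊗ q)) ⊗ b ≡ α ⊗ b ⊕ β ⊗ r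
  bezout-step _ ⟨ b , b′ ⟩ ⟨ q , q′ ⟩ ⟨ r , r′ ⟩ refl ⟨ α , α′ ⟩ ⟨ β , β′ ⟩ = cong₂ ⟨_,_⟩ (l₁ b b′ q q′ r r′ α α′ β β′) (l₂ b b′ q q′ r r′ α α′ β β′)
    where
    l₁ : ∀ b b′ q q′ r r′ α α′ β β′ →
      β * (q * b - q′ * b′ + r) - β′ * (q * b′ + q′ * b - q′ * b′ + r′) + ((α + - (β * q - β′ * q′)) * b - (α′ + - (β * q′ + β′ * q - β′ * q′)) * b′)
      ≡ α * b - α′ * b′ + (β * r - β′ * r′)
    l₁ = solve-∀
    l₂ : ∀ b b′ q q′ r r′ α α′ β β′ →
      β * (q * b′ + q′ * b - q′ * b′ + r′) + β′ * (q * b - q′ * b′ + r) - β′ * (q * b′ + q′ * b - q′ * b′ + r′)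
      + ((α + - (β * q - β′ * q′)) * b′ + (α′ + - (β * q′ + β′ * q - β′ * q′)) * b - (α′ + - (β * q′ + β′ * q - β′ * q′)) * b′)
      ≡ α * b′ + α′ * b - α′ * b′ + (β * r′ + β′ * r - β′ * r′)
    l₂ = solve-∀

  bezoutω : ∀ a b → Acc ℕ._<_ ∣ norm b ∣ → Bezoutω a b
  bezoutω a b (acc rs) = [ base , step ]′ (toSum (∣ norm b ∣ ℕ.≟ 0))
    where
    trivial : Bezoutω a 0ω
    trivial = record
      { g = a ; α = 1ω ; β = 0ω
      ; eq = combine-zero a
      ; g∣a = dividesω 1ω (sym (⊗-identityˡ a))
      ; g∣b = dividesω 0ω (zero-multiple a) }
    base : ∣ norm b ∣ ≡ 0 → Bezoutω a b
    base e = subst (Bezoutω a) (sym (norm≡0 b e)) trivial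
    extend : ∀ q r → a ≡ q ⊗ b ⊕ r → Bezoutω b r → Bezoutω a b
    extend q r e record { g = g ; α = α ; β = β ; eq = eq ; g∣a = dividesω s es ; g∣b = dividesω t et } = record
      { g = g ; α = β ; β = α ⊕ negω (β ⊗ q)
      ; eq = trans eq (sym (bezout-step a b q r e α β))
      ; g∣a = dividesω (q ⊗ s ⊕ t) (trans e (trans (cong₂ (λ u v → q ⊗ u ⊕ v) es et) (common-factor q s t g)))
      ; g∣b = dividesω s es }
    step : ¬ (∣ norm b ∣ ≡ 0) → Bezoutω a b
    step ne = case divMod-ω a b (λ { refl → ne refl }) of λ { (q , r , e , lt) → extend q r e (bezoutω b r (rs lt)) }

  cubeω : ℤω → ℤω
  cubeω a = a ⊗ a ⊗ a

  cubeω-of-coprime : ∀ x y z e f → e ⊗ x ⊕ f ⊗ y ≡ 1ω → x ⊗ y ≡ cubeω z → ∃ λ g → ∃₂ λ s t → x ≡ s ⊗ cubeω g × cubeω g ≡ t ⊗ x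
  cubeω-of-coprime x y z e f cop xy = go (bezoutω x z (<-wellFounded _))
    where
    go : Bezoutω x z → ∃ λ g → ∃₂ λ s t → x ≡ s ⊗ cubeω g × cubeω g ≡ t ⊗ x
    go record { g = g ; α = α ; β = β ; eq = eq ; g∣a = dividesω x′ ex ; g∣b = dividesω z′ ez } =
      g , associate-of-cube x y z e f cop xy g α β x′ z′ eq ex ez

-- Eisenstein integers whose norm is a cube up to a coprime factor

module CubeRoots where

  open CriticalSequence using (prime-divisor; coprime-power; coprime-∣ˡ; IsSq; E; A; EvenSplit; even-split; A-coprime; *-^-comm; ^-injectiveˡ)
  import Algebra.Solver.Ring.NaturalCoefficients.Default as SemiringSolver
  open import Data.Empty using (⊥-elim)
  open import Data.Integer hiding (suc)
  open import Data.Integer.Properties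
  open import Data.Integer.Divisibility.Signed renaming (_∣_ to infix 4 _∣ᶻ_) hiding (divides)
  import Data.Integer.DivMod as DM
  open import Data.Integer.Tactic.RingSolver using (solve-∀)
  open import Data.Nat as ℕ using (ℕ; suc; z≤n; s≤s)
  import Data.Nat.Properties as ℕₚ
  import Data.Nat.Divisibility as ℕ∣
  import Data.Nat.Coprimality as Cop
  open import Data.Nat.GCD using (module Bézout)
  open import Data.Nat.Primality using (Prime; prime⇒irreducible; ¬prime[1]; prime[2]; prime?)
  open import Data.Product using (∃; ∃₂; _×_; _,_)
  open import Data.Sum using (_⊎_; inj₁; inj₂; [_,_]′)
  open import Function using (case_of_)
  open import Relation.Binary.PropositionalEquality
  open import Relation.Nullary using (¬_)
  open import Relation.Nullary.Decidable using (toWitness)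

  open IntegerDivisibility
  open Eisenstein

  lin₁ : ∀ {l x z} → l ∣ᶻ x → ∀ a → z ≡ a * x → l ∣ᶻ z
  lin₁ {l} d a e = subst (l ∣ᶻ_) (sym e) (∣n⇒∣m*n a d)

  lin₂ : ∀ {l x y z} → l ∣ᶻ x → l ∣ᶻ y → ∀ a b → z ≡ a * x + b * y → l ∣ᶻ z
  lin₂ {l} d d′ a b e = subst (l ∣ᶻ_) (sym e) (∣m∣n⇒∣m+n (∣n⇒∣m*n a d) (∣n⇒∣m*n b d′))

  prime-∣-prime : ∀ {p q} → Prime p → Prime q → (+ p) ∣ᶻ (+ q) → p ≡ q
  prime-∣-prime pp pq d = [ (λ e → ⊥-elim (¬prime[1] (subst Prime e pp))) , (λ e → e) ]′ (prime⇒irreducible pq (abs-∣ d))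

  prime[3] : Prime 3
  prime[3] = toWitness {a? = prime? 3} _

  prime[23] : Prime 23
  prime[23] = toWitness {a? = prime? 23} _

  3∤2 : ¬ ((+ 3) ∣ᶻ (+ 2))
  3∤2 d = case prime-∣-prime prime[3] prime[2] d of λ ()

  -- The bound on the norm confines both coordinates to -1, 0, 1; the units found are ±1, ±ω and ±(1
  -- + ω).
  unit-cases : ∀ a b → ∣ norm ⟨ a , b ⟩ ∣ ≡ 1 →
    ∃ λ σ → (σ ≡ + 1 ⊎ σ ≡ - + 1) × (⟨ a , b ⟩ ≡ ⟨ σ , + 0 ⟩ ⊎ ⟨ a , b ⟩ ≡ ⟨ + 0 , σ ⟩ ⊎ ⟨ a , b ⟩ ≡ ⟨ σ , σ ⟩)
  unit-cases a b e = go a b (small a (subst (λ z → 3 ℕ.* (∣ a ∣ ℕ.* ∣ a ∣) ℕ.≤ 4 ℕ.* z) (trans (cong ∣_∣ (norm-swap b a)) e) (norm-bound b a)))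
                            (small b (subst (λ z → 3 ℕ.* (∣ b ∣ ℕ.* ∣ b ∣) ℕ.≤ 4 ℕ.* z) e (norm-bound a b))) e
    where
    small : ∀ z → 3 ℕ.* (∣ z ∣ ℕ.* ∣ z ∣) ℕ.≤ 4 → ∣ z ∣ ℕ.≤ 1
    small z le = ℕₚ.≮⇒≥ λ gt → ℕₚ.<⇒≱ {4} {12} (s≤s (s≤s (s≤s (s≤s (s≤s z≤n))))) (ℕₚ.≤-trans (ℕₚ.*-monoʳ-≤ 3 (ℕₚ.*-mono-≤ gt gt)) le)
    go : ∀ a b → ∣ a ∣ ℕ.≤ 1 → ∣ b ∣ ℕ.≤ 1 → ∣ norm ⟨ a , b ⟩ ∣ ≡ 1 →
         ∃ λ σ → (σ ≡ + 1 ⊎ σ ≡ - + 1) × (⟨ a , b ⟩ ≡ ⟨ σ , + 0 ⟩ ⊎ ⟨ a , b ⟩ ≡ ⟨ + 0 , σ ⟩ ⊎ ⟨ a , b ⟩ ≡ ⟨ σ , σ ⟩)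
    go (+ 0)      (+ 0)      _ _ ()
    go (+ 0)      (+ 1)      _ _ _ = + 1 , inj₁ refl , inj₂ (inj₁ refl)
    go (+ 0)      -[1+ 0 ]   _ _ _ = - + 1 , inj₂ refl , inj₂ (inj₁ refl)
    go (+ 1)      (+ 0)      _ _ _ = + 1 , inj₁ refl , inj₁ refl
    go (+ 1)      (+ 1)      _ _ _ = + 1 , inj₁ refl , inj₂ (inj₂ refl)
    go (+ 1)      -[1+ 0 ]   _ _ ()
    go -[1+ 0 ]   (+ 0)      _ _ _ = - + 1 , inj₂ refl , inj₁ refl
    go -[1+ 0 ]   (+ 1)      _ _ ()
    go -[1+ 0 ]   -[1+ 0 ]   _ _ _ = - + 1 , inj₂ refl , inj₂ (inj₂ refl)
    go (+ suc (suc _)) _ (s≤s ()) _ _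
    go -[1+ suc _ ] _ (s≤s ()) _ _
    go (+ 0) (+ suc (suc _)) _ (s≤s ()) _
    go (+ 1) (+ suc (suc _)) _ (s≤s ()) _
    go -[1+ 0 ] (+ suc (suc _)) _ (s≤s ()) _
    go (+ 0) -[1+ suc _ ] _ (s≤s ()) _
    go (+ 1) -[1+ suc _ ] _ (s≤s ()) _
    go -[1+ 0 ] -[1+ suc _ ] _ (s≤s ()) _

  -- Coordinates of (p + qω)³.
  cubeRe cubeIm : ℤ → ℤ → ℤ
  cubeRe p q = p * p * p + q * q * q - + 3 * (p * q * q)
  cubeIm p q = + 3 * (p * q * (p - q))

  cube-coords : ∀ p q → cubeω ⟨ p , q ⟩ ≡ ⟨ cubeRe p q , cubeIm p q ⟩
  cube-coords p q = cong₂ ⟨_,_⟩ (l₁ p q) (l₂ p q)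
    where
    l₁ : ∀ p q → (p * p - q * q) * p - (p * q + q * p - q * q) * q ≡ p * p * p + q * q * q - + 3 * (p * q * q)
    l₁ = solve-∀
    l₂ : ∀ p q → (p * p - q * q) * q + (p * q + q * p - q * q) * p - (p * q + q * p - q * q) * q ≡ + 3 * (p * q * (p - q))
    l₂ = solve-∀

  unit-times-cube : ∀ σ u v → σ ≡ + 1 ⊎ σ ≡ - + 1 → ∀ p q → u ≡ cubeRe p q → v ≡ cubeIm p q →
    ∃₂ λ p′ q′ → σ * u ≡ cubeRe p′ q′ × σ * v ≡ cubeIm p′ q′
  unit-times-cube _ u v (inj₁ refl) p q eu ev = p , q , trans (*-identityˡ u) eu , trans (*-identityˡ v) ev
  unit-times-cube _ _ _ (inj₂ refl) p q refl refl = - p , - q , l₁ p q , l₂ p q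
    where
    l₁ : ∀ p q → - + 1 * (p * p * p + q * q * q - + 3 * (p * q * q)) ≡ - p * - p * - p + - q * - q * - q - + 3 * (- p * - q * - q)
    l₁ = solve-∀
    l₂ : ∀ p q → - + 1 * (+ 3 * (p * q * (p - q))) ≡ + 3 * (- p * - q * (- p - - q))
    l₂ = solve-∀

  -- X + Yω is a cube times 1, ω or 1 + ω = -ω². Signs are absorbed into the cube.
  AssociateCube : ℤ → ℤ → Set
  AssociateCube X Y = ∃₂ λ p q → (X ≡ cubeRe p q × Y ≡ cubeIm p q)
                               ⊎ (X ≡ - cubeIm p q × Y ≡ cubeRe p q - cubeIm p q)
                               ⊎ (X ≡ cubeRe p q - cubeIm p q × Y ≡ cubeRe p q)

  -- √-3 X and √-3 Y lie in the ideal (Λ , Λ̄), so it is the unit ideal once 3 ∤ N(Λ) = Λ Λ̄.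
  conjugates-coprime : ∀ X Y i j k l → i * X + j * Y ≡ + 1 → k * + 3 + l * norm ⟨ X , Y ⟩ ≡ + 1 →
    ⟨ k * (i - j) + l * (X - Y) , - (k * (i + + 2 * j)) - l * Y ⟩ ⊗ ⟨ X , Y ⟩ ⊕ ⟨ k * (+ 2 * i + j) , k * (i + + 2 * j) ⟩ ⊗ conj ⟨ X , Y ⟩ ≡ 1ω
  conjugates-coprime X Y i j k l e₁ e₂ = cong₂ ⟨_,_⟩
    (trans (m₁ X Y i j k l) (trans (cong (λ z → k * + 3 * z + l * norm ⟨ X , Y ⟩) e₁) (trans (cong (_+ l * norm ⟨ X , Y ⟩) (*-identityʳ (k * + 3))) e₂)))
    (m₂ X Y i j k l)
    where
    m₁ : ∀ X Y i j k l → (k * (i - j) + l * (X - Y)) * X - (- (k * (i + + 2 * j)) - l * Y) * Y + (k * (+ 2 * i + j) * (X - Y) - k * (i + + 2 * j) * - Y)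
         ≡ k * + 3 * (i * X + j * Y) + l * (X * X - X * Y + Y * Y)
    m₁ = solve-∀
    m₂ : ∀ X Y i j k l → (k * (i - j) + l * (X - Y)) * Y + (- (k * (i + + 2 * j)) - l * Y) * X - (- (k * (i + + 2 * j)) - l * Y) * Y
         + (k * (+ 2 * i + j) * - Y + k * (i + + 2 * j) * (X - Y) - k * (i + + 2 * j) * - Y) ≡ + 0
    m₂ = solve-∀

  -- Taking norms in Λ = s g³ and g³ = t Λ gives N(s) N(t) = 1, so s is a unit.
  associate-cube : ∀ X Y s g t → ⟨ X , Y ⟩ ≡ s ⊗ cubeω g → cubeω g ≡ t ⊗ ⟨ X , Y ⟩ → norm ⟨ X , Y ⟩ ≢ + 0 → AssociateCube X Y
  associate-cube X Y ⟨ a , b ⟩ ⟨ p , q ⟩ t eΛ eg N≢0 = go (unit-cases a b unit)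
    where
    N : ℤ
    N = norm ⟨ X , Y ⟩
    norms : norm ⟨ X , Y ⟩ ≡ norm ⟨ a , b ⟩ * norm t * N
    norms = trans (cong norm (trans eΛ (cong (⟨ a , b ⟩ ⊗_) eg))) (trans (norm-⊗ ⟨ a , b ⟩ (t ⊗ ⟨ X , Y ⟩))
              (trans (cong (norm ⟨ a , b ⟩ *_) (norm-⊗ t ⟨ X , Y ⟩)) (sym (*-assoc (norm ⟨ a , b ⟩) (norm t) N))))
    instance N-nonZero = ≢-nonZero N≢0
    one : norm ⟨ a , b ⟩ * norm t ≡ + 1
    one = *-cancelʳ-≡ _ (+ 1) N (trans (sym norms) (sym (*-identityˡ N)))
    unit : ∣ norm ⟨ a , b ⟩ ∣ ≡ 1
    unit = ℕₚ.m*n≡1⇒m≡1 _ (∣ norm t ∣) (trans (sym (abs-* (norm ⟨ a , b ⟩) (norm t))) (cong ∣_∣ one))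
    u v : ℤ
    u = cubeRe p q
    v = cubeIm p q
    Λ≡ : ∀ a′ b′ → ⟨ a , b ⟩ ≡ ⟨ a′ , b′ ⟩ → ⟨ X , Y ⟩ ≡ ⟨ a′ , b′ ⟩ ⊗ ⟨ u , v ⟩
    Λ≡ a′ b′ e = trans eΛ (cong₂ _⊗_ e (cube-coords p q))
    re≡ : ∀ {x y x′ y′} → ⟨ x , y ⟩ ≡ ⟨ x′ , y′ ⟩ → x ≡ x′
    re≡ refl = refl
    im≡ : ∀ {x y x′ y′} → ⟨ x , y ⟩ ≡ ⟨ x′ , y′ ⟩ → y ≡ y′
    im≡ refl = refl
    go : (∃ λ σ → (σ ≡ + 1 ⊎ σ ≡ - + 1) × (⟨ a , b ⟩ ≡ ⟨ σ , + 0 ⟩ ⊎ ⟨ a , b ⟩ ≡ ⟨ + 0 , σ ⟩ ⊎ ⟨ a , b ⟩ ≡ ⟨ σ , σ ⟩)) → AssociateCube X Y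
    go (σ , sign , cases) = finish (unit-times-cube σ u v sign p q refl refl) cases
      where
      finish : (∃₂ λ p′ q′ → σ * u ≡ cubeRe p′ q′ × σ * v ≡ cubeIm p′ q′) →
               ⟨ a , b ⟩ ≡ ⟨ σ , + 0 ⟩ ⊎ ⟨ a , b ⟩ ≡ ⟨ + 0 , σ ⟩ ⊎ ⟨ a , b ⟩ ≡ ⟨ σ , σ ⟩ → AssociateCube X Y
      finish (p′ , q′ , eu , ev) (inj₁ e) = p′ , q′ , inj₁
        ( trans (re≡ (Λ≡ σ (+ 0) e)) (trans (l₁ σ u v) eu) , trans (im≡ (Λ≡ σ (+ 0) e)) (trans (l₂ σ u v) ev))
        where
        l₁ : ∀ σ u v → σ * u - + 0 * v ≡ σ * u
        l₁ = solve-∀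
        l₂ : ∀ σ u v → σ * v + + 0 * u - + 0 * v ≡ σ * v
        l₂ = solve-∀
      finish (p′ , q′ , eu , ev) (inj₂ (inj₁ e)) = p′ , q′ , inj₂ (inj₁
        ( trans (re≡ (Λ≡ (+ 0) σ e)) (trans (l₁ σ u v) (cong -_ ev)) , trans (im≡ (Λ≡ (+ 0) σ e)) (trans (l₂ σ u v) (cong₂ _-_ eu ev))))
        where
        l₁ : ∀ σ u v → + 0 * u - σ * v ≡ - (σ * v)
        l₁ = solve-∀
        l₂ : ∀ σ u v → + 0 * v + σ * u - σ * v ≡ σ * u - σ * v
        l₂ = solve-∀
      finish (p′ , q′ , eu , ev) (inj₂ (inj₂ e)) = p′ , q′ , inj₂ (inj₂
        ( trans (re≡ (Λ≡ σ σ e)) (cong₂ _-_ eu ev) , trans (im≡ (Λ≡ σ σ e)) (trans (l₂ σ u v) eu)))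
        where
        l₂ : ∀ σ u v → σ * v + σ * u - σ * v ≡ σ * u
        l₂ = solve-∀

  -- The norm N is itself a cube, being coprime to K. It factors as Λ Λ̄ with coprime factors, so Λ
  -- is a unit times a cube.
  cube-root : ∀ X Y K Z → CoprimeZ X Y → ¬ ((+ 3) ∣ᶻ norm ⟨ X , Y ⟩) → CoprimeZ (norm ⟨ X , Y ⟩) K → norm ⟨ X , Y ⟩ * K ≡ cube Z → AssociateCube X Y
  cube-root X Y K Z copXY 3∤N copNK eq =
    go (cube-of-coprime N K Z N≢0 copNK eq) (bezoutZ X Y copXY)
       (bezoutZ (+ 3) N (coprime-by-primes (+ 3) N λ { p pr p∣3 p∣N → 3∤N (subst (λ z → (+ z) ∣ᶻ N) (prime-∣-prime pr prime[3] p∣3) p∣N) }))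
    where
    N : ℤ
    N = norm ⟨ X , Y ⟩
    N≢0 : N ≢ + 0
    N≢0 e = 3∤N (subst ((+ 3) ∣ᶻ_) (sym e) (∣-abs (3 ℕ∣.∣0)))
    go : (∃ λ n → N ≡ cube n) → (∃₂ λ i j → i * X + j * Y ≡ + 1) → (∃₂ λ k l → k * + 3 + l * N ≡ + 1) → AssociateCube X Y
    go (n , en) (i , j , e₁) (k , l , e₂) = finish (cubeω-of-coprime ⟨ X , Y ⟩ (conj ⟨ X , Y ⟩) ⟨ n , + 0 ⟩
          ⟨ k * (i - j) + l * (X - Y) , - (k * (i + + 2 * j)) - l * Y ⟩ ⟨ k * (+ 2 * i + j) , k * (i + + 2 * j) ⟩
          (conjugates-coprime X Y i j k l e₁ e₂)
          (trans (norm-conj ⟨ X , Y ⟩) (trans (cong (λ z → ⟨ z , + 0 ⟩) en) (cong₂ ⟨_,_⟩ (c₁ n) (c₂ n)))))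
      where
      c₁ : ∀ n → n * n * n ≡ (n * n - + 0 * + 0) * n - (n * + 0 + + 0 * n - + 0 * + 0) * + 0
      c₁ = solve-∀
      c₂ : ∀ n → + 0 ≡ (n * n - + 0 * + 0) * + 0 + (n * + 0 + + 0 * n - + 0 * + 0) * n - (n * + 0 + + 0 * n - + 0 * + 0) * + 0
      c₂ = solve-∀
      finish : (∃ λ g → ∃₂ λ s t → ⟨ X , Y ⟩ ≡ s ⊗ cubeω g × cubeω g ≡ t ⊗ ⟨ X , Y ⟩) → AssociateCube X Y
      finish (g , s , t , x , y) = associate-cube X Y s g t x y N≢0

-- The curve A³ + B³ + 2C³ = 2ABC, and its points with C prime to 3

module CubicCurve where

  open CriticalSequence using (prime-divisor; coprime-power; coprime-∣ˡ; IsSq; E; A; EvenSplit; even-split; A-coprime; *-^-comm; ^-injectiveˡ)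
  import Algebra.Solver.Ring.NaturalCoefficients.Default as SemiringSolver
  open import Data.Empty using (⊥; ⊥-elim)
  open import Data.Integer hiding (suc)
  open import Data.Integer.Properties
  open import Data.Integer.Divisibility.Signed renaming (_∣_ to infix 4 _∣ᶻ_; divides to dividesᶻ) 
  import Data.Integer.DivMod as DM
  open import Data.Integer.Tactic.RingSolver using (solve-∀)
  open import Data.Nat as ℕ using (ℕ; suc; s≤s)
  import Data.Nat.Properties as ℕₚ
  import Data.Nat.Divisibility as ℕ∣
  import Data.Nat.Coprimality as Cop
  open import Data.Nat.GCD using (module Bézout)
  open import Data.Nat.Primality using (Prime; ¬prime[0]; prime[2])
  open import Data.Product using (∃; _×_; _,_; proj₁; proj₂)
  open import Data.Sum using (inj₁; inj₂; [_,_]′)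
  open import Function using (case_of_)
  open import Relation.Binary.PropositionalEquality
  open import Relation.Nullary using (¬_; Dec)
  open import Relation.Nullary.Decidable using (toWitness; _→-dec_; _×-dec_)

  open IntegerDivisibility
  open Eisenstein
  open CubeRoots

  fermat₃ : ∀ x → (+ 3) ∣ᶻ x * x * x - x
  fermat₃ x = go (x DM.%ℕ 3) (x DM./ℕ 3) (DM.n%ℕd<d x 3) (DM.a≡a%ℕn+[a/ℕn]*n x 3)
    where
    go : ∀ r q → r ℕ.< 3 → x ≡ + r + q * + 3 → (+ 3) ∣ᶻ x * x * x - x
    go 0 q _ refl = dividesᶻ (+ 9 * (q * q * q) - q) (l q)
      where
      l : ∀ q → (+ 0 + q * + 3) * (+ 0 + q * + 3) * (+ 0 + q * + 3) - (+ 0 + q * + 3) ≡ (+ 9 * (q * q * q) - q) * + 3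
      l = solve-∀
    go 1 q _ refl = dividesᶻ (+ 9 * (q * q * q) + + 9 * (q * q) + + 2 * q) (l q)
      where
      l : ∀ q → (+ 1 + q * + 3) * (+ 1 + q * + 3) * (+ 1 + q * + 3) - (+ 1 + q * + 3) ≡ (+ 9 * (q * q * q) + + 9 * (q * q) + + 2 * q) * + 3
      l = solve-∀
    go 2 q _ refl = dividesᶻ (+ 9 * (q * q * q) + + 18 * (q * q) + + 11 * q + + 2) (l q)
      where
      l : ∀ q → (+ 2 + q * + 3) * (+ 2 + q * + 3) * (+ 2 + q * + 3) - (+ 2 + q * + 3) ≡ (+ 9 * (q * q * q) + + 18 * (q * q) + + 11 * q + + 2) * + 3
      l = solve-∀
    go (suc (suc (suc _))) _ (s≤s (s≤s (s≤s ()))) _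

  -- The norm form x² - xy + y² has no zero modulo m except the trivial one; the coefficient -1 is
  -- written m - 1 to stay in ℕ. It is used for 2 and 23, which are inert in ℤ[ω].
  Anisotropic : (m : ℕ) .{{_ : ℕ.NonZero m}} → Set
  Anisotropic m = ∀ {a} → a ℕ.< m → ∀ {b} → b ℕ.< m → (a ℕ.* a ℕ.+ b ℕ.* b ℕ.+ ℕ.pred m ℕ.* (a ℕ.* b)) ℕ.% m ≡ 0 → a ≡ 0 × b ≡ 0

  anisotropic? : (m : ℕ) .{{_ : ℕ.NonZero m}} → Dec (Anisotropic m)
  anisotropic? m = ℕₚ.allUpTo? (λ a → ℕₚ.allUpTo? (λ b → ((a ℕ.* a ℕ.+ b ℕ.* b ℕ.+ ℕ.pred m ℕ.* (a ℕ.* b)) ℕ.% m ℕ.≟ 0) →-dec ((a ℕ.≟ 0) ×-dec (b ℕ.≟ 0))) m) m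

  anisotropic[2] : Anisotropic 2
  anisotropic[2] = toWitness {a? = anisotropic? 2} _

  anisotropic[23] : Anisotropic 23
  anisotropic[23] = toWitness {a? = anisotropic? 23} _

  norm-∣ : ∀ n → Anisotropic (suc n) → ∀ X Y → (+ suc n) ∣ᶻ norm ⟨ X , Y ⟩ → ((+ suc n) ∣ᶻ X) × ((+ suc n) ∣ᶻ Y)
  norm-∣ n aniso X Y d = go (X DM.%ℕ m) (Y DM.%ℕ m) (DM.n%ℕd<d X m) (DM.n%ℕd<d Y m) (DM.a≡a%ℕn+[a/ℕn]*n X m) (DM.a≡a%ℕn+[a/ℕn]*n Y m)
    where
    m : ℕ
    m = suc n
    go : ∀ a b → a ℕ.< m → b ℕ.< m → X ≡ + a + X DM./ℕ m * + m → Y ≡ + b + Y DM./ℕ m * + m → ((+ m) ∣ᶻ X) × ((+ m) ∣ᶻ Y)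
    go a b a<m b<m eX eY = subst ((+ m) ∣ᶻ_) (sym eX) (lead (proj₁ both) (X DM./ℕ m)) , subst ((+ m) ∣ᶻ_) (sym eY) (lead (proj₂ both) (Y DM./ℕ m))
      where
      lead : ∀ {a} → a ≡ 0 → ∀ q → (+ m) ∣ᶻ + a + q * + m
      lead refl q = dividesᶻ q (+-identityˡ _)
      l′ : ∀ a b x y n → a * a + b * b + n * (a * b)
           ≡ + 1 * ((a + x * (+ 1 + n)) * (a + x * (+ 1 + n)) - (a + x * (+ 1 + n)) * (b + y * (+ 1 + n)) + (b + y * (+ 1 + n)) * (b + y * (+ 1 + n)))
             + (a * b - (+ 2 * (a * x) - a * y - b * x + + 2 * (b * y) + (+ 1 + n) * (x * x - x * y + y * y))) * (+ 1 + n)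
      l′ = solve-∀
      d′ : (+ m) ∣ᶻ norm ⟨ + a + X DM./ℕ m * + m , + b + Y DM./ℕ m * + m ⟩
      d′ = subst₂ (λ x y → (+ m) ∣ᶻ norm ⟨ x , y ⟩) eX eY d
      pos≡ : + (a ℕ.* a ℕ.+ b ℕ.* b ℕ.+ n ℕ.* (a ℕ.* b)) ≡ + a * + a + + b * + b + + n * (+ a * + b)
      pos≡ = cong₂ _+_ (cong₂ _+_ (pos-* a a) (pos-* b b)) (trans (pos-* n (a ℕ.* b)) (cong (+ n *_) (pos-* a b)))
      both : a ≡ 0 × b ≡ 0
      both = aniso a<m b<m (ℕ∣.n∣m⇒m%n≡0 _ m (abs-∣ {m} (subst ((+ m) ∣ᶻ_) (sym pos≡)
               (lin₂ d′ (∣-refl {+ m}) (+ 1) (+ a * + b - (+ 2 * (+ a * (X DM./ℕ m)) - + a * (Y DM./ℕ m) - + b * (X DM./ℕ m) + + 2 * (+ b * (Y DM./ℕ m)) + (+ 1 + + n) * (X DM./ℕ m * (X DM./ℕ m) - X DM./ℕ m * (Y DM./ℕ m) + Y DM./ℕ m * (Y DM./ℕ m)))) (l′ (+ a) (+ b) (X DM./ℕ m) (Y DM./ℕ m) (+ n))))))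

  -- With E = 2C/3 the form A³ + B³ + E³ - 3ABE splits off A + B + E, the cofactor being the norm
  -- form in A - E and B - E. On the curve its value is (8/27 - 2) C³. Clearing denominators gives
  -- this equation, with X = 3A - 2C, Y = 3B - 2C, D = C and the constant 46 = 54 - 8.
  module Factors (X Y D : ℤ) (eqn : (X + Y + + 6 * D) * norm ⟨ X , Y ⟩ ≡ - (+ 46 * cube D))
                 (no-common : ∀ l → Prime l → (+ l) ∣ᶻ X → (+ l) ∣ᶻ Y → (+ l) ∣ᶻ D → ⊥) where

    L N : ℤ
    L = X + Y + + 6 * D
    N = norm ⟨ X , Y ⟩

    private
      -- If l divides X and Y, then l² divides the norm; l divides 46 only once, so it must divide
      -- D.
      square-factor : ∀ l m → Prime l → + 46 ≡ + l * + m → ¬ ((+ l) ∣ᶻ + m) → (+ l) ∣ᶻ X → (+ l) ∣ᶻ Y → ⊥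
      square-factor l m pr e l∤m l∣X@(dividesᶻ x ex) l∣Y@(dividesᶻ y ey) =
        [ l∤m , (λ d → no-common l pr l∣X l∣Y (euclid-cube D pr d)) ]′ (euclid (+ m) (cube D) pr (dividesᶻ (- (L * (x * x - x * y + y * y))) mD³))
        where
        l≢0 : l ≢ 0
        l≢0 refl = ¬prime[0] pr
        instance l-nonZero = ≢-nonZero {+ l} (λ { refl → l≢0 refl })
        a₁ : ∀ L x y l → - (L * (x * x - x * y + y * y)) * l * l ≡ - (L * (x * l * (x * l) - x * l * (y * l) + y * l * (y * l)))
        a₁ = solve-∀
        a₂ : ∀ l m d → - (- (l * m * d)) ≡ m * d * l
        a₂ = solve-∀
        mD³ : + m * cube D ≡ - (L * (x * x - x * y + y * y)) * + l
        mD³ = sym (*-cancelʳ-≡ _ _ (+ l) (trans (a₁ L x y (+ l)) (trans (cong -_ (trans (cong (L *_) (sym (cong₂ (λ X Y → norm ⟨ X , Y ⟩) ex ey))) (trans eqn (cong (λ z → - (z * cube D)) e)))) (a₂ (+ l) (+ m) (cube D)))))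

    no-common-prime : ∀ l → Prime l → (+ l) ∣ᶻ X → (+ l) ∣ᶻ Y → ⊥
    no-common-prime l pr l∣X l∣Y = [ by-46 , (λ d → no-common l pr l∣X l∣Y (euclid-cube D pr d)) ]′ (euclid (+ 46) (cube D) pr l∣46D³)
      where
      l∣46D³ : (+ l) ∣ᶻ + 46 * cube D
      l∣46D³ = lin₁ (lin₂ l∣X l∣Y X (Y - X) (n X Y)) (- L) (trans (sym (neg-involutive _)) (trans (cong -_ (sym eqn)) (neg-distribˡ-* L N)))
        where
        n : ∀ X Y → X * X - X * Y + Y * Y ≡ X * X + (Y - X) * Y
        n = solve-∀
      by-46 : (+ l) ∣ᶻ + 46 → ⊥
      by-46 d = [ (λ d′ → at 2 23 prime[2] (prime-∣-prime pr prime[2] d′) refl (λ z → case prime-∣-prime prime[2] prime[23] z of λ ()))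
                , (λ d′ → at 23 2 prime[23] (prime-∣-prime pr prime[23] d′) refl (λ z → case prime-∣-prime prime[23] prime[2] z of λ ())) ]′ (euclid (+ 2) (+ 23) pr d)
        where
        at : ∀ q m → Prime q → l ≡ q → + 46 ≡ + q * + m → ¬ ((+ q) ∣ᶻ + m) → ⊥
        at q m pq refl e ∤m = square-factor q m pq e ∤m l∣X l∣Y

    coprimeXY : CoprimeZ X Y
    coprimeXY = coprime-by-primes X Y no-common-prime

    private
      ∣L : ∀ n m → Prime (suc n) → Anisotropic (suc n) → + 46 ≡ + m * + suc n → (+ suc n) ∣ᶻ L
      ∣L n m pr an e = [ (λ d → d) , (λ d → ⊥-elim (no-common-prime (suc n) pr (proj₁ (norm-∣ n an X Y d)) (proj₂ (norm-∣ n an X Y d)))) ]′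
        (euclid L N pr (dividesᶻ (- (+ m * cube D)) (trans eqn (trans (cong (λ z → - (z * cube D)) e) (l (+ m) (+ suc n) (cube D))))))
        where
        l : ∀ a b d → - (a * b * d) ≡ - (a * d) * b
        l = solve-∀

    2∣L : (+ 2) ∣ᶻ L
    2∣L = ∣L 1 23 prime[2] anisotropic[2] refl

    23∣L : (+ 23) ∣ᶻ L
    23∣L = ∣L 22 2 prime[23] anisotropic[23] refl

    -- l divides X + Y = L - 6D, and 3XY = (X + Y)² - N. If l divided X or Y it would divide both.
    common-prime : ∀ l → Prime l → (+ l) ∣ᶻ N → (+ l) ∣ᶻ L → (+ l) ∣ᶻ D → l ≡ 3
    common-prime l pr l∣N l∣L l∣D = [ prime-∣-prime pr prime[3] , (λ d → ⊥-elim ([ left , right ]′ (euclid X Y pr d))) ]′ (euclid (+ 3) (X * Y) pr l∣3XY)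
      where
      l∣X+Y : (+ l) ∣ᶻ X + Y
      l∣X+Y = lin₂ l∣L l∣D (+ 1) (- + 6) (e X Y D)
        where
        e : ∀ X Y D → X + Y ≡ + 1 * (X + Y + + 6 * D) + - + 6 * D
        e = solve-∀
      l∣3XY : (+ l) ∣ᶻ + 3 * (X * Y)
      l∣3XY = lin₂ l∣X+Y l∣N (X + Y) (- + 1) (e X Y)
        where
        e : ∀ X Y → + 3 * (X * Y) ≡ (X + Y) * (X + Y) + - + 1 * (X * X - X * Y + Y * Y)
        e = solve-∀
      e₁ : ∀ X Y → Y ≡ + 1 * (X + Y) + - + 1 * X
      e₁ = solve-∀
      e₂ : ∀ X Y → X ≡ + 1 * (X + Y) + - + 1 * Y
      e₂ = solve-∀
      left : (+ l) ∣ᶻ X → ⊥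
      left d = no-common-prime l pr d (lin₂ l∣X+Y d (+ 1) (- + 1) (e₁ X Y))
      right : (+ l) ∣ᶻ Y → ⊥
      right d = no-common-prime l pr (lin₂ l∣X+Y d (+ 1) (- + 1) (e₂ X Y)) d

  Curve : ℤ → ℤ → ℤ → Set
  Curve A B C = A * A * A + B * B * B + + 2 * (C * C * C) ≡ + 2 * (A * B * C)

  46-divides : ∀ {L} → (+ 2) ∣ᶻ L → (+ 23) ∣ᶻ L → ∃ λ K → L ≡ + 46 * K
  46-divides {L} (dividesᶻ a ea) d = go ([ (λ d′ → d′) , (λ d′ → case prime-∣-prime prime[23] prime[2] d′ of λ ()) ]′ (euclid a (+ 2) prime[23] (subst ((+ 23) ∣ᶻ_) ea d)))
    where
    go : (+ 23) ∣ᶻ a → ∃ λ K → L ≡ + 46 * K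
    go (dividesᶻ K eK) = K , trans ea (trans (cong (_* + 2) eK) (l K))
      where
      l : ∀ K → K * + 23 * + 2 ≡ + 46 * K
      l = solve-∀

  -- As L = 46K and NK = (-C)³ with N prime to 3 and to K, X + Yω is a unit times a cube. The
  -- ω-coordinate of a cube is divisible by 3 while X and Y are not, so the unit is ±(1 + ω). Then A
  -- ≡ B modulo 3, and the curve modulo 3 forces 3 to divide A and then C.
  no-point-3∤C : ∀ A B C → CoprimeZ A B → Curve A B C → ¬ ((+ 3) ∣ᶻ C) → ⊥
  no-point-3∤C A B C cop curve 3∤C = go (46-divides 2∣L 23∣L)
    where
    X Y : ℤ
    X = + 3 * A - + 2 * C
    Y = + 3 * B - + 2 * C
    3∤2C : ¬ ((+ 3) ∣ᶻ + 2 * C)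
    3∤2C d = [ 3∤2 , 3∤C ]′ (euclid (+ 2) C prime[3] d)
    eqn : (X + Y + + 6 * C) * norm ⟨ X , Y ⟩ ≡ - (+ 46 * cube C)
    eqn = trans (l A B C) (trans (cong (λ z → + 27 * z - (+ 46 * (C * C * C)) - + 54 * (A * B * C)) curve) (l′ A B C))
      where
      l : ∀ A B C → (+ 3 * A - + 2 * C + (+ 3 * B - + 2 * C) + + 6 * C) * ((+ 3 * A - + 2 * C) * (+ 3 * A - + 2 * C) - (+ 3 * A - + 2 * C) * (+ 3 * B - + 2 * C) + (+ 3 * B - + 2 * C) * (+ 3 * B - + 2 * C))
          ≡ + 27 * (A * A * A + B * B * B + + 2 * (C * C * C)) - + 46 * (C * C * C) - + 54 * (A * B * C)
      l = solve-∀
      l′ : ∀ A B C → + 27 * (+ 2 * (A * B * C)) - + 46 * (C * C * C) - + 54 * (A * B * C) ≡ - (+ 46 * (C * C * C))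
      l′ = solve-∀
    from-X : ∀ A C → + 3 * A ≡ + 1 * (+ 3 * A - + 2 * C) + + 2 * C
    from-X = solve-∀
    no-common : ∀ l → Prime l → (+ l) ∣ᶻ X → (+ l) ∣ᶻ Y → (+ l) ∣ᶻ C → ⊥
    no-common l pr dX dY dC = coprime-prime cop pr (part A dX) (part B dY)
      where
      part : ∀ A → (+ l) ∣ᶻ + 3 * A - + 2 * C → (+ l) ∣ᶻ A
      part A d = [ (λ d′ → ⊥-elim (3∤C (subst (λ z → (+ z) ∣ᶻ C) (prime-∣-prime pr prime[3] d′) dC))) , (λ d′ → d′) ]′ (euclid (+ 3) A pr (lin₂ d dC (+ 1) (+ 2) (from-X A C)))
    open Factors X Y C eqn no-common
    3∤X : ∀ A → ¬ ((+ 3) ∣ᶻ + 3 * A - + 2 * C)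
    3∤X A d = 3∤2C (lin₂ d (∣m⇒∣m*n {+ 3} A (∣-refl {+ 3})) (- + 1) (+ 1) (l A C))
      where
      l : ∀ A C → + 2 * C ≡ - + 1 * (+ 3 * A - + 2 * C) + + 1 * (+ 3 * A)
      l = solve-∀
    3∤N : ¬ ((+ 3) ∣ᶻ N)
    3∤N d = 3∤2C (euclid-sq (+ 2 * C) prime[3] (lin₂ d (∣-refl {+ 3}) (+ 1) (- (+ 3 * (A * A) - + 3 * (A * B) + + 3 * (B * B) - + 2 * (A * C) - + 2 * (B * C))) (l A B C)))
      where
      l : ∀ A B C → + 2 * C * (+ 2 * C) ≡ + 1 * ((+ 3 * A - + 2 * C) * (+ 3 * A - + 2 * C) - (+ 3 * A - + 2 * C) * (+ 3 * B - + 2 * C) + (+ 3 * B - + 2 * C) * (+ 3 * B - + 2 * C))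
          + - (+ 3 * (A * A) - + 3 * (A * B) + + 3 * (B * B) - + 2 * (A * C) - + 2 * (B * C)) * + 3
      l = solve-∀
    go : (∃ λ K → L ≡ + 46 * K) → ⊥
    go (K , eL) = finish (cube-root X Y K (- C) coprimeXY 3∤N (coprime-by-primes N K common) NK)
      where
      NK : N * K ≡ cube (- C)
      NK = *-cancelˡ-≡ (+ 46) _ _ (trans (a N K) (trans (cong (_* N) (sym eL)) (trans eqn (b C))))
        where
        a : ∀ N K → + 46 * (N * K) ≡ + 46 * K * N
        a = solve-∀
        b : ∀ C → - (+ 46 * (C * C * C)) ≡ + 46 * (- C * - C * - C)
        b = solve-∀
      common : ∀ l → Prime l → (+ l) ∣ᶻ N → (+ l) ∣ᶻ K → ⊥
      common l pr dN dK = 3∤N (subst (λ z → (+ z) ∣ᶻ N) (common-prime l pr dN (lin₁ dK (+ 46) eL)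
        (lin₁ (euclid-cube (- C) pr (subst ((+ l) ∣ᶻ_) NK (∣m⇒∣m*n K dN))) (- + 1) (c C))) dN)
        where
        c : ∀ C → C ≡ - + 1 * - C
        c = solve-∀
      3∣Im : ∀ p q → (+ 3) ∣ᶻ cubeIm p q
      3∣Im p q = ∣m⇒∣m*n {+ 3} (p * q * (p - q)) (∣-refl {+ 3})
      finish : AssociateCube X Y → ⊥
      finish (p , q , inj₁ (_ , eY)) = 3∤X B (subst ((+ 3) ∣ᶻ_) (sym eY) (3∣Im p q))
      finish (p , q , inj₂ (inj₁ (eX , _))) = 3∤X A (subst ((+ 3) ∣ᶻ_) (sym eX) (lin₁ (3∣Im p q) (- + 1) (sym (-1*i≡-i (cubeIm p q)))))
      finish (p , q , inj₂ (inj₂ (eX , eY))) = 3∤C (lin₂ 3∣A+C-A²C 3∣A (+ 1) (A * C - + 1) (w A C))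
        where
        W : ℤ
        W = p * q * (p - q)
        3∤p+q : ¬ ((+ 3) ∣ᶻ p + q)
        3∤p+q d = 3∤X B (subst ((+ 3) ∣ᶻ_) (sym eY) (lin₂ (lin₂ (fermat₃ p) (fermat₃ q) (+ 1) (+ 1) refl) (lin₂ d (∣-refl {+ 3}) (+ 1) (- (p * q * q)) refl) (+ 1) (+ 1) (l p q)))
          where
          l : ∀ p q → p * p * p + q * q * q - + 3 * (p * q * q) ≡ + 1 * (+ 1 * (p * p * p - p) + + 1 * (q * q * q - q)) + + 1 * (+ 1 * (p + q) + - (p * q * q) * + 3)
          l = solve-∀
        -- Modulo 3, Y is p + q and hence nonzero, whereas (p + q) W = pq(p² - q²) vanishes by
        -- Fermat.
        3∣W : (+ 3) ∣ᶻ W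
        3∣W = [ (λ d → ⊥-elim (3∤p+q d)) , (λ d → d) ]′ (euclid (p + q) W prime[3] (lin₂ (fermat₃ p) (fermat₃ q) q (- p) (l p q)))
          where
          l : ∀ p q → (p + q) * (p * q * (p - q)) ≡ q * (p * p * p - p) + - p * (q * q * q - q)
          l = solve-∀
        A-B : A - B ≡ - W
        A-B = *-cancelˡ-≡ (+ 3) _ _ (trans (l A B C) (trans (cong₂ _-_ eX eY) (l′ p q)))
          where
          l : ∀ A B C → + 3 * (A - B) ≡ + 3 * A - + 2 * C - (+ 3 * B - + 2 * C)
          l = solve-∀
          l′ : ∀ p q → p * p * p + q * q * q - + 3 * (p * q * q) - + 3 * (p * q * (p - q)) - (p * p * p + q * q * q - + 3 * (p * q * q)) ≡ + 3 * - (p * q * (p - q))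
          l′ = solve-∀
        3∣A-B : (+ 3) ∣ᶻ A - B
        3∣A-B = lin₁ 3∣W (- + 1) (trans A-B (sym (-1*i≡-i W)))
        2∣₃ : (+ 3) ∣ᶻ + 2 * (A + C - A * A * C)
        2∣₃ = lin₂ 3∣A-B (lin₂ (fermat₃ A) (fermat₃ C) (- + 2) (- + 2) refl) (A * A + A * B + B * B - + 2 * (A * C)) (+ 1) (trans (l A B C) (trans (cong (λ z → z - + 2 * (A * B * C) + r A B C) curve) (l′ A B C)))
          where
          r : ∀ A B C → ℤ
          r A B C = (A * A + A * B + B * B - + 2 * (A * C)) * (A - B) + + 1 * (- + 2 * (A * A * A - A) + - + 2 * (C * C * C - C))
          l : ∀ A B C → + 2 * (A + C - A * A * C) ≡ A * A * A + B * B * B + + 2 * (C * C * C) - + 2 * (A * B * C)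
              + ((A * A + A * B + B * B - + 2 * (A * C)) * (A - B) + + 1 * (- + 2 * (A * A * A - A) + - + 2 * (C * C * C - C)))
          l = solve-∀
          l′ : ∀ A B C → + 2 * (A * B * C) - + 2 * (A * B * C) + ((A * A + A * B + B * B - + 2 * (A * C)) * (A - B) + + 1 * (- + 2 * (A * A * A - A) + - + 2 * (C * C * C - C)))
               ≡ (A * A + A * B + B * B - + 2 * (A * C)) * (A - B) + + 1 * (- + 2 * (A * A * A - A) + - + 2 * (C * C * C - C))
          l′ = solve-∀
        3∣A+C-A²C : (+ 3) ∣ᶻ A + C - A * A * C
        3∣A+C-A²C = [ (λ d → ⊥-elim (3∤2 d)) , (λ d → d) ]′ (euclid (+ 2) (A + C - A * A * C) prime[3] 2∣₃)
        3∣A : (+ 3) ∣ᶻ A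
        3∣A = euclid-sq A prime[3] (lin₂ 3∣A+C-A²C (fermat₃ A) A C (l A C))
          where
          l : ∀ A C → A * A ≡ A * (A + C - A * A * C) + C * (A * A * A - A)
          l = solve-∀
        w : ∀ A C → C ≡ + 1 * (A + C - A * A * C) + (A * C - + 1) * A
        w = solve-∀

-- Points with C divisible by 3

module DescentStep where

  open CriticalSequence using (prime-divisor; coprime-power; coprime-∣ˡ; IsSq; E; A; EvenSplit; even-split; A-coprime; *-^-comm; ^-injectiveˡ)
  import Algebra.Solver.Ring.NaturalCoefficients.Default as SemiringSolver
  open import Data.Empty using (⊥; ⊥-elim)
  open import Data.Integer hiding (suc)
  open import Data.Integer.Properties
  open import Data.Integer.Divisibility.Signed renaming (_∣_ to infix 4 _∣ᶻ_; divides to dividesᶻ) 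
  import Data.Integer.DivMod as DM
  open import Data.Integer.Tactic.RingSolver using (solve-∀)
  open import Data.Nat as ℕ using (ℕ)
  import Data.Nat.Properties as ℕₚ
  import Data.Nat.Divisibility as ℕ∣
  import Data.Nat.Coprimality as Cop
  open import Data.Nat.GCD using (module Bézout)
  open import Data.Nat.Primality using (Prime; prime[2])
  open import Data.Product using (∃; _,_)
  open import Data.Sum using (inj₁; inj₂; [_,_]′)
  open import Function using (case_of_)
  open import Relation.Binary.PropositionalEquality
  open import Relation.Nullary using (¬_)

  open IntegerDivisibility
  open Eisenstein
  open CubeRoots
  open CubicCurve

  norm-cube : ∀ p q → norm ⟨ cubeRe p q , cubeIm p q ⟩ ≡ cube (norm ⟨ p , q ⟩)
  norm-cube p q = trans (cong norm (sym (cube-coords p q))) (trans (norm-⊗ (g ⊗ g) g) (cong (_* norm g) (norm-⊗ g g)))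
    where
    g : ℤω
    g = ⟨ p , q ⟩

  cube≡0 : ∀ x → cube x ≡ + 0 → x ≡ + 0
  cube≡0 x e = cube-injective x (+ 0) e

  -- These data come from s + tω = (p + qω)³ and K = r³: then C₁/3 = -N(p + qω) r, and t + 6 (C₁/3)
  -- = 138 r³ becomes `eq`.
  record Descent (C₁ : ℤ) : Set where
    field
      p q r : ℤ
      r≢0   : r ≢ + 0
      size  : ∣ C₁ ∣ ≡ 3 ℕ.* (∣ norm ⟨ p , q ⟩ ∣ ℕ.* ∣ r ∣)
      eq    : p * q * (p - q) - + 2 * (norm ⟨ p , q ⟩ * r) ≡ + 46 * cube r

  module _ (A B C₁ : ℤ) (cop : CoprimeZ A B) (curve : Curve A B (+ 3 * C₁)) (C₁≢0 : C₁ ≢ + 0) where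

    private
      C : ℤ
      C = + 3 * C₁

      3∣C : (+ 3) ∣ᶻ C
      3∣C = ∣m⇒∣m*n {+ 3} C₁ (∣-refl {+ 3})

      3∣A+B : (+ 3) ∣ᶻ A + B
      3∣A+B = lin₂ (lin₂ (fermat₃ A) (fermat₃ B) (+ 1) (+ 1) refl) 3∣C (- + 1) (+ 2 * (A * B) - + 2 * (C * C)) (trans (l A B C) (trans (cong (λ z → z - + 2 * (A * B * C) + (- + 1 * (+ 1 * (A * A * A - A) + + 1 * (B * B * B - B)) + (+ 2 * (A * B) - + 2 * (C * C)) * C)) curve) (l′ A B C)))
        where
        l : ∀ A B C → A + B ≡ A * A * A + B * B * B + + 2 * (C * C * C) - + 2 * (A * B * C) + (- + 1 * (+ 1 * (A * A * A - A) + + 1 * (B * B * B - B)) + (+ 2 * (A * B) - + 2 * (C * C)) * C)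
        l = solve-∀
        l′ : ∀ A B C → + 2 * (A * B * C) - + 2 * (A * B * C) + (- + 1 * (+ 1 * (A * A * A - A) + + 1 * (B * B * B - B)) + (+ 2 * (A * B) - + 2 * (C * C)) * C)
             ≡ - + 1 * (+ 1 * (A * A * A - A) + + 1 * (B * B * B - B)) + (+ 2 * (A * B) - + 2 * (C * C)) * C
        l′ = solve-∀

      3∤A : ¬ ((+ 3) ∣ᶻ A)
      3∤A d = coprime-prime cop prime[3] d (lin₂ 3∣A+B d (+ 1) (- + 1) (l A B))
        where
        l : ∀ A B → B ≡ + 1 * (A + B) + - + 1 * A
        l = solve-∀

      3∤B : ¬ ((+ 3) ∣ᶻ B)
      3∤B d = coprime-prime cop prime[3] (lin₂ 3∣A+B d (+ 1) (- + 1) (l A B)) d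
        where
        l : ∀ A B → A ≡ + 1 * (A + B) + - + 1 * B
        l = solve-∀

      -- A³ + B³ = (A + B)((A + B)² - 3AB) is divisible by 9, hence so is 6ABC₁, and 3 divides
      -- neither A nor B.
      3∣C₁ : ∀ h → A + B ≡ h * + 3 → (+ 3) ∣ᶻ C₁
      3∣C₁ h eh = [ (λ d → ⊥-elim ([ 3∤2 , (λ d′ → [ 3∤A , 3∤B ]′ (euclid A B prime[3] d′)) ]′ (euclid (+ 2) (A * B) prime[3] d))) , (λ d → d) ]′
        (euclid (+ 2 * (A * B)) C₁ prime[3] (dividesᶻ (+ 3 * (h * h * h) - h * (A * B) + + 6 * (C₁ * C₁ * C₁)) 2ABC₁))
        where
        l : ∀ A B C₁ → + 3 * (+ 2 * (A * B) * C₁) ≡ + 2 * (A * B * (+ 3 * C₁))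
        l = solve-∀
        l′ : ∀ A B C₁ → A * A * A + B * B * B + + 2 * (+ 3 * C₁ * (+ 3 * C₁) * (+ 3 * C₁)) ≡ (A + B) * ((A + B) * (A + B) - + 3 * (A * B)) + + 54 * (C₁ * C₁ * C₁)
        l′ = solve-∀
        l″ : ∀ A B C₁ h → h * + 3 * (h * + 3 * (h * + 3) - + 3 * (A * B)) + + 54 * (C₁ * C₁ * C₁) ≡ + 3 * ((+ 3 * (h * h * h) - h * (A * B) + + 6 * (C₁ * C₁ * C₁)) * + 3)
        l″ = solve-∀
        2ABC₁ : + 2 * (A * B) * C₁ ≡ (+ 3 * (h * h * h) - h * (A * B) + + 6 * (C₁ * C₁ * C₁)) * + 3
        2ABC₁ = *-cancelˡ-≡ (+ 3) _ _ (trans (l A B C₁) (trans (sym curve) (trans (l′ A B C₁)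
                  (trans (cong (λ z → z * (z * z - + 3 * (A * B)) + + 54 * (C₁ * C₁ * C₁)) eh) (l″ A B C₁ h)))))

      module _ (h C₂ : ℤ) (eh : A + B ≡ h * + 3) (eC : C₁ ≡ C₂ * + 3) where

        -- X and Y are a third of 3A - 2C and 3B - 2C. Since X + Y = 3t, the number X + Yω is
        -- divisible by 1 - ω, the prime above 3, and s + tω is the quotient.
        X Y t s : ℤ
        X = A - + 2 * C₁
        Y = B - + 2 * C₁
        t = h - + 4 * C₂
        s = X - t

        C₂≢0 : C₂ ≢ + 0
        C₂≢0 e = C₁≢0 (trans eC (cong (_* + 3) e))

        eqn : (X + Y + + 6 * C₁) * norm ⟨ X , Y ⟩ ≡ - (+ 46 * cube C₁)
        eqn = trans (l A B C₁) (trans (cong (λ z → z - (+ 46 * (C₁ * C₁ * C₁)) - + 6 * (A * B * C₁)) curve) (l′ A B C₁))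
          where
          l : ∀ A B C → (A - + 2 * C + (B - + 2 * C) + + 6 * C) * ((A - + 2 * C) * (A - + 2 * C) - (A - + 2 * C) * (B - + 2 * C) + (B - + 2 * C) * (B - + 2 * C))
              ≡ A * A * A + B * B * B + + 2 * (+ 3 * C * (+ 3 * C) * (+ 3 * C)) - + 46 * (C * C * C) - + 6 * (A * B * C)
          l = solve-∀
          l′ : ∀ A B C → + 2 * (A * B * (+ 3 * C)) - + 46 * (C * C * C) - + 6 * (A * B * C) ≡ - (+ 46 * (C * C * C))
          l′ = solve-∀

        no-common : ∀ l → Prime l → (+ l) ∣ᶻ X → (+ l) ∣ᶻ Y → (+ l) ∣ᶻ C₁ → ⊥
        no-common l pr dX dY dC = coprime-prime cop pr (lin₂ dX dC (+ 1) (+ 2) (e A C₁)) (lin₂ dY dC (+ 1) (+ 2) (e B C₁))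
          where
          e : ∀ A C → A ≡ + 1 * (A - + 2 * C) + + 2 * C
          e = solve-∀

        open Factors X Y C₁ eqn no-common

        n : ℤ
        n = norm ⟨ s , t ⟩

        X≡ : X ≡ s + t
        X≡ = l X t
          where
          l : ∀ X t → X ≡ X - t + t
          l = solve-∀

        Y≡ : Y ≡ + 2 * t - s
        Y≡ = trans (l A B C₁) (trans (cong₂ (λ u v → u - A - + 2 * v) eh eC) (trans (l′ A C₂ h) (cong (λ z → + 2 * t - (A - + 2 * z - t)) (sym eC))))
          where
          l : ∀ A B C → B - + 2 * C ≡ A + B - A - + 2 * C
          l = solve-∀
          l′ : ∀ A C h → h * + 3 - A - + 2 * (C * + 3) ≡ + 2 * (h - + 4 * C) - (A - + 2 * (C * + 3) - (h - + 4 * C))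
          l′ = solve-∀

        N≡3n : N ≡ + 3 * n
        N≡3n = trans (cong₂ (λ u v → norm ⟨ u , v ⟩) X≡ Y≡) (l s t)
          where
          l : ∀ s t → (s + t) * (s + t) - (s + t) * (+ 2 * t - s) + (+ 2 * t - s) * (+ 2 * t - s) ≡ + 3 * (s * s - s * t + t * t)
          l = solve-∀

        L≡ : L ≡ + 3 * (t + + 6 * C₂)
        L≡ = trans (cong₂ (λ u v → u + v + + 6 * C₁) X≡ Y≡) (trans (cong (λ z → s + t + (+ 2 * t - s) + + 6 * z) eC) (l s t C₂))
          where
          l : ∀ s t C → s + t + (+ 2 * t - s) + + 6 * (C * + 3) ≡ + 3 * (t + + 6 * C)
          l = solve-∀

        reduced : (t + + 6 * C₂) * n ≡ - (+ 138 * cube C₂)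
        reduced = *-cancelˡ-≡ (+ 9) _ _ (trans (l (t + + 6 * C₂) n) (trans (sym (cong₂ _*_ L≡ N≡3n)) (trans eqn (trans (cong (λ z → - (+ 46 * (z * z * z))) eC) (l′ C₂)))))
          where
          l : ∀ a n → + 9 * (a * n) ≡ + 3 * a * (+ 3 * n)
          l = solve-∀
          l′ : ∀ C → - (+ 46 * (C * + 3 * (C * + 3) * (C * + 3))) ≡ + 9 * - (+ 138 * (C * C * C))
          l′ = solve-∀

        3∤X : ¬ ((+ 3) ∣ᶻ X)
        3∤X d = 3∤A (lin₂ d (dividesᶻ C₂ eC) (+ 1) (+ 2) (l A C₁))
          where
          l : ∀ A C → A ≡ + 1 * (A - + 2 * C) + + 2 * C
          l = solve-∀

        3∤s,t : (+ 3) ∣ᶻ s → (+ 3) ∣ᶻ t → ⊥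
        3∤s,t ds dt = 3∤X (subst ((+ 3) ∣ᶻ_) (sym X≡) (∣m∣n⇒∣m+n ds dt))

        3∤n : ¬ ((+ 3) ∣ᶻ n)
        3∤n d = 3∤X (subst ((+ 3) ∣ᶻ_) (sym X≡) (euclid-sq (s + t) prime[3] (lin₂ d (∣-refl {+ 3}) (+ 1) (s * t) (l s t))))
          where
          l : ∀ s t → (s + t) * (s + t) ≡ + 1 * (s * s - s * t + t * t) + s * t * + 3
          l = solve-∀

        3∣t+6C₂ : (+ 3) ∣ᶻ t + + 6 * C₂
        3∣t+6C₂ = [ (λ d → d) , (λ d → ⊥-elim (3∤n d)) ]′ (euclid (t + + 6 * C₂) n prime[3] (dividesᶻ (- (+ 46 * cube C₂)) (trans reduced (l (cube C₂)))))
          where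
          l : ∀ c → - (+ 138 * c) ≡ - (+ 46 * c) * + 3
          l = solve-∀

        3∣t : (+ 3) ∣ᶻ t
        3∣t = lin₂ 3∣t+6C₂ (∣-refl {+ 3}) (+ 1) (- (+ 2 * C₂)) (l t C₂)
          where
          l : ∀ t C → t ≡ + 1 * (t + + 6 * C) + - (+ 2 * C) * + 3
          l = solve-∀

        coprime-st : CoprimeZ s t
        coprime-st = coprime-by-primes s t λ l pr ds dt → coprime-prime coprimeXY pr
          (subst ((+ l) ∣ᶻ_) (sym X≡) (∣m∣n⇒∣m+n ds dt)) (lin₂ ds dt (- + 1) (+ 2) (trans Y≡ (e s t)))
          where
          e : ∀ s t → + 2 * t - s ≡ - + 1 * s + + 2 * t
          e = solve-∀

        module _ (K : ℤ) (eK : t + + 6 * C₂ ≡ + 46 * K * + 3) where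

          nK : n * K ≡ cube (- C₂)
          nK = *-cancelˡ-≡ (+ 138) _ _ (trans (a n K) (trans (cong (_* n) (sym eK)) (trans reduced (b C₂))))
            where
            a : ∀ N K → + 138 * (N * K) ≡ + 46 * K * + 3 * N
            a = solve-∀
            b : ∀ C → - (+ 138 * (C * C * C)) ≡ + 138 * (- C * - C * - C)
            b = solve-∀

          common : ∀ l → Prime l → (+ l) ∣ᶻ n → (+ l) ∣ᶻ K → ⊥
          common l pr dn dK = 3∤n (subst (λ z → (+ z) ∣ᶻ n) (common-prime l pr (lin₁ dn (+ 3) N≡3n)
              (lin₁ dK (+ 414) (trans L≡ (trans (cong (+ 3 *_) eK) (e K))))
              (lin₁ (euclid-cube (- C₂) pr (subst ((+ l) ∣ᶻ_) nK (∣m⇒∣m*n K dn))) (- + 3) (trans eC (c C₂)))) dn)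
            where
            c : ∀ C → C * + 3 ≡ - + 3 * - C
            c = solve-∀
            e : ∀ K → + 3 * (+ 46 * K * + 3) ≡ + 414 * K
            e = solve-∀

          coprime-nK : CoprimeZ n K
          coprime-nK = coprime-by-primes n K common

          K≢0 : K ≢ + 0
          K≢0 e = C₂≢0 (trans (sym (neg-involutive C₂)) (cong -_ (cube≡0 (- C₂) (trans (sym nK) (trans (cong (n *_) e) (*-zeroʳ n))))))

          from-cube : ∀ p q → s ≡ cubeRe p q → t ≡ cubeIm p q → (∃ λ r → K ≡ cube r) → Descent C₁
          from-cube p q es et (r , er) = record
            { p = p ; q = q ; r = r
            ; r≢0 = λ { refl → K≢0 er }
            ; size = trans (cong ∣_∣ eC) (trans (abs-* C₂ (+ 3)) (trans (ℕₚ.*-comm (∣ C₂ ∣) 3) (cong (3 ℕ.*_) (trans (sym (∣-i∣≡∣i∣ C₂)) (trans (cong ∣_∣ (sym νr)) (abs-* ν r))))))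
            ; eq = *-cancelˡ-≡ (+ 3) _ _ (trans (a (p * q * (p - q)) (ν * r)) (trans (cong₂ (λ u v → u + - + 6 * v) (sym et) νr) (trans (b t C₂) (trans eK (trans (cong (λ z → + 46 * z * + 3) er) (c (cube r)))))))
            }
            where
            ν : ℤ
            ν = norm ⟨ p , q ⟩
            n≡ : n ≡ cube ν
            n≡ = trans (cong₂ (λ u v → norm ⟨ u , v ⟩) es et) (norm-cube p q)
            νr : ν * r ≡ - C₂
            νr = cube-injective (ν * r) (- C₂) (trans (d ν r) (trans (sym (cong₂ _*_ n≡ er)) nK))
              where
              d : ∀ ν r → ν * r * (ν * r) * (ν * r) ≡ ν * ν * ν * (r * r * r)
              d = solve-∀
            a : ∀ w z → + 3 * (w - + 2 * z) ≡ + 3 * w + - + 6 * z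
            a = solve-∀
            b : ∀ t C → t + - + 6 * - C ≡ t + + 6 * C
            b = solve-∀
            c : ∀ z → + 46 * z * + 3 ≡ + 3 * (+ 46 * z)
            c = solve-∀

          3∣Im : ∀ p q → (+ 3) ∣ᶻ cubeIm p q
          3∣Im p q = ∣m⇒∣m*n {+ 3} (p * q * (p - q)) (∣-refl {+ 3})

          -- Since 3 divides t, the units ω and 1 + ω would make 3 divide s as well; only a pure
          -- cube remains.
          finish : AssociateCube s t → Descent C₁
          finish (p , q , inj₁ (es , et)) = from-cube p q es et
            (cube-of-coprime K n (- C₂) K≢0 (Cop.sym coprime-nK) (trans (*-comm K n) nK))
          finish (p , q , inj₂ (inj₁ (es , et))) = ⊥-elim (3∤s,t (lin₁ (3∣Im p q) (- + 1) (trans es (sym (-1*i≡-i (cubeIm p q))))) 3∣t)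
          finish (p , q , inj₂ (inj₂ (es , et))) = ⊥-elim (3∤s,t (lin₂ 3∣t (3∣Im p q) (+ 1) (- + 1) (trans es (trans (cong (_- cubeIm p q) (sym et)) (l t (cubeIm p q))))) 3∣t)
            where
            l : ∀ t v → t - v ≡ + 1 * t + - + 1 * v
            l = solve-∀

          descent : Descent C₁
          descent = finish (cube-root s t K (- C₂) coprime-st 3∤n coprime-nK nK)

        with-quotient : ∀ j → t + + 6 * C₂ ≡ j * + 3 → Descent C₁
        with-quotient j ej = go (46-divides (part prime[2] 2∣L λ ()) (part prime[23] 23∣L λ ()))
          where
          L≡9j : L ≡ + 3 * (+ 3 * j)
          L≡9j = trans L≡ (cong (+ 3 *_) (trans ej (*-comm j (+ 3))))
          part : ∀ {l} → Prime l → (+ l) ∣ᶻ L → l ≢ 3 → (+ l) ∣ᶻ j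
          part {l} pr d l≢3 = strip j (strip (+ 3 * j) (subst ((+ l) ∣ᶻ_) L≡9j d))
            where
            strip : ∀ z → (+ l) ∣ᶻ + 3 * z → (+ l) ∣ᶻ z
            strip z d = [ (λ d′ → ⊥-elim (l≢3 (prime-∣-prime pr prime[3] d′))) , (λ d′ → d′) ]′ (euclid (+ 3) z pr d)
          go : (∃ λ K → j ≡ + 46 * K) → Descent C₁
          go (K , e) = descent K (trans ej (cong (_* + 3) e))

        result : Descent C₁
        result = case 3∣t+6C₂ of λ { (dividesᶻ j e) → with-quotient j e }

    descent-point : Descent C₁
    descent-point = from 3∣A+B
      where
      from : (+ 3) ∣ᶻ A + B → Descent C₁
      from (dividesᶻ h eh) = case 3∣C₁ h eh of λ { (dividesᶻ C₂ eC) → result h C₂ eh eC }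

-- Closing the descent, and the third term of the sequence

module ThirdIterate where

  open CriticalSequence using (prime-divisor; coprime-power; coprime-∣ˡ; IsSq; E; A; EvenSplit; even-split; A-coprime; *-^-comm; ^-injectiveˡ)
  import Algebra.Solver.Ring.NaturalCoefficients.Default as SemiringSolver
  open import Data.Empty using (⊥)
  open import Data.Integer hiding (suc)
  open import Data.Integer.Properties
  open import Data.Integer.Divisibility.Signed renaming (_∣_ to infix 4 _∣ᶻ_; divides to dividesᶻ) 
  import Data.Integer.DivMod as DM
  open import Data.Integer.Tactic.RingSolver using (solve-∀)
  open import Data.Nat as ℕ using (ℕ; z≤n; s≤s)
  import Data.Nat.Properties as ℕₚ
  import Data.Nat.Divisibility as ℕ∣
  import Data.Nat.Coprimality as Cop
  open import Data.Nat.GCD using (module Bézout; gcd; gcd[m,n]∣m; gcd[m,n]∣n; gcd-greatest)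
  open import Data.Nat.Induction using (<-wellFounded)
  open import Data.Nat.Primality using (Prime; ¬prime[1]; prime[2])
  open import Data.Product using (∃; _×_; _,_; proj₁; proj₂)
  open import Data.Sum using ([_,_]′)
  open import Induction.WellFounded using (Acc; acc)
  open import Relation.Binary.PropositionalEquality
  open import Relation.Nullary using (¬_)
  open import Relation.Nullary.Decidable using (toSum)

  open IntegerDivisibility
  open Eisenstein
  open CubeRoots
  open CubicCurve
  open DescentStep

  record Point (ρ : ℤ) : Set where
    field
      a b c   : ℤ
      coprime : CoprimeZ a b
      curve   : Curve a b c
      c≢0     : c ≢ + 0
      c∣ρ     : c ∣ᶻ ρ

  *≢0ˡ : ∀ {x y z} → z ≢ + 0 → x * y ≡ z → x ≢ + 0
  *≢0ˡ z≢0 e refl = z≢0 (sym e)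

  *≢0ʳ : ∀ {x y z} → z ≢ + 0 → x * y ≡ z → y ≢ + 0
  *≢0ʳ {x} z≢0 e refl = z≢0 (trans (sym e) (*-zeroʳ x))

  -- With x = ρ/k and y = m/k the equation is y² = x³ + (x + 1)², an elliptic curve on which (0, 1)
  -- has order 3. In coprime integers k (m² - (k + ρ)²) = ρ³ makes k a cube p³ and the other factor
  -- a cube σ³ with pσ = ρ, and that factor splits once more as a difference of squares.
  module PrimitivePoint (k m ρ : ℤ) (ρ≢0 : ρ ≢ + 0) (eq : k * (m * m) ≡ k * ((k + ρ) * (k + ρ)) + ρ * ρ * ρ)
                        (no-common : ∀ l → Prime l → (+ l) ∣ᶻ k → (+ l) ∣ᶻ m → (+ l) ∣ᶻ ρ → ⊥) where

    private
      S : ℤ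
      S = m * m - (k + ρ) * (k + ρ)

      kS : k * S ≡ cube ρ
      kS = trans (l k m (k + ρ)) (trans (cong (_- k * ((k + ρ) * (k + ρ))) eq) (l′ (k * ((k + ρ) * (k + ρ))) (cube ρ)))
        where
        l : ∀ k m x → k * (m * m - x * x) ≡ k * (m * m) - k * (x * x)
        l = solve-∀
        l′ : ∀ x y → x + y - x ≡ y
        l′ = solve-∀

      ρ³≢0 : cube ρ ≢ + 0
      ρ³≢0 e = ρ≢0 (cube≡0 ρ e)

      coprime-kS : CoprimeZ k S
      coprime-kS = coprime-by-primes k S λ l pr dk dS →
        let dρ = euclid-cube ρ pr (subst ((+ l) ∣ᶻ_) kS (∣m⇒∣m*n S dk)) in
        no-common l pr dk (euclid-sq m pr (lin₂ dS (∣m∣n⇒∣m+n dk dρ) (+ 1) (k + ρ) (e m (k + ρ)))) dρ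
        where
        e : ∀ m x → m * m ≡ + 1 * (m * m - x * x) + x * x
        e = solve-∀

      module _ (p σ : ℤ) (ep : k ≡ cube p) (eσ : S ≡ cube σ) where

        pσ : p * σ ≡ ρ
        pσ = cube-injective (p * σ) ρ (trans (d p σ) (trans (sym (cong₂ _*_ ep eσ)) kS))
          where
          d : ∀ p s → p * s * (p * s) * (p * s) ≡ p * p * p * (s * s * s)
          d = solve-∀

        p≢0 : p ≢ + 0
        p≢0 = *≢0ˡ ρ≢0 pσ

        σ³≢0 : cube σ ≢ + 0
        σ³≢0 e = *≢0ʳ {p} ρ≢0 pσ (cube≡0 σ e)

        ∣cube : ∀ {l x} → l ∣ᶻ x → l ∣ᶻ cube x
        ∣cube {l} {x} d = ∣n⇒∣m*n (x * x) d

        coprime-pσ : ∀ l → Prime l → (+ l) ∣ᶻ p → (+ l) ∣ᶻ σ → ⊥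
        coprime-pσ l pr dp dσ = coprime-prime coprime-kS pr (subst ((+ l) ∣ᶻ_) (sym ep) (∣cube dp)) (subst ((+ l) ∣ᶻ_) (sym eσ) (∣cube dσ))

        T f f′ : ℤ
        T  = k + ρ
        f  = m - T
        f′ = m + T

        T≡ : T ≡ p * p * p + p * σ
        T≡ = cong₂ _+_ ep (sym pσ)

        ff′ : f * f′ ≡ cube σ
        ff′ = trans (l m T) eσ
          where
          l : ∀ m x → (m - x) * (m + x) ≡ m * m - x * x
          l = solve-∀

        T-σ : ∀ l → Prime l → (+ l) ∣ᶻ T → (+ l) ∣ᶻ σ → ⊥
        T-σ l pr dT dσ = coprime-pσ l pr (euclid-cube p pr (lin₂ (subst ((+ l) ∣ᶻ_) T≡ dT) dσ (+ 1) (- p) (e p σ))) dσ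
          where
          e : ∀ p s → p * p * p ≡ + 1 * (p * p * p + p * s) + - p * s
          e = solve-∀

        f′-f : ∀ m T → + 2 * T ≡ + 1 * (m + T) + - + 1 * (m - T)
        f′-f = solve-∀

        cubes-product : ∀ {x y q s z} → x ≡ cube q → y ≡ cube s → x * y ≡ cube z → q * s ≡ z
        cubes-product {q = q} {s} {z} ex ey e = cube-injective (q * s) z (trans (d q s) (trans (sym (cong₂ _*_ ex ey)) e))
          where
          d : ∀ p s → p * s * (p * s) * (p * s) ≡ p * p * p * (s * s * s)
          d = solve-∀

        -- For odd σ the factors m ∓ T of σ³ are coprime, so they are cubes q³ and s³ with qs = σ,
        -- and s³ - q³ = 2T = 2p³ + 2pqs is a point on the cubic.
        odd-case : ¬ ((+ 2) ∣ᶻ σ) → Point ρ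
        odd-case 2∤σ = go (cube-of-coprime f f′ σ (*≢0ˡ σ³≢0 ff′) cop ff′)
                          (cube-of-coprime f′ f σ (*≢0ʳ {f} σ³≢0 ff′) (Cop.sym cop) (trans (*-comm f′ f) ff′))
          where
          common : ∀ l → Prime l → (+ l) ∣ᶻ f → (+ l) ∣ᶻ f′ → ⊥
          common l pr df df′ = [ (λ d → 2∤σ (subst (λ z → (+ z) ∣ᶻ σ) (prime-∣-prime pr prime[2] d) dσ)) , (λ d → T-σ l pr d dσ) ]′
                                 (euclid (+ 2) T pr (lin₂ df′ df (+ 1) (- + 1) (f′-f m T)))
            where
            dσ : (+ l) ∣ᶻ σ
            dσ = euclid-cube σ pr (subst ((+ l) ∣ᶻ_) ff′ (∣m⇒∣m*n f′ df))
          cop : CoprimeZ f f′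
          cop = coprime-by-primes f f′ common
          go : (∃ λ q → f ≡ cube q) → (∃ λ s → f′ ≡ cube s) → Point ρ
          go (q , eq′) (s , es) = record
            { a = s ; b = - q ; c = - p
            ; coprime = coprime-by-primes s (- q) λ l pr ds dq → common l pr
                (subst ((+ l) ∣ᶻ_) (sym eq′) (∣cube (lin₁ dq (- + 1) (n q)))) (subst ((+ l) ∣ᶻ_) (sym es) (∣cube ds))
            ; curve = trans (l₁ s q p) (trans (cong₂ (λ u v → u - v - + 2 * (p * p * p)) (sym es) (sym eq′)) (trans (l₂ m T p)
                (trans (cong (λ z → + 2 * z - + 2 * (p * p * p)) T≡) (trans (cong (λ z → + 2 * (p * p * p + p * z) - + 2 * (p * p * p)) (sym qs)) (l₃ p q s)))))
            ; c≢0 = λ e → p≢0 (trans (n p) (cong (- + 1 *_) e))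
            ; c∣ρ = dividesᶻ (- σ) (trans (sym pσ) (l₄ p σ)) }
            where
            qs : q * s ≡ σ
            qs = cubes-product {f} {f′} {q} {s} {σ} eq′ es ff′
            n : ∀ q → q ≡ - + 1 * - q
            n = solve-∀
            l₁ : ∀ s q p → s * s * s + - q * - q * - q + + 2 * (- p * - p * - p) ≡ s * s * s - q * q * q - + 2 * (p * p * p)
            l₁ = solve-∀
            l₂ : ∀ m T p → m + T - (m - T) - + 2 * (p * p * p) ≡ + 2 * T - + 2 * (p * p * p)
            l₂ = solve-∀
            l₃ : ∀ p q s → + 2 * (p * p * p + p * (q * s)) - + 2 * (p * p * p) ≡ + 2 * (s * - q * - p)
            l₃ = solve-∀
            l₄ : ∀ p s → p * s ≡ - s * - p
            l₄ = solve-∀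

        -- The halves of m - T and m + T are coprime with product 2σ′³. One of them is even, and
        -- taking out that factor 2 leaves two cubes; their difference equation is again the cubic.
        module Even (σ′ f₁ f₂ : ℤ) (eσ′ : σ ≡ σ′ * + 2) (e₁ : f ≡ f₁ * + 2) (e₂ : f′ ≡ f₂ * + 2) where

          f₁f₂ : f₁ * f₂ ≡ + 2 * cube σ′
          f₁f₂ = *-cancelˡ-≡ (+ 4) _ _ (trans (l f₁ f₂) (trans (sym (cong₂ _*_ e₁ e₂)) (trans ff′ (trans (cong cube eσ′) (l′ σ′)))))
            where
            l : ∀ x y → + 4 * (x * y) ≡ x * + 2 * (y * + 2)
            l = solve-∀
            l′ : ∀ x → x * + 2 * (x * + 2) * (x * + 2) ≡ + 4 * (+ 2 * (x * x * x))
            l′ = solve-∀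

          f₂-f₁ : f₂ - f₁ ≡ p * p * p + + 2 * (p * σ′)
          f₂-f₁ = *-cancelˡ-≡ (+ 2) _ _ (trans (l f₁ f₂) (trans (sym (cong₂ _-_ e₂ e₁)) (trans (l′ m T) (cong (+ 2 *_) (trans T≡ (trans (cong (λ z → p * p * p + p * z) eσ′) (l″ p σ′)))))))
            where
            l : ∀ x y → + 2 * (y - x) ≡ y * + 2 - x * + 2
            l = solve-∀
            l′ : ∀ m T → m + T - (m - T) ≡ + 2 * T
            l′ = solve-∀
            l″ : ∀ p s → p * p * p + p * (s * + 2) ≡ p * p * p + + 2 * (p * s)
            l″ = solve-∀

          ∣σ : ∀ {l} → l ∣ᶻ σ′ → l ∣ᶻ σ
          ∣σ d = subst (_ ∣ᶻ_) (sym eσ′) (∣m⇒∣m*n (+ 2) d)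

          common : ∀ l → Prime l → (+ l) ∣ᶻ f₁ → (+ l) ∣ᶻ f₂ → ⊥
          common l pr d₁ d₂ = T-σ l pr (lin₂ d₂ d₁ (+ 1) (- + 1) T≡f₂-f₁)
              ([ (λ d → subst ((+ l) ∣ᶻ_) (sym eσ′) (∣n⇒∣m*n σ′ d)) , (λ d → ∣σ (euclid-cube σ′ pr d)) ]′
                (euclid (+ 2) (cube σ′) pr (subst ((+ l) ∣ᶻ_) f₁f₂ (∣m⇒∣m*n f₂ d₁))))
            where
            a : ∀ p s → p * p * p + p * (s * + 2) ≡ p * p * p + + 2 * (p * s)
            a = solve-∀
            b : ∀ x y → y - x ≡ + 1 * y + - + 1 * x
            b = solve-∀
            T≡f₂-f₁ : T ≡ + 1 * f₂ + - + 1 * f₁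
            T≡f₂-f₁ = trans (trans T≡ (trans (cong (λ z → p * p * p + p * z) eσ′) (a p σ′))) (trans (sym f₂-f₁) (b f₁ f₂))

          σ′³≢0 : cube σ′ ≢ + 0
          σ′³≢0 e = σ³≢0 (cong cube (trans eσ′ (cong (_* + 2) (cube≡0 σ′ e))))

          n : ∀ q → q ≡ - + 1 * - q
          n = solve-∀

          coprime-with-p : ∀ q s → q * s ≡ σ′ → ∀ l → Prime l → (+ l) ∣ᶻ q → (+ l) ∣ᶻ - p → ⊥
          coprime-with-p q s e l pr dq dp = coprime-pσ l pr (lin₁ dp (- + 1) (n p)) (∣σ (subst ((+ l) ∣ᶻ_) e (∣m⇒∣m*n s dq)))

          ρ≡ : ∀ q s → q * s ≡ σ′ → ρ ≡ + 2 * p * q * s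
          ρ≡ q s e = trans (sym pσ) (trans (cong (p *_) (trans eσ′ (cong (_* + 2) (sym e)))) (l p q s))
            where
            l : ∀ p q s → p * (q * s * + 2) ≡ + 2 * p * q * s
            l = solve-∀

          s≢0 : ∀ q s → q * s ≡ σ′ → s ≢ + 0
          s≢0 q s e = *≢0ʳ {q} (λ z → σ′³≢0 (cong cube z)) e

          first-even : ∀ h → f₁ ≡ h * + 2 → Point ρ
          first-even h eh = go (cube-of-coprime f₂ h σ′ (*≢0ˡ σ′³≢0 f₂h) cop f₂h) (cube-of-coprime h f₂ σ′ (*≢0ʳ {f₂} σ′³≢0 f₂h) (Cop.sym cop) (trans (*-comm h f₂) f₂h))
            where
            f₂h : f₂ * h ≡ cube σ′
            f₂h = *-cancelˡ-≡ (+ 2) _ _ (trans (l f₂ h) (trans (cong (_* f₂) (sym eh)) f₁f₂))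
              where
              l : ∀ f h → + 2 * (f * h) ≡ h * + 2 * f
              l = solve-∀
            cop : CoprimeZ f₂ h
            cop = coprime-by-primes f₂ h λ l pr d d′ → common l pr (subst ((+ l) ∣ᶻ_) (sym eh) (∣m⇒∣m*n (+ 2) d′)) d
            go : (∃ λ q → f₂ ≡ cube q) → (∃ λ s → h ≡ cube s) → Point ρ
            go (q , eq′) (s , es) = record
              { a = q ; b = - p ; c = - s
              ; coprime = coprime-by-primes q (- p) (coprime-with-p q s qs)
              ; curve = trans (l₁ q p s) (trans (cong₂ (λ u v → u - v * + 2 - p * p * p) (sym eq′) (sym es)) (trans (cong (λ z → f₂ - z - p * p * p) (sym eh))
                  (trans (cong (_- p * p * p) f₂-f₁) (trans (cong (λ z → p * p * p + + 2 * (p * z) - p * p * p) (sym qs)) (l₂ p q s)))))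
              ; c≢0 = λ e → s≢0 q s qs (trans (n s) (cong (- + 1 *_) e))
              ; c∣ρ = dividesᶻ (- (+ 2 * p * q)) (trans (ρ≡ q s qs) (l₃ (+ 2 * p * q) s)) }
              where
              qs : q * s ≡ σ′
              qs = cubes-product {f₂} {h} {q} {s} {σ′} eq′ es f₂h
              l₁ : ∀ q p s → q * q * q + - p * - p * - p + + 2 * (- s * - s * - s) ≡ q * q * q - s * s * s * + 2 - p * p * p
              l₁ = solve-∀
              l₂ : ∀ p q s → p * p * p + + 2 * (p * (q * s)) - p * p * p ≡ + 2 * (q * - p * - s)
              l₂ = solve-∀
              l₃ : ∀ x s → x * s ≡ - x * - s
              l₃ = solve-∀

          second-even : ∀ h → f₂ ≡ h * + 2 → Point ρ
          second-even h eh = go (cube-of-coprime f₁ h σ′ (*≢0ˡ σ′³≢0 f₁h) cop f₁h) (cube-of-coprime h f₁ σ′ (*≢0ʳ {f₁} σ′³≢0 f₁h) (Cop.sym cop) (trans (*-comm h f₁) f₁h))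
            where
            f₁h : f₁ * h ≡ cube σ′
            f₁h = *-cancelˡ-≡ (+ 2) _ _ (trans (l f₁ h) (trans (cong (f₁ *_) (sym eh)) f₁f₂))
              where
              l : ∀ f h → + 2 * (f * h) ≡ f * (h * + 2)
              l = solve-∀
            cop : CoprimeZ f₁ h
            cop = coprime-by-primes f₁ h λ l pr d d′ → common l pr d (subst ((+ l) ∣ᶻ_) (sym eh) (∣m⇒∣m*n (+ 2) d′))
            go : (∃ λ q → f₁ ≡ cube q) → (∃ λ s → h ≡ cube s) → Point ρ
            go (q , eq′) (s , es) = record
              { a = - q ; b = - p ; c = s
              ; coprime = coprime-by-primes (- q) (- p) λ l pr dq dp → coprime-with-p q s qs l pr (lin₁ dq (- + 1) (n q)) dp
              ; curve = trans (l₁ q p s) (trans (cong₂ (λ u v → u * + 2 - v - p * p * p) (sym es) (sym eq′)) (trans (cong (λ z → z - f₁ - p * p * p) (sym eh))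
                  (trans (cong (_- p * p * p) f₂-f₁) (trans (cong (λ z → p * p * p + + 2 * (p * z) - p * p * p) (sym qs)) (l₂ p q s)))))
              ; c≢0 = s≢0 q s qs
              ; c∣ρ = dividesᶻ (+ 2 * p * q) (ρ≡ q s qs) }
              where
              qs : q * s ≡ σ′
              qs = cubes-product {f₁} {h} {q} {s} {σ′} eq′ es f₁h
              l₁ : ∀ q p s → - q * - q * - q + - p * - p * - p + + 2 * (s * s * s) ≡ s * s * s * + 2 - q * q * q - p * p * p
              l₁ = solve-∀
              l₂ : ∀ p q s → p * p * p + + 2 * (p * (q * s)) - p * p * p ≡ + 2 * (- q * - p * s)
              l₂ = solve-∀

          point : Point ρ
          point = [ (λ { (dividesᶻ h e) → first-even h e }) , (λ { (dividesᶻ h e) → second-even h e }) ]′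
                    (euclid f₁ f₂ prime[2] (dividesᶻ (cube σ′) (trans f₁f₂ (*-comm (+ 2) (cube σ′)))))

        even-case : (+ 2) ∣ᶻ σ → Point ρ
        even-case d@(dividesᶻ σ′ eσ′) = go (proj₁ halves) (proj₂ halves)
          where
          2∣2T : (+ 2) ∣ᶻ + 2 * T
          2∣2T = ∣m⇒∣m*n {+ 2} T (∣-refl {+ 2})
          l₁ : ∀ m T → m + T ≡ + 1 * (m - T) + + 1 * (+ 2 * T)
          l₁ = solve-∀
          l₂ : ∀ m T → m - T ≡ + 1 * (m + T) + - + 1 * (+ 2 * T)
          l₂ = solve-∀
          halves : ((+ 2) ∣ᶻ f) × ((+ 2) ∣ᶻ f′)
          halves = [ (λ e → e , lin₂ e 2∣2T (+ 1) (+ 1) (l₁ m T)) , (λ e → lin₂ e 2∣2T (+ 1) (- + 1) (l₂ m T) , e) ]′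
                     (euclid f f′ prime[2] (subst ((+ 2) ∣ᶻ_) (sym ff′) (∣cube d)))
          go : (+ 2) ∣ᶻ f → (+ 2) ∣ᶻ f′ → Point ρ
          go (dividesᶻ f₁ e₁) (dividesᶻ f₂ e₂) = Even.point σ′ f₁ f₂ eσ′ e₁ e₂

        parity : Point ρ
        parity = [ even-case , odd-case ]′ (toSum ((+ 2) ∣? σ))

    primitive-point : Point ρ
    primitive-point = go (cube-of-coprime k S ρ (*≢0ˡ ρ³≢0 kS) coprime-kS kS)
                         (cube-of-coprime S k ρ (*≢0ʳ {k} ρ³≢0 kS) (Cop.sym coprime-kS) (trans (*-comm S k) kS))
      where
      go : (∃ λ p → k ≡ cube p) → (∃ λ σ → S ≡ cube σ) → Point ρ
      go (p , ep) (σ , eσ) = parity p σ ep eσ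

  -- The equation is homogeneous, so common factors can be divided out; a divisor of the smaller ρ
  -- still divides ρ.
  curve-point : ∀ k m ρ → ρ ≢ + 0 → k * (m * m) ≡ k * ((k + ρ) * (k + ρ)) + ρ * ρ * ρ → Point ρ
  curve-point k m ρ ρ≢0 eq = go (∣-abs {g} (ℕ∣.∣-trans (gcd[m,n]∣m g₀ (∣ ρ ∣)) (gcd[m,n]∣m (∣ k ∣) (∣ m ∣))))
                                (∣-abs {g} (ℕ∣.∣-trans (gcd[m,n]∣m g₀ (∣ ρ ∣)) (gcd[m,n]∣n (∣ k ∣) (∣ m ∣)))) (∣-abs {g} (gcd[m,n]∣n g₀ (∣ ρ ∣)))
    where
    g₀ g : ℕ
    g₀ = gcd (∣ k ∣) (∣ m ∣)
    g = gcd g₀ (∣ ρ ∣)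
    g≢0 : g ≢ 0
    g≢0 e = ρ≢0 (∣i∣≡0⇒i≡0 (ℕ∣.0∣⇒≡0 (subst (ℕ∣._∣ ∣ ρ ∣) e (gcd[m,n]∣n g₀ (∣ ρ ∣)))))
    instance
      g-nonZero = ℕ.≢-nonZero g≢0
      g-nonZeroℤ = ≢-nonZero {+ g} (λ e → g≢0 (+-injective e))
    go : (+ g) ∣ᶻ k → (+ g) ∣ᶻ m → (+ g) ∣ᶻ ρ → Point ρ
    go (dividesᶻ k′ ek) (dividesᶻ m′ em) (dividesᶻ ρ′ eρ) = lift (PrimitivePoint.primitive-point k′ m′ ρ′ ρ′≢0 eq′ no-common)
      where
      ρ′≢0 : ρ′ ≢ + 0
      ρ′≢0 e = ρ≢0 (trans eρ (cong (_* + g) e))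
      eq′ : k′ * (m′ * m′) ≡ k′ * ((k′ + ρ′) * (k′ + ρ′)) + ρ′ * ρ′ * ρ′
      eq′ = *-cancelʳ-≡ _ _ (+ g) (*-cancelʳ-≡ _ _ (+ g) (*-cancelʳ-≡ _ _ (+ g)
              (trans (l₁ k′ m′ (+ g)) (trans (sym (cong₂ (λ u v → u * (v * v)) ek em)) (trans eq (trans (cong₂ (λ u v → u * ((u + v) * (u + v)) + v * v * v) ek eρ) (l₂ k′ ρ′ (+ g))))))))
        where
        l₁ : ∀ k m g → k * (m * m) * g * g * g ≡ k * g * (m * g * (m * g))
        l₁ = solve-∀
        l₂ : ∀ k r g → k * g * ((k * g + r * g) * (k * g + r * g)) + r * g * (r * g) * (r * g) ≡ (k * ((k + r) * (k + r)) + r * r * r) * g * g * g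
        l₂ = solve-∀
      no-common : ∀ l → Prime l → (+ l) ∣ᶻ k′ → (+ l) ∣ᶻ m′ → (+ l) ∣ᶻ ρ′ → ⊥
      no-common l pr dk dm dρ = ¬prime[1] (subst Prime (ℕ∣.∣1⇒≡1 (ℕ∣.*-cancelʳ-∣ g (subst (l ℕ.* g ℕ∣.∣_) (sym (ℕₚ.*-identityˡ g))
          (gcd-greatest (gcd-greatest (part ek dk) (part em dm)) (part eρ dρ))))) pr)
        where
        part : ∀ {x x′} → x ≡ x′ * + g → (+ l) ∣ᶻ x′ → l ℕ.* g ℕ∣.∣ ∣ x ∣
        part {x} {x′} e d = subst (l ℕ.* g ℕ∣.∣_) (sym (trans (cong ∣_∣ e) (abs-* x′ (+ g)))) (ℕ∣.*-monoˡ-∣ g (abs-∣ d))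
      lift : Point ρ′ → Point ρ
      lift P = record { a = Point.a P ; b = Point.b P ; c = Point.c P ; coprime = Point.coprime P ; curve = Point.curve P ; c≢0 = Point.c≢0 P
                      ; c∣ρ = subst (Point.c P ∣ᶻ_) (sym eρ) (∣m⇒∣m*n (+ g) (Point.c∣ρ P)) }

  -- Infinite descent on |C|. Four times the descent equation, completed to a square in p, is km² =
  -- k(k + ρ)² + ρ³ with k = q - 2r, m = 2p - q, ρ = 6r. The new C divides 6r, and 6|r| < 9 N(p +
  -- qω) |r| = |C|.
  no-point : ∀ A B C → Acc ℕ._<_ ∣ C ∣ → CoprimeZ A B → Curve A B C → C ≢ + 0 → ⊥
  no-point A B C (acc rs) cop curve C≢0 = [ divisible , no-point-3∤C A B C cop curve ]′ (toSum ((+ 3) ∣? C))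
    where
    continue : ∀ C₁ → C ≡ + 3 * C₁ → C₁ ≢ + 0 → Descent C₁ → ⊥
    continue C₁ eC C₁≢0 record { p = p ; q = q ; r = r ; r≢0 = r≢0 ; size = size ; eq = eq } =
      recurse (curve-point (q - + 2 * r) (+ 2 * p - q) (+ 6 * r) 6r≢0
        (trans (l₁ p q r) (trans (cong (λ z → + 4 * z + (rest - + 184 * (r * r * r))) eq) (l₂ rest r))))
      where
      rest : ℤ
      rest = (q - + 2 * r) * ((q - + 2 * r + + 6 * r) * (q - + 2 * r + + 6 * r)) + + 6 * r * (+ 6 * r) * (+ 6 * r)
      l₁ : ∀ p q r → (q - + 2 * r) * ((+ 2 * p - q) * (+ 2 * p - q)) ≡ + 4 * (p * q * (p - q) - + 2 * ((p * p - p * q + q * q) * r))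
             + ((q - + 2 * r) * ((q - + 2 * r + + 6 * r) * (q - + 2 * r + + 6 * r)) + + 6 * r * (+ 6 * r) * (+ 6 * r) - + 184 * (r * r * r))
      l₁ = solve-∀
      l₂ : ∀ z r → + 4 * (+ 46 * (r * r * r)) + (z - + 184 * (r * r * r)) ≡ z
      l₂ = solve-∀
      6r≢0 : + 6 * r ≢ + 0
      6r≢0 e = r≢0 (*-cancelˡ-≡ (+ 6) r (+ 0) e)
      ∣r∣>0 : 0 ℕ.< ∣ r ∣
      ∣r∣>0 = ℕₚ.n≢0⇒n>0 (λ e → r≢0 (∣i∣≡0⇒i≡0 e))
      ν : ℕ
      ν = ∣ norm ⟨ p , q ⟩ ∣
      ν>0 : 0 ℕ.< ν
      ν>0 = ℕₚ.n≢0⇒n>0 (λ e → C₁≢0 (∣i∣≡0⇒i≡0 (trans size (cong (λ z → 3 ℕ.* (z ℕ.* ∣ r ∣)) e))))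
      recurse : Point (+ 6 * r) → ⊥
      recurse P = no-point (Point.a P) (Point.b P) (Point.c P) (rs smaller) (Point.coprime P) (Point.curve P) (Point.c≢0 P)
        where
        instance nz = ℕ.≢-nonZero {∣ + 6 * r ∣} (λ e → 6r≢0 (∣i∣≡0⇒i≡0 e))
        smaller : ∣ Point.c P ∣ ℕ.< ∣ C ∣
        smaller = begin-strict
          ∣ Point.c P ∣            ≤⟨ ℕ∣.∣⇒≤ (∣⇒∣ᵤ (Point.c∣ρ P)) ⟩
          ∣ + 6 * r ∣              ≡⟨ abs-* (+ 6) r ⟩
          6 ℕ.* ∣ r ∣              <⟨ ℕₚ.*-monoˡ-< (∣ r ∣) {{ℕ.>-nonZero ∣r∣>0}} {6} {9} (s≤s (s≤s (s≤s (s≤s (s≤s (s≤s (s≤s z≤n))))))) ⟩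
          9 ℕ.* ∣ r ∣              ≤⟨ ℕₚ.*-monoʳ-≤ 9 (ℕₚ.m≤n*m (∣ r ∣) ν {{ℕ.>-nonZero ν>0}}) ⟩
          9 ℕ.* (ν ℕ.* ∣ r ∣)      ≡⟨ ℕₚ.*-assoc 3 3 (ν ℕ.* ∣ r ∣) ⟩
          3 ℕ.* (3 ℕ.* (ν ℕ.* ∣ r ∣)) ≡⟨ cong (3 ℕ.*_) size ⟨
          3 ℕ.* ∣ C₁ ∣             ≡⟨ abs-* (+ 3) C₁ ⟨
          ∣ + 3 * C₁ ∣             ≡⟨ cong ∣_∣ eC ⟨
          ∣ C ∣                    ∎
          where open ℕₚ.≤-Reasoning
    divisible : (+ 3) ∣ᶻ C → ⊥
    divisible (dividesᶻ C₁ e) = continue C₁ eC C₁≢0 (descent-point A B C₁ cop (subst (Curve A B) eC curve) C₁≢0)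
      where
      eC : C ≡ + 3 * C₁
      eC = trans e (*-comm C₁ (+ 3))
      C₁≢0 : C₁ ≢ + 0
      C₁≢0 z = C≢0 (trans eC (trans (cong (+ 3 *_) z) refl))

  -- With w = 2z and a = 1 + 2uz, a quarter of w³ = 4u³ ± 4a says that (-u, ∓1, z) lies on the
  -- cubic.
  third-nonsquare : ∀ c → 2 ℕ∣.∣ c → 0 ℕ.< c → ¬ IsSq (A c 2)
  third-nonsquare c 2∣c 0<c sq = from (even-split c (A c 1) 3 2∣c 0<c (A-coprime c 1) sq)
    where
    from : EvenSplit c (A c 1) 3 → ⊥
    from record { u = u ; w = w ; c≡ = c≡ ; 2∣w = ℕ∣.divides z ez ; eq = eq } =
      [ (λ e → no-point (- + u) (- + 1) (+ z) (<-wellFounded _) (λ { (_ , d) → ℕ∣.∣1⇒≡1 d }) (curve₁ e) z≢0)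
      , (λ e → no-point (- + u) (+ 1) (+ z) (<-wellFounded _) (λ { (_ , d) → ℕ∣.∣1⇒≡1 d }) (curve₂ e) z≢0) ]′ eq
      where
      z≢0 : + z ≢ + 0
      z≢0 e = ℕₚ.<⇒≢ 0<c (sym (trans c≡ (trans (cong (u ℕ.*_) (trans ez (cong (ℕ._* 2) (+-injective e)))) (ℕₚ.*-zeroʳ u))))
      a : ℤ
      a = + 1 + + u * (+ z * + 2)
      a≡ : + (A c 1) ≡ a
      a≡ = trans (cong (λ x → + (1 ℕ.+ x)) (trans (ℕₚ.*-identityʳ c) (trans c≡ (cong (u ℕ.*_) ez)))) (cong (_+_ (+ 1)) (trans (pos-* u (z ℕ.* 2)) (cong (+ u *_) (pos-* z 2))))
      w³ : + (w ℕ.^ 3) ≡ cube (+ z * + 2)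
      w³ = trans (pos-cube w) (cong cube (trans (cong +_ ez) (pos-* z 2)))
      4u³ : + (4 ℕ.* u ℕ.^ 3) ≡ + 4 * cube (+ u)
      4u³ = trans (pos-* 4 (u ℕ.^ 3)) (cong (+ 4 *_) (pos-cube u))
      4a : + (4 ℕ.* A c 1) ≡ + 4 * a
      4a = trans (pos-* 4 (A c 1)) (cong (+ 4 *_) a≡)
      curve₁ : w ℕ.^ 3 ≡ 4 ℕ.* u ℕ.^ 3 ℕ.+ 4 ℕ.* A c 1 → Curve (- + u) (- + 1) (+ z)
      curve₁ e = *-cancelˡ-≡ (+ 4) _ _ (trans (l (+ u) (+ z)) (trans (cong (λ x → x - + 4 * (+ u * + u * + u) - + 4) e′) (l′ (+ u) (+ z))))
        where
        e′ : cube (+ z * + 2) ≡ + 4 * cube (+ u) + + 4 * a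
        e′ = trans (sym w³) (trans (cong +_ e) (cong₂ _+_ 4u³ 4a))
        l : ∀ u z → + 4 * (- u * - u * - u + - + 1 * - + 1 * - + 1 + + 2 * (z * z * z)) ≡ z * + 2 * (z * + 2) * (z * + 2) - + 4 * (u * u * u) - + 4
        l = solve-∀
        l′ : ∀ u z → + 4 * (u * u * u) + + 4 * (+ 1 + u * (z * + 2)) - + 4 * (u * u * u) - + 4 ≡ + 4 * (+ 2 * (- u * - + 1 * z))
        l′ = solve-∀
      curve₂ : w ℕ.^ 3 ℕ.+ 4 ℕ.* A c 1 ≡ 4 ℕ.* u ℕ.^ 3 → Curve (- + u) (+ 1) (+ z)
      curve₂ e = *-cancelˡ-≡ (+ 4) _ _ (trans (l (+ u) (+ z)) (trans (cong (λ x → cube (+ z * + 2) - x + + 4) (sym e′)) (l′ (+ u) (+ z))))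
        where
        e′ : cube (+ z * + 2) + + 4 * a ≡ + 4 * cube (+ u)
        e′ = trans (sym (cong₂ _+_ w³ 4a)) (trans (cong +_ e) 4u³)
        l : ∀ u z → + 4 * (- u * - u * - u + + 1 * + 1 * + 1 + + 2 * (z * z * z)) ≡ z * + 2 * (z * + 2) * (z * + 2) - + 4 * (u * u * u) + + 4
        l = solve-∀
        l′ : ∀ u z → z * + 2 * (z * + 2) * (z * + 2) - (z * + 2 * (z * + 2) * (z * + 2) + + 4 * (+ 1 + u * (z * + 2))) + + 4 ≡ + 4 * (+ 2 * (- u * + 1 * z))
        l′ = solve-∀

-- Products of exact prime powers

module PrimeProducts where

  open CriticalSequence
  open import Defs using (primeProd; v; valAux; oddV; evenV; not1mod4; is1mod4)
  open QuadraticResidues using (prime∤⇒coprime)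
  open import Data.Nat
  open import Data.Nat.Properties
  open import Data.Nat.Divisibility
  open import Data.Nat.DivMod
  open import Data.Nat.Coprimality as Cop using (Coprime; coprime-divisor)
  open import Data.Nat.Induction using (<-wellFounded)
  open import Data.Nat.ListAction using (product)
  open import Data.Nat.Primality using (Prime; prime?; prime⇒irreducible; ¬prime[0]; ¬prime[1])
  open import Data.Bool using (Bool; true; false; if_then_else_; _∧_; not)
  open import Data.Empty using (⊥-elim)
  open import Data.List using (map; applyUpTo)
  open import Data.Product using (∃; _×_; _,_)
  open import Data.Sum using (_⊎_; inj₁; inj₂; [_,_]′)
  open import Function using (_∘_)
  open import Induction.WellFounded using (Acc; acc)
  open import Relation.Binary.PropositionalEquality
  open import Relation.Nullary using (¬_; does; yes; no; contradiction; Dec)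

  coprime-∣-product : ∀ {a b z} → Coprime a b → a ∣ z → b ∣ z → a * b ∣ z
  coprime-∣-product {a} {b} cop (divides q refl) b∣z = subst (_∣ q * a) (*-comm b a) (*-monoˡ-∣ a (coprime-divisor (Cop.sym cop) (subst (b ∣_) (*-comm q a) b∣z)))
  valAux-exact : ∀ q f n → 0 < n → n ≤ f → ∃ λ n′ → n ≡ (2 + q) ^ valAux q f n * n′ × ¬ 2 + q ∣ n′
  valAux-exact q zero    (suc m) _ ()
  valAux-exact q (suc f) (suc m) _ (s≤s m≤f) with suc (suc q) ∣? suc m
  ... | no  ∤ = suc m , sym (*-identityˡ (suc m)) , ∤
  ... | yes d with valAux-exact q f (suc m / suc (suc q)) (m≥n⇒m/n>0 (∣⇒≤ d)) (≤-trans (s≤s⁻¹ (m/n<m (suc m) (suc (suc q)) (s≤s (s≤s z≤n)))) m≤f)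
  ...   | n′ , e , ∤ = n′ , trans (sym (m*[n/m]≡n d)) (trans (cong (suc (suc q) *_) e) (sym (*-assoc (suc (suc q)) (suc (suc q) ^ valAux q f (suc m / suc (suc q))) n′))) , ∤

  v-exact : ∀ q n → 0 < n → ∃ λ n′ → n ≡ (2 + q) ^ v (2 + q) n * n′ × ¬ 2 + q ∣ n′
  v-exact q n 0<n = valAux-exact q n n 0<n ≤-refl

  prime≥2 : ∀ {p} → Prime p → ∃ λ q → p ≡ 2 + q
  prime≥2 {0} pr = ⊥-elim (¬prime[0] pr)
  prime≥2 {1} pr = ⊥-elim (¬prime[1] pr)
  prime≥2 {suc (suc q)} pr = q , refl

  distinct-primes-coprime : ∀ {p q} → Prime p → Prime q → p ≢ q → Coprime p q
  distinct-primes-coprime pp pq p≢q = prime∤⇒coprime pq λ q∣p → [ (λ { refl → ¬prime[1] pq }) , (λ e → p≢q (sym e)) ]′ (prime⇒irreducible pp q∣p)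
  prime-power-local : ∀ n d → Acc _<_ n → 0 < n → (∀ p e → Prime p → p ^ e ∣ n → p ^ e ∣ d) → n ∣ d
  prime-power-local 1 d _ _ h = 1∣ d
  prime-power-local n@(suc (suc _)) d (acc rs) 0<n h with prime-divisor n (s≤s (s≤s z≤n))
  ... | p , pr , p∣n with prime≥2 pr
  ...   | q , refl with v-exact q n 0<n
  ...     | n′ , e , p∤n′ = subst (_∣ d) (sym e) (coprime-∣-product cop (h p (v p n) pr (subst (p ^ v p n ∣_) (sym e) (m∣m*n n′)))
              (prime-power-local n′ d (rs n′<n) 0<n′ λ p′ e′ pr′ d′ → h p′ e′ pr′ (∣-trans d′ n′∣n)))
    where
    n′∣n : n′ ∣ n
    n′∣n = subst (n′ ∣_) (sym e) (n∣m*n (p ^ v p n))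
    0<n′ : 0 < n′
    0<n′ = n≢0⇒n>0 λ { refl → p∤n′ (p ∣0) }
    n′<n : n′ < n
    n′<n = ≤∧≢⇒< (∣⇒≤ n′∣n) λ { refl → p∤n′ p∣n }
    cop : Coprime (p ^ v p n) n′
    cop = coprime-^ˡ (v p n) (Cop.sym (prime∤⇒coprime pr p∤n′))
  Π : (ℕ → ℕ) → ℕ → ℕ
  Π f zero    = 1
  Π f (suc n) = f 0 * Π (f ∘ suc) n

  product≡Π : ∀ (f g : ℕ → ℕ) n → product (map f (applyUpTo g n)) ≡ Π (f ∘ g) n
  product≡Π f g zero    = refl
  product≡Π f g (suc n) = cong (f (g 0) *_) (product≡Π f (g ∘ suc) n)

  Π-coprime : ∀ f n u → (∀ q → Coprime (f q) u) → Coprime (Π f n) u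
  Π-coprime f zero    u h = coprime-1ˡ
  Π-coprime f (suc n) u h = coprime-*ˡ (h 0) (Π-coprime (f ∘ suc) n u (h ∘ suc))

  Π-∣ : ∀ f n e z → (∀ q q′ → q ≢ q′ → Coprime (f q) (f q′)) → (∀ q → f q ^ e ∣ z) → Π f n ^ e ∣ z
  Π-∣ f zero    e z cop h = subst (_∣ z) (sym (^-zeroˡ e)) (1∣ z)
  Π-∣ f (suc n) e z cop h = subst (_∣ z) (sym (*-^-comm (f 0) _ e)) (coprime-∣-product
    (coprime-^ˡ e (coprime-^ʳ e (Cop.sym (Π-coprime (f ∘ suc) n (f 0) λ q → cop (suc q) 0 λ ()))))
    (h 0) (Π-∣ (f ∘ suc) n e z (λ q q′ ne → cop (suc q) (suc q′) (ne ∘ suc-injective)) (h ∘ suc)))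

  factor-∣-Π : ∀ f n q → q < n → f q ∣ Π f n
  factor-∣-Π f (suc n) zero    _         = m∣m*n (Π (f ∘ suc) n)
  factor-∣-Π f (suc n) (suc q) (s≤s q<n) = ∣n⇒∣m*n (f 0) (factor-∣-Π (f ∘ suc) n q q<n)
  -- A copy of the local function inside `primeProd`, so that its values can be named in statements.
  primeFactor : (ℕ → ℕ → Bool) → ℕ → ℕ → ℕ
  primeFactor sel n q = if does (prime? (suc (suc q))) ∧ sel (suc (suc q)) (v (suc (suc q)) n) then suc (suc q) ^ v (suc (suc q)) n else 1

  primeProd≡Π : ∀ sel n → primeProd sel n ≡ Π (primeFactor sel n) n
  primeProd≡Π sel n = product≡Π (primeFactor sel n) (λ q → q) n

  data FactorView (sel : ℕ → ℕ → Bool) (n q : ℕ) : ℕ → Set where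
    trivial  : FactorView sel n q 1
    selected : Prime (2 + q) → sel (2 + q) (v (2 + q) n) ≡ true → FactorView sel n q ((2 + q) ^ v (2 + q) n)

  factor-view : ∀ sel n q → FactorView sel n q (primeFactor sel n q)
  factor-view sel n q = go (prime? (2 + q)) (sel (2 + q) (v (2 + q) n)) refl
    where
    go : (d : Dec (Prime (2 + q))) (b : Bool) → sel (2 + q) (v (2 + q) n) ≡ b →
         FactorView sel n q (if does d ∧ b then (2 + q) ^ v (2 + q) n else 1)
    go (no _)   b     _ = trivial
    go (yes _)  false _ = trivial
    go (yes pr) true  e = selected pr e

  Π-nonZero : ∀ f n → (∀ q → NonZero (f q)) → NonZero (Π f n)
  Π-nonZero f zero    h = _
  Π-nonZero f (suc n) h = m*n≢0 (f 0) (Π (f ∘ suc) n) {{h 0}} {{Π-nonZero (f ∘ suc) n (h ∘ suc)}}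

  primeProd-nonZero : ∀ sel n → NonZero (primeProd sel n)
  primeProd-nonZero sel n = subst NonZero (sym (primeProd≡Π sel n)) (Π-nonZero (primeFactor sel n) n each)
    where
    each : ∀ q → NonZero (primeFactor sel n q)
    each q with primeFactor sel n q | factor-view sel n q
    ... | _ | trivial      = _
    ... | _ | selected _ _ = m^n≢0 (2 + q) (v (2 + q) n)

  factor-coprime : ∀ sel n q q′ → q ≢ q′ → Coprime (primeFactor sel n q) (primeFactor sel n q′)
  factor-coprime sel n q q′ ne with primeFactor sel n q | factor-view sel n q | primeFactor sel n q′ | factor-view sel n q′
  ... | _ | trivial | _ | _ = coprime-1ˡ
  ... | _ | selected _ _ | _ | trivial = Cop.sym coprime-1ˡ
  ... | _ | selected pr _ | _ | selected pr′ _ =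
    coprime-^ˡ (v (2 + q) n) (coprime-^ʳ (v (2 + q′) n) (distinct-primes-coprime pr pr′ (ne ∘ suc-injective ∘ suc-injective)))

  module _ (sel : ℕ → ℕ → Bool) (c : ℕ) (0<c : 0 < c) where

    ExactPower : ℕ → ℕ → Set
    ExactPower p e = ∃ λ c′ → c ≡ p ^ e * c′ × ¬ p ∣ c′

    -- Factors of distinct primes are coprime, so divisibility by the product can be checked one
    -- prime power at a time.
    primeProd-^-∣ : ∀ e z → (∀ p w → Prime p → sel p w ≡ true → 0 < w → ExactPower p w → (p ^ w) ^ e ∣ z) → primeProd sel c ^ e ∣ z
    primeProd-^-∣ e z h = subst (λ P → P ^ e ∣ z) (sym (primeProd≡Π sel c)) (Π-∣ (primeFactor sel c) c e z (factor-coprime sel c) each)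
      where
      each : ∀ q → primeFactor sel c q ^ e ∣ z
      each q with primeFactor sel c q | factor-view sel c q
      ... | _ | trivial = subst (_∣ z) (sym (^-zeroˡ e)) (1∣ z)
      ... | _ | selected pr s with v (2 + q) c in eq | v-exact q c 0<c
      ...   | zero  | _ = subst (_∣ z) (sym (^-zeroˡ e)) (1∣ z)
      ...   | suc w | exact = h (2 + q) (suc w) pr s (s≤s z≤n) exact

    primeProd-coprime : ∀ u → (∀ p w → Prime p → sel p w ≡ true → 0 < w → ExactPower p w → ¬ p ∣ u) → Coprime (primeProd sel c) u
    primeProd-coprime u h = subst (λ P → Coprime P u) (sym (primeProd≡Π sel c)) (Π-coprime (primeFactor sel c) c u each)
      where
      each : ∀ q → Coprime (primeFactor sel c q) u
      each q with primeFactor sel c q | factor-view sel c q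
      ... | _ | trivial = coprime-1ˡ
      ... | _ | selected pr s with v (2 + q) c in eq | v-exact q c 0<c
      ...   | zero  | _ = coprime-1ˡ
      ...   | suc w | exact = coprime-^ˡ (suc w) (Cop.sym (prime∤⇒coprime pr (h (2 + q) (suc w) pr s (s≤s z≤n) exact)))

  -- Every exact prime power of c is a factor of at least one of the two products.
  complementary : ∀ sel sel′ c → 0 < c → (∀ p e → sel p e ≡ true ⊎ sel′ p e ≡ true) → c ∣ primeProd sel c * primeProd sel′ c
  complementary sel sel′ c 0<c either = prime-power-local c _ (<-wellFounded c) 0<c local
    where
    local : ∀ p e → Prime p → p ^ e ∣ c → p ^ e ∣ primeProd sel c * primeProd sel′ c
    local p zero    pr d = 1∣ _
    local p (suc e) pr d with prime≥2 pr
    ... | q , refl = ∣-trans pᵉ∣pᵛ ([ (λ s → ∣m⇒∣m*n (primeProd sel′ c) (found sel s)) , (λ s → ∣n⇒∣m*n (primeProd sel c) (found sel′ s)) ]′ (either p (v p c)))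
      where
      q<c : q < c
      q<c = ≤-trans (n≤1+n (suc q)) (∣⇒≤ {{>-nonZero 0<c}} (∣-trans (m∣m*n (p ^ e)) d))
      found : ∀ sel → sel p (v p c) ≡ true → p ^ v p c ∣ primeProd sel c
      found sel s = subst (p ^ v p c ∣_) (sym (primeProd≡Π sel c)) (subst (_∣ Π (primeFactor sel c) c) (go (prime? p) (sel p (v p c)) s) (factor-∣-Π (primeFactor sel c) c q q<c))
        where
        go : (d : Dec (Prime p)) (b : Bool) → b ≡ true → (if does d ∧ b then p ^ v p c else 1) ≡ p ^ v p c
        go (yes _) true refl = refl
        go (no np) _    _    = contradiction pr np
      pᵉ∣pᵛ : p ^ suc e ∣ p ^ v p c
      pᵉ∣pᵛ with v-exact q c 0<c
      ... | c′ , ec , p∤c′ with suc e ≤? v p c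
      ...   | yes le = subst (λ z → p ^ suc e ∣ p ^ z) (m+[n∸m]≡n le) (subst (p ^ suc e ∣_) (sym (^-distribˡ-+-* p (suc e) (v p c ∸ suc e))) (m∣m*n (p ^ (v p c ∸ suc e))))
      ...   | no  gt = contradiction (*-cancelˡ-∣ (p ^ v p c) {{m^n≢0 p (v p c)}} (subst₂ _∣_ (*-comm p (p ^ v p c)) ec (∣-trans sucv∣ d))) p∤c′
        where
        sucv∣ : p ^ suc (v p c) ∣ p ^ suc e
        sucv∣ = subst (λ z → p ^ suc (v p c) ∣ p ^ z) (m+[n∸m]≡n (≰⇒> gt)) (subst (p ^ suc (v p c) ∣_) (sym (^-distribˡ-+-* p (suc (v p c)) (suc e ∸ suc (v p c)))) (m∣m*n (p ^ (suc e ∸ suc (v p c)))))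

  odd-or-even-V : ∀ p e → oddV p e ≡ true ⊎ evenV p e ≡ true
  odd-or-even-V p e = go (e % 2) (m%n<n e 2)
    where
    go : ∀ j → j < 2 → (j ≡ᵇ 1) ≡ true ⊎ (j ≡ᵇ 0) ≡ true
    go 0 _ = inj₂ refl
    go 1 _ = inj₁ refl
    go (suc (suc _)) (s≤s (s≤s ()))

  mod4-dichotomy : ∀ p e → not1mod4 p e ≡ true ⊎ is1mod4 p e ≡ true
  mod4-dichotomy p e = go (p % 4 ≡ᵇ 1)
    where
    go : ∀ b → not b ≡ true ⊎ b ≡ true
    go true  = inj₂ refl
    go false = inj₁ refl

-- The two quartic equations: divisibility at each prime and size

module LocalAnalysis where

  open CriticalSequence
  open DeviationBounds using (square-cancel-≤)
  open QuadraticResidues using (3mod4-∣-sum; prime∤⇒coprime)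
  open PrimeProducts
  open import Data.Nat
  open import Data.Nat.Properties
  open import Data.Nat.Divisibility
  open import Data.Nat.DivMod
  open import Data.Nat.Coprimality as Cop using (Coprime; coprime-divisor)
  open import Data.Nat.Primality using (Prime; euclidsLemma; prime⇒irreducible; ¬prime[0]; ¬prime[1]; prime[2])
  open import Data.Nat.Tactic.RingSolver using (solve-∀)
  open import Data.Empty using (⊥-elim)
  open import Data.Product using (∃; _×_; _,_; proj₁; proj₂)
  open import Data.Sum using (_⊎_; inj₁; inj₂; [_,_]′)
  open import Function using (_∘_)
  open import Relation.Binary.PropositionalEquality
  open import Relation.Nullary using (¬_; yes; no; contradiction)
  open import Relation.Nullary.Decidable using (toWitness)

  euclid² : ∀ {p} x → Prime p → p ∣ x * x → p ∣ x
  euclid² x pr d = [ (λ e → e) , (λ e → e) ]′ (euclidsLemma x x pr d)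

  -- As long as p divides the right side it divides x, and p² can be cancelled from both sides.
  even-valuation : ∀ p k x z z′ → Prime p → ¬ p ∣ z → ¬ p ∣ z′ → x * x * z ≡ p ^ k * z′ → 2 ∣ k
  even-valuation p zero          x z z′ pr p∤z p∤z′ e = 2 ∣0
  even-valuation p (suc k)       x z z′ pr p∤z p∤z′ e
    with [ euclid² x pr , (λ d → contradiction d p∤z) ]′ (euclidsLemma (x * x) z pr (subst (p ∣_) (sym e) (∣m⇒∣m*n z′ (m∣m*n (p ^ k)))))
  ... | divides y refl = go k (*-cancelˡ-≡ _ _ p {{p≢0}} (trans (l y p z) (trans e (*-assoc p (p ^ k) z′))))
    where
    p≢0 : NonZero p
    p≢0 = ≢-nonZero λ { refl → ¬prime[0] pr }
    l : ∀ y p z → p * (p * (y * y * z)) ≡ y * p * (y * p) * z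
    l = solve-∀
    go : ∀ k → p * (y * y * z) ≡ p ^ k * z′ → 2 ∣ suc k
    go zero    e′ = contradiction (subst (p ∣_) (trans e′ (*-identityˡ z′)) (m∣m*n (y * y * z))) p∤z′
    go (suc k) e′ with even-valuation p k y z z′ pr p∤z p∤z′ (*-cancelˡ-≡ _ _ p {{p≢0}} (trans e′ (*-assoc p (p ^ k) z′)))
    ... | divides q eq = divides (suc q) (cong (suc ∘ suc) eq)

  -- x = |α|, n = |ν|, X = |A + α|, X̃ = |A - α| for the integers α, ν obtained from the coordinates of a square
  -- root of f^(k+1)(0) - x₂ in the second level of the tower; the two cases of sign are the signs of α.
  record System (c A M : ℕ) : Set where
    field
      x b n μ y X X̃ : ℕ
      x²    : x * x ≡ A * A + c ^ M + b
      4x²b  : 4 * (x * x) * b ≡ c ^ suc (M + M)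
      n²μ   : n * n * μ ≡ b
      XX̃    : X * X̃ ≡ b + c ^ M
      y²    : y * y ≡ X * X + b
      sign  : (X ≡ x + A × X̃ + A ≡ x × n * n ≡ μ + 2 * X × y ≡ X + μ)
            ⊎ (X + A ≡ x × X̃ ≡ x + A × μ ≡ n * n + 2 * X × μ ≡ X + y)

  module _ {c A M : ℕ} (S : System c A M) (3≤M : 3 ≤ M) (A⊥c : Coprime A c) (0<c : 0 < c) where

    open System S

    private
      N : ℕ
      N = suc (M + M)

      instance c≢0 = >-nonZero 0<c

      b>0 : 0 < b
      b>0 = n≢0⇒n>0 λ e → ≢-nonZero⁻¹ (c ^ N) {{m^n≢0 c N}} (trans (sym 4x²b) (trans (cong (4 * (x * x) *_) e) (*-zeroʳ (4 * (x * x)))))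

      X+X̃ : X + X̃ ≡ x + x
      X+X̃ = [ (λ { (e , e′ , _) → trans (cong (_+ X̃) e) (trans (+-assoc x A X̃) (cong (x +_) (trans (+-comm A X̃) e′))) })
            , (λ { (e , e′ , _) → trans (cong (X +_) e′) (trans (trans (cong (X +_) (+-comm x A)) (sym (+-assoc X A x))) (cong (_+ x) e)) }) ]′ sign

      ∣-2X : ∀ {d} → d ∣ n * n → d ∣ μ → d ∣ 2 * X
      ∣-2X {d} dn dμ = [ (λ { (_ , _ , e , _) → ∣m+n∣m⇒∣n (subst (d ∣_) e dn) dμ }) , (λ { (_ , _ , e , _) → ∣m+n∣m⇒∣n (subst (d ∣_) e dμ) dn }) ]′ sign

      -- In signed form this is ν² - 2(A + α) + 4A = ν² + 2(A - α).
      ∣-μ+4A : ∀ {d} → d ∣ n * n → d ∣ 2 * X̃ → d ∣ μ + 4 * A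
      ∣-μ+4A {d} dn dX̃ = [ (λ { (e₁ , e₂ , e₃ , _) → ∣m+n∣m⇒∣n (subst (d ∣_) (trans e₃ (trans (cong (λ z → μ + 2 * z) (trans e₁ (cong (_+ A) (sym e₂)))) (l μ X̃ A))) dn) dX̃ })
                           , (λ { (e₁ , e₂ , e₃ , _) → subst (d ∣_) (sym (trans (cong (_+ 4 * A) e₃) (trans (l′ (n * n) X A) (cong (λ z → n * n + 2 * z) (trans (cong (_+ A) e₁) (sym e₂)))))) (∣m∣n⇒∣m+n dn dX̃) }) ]′ sign
        where
        l : ∀ μ X̃ A → μ + 2 * (X̃ + A + A) ≡ 2 * X̃ + (μ + 4 * A)
        l = solve-∀
        l′ : ∀ n X A → n + 2 * X + 4 * A ≡ n + 2 * (X + A + A)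
        l′ = solve-∀

      ^-split : ∀ π → π ^ N ≡ π * (π ^ M * π ^ M)
      ^-split π = cong (π *_) (^-distribˡ-+-* π M M)

    record Local (p w : ℕ) : Set where
      field
        prime  : Prime p
        0<w    : 0 < w
        c′     : ℕ
        c≡     : c ≡ p ^ w * c′
        p∤c′   : ¬ p ∣ c′

      π : ℕ
      π = p ^ w

      p∣π : p ∣ π
      p∣π = ∣-^ w {{>-nonZero 0<w}} ∣-refl

      p∣c : p ∣ c
      p∣c = subst (p ∣_) (sym c≡) (∣m⇒∣m*n c′ p∣π)

      p∤A : ¬ p ∣ A
      p∤A d = ¬prime[1] (subst Prime (A⊥c (d , p∣c)) prime)

      c^ : ∀ k → c ^ k ≡ p ^ (w * k) * c′ ^ k
      c^ k = trans (cong (_^ k) c≡) (trans (*-^-comm (p ^ w) c′ k) (cong (_* c′ ^ k) (^-*-assoc p w k)))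

      p∤c′^ : ∀ k → ¬ p ∣ c′ ^ k
      p∤c′^ zero    d = ¬prime[1] (subst Prime (∣1⇒≡1 d) prime)
      p∤c′^ (suc k) d = [ p∤c′ , p∤c′^ k ]′ (euclidsLemma c′ (c′ ^ k) prime d)

      π^∣c^ : ∀ k → π ^ k ∣ c ^ k
      π^∣c^ k = subst (π ^ k ∣_) (sym (trans (cong (_^ k) c≡) (*-^-comm π c′ k))) (m∣m*n (c′ ^ k))

      p∣c^ : ∀ k .{{_ : NonZero k}} → p ∣ c ^ k
      p∣c^ k = ∣-^ k p∣c

      instance M≢0 : NonZero M
               M≢0 = >-nonZero (≤-trans (s≤s z≤n) 3≤M)

      p∤b : p ∣ x → ¬ p ∣ b
      p∤b dx db = p∤A (euclid² A prime (∣m+n∣m⇒∣n {m = c ^ M} (subst (p ∣_) (+-comm (A * A) (c ^ M))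
          (∣m+n∣m⇒∣n {m = b} (subst (p ∣_) (trans x² (+-comm (A * A + c ^ M) b)) (∣m⇒∣m*n x dx)) db)) (p∣c^ M)))

      odd-valuation : ∀ r z → r * r * z ≡ c ^ N → ¬ p ∣ z → 2 ∣ w * N
      odd-valuation r z e p∤z = even-valuation p (w * N) r z (c′ ^ N) prime p∤z (p∤c′^ N) (trans e (c^ N))

      π^N∣4b : ¬ p ∣ x → π ^ N ∣ 4 * b
      π^N∣4b p∤x = coprime-divisor {n = x * x} (coprime-^ˡ N (coprime-^ˡ w (Cop.sym (coprime-*ˡ (prime∤⇒coprime prime p∤x) (prime∤⇒coprime prime p∤x)))))
        (subst (π ^ N ∣_) (trans (sym 4x²b) (l x b)) (π^∣c^ N))
        where
        l : ∀ x b → 4 * (x * x) * b ≡ x * x * (4 * b)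
        l = solve-∀

    -- Under these conditions the full p-part of c^N passes from c^N to b and then either into μ or
    -- into both μ and y. The last field is the analogue of `unitX` at 2, after the forced powers of
    -- 2 are removed.
    record Admissible (p w : ℕ) : Set where
      field
        local   : Local p w
        p∤x     : ¬ p ∣ x
        unitX   : p ≢ 2 → ¬ p ∣ X → ¬ p ∣ n
        oddHalf : ∀ n′ μ′ X′ X̃′ → p ≡ 2 → n ≡ n′ * 2 → μ ≡ μ′ * 4 → X ≡ X′ * 2 → X̃ ≡ X̃′ * 2 → ¬ 2 ∣ X′ → ¬ 2 ∣ n′
      open Local local public

    private
      pass-μ : ∀ {C d} k → d ∣ k * μ → k ∣ C → d ∣ C * (μ * y)
      pass-μ {C} {d} k d∣ (divides j e) = subst (d ∣_) (trans (l j k μ y) (cong (_* (μ * y)) (sym e))) (∣n⇒∣m*n (j * y) d∣)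
        where
        l : ∀ j k μ y → j * y * (k * μ) ≡ j * k * (μ * y)
        l = solve-∀

    module _ {p w : ℕ} (adm : Admissible p w) {C : ℕ} (64∣C : 64 ∣ C) where
      open Admissible adm

      private
        π^2M∣ : ∀ {z} → π ^ N ∣ z → π ^ (M + M) ∣ z
        π^2M∣ d = ∣-trans (n∣m*n π) d

        square-bound : ∀ k → π ^ M ∣ k * X → π ^ N ∣ k * k * b → π ^ M ∣ k * y
        square-bound k dX db = square-∣ (π ^ M) (k * y) (subst (π ^ M * π ^ M ∣_) (trans (l k X b) (trans (cong (k * k *_) (sym y²)) (l′ k y)))
            (∣m∣n⇒∣m+n (*-pres-∣ dX dX) (subst (_∣ k * k * b) (^-distribˡ-+-* π M M) (π^2M∣ db))))
          where
          l : ∀ k X b → k * X * (k * X) + k * k * b ≡ k * k * (X * X + b)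
          l = solve-∀
          l′ : ∀ k y → k * k * (y * y) ≡ k * y * (k * y)
          l′ = solve-∀

        ∣-kμ : ∀ {d} k → d ∣ k * X → d ∣ k * y → d ∣ k * μ
        ∣-kμ {d} k dX dy = [ (λ { (_ , _ , _ , e) → ∣m+n∣m⇒∣n (subst (d ∣_) (trans (cong (k *_) e) (*-distribˡ-+ k X μ)) dy) dX })
                           , (λ { (_ , _ , _ , e) → subst (d ∣_) (sym (trans (cong (k *_) e) (*-distribˡ-+ k X y))) (∣m∣n⇒∣m+n dX dy) }) ]′ sign

        both : ∀ k → k * k ∣ C → π ^ M ∣ k * X → π ^ N ∣ k * k * b → π ^ (M + M) ∣ C * (μ * y)
        both k (divides j e) dX db = subst₂ _∣_ (sym (^-distribˡ-+-* π M M)) (trans (l j k μ y) (cong (_* (μ * y)) (sym e)))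
            (∣n⇒∣m*n j (*-pres-∣ (∣-kμ k dX (square-bound k dX db)) (square-bound k dX db)))
          where
          l : ∀ j k μ y → j * (k * μ * (k * y)) ≡ j * (k * k) * (μ * y)
          l = solve-∀

        p⊥ : ∀ {z} → ¬ p ∣ z → ∀ k → Coprime (π ^ k) z
        p⊥ p∤z k = coprime-^ˡ k (coprime-^ˡ w (Cop.sym (prime∤⇒coprime prime p∤z)))

        -- π^N divides b. If p does not divide X, it does not divide n, and b = n²μ puts π^N into μ.
        -- Otherwise X + X̃ = 2x keeps p out of X̃, so XX̃ = b + c^M puts π^M into X, then y² = X² +
        -- b into y, and the relation between X, y, μ into μ.
        odd-prime : p ≢ 2 → π ^ (M + M) ∣ C * (μ * y)
        odd-prime p≢2 with p ∣? X
        ... | no p∤X = pass-μ 1 (subst (π ^ (M + M) ∣_) (sym (*-identityˡ μ)) (π^2M∣ (coprime-divisor (p⊥ p∤n² N) (subst (π ^ N ∣_) (sym n²μ) π^N∣b)))) (1∣ C)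
          where
          p∤n² : ¬ p ∣ n * n
          p∤n² d = unitX p≢2 p∤X (euclid² n prime d)
          p∤4 : ¬ p ∣ 4
          p∤4 d = p≢2 ([ (λ e → ⊥-elim (¬prime[1] (subst Prime e prime))) , (λ e → e) ]′ (prime⇒irreducible prime[2] (euclid² 2 prime d)))
          π^N∣b : π ^ N ∣ b
          π^N∣b = coprime-divisor (p⊥ p∤4 N) (π^N∣4b p∤x)
        ... | yes p∣X = both 1 (1∣ C) (subst (π ^ M ∣_) (sym (*-identityˡ X)) (coprime-divisor (p⊥ p∤X̃ M) (subst (π ^ M ∣_) (trans (sym XX̃) (*-comm X X̃)) (∣m∣n⇒∣m+n π^M∣b (π^∣c^ M)))))
                          (subst (π ^ N ∣_) (sym (+-identityʳ b)) π^N∣b)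
          where
          p∤2 : ¬ p ∣ 2
          p∤2 d = p≢2 ([ (λ e → ⊥-elim (¬prime[1] (subst Prime e prime))) , (λ e → e) ]′ (prime⇒irreducible prime[2] d))
          p∤4 : ¬ p ∣ 4
          p∤4 d = p∤2 (euclid² 2 prime d)
          π^N∣b : π ^ N ∣ b
          π^N∣b = coprime-divisor (p⊥ p∤4 N) (π^N∣4b p∤x)
          π^M∣b : π ^ M ∣ b
          π^M∣b = ∣-trans (m∣m*n (π ^ M)) (subst (_∣ b) (^-distribˡ-+-* π M M) (π^2M∣ π^N∣b))
          p∤X̃ : ¬ p ∣ X̃
          p∤X̃ d = [ p∤2 , p∤x ]′ (euclidsLemma 2 x prime (subst (p ∣_) (trans X+X̃ (cong (x +_) (sym (+-identityʳ x)))) (∣m∣n⇒∣m+n p∣X d)))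

        -- The same dichotomy for X/2. What is lost is a factor 8 in each of μ and y, or a factor 16
        -- in μ; 64 covers both.
        module Two (p≡2 : p ≡ 2) where
          2∤ : ∀ {z} → ¬ p ∣ z → ¬ 2 ∣ z
          2∤ {z} h = subst (λ q → ¬ q ∣ z) p≡2 h

          odd-sum : ∀ {i j} → ¬ 2 ∣ i → ¬ 2 ∣ j → 2 ∣ i + j
          odd-sum {i} {j} oi oj with odd-or-even i | odd-or-even j
          ... | h , inj₁ refl | _ = contradiction (2∣double h) oi
          ... | _ | h , inj₁ refl = contradiction (2∣double h) oj
          ... | h , inj₂ refl | h′ , inj₂ refl = divides (suc (h + h′)) (l h h′)
            where
            l : ∀ h h′ → suc (h + h) + suc (h′ + h′) ≡ suc (h + h′) * 2
            l = solve-∀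

          2∣X : 2 ∣ X
          2∣X = [ (λ { (e , _) → subst (2 ∣_) (sym e) (odd-sum (2∤ p∤x) (2∤ p∤A)) }) , (λ { (e , _) → parity-cases X e }) ]′ sign
            where
            parity-cases : ∀ Z → Z + A ≡ x → 2 ∣ Z
            parity-cases Z e with odd-or-even Z
            ... | h , inj₁ refl = 2∣double h
            ... | h , inj₂ refl = contradiction (subst (2 ∣_) e (odd-sum (2∣∧2∤ h) (2∤ p∤A))) (2∤ p∤x)

          2∣X̃ : 2 ∣ X̃
          2∣X̃ = ∣m+n∣m⇒∣n (subst (2 ∣_) (sym X+X̃) (2∣double x)) 2∣X

          128∣π^N : 128 ∣ π ^ N
          128∣π^N = ∣-trans (2^7∣ N (s≤s (+-mono-≤ 3≤M 3≤M))) (^-∣-base N)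
            where
            2^7∣ : ∀ N → 7 ≤ N → 128 ∣ 2 ^ N
            2^7∣ N le = subst (λ z → 128 ∣ 2 ^ z) (m+[n∸m]≡n le) (subst (128 ∣_) (sym (^-distribˡ-+-* 2 7 (N ∸ 7))) (m∣m*n (2 ^ (N ∸ 7))))
            ^-∣-base : ∀ k → 2 ^ k ∣ π ^ k
            ^-∣-base zero    = ∣-refl
            ^-∣-base (suc k) = *-pres-∣ (subst (_∣ π) p≡2 p∣π) (^-∣-base k)

          32∣b : 32 ∣ b
          32∣b = *-cancelˡ-∣ 4 (∣-trans 128∣π^N (π^N∣4b p∤x))

          two-bound : π ^ (M + M) ∣ C * (μ * y)
          two-bound with 2∣X | 2∣X̃
          ... | divides X′ eX | divides X̃′ eX̃ with 2 ∣? X′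
          ...   | yes 2∣X′ = both 8 64∣C π^M∣8X (subst (π ^ N ∣_) (l′ b) (∣n⇒∣m*n 16 (π^N∣4b p∤x)))
            where
            l′ : ∀ b → 16 * (4 * b) ≡ 8 * 8 * b
            l′ = solve-∀
            X′+X̃′ : X′ + X̃′ ≡ x
            X′+X̃′ = *-cancelʳ-≡ _ _ 2 (trans (*-distribʳ-+ 2 X′ X̃′) (trans (sym (cong₂ _+_ eX eX̃)) (trans X+X̃ (l x))))
              where
              l : ∀ x → x + x ≡ x * 2
              l = solve-∀
            2∤X̃′ : ¬ p ∣ X̃′
            2∤X̃′ d = 2∤ p∤x (subst (2 ∣_) X′+X̃′ (∣m∣n⇒∣m+n 2∣X′ (subst (_∣ X̃′) p≡2 d)))
            π^M∣8X : π ^ M ∣ 8 * X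
            π^M∣8X = coprime-divisor (p⊥ 2∤X̃′ M) (subst (π ^ M ∣_) eq (∣m∣n⇒∣m+n (∣-trans (∣-trans (m∣m*n (π ^ M)) (subst (_∣ 4 * b) (^-distribˡ-+-* π M M) (π^2M∣ (π^N∣4b p∤x)))) ∣-refl) (∣n⇒∣m*n 4 (π^∣c^ M))))
              where
              l : ∀ X Z → 4 * (X * (Z * 2)) ≡ Z * (8 * X)
              l = solve-∀
              eq : 4 * b + 4 * c ^ M ≡ X̃′ * (8 * X)
              eq = trans (sym (*-distribˡ-+ 4 b (c ^ M))) (trans (cong (4 *_) (trans (sym XX̃) (cong (X *_) eX̃))) (l X X̃′))
          ...   | no 2∤X′ = go 2∣n
            where
            2∣b : 2 ∣ b
            2∣b = ∣-trans (divides 16 refl) 32∣b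
            2∣n : 2 ∣ n
            2∣n = [ 2∣² n , (λ d → 2∣² n (from-μ d)) ]′ (euclidsLemma (n * n) μ prime[2] (subst (2 ∣_) (sym n²μ) 2∣b))
              where
              from-μ : 2 ∣ μ → 2 ∣ n * n
              from-μ d = [ (λ { (_ , _ , e , _) → subst (2 ∣_) (sym e) (∣m∣n⇒∣m+n d (m∣m*n X)) })
                         , (λ { (_ , _ , e , _) → ∣m+n∣m⇒∣n (subst (2 ∣_) (trans e (+-comm (n * n) (2 * X))) d) (m∣m*n X) }) ]′ sign
            go : 2 ∣ n → π ^ (M + M) ∣ C * (μ * y)
            go (divides n′ en) = pass-μ 16 (π^2M∣ (done 4∣μ)) (∣-trans (divides 4 refl) 64∣C)
              where
              4∣n² : 4 ∣ n * n
              4∣n² = *-pres-∣ {2} {n} {2} {n} (divides n′ en) (divides n′ en)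
              4∣2X : 4 ∣ 2 * X
              4∣2X = *-monoʳ-∣ 2 2∣X
              4∣μ : 4 ∣ μ
              4∣μ = [ (λ { (_ , _ , e , _) → ∣m+n∣m⇒∣n (subst (4 ∣_) (trans e (+-comm μ (2 * X))) 4∣n²) 4∣2X })
                    , (λ { (_ , _ , e , _) → subst (4 ∣_) (sym e) (∣m∣n⇒∣m+n 4∣n² 4∣2X) }) ]′ sign
              done : 4 ∣ μ → π ^ N ∣ 16 * μ
              done (divides μ′ eμ) = coprime-divisor (p⊥ p∤n′² N) (subst (π ^ N ∣_) eq (π^N∣4b p∤x))
                where
                p∤n′² : ¬ p ∣ n′ * n′
                p∤n′² d = oddHalf n′ μ′ X′ X̃′ p≡2 en eμ eX eX̃ 2∤X′ (2∣² n′ (subst (_∣ n′ * n′) p≡2 d))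
                l : ∀ n μ → 4 * (n * 2 * (n * 2) * μ) ≡ n * n * (16 * μ)
                l = solve-∀
                eq : 4 * b ≡ n′ * n′ * (16 * μ)
                eq = trans (cong (4 *_) (trans (sym n²μ) (cong (λ z → z * z * μ) en))) (l n′ μ)

      local-bound : π ^ (M + M) ∣ C * (μ * y)
      local-bound with p ≟ 2
      ... | yes p≡2 = Two.two-bound p≡2
      ... | no  p≢2 = odd-prime p≢2

    -- w odd: no square can absorb the p-part of c^N.
    odd-admissible : ∀ p w → Prime p → ¬ 2 ∣ w → 0 < w → (∃ λ c′ → c ≡ p ^ w * c′ × ¬ p ∣ c′) → Admissible p w
    odd-admissible p w pr 2∤w 0<w (c′ , c≡ , p∤c′) = record { local = loc ; p∤x = E₁ ; unitX = E₂ ; oddHalf = E₃ }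
      where
      loc : Local p w
      loc = record { prime = pr ; 0<w = 0<w ; c′ = c′ ; c≡ = c≡ ; p∤c′ = p∤c′ }
      open Local loc
      odd : ¬ 2 ∣ w * N
      odd d = [ 2∤w , 2∣∧2∤ M ]′ (euclidsLemma w N prime[2] d)
      l₁ : ∀ x b → 2 * x * (2 * x) * b ≡ 4 * (x * x) * b
      l₁ = solve-∀
      E₁ : ¬ p ∣ x
      E₁ d = odd (odd-valuation (2 * x) b (trans (l₁ x b) 4x²b) (p∤b d))
      E₂ : p ≢ 2 → ¬ p ∣ X → ¬ p ∣ n
      E₂ p≢2 p∤X d = odd (odd-valuation (2 * x * n) μ (trans (l x n μ) (trans (cong (4 * (x * x) *_) n²μ) 4x²b)) p∤μ)
        where
        l : ∀ x n μ → 2 * x * n * (2 * x * n) * μ ≡ 4 * (x * x) * (n * n * μ)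
        l = solve-∀
        p∤μ : ¬ p ∣ μ
        p∤μ dμ = [ (λ d₂ → p≢2 ([ (λ e → ⊥-elim (¬prime[1] (subst Prime e pr))) , (λ e → e) ]′ (prime⇒irreducible prime[2] d₂))) , p∤X ]′ (euclidsLemma 2 X pr (∣-2X (∣m⇒∣m*n n d) dμ))
      E₃ : ∀ n′ μ′ X′ X̃′ → p ≡ 2 → n ≡ n′ * 2 → μ ≡ μ′ * 4 → X ≡ X′ * 2 → X̃ ≡ X̃′ * 2 → ¬ 2 ∣ X′ → ¬ 2 ∣ n′
      E₃ n′ μ′ X′ X̃′ refl en eμ eX eX̃ 2∤X′ 2∣n′ = odd (odd-valuation (8 * x * n′) μ′
          (trans (l x n′ μ′) (trans (cong₂ (λ u v → 4 * (x * x) * (u * u * v)) (sym en) (sym eμ)) (trans (cong (4 * (x * x) *_) n²μ) 4x²b))) 2∤μ′)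
        where
        l : ∀ x n μ → 8 * x * n * (8 * x * n) * μ ≡ 4 * (x * x) * (n * 2 * (n * 2) * (μ * 4))
        l = solve-∀
        2∤μ′ : ¬ 2 ∣ μ′
        2∤μ′ d = 2∤X′ (*-cancelʳ-∣ {2} {X′} 4 (subst (8 ∣_) (trans (cong (2 *_) eX) (l′ X′)) (∣-2X 8∣n² (subst (8 ∣_) (sym eμ) (*-monoˡ-∣ 4 d)))))
          where
          l′ : ∀ X → 2 * (X * 2) ≡ X * 4
          l′ = solve-∀
          8∣n² : 8 ∣ n * n
          8∣n² = subst (λ z → 8 ∣ z * z) (sym en) (subst (8 ∣_) (l″ n′) (*-monoˡ-∣ 4 (∣m⇒∣m*n n′ 2∣n′)))
            where
            l″ : ∀ n → n * n * 4 ≡ n * 2 * (n * 2)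
            l″ = solve-∀

    module Square (κ : ℕ) (c≡κ² : c ≡ κ * κ) (A≡1 : ∃ λ t → A ≡ 1 + c * t) where

      square-cofactor : ∀ r z s → r ≢ 0 → r * r * z ≡ s * s → IsSq z
      square-cofactor r z s r≢0 e with square-∣ r s (subst (r * r ∣_) e (m∣m*n z))
      ... | divides q refl = q , *-cancelˡ-≡ _ _ (r * r) {{m*n≢0 r r {{≢-nonZero r≢0}} {{≢-nonZero r≢0}}}} (trans e (l q r))
        where
        l : ∀ q r → q * r * (q * r) ≡ r * r * (q * q)
        l = solve-∀

      abstract
        b-square : IsSq b
        b-square = square-cofactor (2 * x) b (κ ^ N) 2x≢0 (trans (l x b) (trans 4x²b (trans (cong (_^ N) c≡κ²) (*-^-comm κ κ N))))
          where
          l : ∀ x b → 2 * x * (2 * x) * b ≡ 4 * (x * x) * b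
          l = solve-∀
          2x≢0 : 2 * x ≢ 0
          2x≢0 e = ≢-nonZero⁻¹ (c ^ N) {{m^n≢0 c N}} (trans (sym 4x²b) (trans (sym (l x b)) (cong (λ z → z * z * b) e)))

        μ-square : IsSq μ
        μ-square with b-square
        ... | β , eβ = square-cofactor n μ β (λ e → <⇒≢ b>0 (trans (sym (cong (λ z → z * z * μ) e)) n²μ)) (trans n²μ eβ)

      odd-square-mod4 : ∀ z → ¬ 2 ∣ z → ∃ λ t → z * z ≡ 1 + 4 * t
      odd-square-mod4 z o with odd-or-even z
      ... | h , inj₁ refl = contradiction (2∣double h) o
      ... | h , inj₂ refl = h * h + h , l h
        where
        l : ∀ h → suc (h + h) * suc (h + h) ≡ 1 + 4 * (h * h + h)
        l = solve-∀

      4∤2+ : ∀ t → ¬ 4 ∣ 2 + 4 * t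
      4∤2+ t d with ∣m+n∣m⇒∣n (subst (4 ∣_) (+-comm 2 (4 * t)) d) (m∣m*n t)
      ... | d′ = contradiction (∣⇒≤ d′) λ { (s≤s (s≤s ())) }

      -- Since c is a square, so are b = β² and μ = m². A violated condition at an odd p would make
      -- it divide β² + A² or, as A ≡ 1 modulo c, m² + 4, with p not dividing the second base; this
      -- is impossible for p ≡ 3 mod 4. At p = 2 the same sums, stripped of powers of 2, are 1 or 2
      -- modulo 4.
      square-admissible : ∀ p w → Prime p → p % 4 ≢ 1 → 0 < w → (∃ λ c′ → c ≡ p ^ w * c′ × ¬ p ∣ c′) → Admissible p w
      square-admissible p w pr p≢1 0<w (c′ , c≡ , p∤c′) = record { local = loc ; p∤x = E₁ ; unitX = E₂ ; oddHalf = E₃ }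
        where
        loc : Local p w
        loc = record { prime = pr ; 0<w = 0<w ; c′ = c′ ; c≡ = c≡ ; p∤c′ = p∤c′ }
        open Local loc
        p≡3 : p ≢ 2 → p % 4 ≡ 3
        p≡3 p≢2 = go (p % 4) refl (m%n<n p 4)
          where
          2∤p : ¬ 2 ∣ p
          2∤p d = [ (λ ()) , (λ e → p≢2 (sym e)) ]′ (prime⇒irreducible pr d)
          go : ∀ j → p % 4 ≡ j → j < 4 → p % 4 ≡ 3
          go 0 e _ = contradiction (∣-trans (divides 2 refl) (m%n≡0⇒n∣m p 4 e)) 2∤p
          go 1 e _ = contradiction e p≢1
          go 2 e _ = contradiction (subst (2 ∣_) (sym (trans (m≡m%n+[m/n]*n p 4) (cong (_+ p / 4 * 4) e))) (∣m∣n⇒∣m+n ∣-refl (∣n⇒∣m*n (p / 4) (divides 2 refl)))) 2∤p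
          go 3 e _ = e
          go (suc (suc (suc (suc _)))) _ (s≤s (s≤s (s≤s (s≤s ()))))
        4∣c : p ≡ 2 → 4 ∣ c
        4∣c refl = subst (4 ∣_) (sym c≡κ²) (*-pres-∣ {2} {κ} {2} {κ} 2∣κ 2∣κ)
          where
          2∣κ : 2 ∣ κ
          2∣κ = 2∣² κ (subst (2 ∣_) c≡κ² p∣c)
        E₁ : ¬ p ∣ x
        E₁ d with p ≟ 2 | b-square
        ... | no p≢2 | β , eβ = p∤A (3mod4-∣-sum p β A pr (p≡3 p≢2) (∣m+n∣m⇒∣n {m = c ^ M} (subst (p ∣_) (trans x² (trans (cong (A * A + c ^ M +_) eβ) (l A (c ^ M) β))) (∣m⇒∣m*n x d)) (p∣c^ M)))
          where
          l : ∀ A C β → A * A + C + β * β ≡ C + (β * β + A * A)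
          l = solve-∀
        ... | yes refl | β , eβ = contradiction 4∣β²+A² bad
          where
          4∣x² : 4 ∣ x * x
          4∣x² = *-pres-∣ {2} {x} {2} {x} d d
          l : ∀ A C β → A * A + C + β * β ≡ C + (β * β + A * A)
          l = solve-∀
          4∣β²+A² : 4 ∣ β * β + A * A
          4∣β²+A² = ∣m+n∣m⇒∣n {m = c ^ M} (subst (4 ∣_) (trans x² (trans (cong (A * A + c ^ M +_) eβ) (l A (c ^ M) β))) 4∣x²) (∣-^ M (4∣c refl))
          bad : ¬ 4 ∣ β * β + A * A
          bad d₄ with odd-square-mod4 A p∤A | odd-or-even β
          ... | t , et | h , inj₁ refl = 2∣∧2∤ (2 * t + 2 * (h * h)) (subst (2 ∣_) (trans (cong ((h + h) * (h + h) +_) et) (l′ h t)) (∣-trans (divides 2 refl) d₄))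
            where
            l′ : ∀ h t → (h + h) * (h + h) + (1 + 4 * t) ≡ suc (2 * t + 2 * (h * h) + (2 * t + 2 * (h * h)))
            l′ = solve-∀
          ... | t , et | h , inj₂ refl = 4∤2+ (h * h + h + t) (subst (4 ∣_) (trans (cong (suc (h + h) * suc (h + h) +_) et) (l′ h t)) d₄)
            where
            l′ : ∀ h t → suc (h + h) * suc (h + h) + (1 + 4 * t) ≡ 2 + 4 * (h * h + h + t)
            l′ = solve-∀
        E₂ : p ≢ 2 → ¬ p ∣ X → ¬ p ∣ n
        E₂ p≢2 p∤X d with μ-square
        ... | m , em = p≢2 ([ (λ e → ⊥-elim (¬prime[1] (subst Prime e pr))) , (λ e → e) ]′ (prime⇒irreducible prime[2] p∣2))
          where
          p∣b : p ∣ b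
          p∣b = subst (p ∣_) n²μ (∣m⇒∣m*n μ (∣m⇒∣m*n n d))
          p∣X̃ : p ∣ X̃
          p∣X̃ = [ (λ e → contradiction e p∤X) , (λ e → e) ]′ (euclidsLemma X X̃ pr (subst (p ∣_) (sym XX̃) (∣m∣n⇒∣m+n p∣b (p∣c^ M))))
          t : ℕ
          t = proj₁ A≡1
          l : ∀ m c t → m + 4 * (1 + c * t) ≡ c * (4 * t) + (m + 2 * 2)
          l = solve-∀
          p∣2 : p ∣ 2
          p∣2 = 3mod4-∣-sum p m 2 pr (p≡3 p≢2) (∣m+n∣m⇒∣n (subst (p ∣_) (trans (cong₂ (λ u v → u + 4 * v) em (proj₂ A≡1)) (l (m * m) c t)) (∣-μ+4A (∣m⇒∣m*n n d) (∣n⇒∣m*n 2 p∣X̃))) (∣m⇒∣m*n (4 * t) p∣c))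
        E₃ : ∀ n′ μ′ X′ X̃′ → p ≡ 2 → n ≡ n′ * 2 → μ ≡ μ′ * 4 → X ≡ X′ * 2 → X̃ ≡ X̃′ * 2 → ¬ 2 ∣ X′ → ¬ 2 ∣ n′
        E₃ n′ μ′ X′ X̃′ refl en eμ eX eX̃ 2∤X′ 2∣n′ with μ-square
        ... | m , em with 2∣² m (subst (2 ∣_) (trans (sym eμ) em) (∣n⇒∣m*n μ′ (divides 2 refl)))
        ...   | divides m′ refl = 4∤2+ (proj₁ odd-m + c₄ * proj₁ A≡1) (subst (4 ∣_) eq 4∣μ′+A)
          where
          μ′≡ : μ′ ≡ m′ * m′
          μ′≡ = *-cancelʳ-≡ _ _ 4 (trans (sym eμ) (trans em (l m′)))
            where
            l : ∀ m → m * 2 * (m * 2) ≡ m * m * 4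
            l = solve-∀
          16∣n² : 16 ∣ n * n
          16∣n² = subst (λ z → 16 ∣ z * z) (sym en) (subst (16 ∣_) (l n′) (*-monoˡ-∣ 4 (*-pres-∣ {2} {n′} {2} {n′} 2∣n′ 2∣n′)))
            where
            l : ∀ n → n * n * 4 ≡ n * 2 * (n * 2)
            l = solve-∀
          2∤μ′ : ¬ 2 ∣ μ′
          2∤μ′ d = 2∤X′ (*-cancelʳ-∣ {2} {X′} 4 (subst (8 ∣_) (trans (cong (2 *_) eX) (l′ X′)) (∣-2X (∣-trans (divides 2 refl) 16∣n²) (subst (8 ∣_) (sym eμ) (*-monoˡ-∣ 4 d)))))
            where
            l′ : ∀ X → 2 * (X * 2) ≡ X * 4
            l′ = solve-∀
          odd-m : ∃ λ t → m′ * m′ ≡ 1 + 4 * t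
          odd-m = odd-square-mod4 m′ λ d → 2∤μ′ (subst (2 ∣_) (sym μ′≡) (∣m⇒∣m*n m′ d))
          16∣b : 16 ∣ b
          16∣b = subst (16 ∣_) n²μ (∣m⇒∣m*n μ 16∣n²)
          16∣c^M : 16 ∣ c ^ M
          16∣c^M = subst (λ z → 16 ∣ c ^ z) (m+[n∸m]≡n (≤-trans (s≤s (s≤s z≤n)) 3≤M)) (subst (16 ∣_) (sym (^-distribˡ-+-* c 2 (M ∸ 2))) (∣m⇒∣m*n (c ^ (M ∸ 2))
                     (*-pres-∣ {4} {c} {4} {c * 1} (4∣c refl) (subst (4 ∣_) (sym (*-identityʳ c)) (4∣c refl)))))
          4∣X̃′ : 4 ∣ X̃′
          4∣X̃′ = coprime-divisor {n = X′} (coprime-*ˡ {2} {2} 2⊥X′ 2⊥X′) (*-cancelʳ-∣ {4} {X′ * X̃′} 4 (subst (16 ∣_) (trans (sym XX̃) (trans (cong₂ _*_ eX eX̃) (l X′ X̃′))) (∣m∣n⇒∣m+n 16∣b 16∣c^M)))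
            where
            2⊥X′ : Coprime 2 X′
            2⊥X′ = Cop.sym (prime∤⇒coprime prime[2] 2∤X′)
            l : ∀ X Z → X * 2 * (Z * 2) ≡ X * Z * 4
            l = solve-∀
          4∣μ′+A : 4 ∣ μ′ + A
          4∣μ′+A = *-cancelʳ-∣ {4} {μ′ + A} 4 (subst (16 ∣_) (trans (cong (_+ 4 * A) eμ) (l μ′ A)) (∣-μ+4A 16∣n² (subst (16 ∣_) (trans (l″ X̃′) (cong (2 *_) (sym eX̃))) (*-monoʳ-∣ 4 4∣X̃′))))
            where
            l : ∀ μ A → μ * 4 + 4 * A ≡ (μ + A) * 4
            l = solve-∀
            l″ : ∀ X → 4 * X ≡ 2 * (X * 2)
            l″ = solve-∀
          c₄ : ℕ
          c₄ = quotient (4∣c refl)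
          eq : μ′ + A ≡ 2 + 4 * (proj₁ odd-m + c₄ * proj₁ A≡1)
          eq = trans (cong₂ _+_ (trans μ′≡ (proj₂ odd-m)) (trans (proj₂ A≡1) (cong (λ z → 1 + z * proj₁ A≡1) (m∣n⇒n≡quotient*m (4∣c refl))))) (l (proj₁ odd-m) c₄ (proj₁ A≡1))
            where
            l : ∀ a c t → 1 + 4 * a + (1 + c * 4 * t) ≡ 2 + 4 * (a + c * t)
            l = solve-∀

    private
      a : ℕ
      a = A * A + c ^ M

    -- The constants are kept variable: as numerals they would be unfolded during type checking.
    module Size (a⊥c : Coprime a c) (A²≤ : A * A ≤ c ^ M) (16≤c : 16 ≤ c)
                (h K : ℕ) (h≢0 : h ≢ 0) (30h≤K : 2 * h * 15 ≤ K) where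

      -- In 4x²b = c^N with x prime to b, the coprime factors are x² and 4b for odd x, 4x² and b for
      -- even x. So u^N is x² or 4x², and the fields hold in both cases.
      record Root : Set where
        field
          u     : ℕ
          u∣c   : u ∣ c
          lower : x * x ≤ u ^ N
          upper : u ^ N ∣ 4 * (x * x)
          p∣u⇒p∣x : ∀ p → Prime p → p ∣ u → p ∣ x

      private
        x≢0 : x ≢ 0
        x≢0 e = ≢-nonZero⁻¹ (c ^ N) {{m^n≢0 c N}} (trans (sym 4x²b) (cong (λ z → 4 * (z * z) * b) e))

        instance x-nonZero = ≢-nonZero x≢0

        x⊥b : Coprime x b
        x⊥b {d} (d∣x , d∣b) = coprime-^ʳ N a⊥c (∣m+n∣m⇒∣n {m = b} (subst (d ∣_) (trans x² (+-comm a b)) (∣m⇒∣m*n x d∣x)) d∣b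
                                               , subst (d ∣_) 4x²b (∣n⇒∣m*n (4 * (x * x)) d∣b))

        2⊥odd : ∀ {z} → ¬ 2 ∣ z → Coprime 2 z
        2⊥odd 2∤z = Cop.sym (prime∤⇒coprime prime[2] 2∤z)

      root : Root
      root with 2 ∣? x
      ... | no 2∤x = go (coprime-power (x * x) (4 * b) c N (m*n≢0 x x) (coprime-*ˡ x⊥4b x⊥4b) (trans (l x b) 4x²b))
        where
        l : ∀ x b → x * x * (4 * b) ≡ 4 * (x * x) * b
        l = solve-∀
        x⊥4b : Coprime x (4 * b)
        x⊥4b = Cop.sym (coprime-*ˡ {4} {b} (coprime-*ˡ {2} {2} (2⊥odd 2∤x) (2⊥odd 2∤x)) (Cop.sym x⊥b))
        go : (∃ λ u → x * x ≡ u ^ N × u ∣ c) → Root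
        go (u , e , u∣c) = record { u = u ; u∣c = u∣c ; lower = ≤-reflexive e ; upper = subst (_∣ 4 * (x * x)) e (n∣m*n 4)
                                  ; p∣u⇒p∣x = λ p pr d → euclid² x pr (subst (p ∣_) (sym e) (∣-^ N d)) }
      ... | yes 2∣x = go (coprime-power (4 * (x * x)) b c N (m*n≢0 4 (x * x) {{_}} {{m*n≢0 x x}}) (coprime-*ˡ {4} {x * x} (coprime-*ˡ {2} {2} 2⊥b 2⊥b) (coprime-*ˡ x⊥b x⊥b)) 4x²b)
        where
        2⊥b : Coprime 2 b
        2⊥b = coprime-∣ˡ 2∣x x⊥b
        go : (∃ λ u → 4 * (x * x) ≡ u ^ N × u ∣ c) → Root
        go (u , e , u∣c) = record { u = u ; u∣c = u∣c ; lower = ≤-trans (m≤n*m (x * x) 4) (≤-reflexive e) ; upper = ∣-reflexive (sym e)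
                                  ; p∣u⇒p∣x = λ p pr d → [ (λ d₄ → subst (_∣ x) ([ (λ e′ → ⊥-elim (¬prime[1] (subst Prime (sym e′) pr))) , (λ e′ → e′) ]′ (swap p pr d₄)) 2∣x)
                                                          , euclid² x pr ]′ (euclidsLemma 4 (x * x) pr (subst (p ∣_) (sym e) (∣-^ N d))) }
          where
          swap : ∀ p → Prime p → p ∣ 4 → 1 ≡ p ⊎ 2 ≡ p
          swap p pr d = [ (λ e′ → inj₁ (sym e′)) , (λ e′ → inj₂ (sym e′)) ]′ (prime⇒irreducible prime[2] (euclid² 2 pr d))

      -- If b ≥ a, then x² ≤ 2b and 4x²b = c^N. Otherwise x² ≤ 2a ≤ 4c^M, and 16 ≤ c absorbs the
      -- constant.
      x⁴≤ : x * x * (x * x) ≤ c ^ N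
      x⁴≤ with a ≤? b
      ... | yes a≤b = begin
        x * x * (x * x)       ≤⟨ *-monoʳ-≤ (x * x) (≤-trans (≤-reflexive x²) (+-monoˡ-≤ b a≤b)) ⟩
        x * x * (b + b)       ≤⟨ m≤m+n _ (x * x * (b + b)) ⟩
        x * x * (b + b) + x * x * (b + b) ≡⟨ l (x * x) b ⟩
        4 * (x * x) * b       ≡⟨ 4x²b ⟩
        c ^ N                 ∎
        where
        open ≤-Reasoning
        l : ∀ x b → x * (b + b) + x * (b + b) ≡ 4 * x * b
        l = solve-∀
      ... | no a≰b = begin
        x * x * (x * x)       ≤⟨ *-mono-≤ x²≤ x²≤ ⟩
        4 * H * (4 * H)       ≡⟨ l H ⟩
        16 * (H * H)          ≤⟨ *-monoˡ-≤ (H * H) 16≤c ⟩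
        c * (H * H)           ≡⟨ ^-split c ⟨
        c ^ N                 ∎
        where
        open ≤-Reasoning
        H : ℕ
        H = c ^ M
        l : ∀ H → 4 * H * (4 * H) ≡ 16 * (H * H)
        l = solve-∀
        l′ : ∀ H → H + H + (H + H) ≡ 4 * H
        l′ = solve-∀
        x²≤ : x * x ≤ 4 * H
        x²≤ = ≤-trans (≤-reflexive x²) (≤-trans (+-mono-≤ (+-monoˡ-≤ H A²≤) (≤-trans (<⇒≤ (≰⇒> a≰b)) (+-monoˡ-≤ H A²≤))) (≤-reflexive (l′ H)))

      private
        A≤x : A ≤ x
        A≤x = square-cancel-≤ (≤-trans (≤-trans (m≤m+n (A * A) (c ^ M)) (m≤m+n a b)) (≤-reflexive (sym x²)))

        X≤2x : X ≤ 2 * x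
        X≤2x = ≤-trans ([ (λ { (e , _) → ≤-trans (≤-reflexive e) (+-monoʳ-≤ x A≤x) })
                        , (λ { (e , _) → ≤-trans (m≤m+n X A) (≤-trans (≤-reflexive e) (m≤m+n x x)) }) ]′ sign) (≤-reflexive (cong (x +_) (sym (+-identityʳ x))))

        y≤3x : y ≤ 3 * x
        y≤3x = square-cancel-≤ (begin
          y * y                         ≡⟨ y² ⟩
          X * X + b                     ≤⟨ +-mono-≤ (*-mono-≤ X≤2x X≤2x) (≤-trans (m≤n+m b a) (≤-reflexive (sym x²))) ⟩
          2 * x * (2 * x) + x * x       ≤⟨ m≤m+n _ (4 * (x * x)) ⟩
          2 * x * (2 * x) + x * x + 4 * (x * x) ≡⟨ l x ⟩
          3 * x * (3 * x)               ∎)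
          where
          open ≤-Reasoning
          l : ∀ x → 2 * x * (2 * x) + x * x + 4 * (x * x) ≡ 3 * x * (3 * x)
          l = solve-∀

        μ≤5x : μ ≤ 5 * x
        μ≤5x = [ (λ { (_ , _ , _ , e) → ≤-trans (m≤n+m μ X) (≤-trans (≤-reflexive (sym e)) (≤-trans y≤3x (*-monoˡ-≤ x {3} {5} (s≤s (s≤s (s≤s z≤n)))))) })
               , (λ { (_ , _ , _ , e) → ≤-trans (≤-reflexive e) (≤-trans (+-mono-≤ X≤2x y≤3x) (≤-reflexive (sym (*-distribʳ-+ x 2 3)))) }) ]′ sign

        Z : ℕ
        Z = 2 * h * (μ * y)

        Z≤ : Z ≤ K * (x * x)
        Z≤ = begin
          2 * h * (μ * y)              ≤⟨ *-monoʳ-≤ (2 * h) (*-mono-≤ μ≤5x y≤3x) ⟩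
          2 * h * (5 * x * (3 * x))    ≡⟨ l (2 * h) x ⟩
          2 * h * 15 * (x * x)         ≤⟨ *-monoˡ-≤ (x * x) 30h≤K ⟩
          K * (x * x)                  ∎
          where
          open ≤-Reasoning
          l : ∀ k x → k * (5 * x * (3 * x)) ≡ k * 15 * (x * x)
          l = solve-∀

        μ≢0 : μ ≢ 0
        μ≢0 e = <⇒≢ b>0 (trans (sym (*-zeroʳ (n * n))) (trans (cong (n * n *_) (sym e)) n²μ))

        y≢0 : y ≢ 0
        y≢0 e = <⇒≢ b>0 (sym (m+n≡0⇒n≡0 (X * X) (trans (sym y²) (cong (λ z → z * z) e))))

        instance
          Z-nonZero : NonZero Z
          Z-nonZero = m*n≢0 (2 * h) (μ * y) {{m*n≢0 2 h {{_}} {{≢-nonZero h≢0}}}} {{m*n≢0 μ y {{≢-nonZero μ≢0}} {{≢-nonZero y≢0}}}}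

      module _ (P : ℕ) (P∣ : P ^ (M + M) ∣ 2 * h * (μ * y)) (P⊥u : Coprime P (Root.u root)) where

        open Root root

        private
          q H : ℕ
          q = P ^ (M + M)
          H = c ^ M

          u^M∣2x : u ^ M ∣ 2 * x
          u^M∣2x = square-∣ (u ^ M) (2 * x) (∣-trans (subst (u ^ M * u ^ M ∣_) (sym (^-split u)) (n∣m*n u)) (subst (u ^ N ∣_) (l x) upper))
            where
            l : ∀ x → 4 * (x * x) ≡ 2 * x * (2 * x)
            l = solve-∀

          -- 2X · 2x = 2X(X + X̃) = 2y² + 2c^M, and u^M divides 2x as well as c^M.
          u^M∣y² : u ^ M ∣ 2 * (y * y)
          u^M∣y² = ∣m+n∣m⇒∣n {m = 2 * c ^ M} (subst (u ^ M ∣_) eq (∣n⇒∣m*n (2 * X) u^M∣2x)) (∣n⇒∣m*n 2 (^-∣ M))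
            where
            ^-∣ : ∀ k → u ^ k ∣ c ^ k
            ^-∣ zero    = ∣-refl
            ^-∣ (suc k) = *-pres-∣ u∣c (^-∣ k)
            l₁ : ∀ X x → 2 * X * (2 * x) ≡ 2 * (X * (x + x))
            l₁ = solve-∀
            l₂ : ∀ X X̃ → 2 * (X * (X + X̃)) ≡ 2 * (X * X) + 2 * (X * X̃)
            l₂ = solve-∀
            l₃ : ∀ s b h → 2 * s + 2 * (b + h) ≡ 2 * h + 2 * (s + b)
            l₃ = solve-∀
            eq : 2 * X * (2 * x) ≡ 2 * c ^ M + 2 * (y * y)
            eq = trans (l₁ X x) (trans (cong (λ z → 2 * (X * z)) (sym X+X̃)) (trans (l₂ X X̃) (trans (cong (λ z → 2 * (X * X) + 2 * z) XX̃)
                   (trans (l₃ (X * X) b (c ^ M)) (cong (λ z → 2 * c ^ M + 2 * z) (sym y²))))))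

          -- q² and u^M are coprime and both divide Z², the latter through 2y²; and Z² ≤ K²x⁴.
          product≤ : q * q * u ^ M ≤ K * K * c ^ N
          product≤ = begin
            q * q * u ^ M           ≤⟨ ∣⇒≤ {{m*n≢0 Z Z}} (coprime-∣-product (coprime-*ˡ q⊥ q⊥) (*-pres-∣ P∣ P∣) (∣-trans u^M∣y² 2y²∣)) ⟩
            Z * Z                   ≤⟨ *-mono-≤ Z≤ Z≤ ⟩
            K * (x * x) * (K * (x * x)) ≡⟨ l K (x * x) ⟩
            K * K * (x * x * (x * x))   ≤⟨ *-monoʳ-≤ (K * K) x⁴≤ ⟩
            K * K * c ^ N           ∎
            where
            open ≤-Reasoning
            l : ∀ k w → k * w * (k * w) ≡ k * k * (w * w)
            l = solve-∀
            q⊥ : Coprime q (u ^ M)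
            q⊥ = coprime-^ˡ (M + M) (coprime-^ʳ M P⊥u)
            2y²∣ : 2 * (y * y) ∣ Z * Z
            2y²∣ = divides (2 * h * h * (μ * μ)) (l′ h μ y)
              where
              l′ : ∀ h μ y → 2 * h * (μ * y) * (2 * h * (μ * y)) ≡ 2 * h * h * (μ * μ) * (2 * (y * y))
              l′ = solve-∀

          u²≤2c : u * u ≤ 2 * c
          u²≤2c = ≮⇒≥ λ gt → <⇒≱ (^-monoˡ-< N gt) (begin
            (u * u) ^ N                        ≡⟨ *-^-comm u u N ⟩
            u ^ N * u ^ N                      ≤⟨ *-mono-≤ u^N≤ u^N≤ ⟩
            4 * (x * x) * (4 * (x * x))        ≡⟨ l (x * x) ⟩
            16 * (x * x * (x * x))             ≤⟨ *-mono-≤ (2^N N (s≤s (≤-trans (+-mono-≤ 3≤M 3≤M) ≤-refl))) x⁴≤ ⟩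
            2 ^ N * c ^ N                      ≡⟨ *-^-comm 2 c N ⟨
            (2 * c) ^ N                        ∎)
            where
            open ≤-Reasoning
            l : ∀ w → 4 * w * (4 * w) ≡ 16 * (w * w)
            l = solve-∀
            u^N≤ : u ^ N ≤ 4 * (x * x)
            u^N≤ = ∣⇒≤ {{m*n≢0 4 (x * x) {{_}} {{m*n≢0 x x}}}} upper
            2^N : ∀ N → 7 ≤ N → 16 ≤ 2 ^ N
            2^N N le = ≤-trans (toWitness {a? = 16 ≤? 128} _) (^-monoʳ-≤ 2 {7} {N} le)

          H≤ : H * H ≤ u ^ M * u ^ M * (u ^ M * u ^ M) * (2 * c)
          H≤ = begin
            H * H                                    ≤⟨ *-mono-≤ H≤u^N H≤u^N ⟩
            u ^ N * u ^ N                            ≡⟨ cong (λ z → z * z) (^-split u) ⟩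
            u * (u ^ M * u ^ M) * (u * (u ^ M * u ^ M)) ≡⟨ l u (u ^ M * u ^ M) ⟩
            u ^ M * u ^ M * (u ^ M * u ^ M) * (u * u) ≤⟨ *-monoʳ-≤ (u ^ M * u ^ M * (u ^ M * u ^ M)) u²≤2c ⟩
            u ^ M * u ^ M * (u ^ M * u ^ M) * (2 * c) ∎
            where
            open ≤-Reasoning
            l : ∀ u w → u * w * (u * w) ≡ w * w * (u * u)
            l = solve-∀
            H≤u^N : H ≤ u ^ N
            H≤u^N = ≤-trans (≤-trans (m≤n+m H (A * A)) (≤-trans (m≤m+n a b) (≤-reflexive (sym x²)))) lower

        -- The fourth power of the preceding bound is multiplied by H² ≤ u^(4M) · 2c, which
        -- eliminates u. Up to constants the result is P^(16M) ≤ c^(6M+5).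
        selected-part-bound : q * q * (q * q) * (q * q * (q * q)) ≤ K * K * (K * K) * (K * K * (K * K)) * 2 * (H ^ 6 * c ^ 5)
        selected-part-bound = *-cancelʳ-≤ _ _ (H * H) {{m*n≢0 H H {{m^n≢0 c M}} {{m^n≢0 c M}}}} (begin
            t * t * (H * H)                          ≤⟨ *-monoʳ-≤ (t * t) H≤ ⟩
            t * t * (w * w * (w * w) * (2 * c))      ≡⟨ l₁ q w c ⟩
            s * s * (s * s) * (2 * c)                ≤⟨ *-monoˡ-≤ (2 * c) (*-mono-≤ (*-mono-≤ product≤ product≤) (*-mono-≤ product≤ product≤)) ⟩
            K² * c ^ N * (K² * c ^ N) * (K² * c ^ N * (K² * c ^ N)) * (2 * c)  ≡⟨ cong (λ z → K² * z * (K² * z) * (K² * z * (K² * z)) * (2 * c)) (^-split c) ⟩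
            K² * (c * (H * H)) * (K² * (c * (H * H))) * (K² * (c * (H * H)) * (K² * (c * (H * H)))) * (2 * c) ≡⟨ l₂ K² c H ⟩
            K² * K² * (K² * K²) * 2 * (H ^ 6 * c ^ 5) * (H * H) ∎)
          where
          open ≤-Reasoning
          K² t s w : ℕ
          K² = K * K
          t = q * q * (q * q)
          w = u ^ M
          s = q * q * w
          l₁ : ∀ q w c → q * q * (q * q) * (q * q * (q * q)) * (w * w * (w * w) * (2 * c)) ≡ q * q * w * (q * q * w) * (q * q * w * (q * q * w)) * (2 * c)
          l₁ = solve-∀
          l₂ : ∀ K c H → K * (c * (H * H)) * (K * (c * (H * H))) * (K * (c * (H * H)) * (K * (c * (H * H)))) * (2 * c)
                         ≡ K * K * (K * K) * 2 * (H * (H * (H * (H * (H * (H * 1))))) * (c * (c * (c * (c * (c * 1)))))) * (H * H)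
          l₂ = solve-∀

        power-bound : P ^ ((M + M) * 8) ≤ K ^ 8 * 2 * (H ^ 6 * c ^ 5)
        power-bound = subst₂ _≤_ (trans (l q) (^-*-assoc P (M + M) 8)) (cong (λ z → z * 2 * (H ^ 6 * c ^ 5)) (l′ K)) selected-part-bound
          where
          l : ∀ q → q * q * (q * q) * (q * q * (q * q)) ≡ q * (q * (q * (q * (q * (q * (q * (q * 1)))))))
          l = solve-∀
          l′ : ∀ q → q * q * (q * q) * (q * q * (q * q)) ≡ q * (q * (q * (q * (q * (q * (q * (q * 1)))))))
          l′ = solve-∀

-- Contradiction for c > 10^1000, and the passage from signed integers to a system

module LargeParameter where

  open CriticalSequence
  open PrimeProducts
  open LocalAnalysis
  open import Defs using (primeProd; oddV; evenV; not1mod4; is1mod4; RatioBound)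
  open import Data.Nat
  open import Data.Nat.Properties
  open import Data.Nat.Divisibility
  open import Data.Nat.DivMod
  open import Data.Nat.Coprimality as Cop using (Coprime)
  open import Data.Nat.Primality using (Prime)
  open import Data.Nat.Tactic.RingSolver using (solve-∀)
  open import Data.Integer as ℤ using (ℤ; +_; -[1+_])
  import Data.Integer.Properties as ℤₚ
  import Data.Integer.Tactic.RingSolver as ℤ-Solver
  open import Data.Bool using (true; T; not)
  open import Data.Empty using (⊥)
  open import Data.Product using (∃; _×_; _,_; proj₁; proj₂)
  open import Data.Sum using (_⊎_; inj₁; inj₂; [_,_]′)
  open import Relation.Binary.PropositionalEquality
  open import Relation.Nullary using (¬_; contradiction)

  -- With α = 115³⁰ and β = 100³⁰ the hypothesis is RatioBound.
  ratio-bound : ∀ α β P Q c → β ≤ α → 0 < c → c ≤ P * Q → α * Q ^ 30 < β * P ^ 30 * c → c ^ 29 < P ^ 30 * P ^ 30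
  ratio-bound α β P Q c β≤α 0<c c≤PQ lt = *-cancelˡ-< β _ _ (*-cancelˡ-< c _ _ (begin-strict
    c * (β * c ^ 29)           ≡⟨ l₁ c β (c ^ 29) ⟩
    β * c ^ 30                 ≤⟨ *-mono-≤ β≤α (^-monoˡ-≤ 30 c≤PQ) ⟩
    α * (P * Q) ^ 30           ≡⟨ cong (α *_) (*-^-comm P Q 30) ⟩
    α * (P ^ 30 * Q ^ 30)      ≡⟨ l₂ α (P ^ 30) (Q ^ 30) ⟩
    α * Q ^ 30 * P ^ 30        <⟨ *-monoˡ-< (P ^ 30) {{m^n≢0 P 30 {{P≢0}}}} lt ⟩
    β * P ^ 30 * c * P ^ 30    ≡⟨ l₃ β (P ^ 30) c ⟩
    c * (β * (P ^ 30 * P ^ 30)) ∎))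
    where
    open ≤-Reasoning
    l₁ : ∀ c β e → c * (β * e) ≡ β * (c * e)
    l₁ = solve-∀
    l₂ : ∀ α p q → α * (p * q) ≡ α * q * p
    l₂ = solve-∀
    l₃ : ∀ β p c → β * p * c * p ≡ c * (β * (p * p))
    l₃ = solve-∀
    P≢0 : NonZero P
    P≢0 = ≢-nonZero λ { refl → <⇒≱ 0<c c≤PQ }

  ^-swap : ∀ x m n → (x ^ m) ^ n ≡ (x ^ n) ^ m
  ^-swap x m n = trans (^-*-assoc x m n) (trans (cong (x ^_) (*-comm m n)) (sym (^-*-assoc x n m)))

  -- In exponents, 16M · 29/60 is compared with 6M + 5. All is raised to the power 60: 464 = 16 ·
  -- 29, 360 = 6 · 60, 300 = 5 · 60. What remains is H^104 ≤ T^60 c^300, and H ≥ c³ since M ≥ 3.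
  too-large : ∀ c M P T → 3 ≤ M → 0 < c → c ^ 29 < P ^ 30 * P ^ 30 → P ^ ((M + M) * 8) ≤ T * ((c ^ M) ^ 6 * c ^ 5) → c ^ 12 ≤ T ^ 60
  too-large c M P T 3≤M 0<c ratio bound = *-cancelˡ-≤ (c ^ 300) {{m^n≢0 c 300}} (begin
      c ^ 300 * c ^ 12       ≡⟨ cong₂ _*_ (^-*-assoc c 3 100) (^-*-assoc c 3 4) ⟨
      (c ^ 3) ^ 100 * (c ^ 3) ^ 4  ≤⟨ *-mono-≤ (^-monoˡ-≤ 100 c³≤H) (^-monoˡ-≤ 4 c³≤H) ⟩
      H ^ 100 * H ^ 4        ≤⟨ *-cancelˡ-≤ (H ^ 360) {{m^n≢0 H 360 {{m^n≢0 c M}}}} core ⟩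
      T ^ 60 * c ^ 300       ≡⟨ *-comm (T ^ 60) (c ^ 300) ⟩
      c ^ 300 * T ^ 60       ∎)
    where
    open ≤-Reasoning
    instance c≢0 = >-nonZero 0<c
    H e : ℕ
    H = c ^ M
    e = (M + M) * 8
    c³≤H : c ^ 3 ≤ H
    c³≤H = ^-monoʳ-≤ c 3≤M
    H^464 : (c ^ 29) ^ e ≡ H ^ 360 * (H ^ 100 * H ^ 4)
    H^464 = trans (^-swap c 29 e) (trans (cong (_^ 29) (trans (sym (^-*-assoc c (M + M) 8)) (cong (_^ 8) (trans (^-distribˡ-+-* c M M) (cong (H *_) (sym (*-identityʳ H)))))))
            (trans (trans (cong (_^ 29) (^-*-assoc H 2 8)) (^-*-assoc H 16 29)) (trans (^-distribˡ-+-* H 360 104) (cong (H ^ 360 *_) (^-distribˡ-+-* H 100 4)))))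
    core : H ^ 360 * (H ^ 100 * H ^ 4) ≤ H ^ 360 * (T ^ 60 * c ^ 300)
    core = begin
      H ^ 360 * (H ^ 100 * H ^ 4)      ≡⟨ H^464 ⟨
      (c ^ 29) ^ e                     ≤⟨ ^-monoˡ-≤ e (<⇒≤ ratio) ⟩
      (P ^ 30 * P ^ 30) ^ e            ≡⟨ cong (_^ e) (^-distribˡ-+-* P 30 30) ⟨
      (P ^ 60) ^ e                     ≡⟨ ^-swap P 60 e ⟩
      (P ^ e) ^ 60                     ≤⟨ ^-monoˡ-≤ 60 bound ⟩
      (T * (H ^ 6 * c ^ 5)) ^ 60       ≡⟨ *-^-comm T (H ^ 6 * c ^ 5) 60 ⟩
      T ^ 60 * (H ^ 6 * c ^ 5) ^ 60    ≡⟨ cong (T ^ 60 *_) (*-^-comm (H ^ 6) (c ^ 5) 60) ⟩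
      T ^ 60 * ((H ^ 6) ^ 60 * (c ^ 5) ^ 60) ≡⟨ cong₂ (λ u v → T ^ 60 * (u * v)) (^-*-assoc H 6 60) (^-*-assoc c 5 60) ⟩
      T ^ 60 * (H ^ 360 * c ^ 300)     ≡⟨ l (T ^ 60) (H ^ 360) (c ^ 300) ⟩
      H ^ 360 * (T ^ 60 * c ^ 300)     ∎
      where
      l : ∀ t h c → t * (h * c) ≡ h * (t * c)
      l = solve-∀

  abstract
    constant-bound : ∀ c → 10 ^ 1000 < c → ¬ c ^ 12 ≤ (1024 ^ 8 * 2) ^ 60
    constant-bound c lt le = <⇒≱ (<-≤-trans step (^-monoˡ-≤ 12 (<⇒≤ lt))) le
      where
      step : (1024 ^ 8 * 2) ^ 60 < (10 ^ 1000) ^ 12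
      step = <ᵇ⇒< ((1024 ^ 8 * 2) ^ 60) ((10 ^ 1000) ^ 12) _

  module _ (c k : ℕ) (10^1000<c : 10 ^ 1000 < c) (S : System c (A c (suc k)) (E (suc k))) where

    private
      M : ℕ
      M = E (suc k)

      16≤c : 16 ≤ c
      16≤c = ≤-trans (≤ᵇ⇒≤ 16 (10 ^ 1000) _) (<⇒≤ 10^1000<c)

      0<c : 0 < c
      0<c = ≤-trans (s≤s z≤n) 16≤c

      E≥1 : ∀ k → 1 ≤ E k
      E≥1 zero    = ≤-refl
      E≥1 (suc k) = s≤s z≤n

      3≤M : 3 ≤ M
      3≤M = s≤s (+-mono-≤ (E≥1 k) (E≥1 k))

      A²≤ : A c (suc k) * A c (suc k) ≤ c ^ M
      A²≤ = begin
        A c (suc k) * A c (suc k)      ≤⟨ *-mono-≤ (A-upper c k 4≤c) (A-upper c k 4≤c) ⟩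
        2 * c ^ E k * (2 * c ^ E k)    ≡⟨ l (c ^ E k) ⟩
        4 * (c ^ E k * c ^ E k)        ≤⟨ *-monoˡ-≤ (c ^ E k * c ^ E k) 4≤c ⟩
        c * (c ^ E k * c ^ E k)        ≡⟨ ^-E-suc c k ⟨
        c ^ M                          ∎
        where
        open ≤-Reasoning
        4≤c : 4 ≤ c
        4≤c = ≤-trans (≤ᵇ⇒≤ 4 16 _) 16≤c
        l : ∀ z → 2 * z * (2 * z) ≡ 4 * (z * z)
        l = solve-∀

      A⊥c : Coprime (A c (suc k)) c
      A⊥c = A-coprime c (suc k)

      -- 2 · 32 = 64 pays for the loss at the prime 2; with μ ≤ 5x and y ≤ 3x the bound on 64μy is
      -- 64 · 15 = 960 ≤ 1024 times x².
      module Sz = Size S 3≤M A⊥c 0<c (A-coprime c (suc (suc k))) A²≤ 16≤c 32 1024 (λ ()) (≤ᵇ⇒≤ 960 1024 _)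

      contradict : ∀ sel sel′ → (∀ p w → Prime p → sel p w ≡ true → 0 < w → ExactPower sel c 0<c p w → Admissible S 3≤M A⊥c 0<c p w) →
                   (∀ p e → sel p e ≡ true ⊎ sel′ p e ≡ true) → RatioBound (primeProd sel c) (primeProd sel′ c) c → ⊥
      contradict sel sel′ adm either ratio = constant-bound c 10^1000<c (too-large c M P (1024 ^ 8 * 2) 3≤M 0<c
          (ratio-bound (115 ^ 30) (100 ^ 30) P Q c (^-monoˡ-≤ 30 (≤ᵇ⇒≤ 100 115 _)) 0<c (∣⇒≤ {{PQ≢0}} (complementary sel sel′ c 0<c either)) ratio)
          (Sz.power-bound P P∣ P⊥u))
        where
        P Q : ℕ
        P = primeProd sel c
        Q = primeProd sel′ c
        PQ≢0 : NonZero (P * Q)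
        PQ≢0 = m*n≢0 P Q {{primeProd-nonZero sel c}} {{primeProd-nonZero sel′ c}}
        P∣ : P ^ (M + M) ∣ 2 * 32 * (System.μ S * System.y S)
        P∣ = primeProd-^-∣ sel c 0<c (M + M) _ λ p w pr s 0<w ex → local-bound S 3≤M A⊥c 0<c (adm p w pr s 0<w ex) {2 * 32} ∣-refl
        P⊥u : Coprime P (Sz.Root.u Sz.root)
        P⊥u = primeProd-coprime sel c 0<c _ λ p w pr s 0<w ex d → Admissible.p∤x (adm p w pr s 0<w ex) (Sz.Root.p∣u⇒p∣x Sz.root p pr d)

    odd-part-contradiction : RatioBound (primeProd oddV c) (primeProd evenV c) c → ⊥
    odd-part-contradiction = contradict oddV evenV
      (λ p w pr s 0<w ex → odd-admissible S 3≤M A⊥c 0<c p w pr (odd-w w s) 0<w ex) odd-or-even-V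
      where
      odd-w : ∀ w → (w % 2 ≡ᵇ 1) ≡ true → ¬ 2 ∣ w
      odd-w w e d = case-0 (subst (λ z → (z ≡ᵇ 1) ≡ true) (n∣m⇒m%n≡0 w 2 d) e)
        where
        case-0 : (0 ≡ᵇ 1) ≡ true → ⊥
        case-0 ()

    square-part-contradiction : ∀ κ → c ≡ κ * κ → RatioBound (primeProd not1mod4 c) (primeProd is1mod4 c) c → ⊥
    square-part-contradiction κ c≡ = contradict not1mod4 is1mod4
      (λ p w pr s 0<w ex → Square.square-admissible S 3≤M A⊥c 0<c κ c≡ (A-mod-c c (suc k)) p w pr (≢1 p s) 0<w ex) mod4-dichotomy
      where
      ≢1 : ∀ p → not (p % 4 ≡ᵇ 1) ≡ true → p % 4 ≢ 1
      ≢1 p s e = case-1 (subst (λ z → not (z ≡ᵇ 1) ≡ true) e s)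
        where
        case-1 : not (1 ≡ᵇ 1) ≡ true → ⊥
        case-1 ()
  module _ where
    private
      difference : ∀ s z t r → 0 < r → + s ℤ.* (+ z ℤ.- + t) ≡ + r → ∃ λ d → z ≡ t + d × s * d ≡ r
      difference s z t r 0<r e = [ below , above ]′ (≤-total t z)
        where
        l : ∀ s t d → s ℤ.* (t ℤ.+ d ℤ.- t) ≡ s ℤ.* d
        l = ℤ-Solver.solve-∀
        l′ : ∀ s z d → s ℤ.* (z ℤ.- (z ℤ.+ d)) ℤ.+ s ℤ.* d ≡ + 0
        l′ = ℤ-Solver.solve-∀
        below : t ≤ z → ∃ λ d → z ≡ t + d × s * d ≡ r
        below t≤z with m≤n⇒∃[o]m+o≡n t≤z
        ... | d , refl = d , refl , ℤₚ.+-injective (trans (ℤₚ.pos-* s d) (trans (sym (l (+ s) (+ t) (+ d))) e))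
        above : z ≤ t → ∃ λ d → z ≡ t + d × s * d ≡ r
        above z≤t with m≤n⇒∃[o]m+o≡n z≤t
        ... | d , refl = contradiction (m+n≡0⇒m≡0 r (ℤₚ.+-injective (trans (cong₂ ℤ._+_ (sym e) (ℤₚ.pos-* s d)) (l′ (+ s) (+ z) (+ d))))) (λ z → <⇒≢ 0<r (sym z))

    module _ (c A M : ℕ) (0<c : 0 < c) where

      private
        N a : ℕ
        N = suc (M + M)
        a = A * A + c ^ M

        square-pos : ∀ z → ∃ λ n → z ℤ.* z ≡ + (n * n)
        square-pos (+ n)    = n , sym (ℤₚ.pos-* n n)
        square-pos -[1+ n ] = suc n , refl

        module Build (x : ℕ) (e₁ : + (4 * (x * x)) ℤ.* (+ (x * x) ℤ.- + a) ≡ + (c ^ N)) where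
          private
            D : ∃ λ d → x * x ≡ a + d × 4 * (x * x) * d ≡ c ^ N
            D = difference (4 * (x * x)) (x * x) a (c ^ N) (m^n>0 c {{>-nonZero 0<c}} N) e₁
          b : ℕ
          b = proj₁ D
          x² : x * x ≡ a + b
          x² = proj₁ (proj₂ D)
          4x²b : 4 * (x * x) * b ≡ c ^ N
          4x²b = proj₂ (proj₂ D)
          0<b : 0 < b
          0<b = n≢0⇒n>0 λ e → ≢-nonZero⁻¹ (c ^ N) {{m^n≢0 c N {{>-nonZero 0<c}}}} (trans (sym 4x²b) (trans (cong (4 * (x * x) *_) e) (*-zeroʳ (4 * (x * x)))))
          A≤x : A ≤ x
          A≤x = ≮⇒≥ λ x<A → <⇒≱ (*-mono-< x<A x<A) (≤-trans (m≤m+n (A * A) (c ^ M)) (≤-trans (m≤m+n a b) (≤-reflexive (sym x²))))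
          b≡ : + (x * x) ℤ.- + a ≡ + b
          b≡ = trans (cong (λ z → + z ℤ.- + a) x²) (l (+ a) (+ b))
            where
            l : ∀ a b → a ℤ.+ b ℤ.- a ≡ b
            l = ℤ-Solver.solve-∀
          d : ℕ
          d = x ∸ A
          x≡ : x ≡ A + d
          x≡ = sym (m+[n∸m]≡n A≤x)
          product≡ : d * (x + A) ≡ b + c ^ M
          product≡ = +-cancelˡ-≡ (A * A) _ _ (trans (cong (λ z → A * A + d * (z + A)) x≡) (trans (l A d) (trans (cong (λ z → z * z) (sym x≡)) (trans x² (l′ (A * A) (c ^ M) b)))))
            where
            l : ∀ A d → A * A + d * (A + d + A) ≡ (A + d) * (A + d)
            l = solve-∀
            l′ : ∀ s h b → s + h + b ≡ s + (b + h)
            l′ = solve-∀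

      -- The difference b = α² - a is positive because its product with 4α² is c^N. Here μ = |ν² -
      -- 2(A + α)| and y = |ν² - (A + α)|; completing the square in the second equation gives y² =
      -- X² + b.
      system : ∀ α ν → + 4 ℤ.* (α ℤ.* α) ℤ.* (α ℤ.* α ℤ.- + a) ≡ + (c ^ N) →
               ν ℤ.* ν ℤ.* (ν ℤ.* ν ℤ.- + 2 ℤ.* (+ A ℤ.+ α)) ≡ α ℤ.* α ℤ.- + a → System c A M
      system (+ x) ν e₁ e₂ = record
        { x = x ; b = b ; n = n ; μ = μ ; y = X + μ ; X = X ; X̃ = d
        ; x² = x² ; 4x²b = 4x²b ; n²μ = proj₂ (proj₂ D)
        ; XX̃ = trans (*-comm X d) product≡
        ; y² = trans (l X μ) (cong (λ z → X * X + z) (trans (cong (_* μ) (sym n²≡)) (proj₂ (proj₂ D))))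
        ; sign = inj₁ (refl , trans (+-comm d A) (sym x≡) , n²≡′ , refl) }
        where
        xx : + x ℤ.* + x ≡ + (x * x)
        xx = sym (ℤₚ.pos-* x x)
        open Build x (trans (cong₂ ℤ._*_ (trans (ℤₚ.pos-* 4 (x * x)) (cong (+ 4 ℤ.*_) (sym xx))) (cong (ℤ._- + a) (sym xx))) e₁)
        n X : ℕ
        n = proj₁ (square-pos ν)
        X = x + A
        nn : ν ℤ.* ν ≡ + (n * n)
        nn = proj₂ (square-pos ν)
        D : ∃ λ μ → n * n ≡ 2 * X + μ × n * n * μ ≡ b
        D = difference (n * n) (n * n) (2 * X) b 0<b (trans (cong (λ z → + (n * n) ℤ.* (+ (n * n) ℤ.- z)) (trans (ℤₚ.pos-* 2 X) (cong (λ z → + 2 ℤ.* z) (trans (cong +_ (+-comm x A)) refl))))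
              (trans (cong₂ (λ u v → u ℤ.* (v ℤ.- + 2 ℤ.* (+ A ℤ.+ + x))) (sym nn) (sym nn)) (trans e₂ (trans (cong (ℤ._- + a) xx) b≡))))
        μ : ℕ
        μ = proj₁ D
        n²≡ : n * n ≡ 2 * X + μ
        n²≡ = proj₁ (proj₂ D)
        n²≡′ : n * n ≡ μ + 2 * X
        n²≡′ = trans n²≡ (+-comm (2 * X) μ)
        l : ∀ X μ → (X + μ) * (X + μ) ≡ X * X + (2 * X + μ) * μ
        l = solve-∀
      system -[1+ x₀ ] ν e₁ e₂ = record
        { x = x ; b = b ; n = n ; μ = n * n + 2 * d ; y = d + n * n ; X = d ; X̃ = x + A
        ; x² = x² ; 4x²b = 4x²b ; n²μ = n²μ
        ; XX̃ = product≡
        ; y² = trans (l d (n * n)) (cong (λ z → d * d + z) n²μ)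
        ; sign = inj₂ (trans (+-comm d A) (sym x≡) , refl , refl , l″ (n * n) d) }
        where
        x : ℕ
        x = suc x₀
        open Build x (trans (cong (ℤ._* (+ (x * x) ℤ.- + a)) (ℤₚ.pos-* 4 (x * x))) e₁)
        n : ℕ
        n = proj₁ (square-pos ν)
        nn : ν ℤ.* ν ≡ + (n * n)
        nn = proj₂ (square-pos ν)
        -A-x : + 2 ℤ.* (+ A ℤ.+ -[1+ x₀ ]) ≡ ℤ.- (+ (2 * d))
        -A-x = trans (cong (λ z → + 2 ℤ.* (+ A ℤ.- + z)) x≡) (trans (l₀ (+ A) (+ d)) (cong ℤ.-_ (sym (ℤₚ.pos-* 2 d))))
          where
          l₀ : ∀ A d → + 2 ℤ.* (A ℤ.- (A ℤ.+ d)) ≡ ℤ.- (+ 2 ℤ.* d)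
          l₀ = ℤ-Solver.solve-∀
        n²μ : n * n * (n * n + 2 * d) ≡ b
        n²μ = ℤₚ.+-injective (trans (ℤₚ.pos-* (n * n) (n * n + 2 * d)) (trans (cong₂ (λ u v → u ℤ.* (v ℤ.+ + (2 * d))) (sym nn) (sym nn))
                (trans (cong (λ z → ν ℤ.* ν ℤ.* (ν ℤ.* ν ℤ.+ z)) (trans (sym (ℤₚ.neg-involutive (+ (2 * d)))) (cong ℤ.-_ (sym -A-x)))) (trans e₂ b≡))))
        l : ∀ X m → (X + m) * (X + m) ≡ X * X + m * (m + 2 * X)
        l = solve-∀
        l″ : ∀ m d → m + 2 * d ≡ d + (d + m)
        l″ = solve-∀

-- Elimination identities for coordinates of square roots

module RationalIdentities where

  open Fields
  open import Data.Rational using (ℚ; 0ℚ; 1ℚ; _+_; _*_; -_)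
  import Data.Rational.Properties as ℚₚ
  open import Relation.Binary.PropositionalEquality
  open import Relation.Nullary.Decidable using (dec⇒maybe)
  open import Tactic.RingSolver using (solve-∀)
  open import Tactic.RingSolver.Core.AlmostCommutativeRing using (AlmostCommutativeRing; fromCommutativeRing)
  open import Level using (0ℓ)

  ℚ-ring : AlmostCommutativeRing 0ℓ 0ℓ
  ℚ-ring = fromCommutativeRing ℚₚ.+-*-commutativeRing (λ x → dec⇒maybe (0ℚ ℚₚ.≟ x))

  2ℚ 4ℚ : ℚ
  2ℚ = 1ℚ + 1ℚ
  4ℚ = 2ℚ + 2ℚ

  -- Coordinates with respect to x₁, where x₁² = 0 - r: the hypotheses say that g + g₁x₁ has square
  -- o′ - x₁.
  module _ {r o o′ g g₁ d₀ d₁ : ℚ} (q₁ : g * g + (0ℚ + - r) * (g₁ * g₁) ≡ o′ + - 0ℚ) (q₂ : g * g₁ + g₁ * g ≡ 0ℚ + - 1ℚ) where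

    quartic₁ : 4ℚ * (g * g) * (g * g) ≡ r + 4ℚ * (g * g) * o′
    quartic₁ = trans (l g g₁ r) (trans (cong₂ (λ u v → r * (u * u) + 4ℚ * (g * g) * v) q₂ q₁) (l′ r (4ℚ * (g * g)) o′))
      where
      l : ∀ g g₁ r → 4ℚ * (g * g) * (g * g) ≡ r * ((g * g₁ + g₁ * g) * (g * g₁ + g₁ * g)) + 4ℚ * (g * g) * (g * g + (0ℚ + - r) * (g₁ * g₁))
      l = solve-∀ ℚ-ring
      l′ : ∀ r z o → r * ((0ℚ + - 1ℚ) * (0ℚ + - 1ℚ)) + z * (o + - 0ℚ) ≡ r + z * o
      l′ = solve-∀ ℚ-ring

    -- The hypotheses are the two coordinates of 2u² = o + γ, where u = d₀ + d₁x₁ and γ = g + g₁x₁.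
    -- Eliminating d₁ and g₁ leaves a quartic in e = 2d₀.
    quartic₂ : (d₀ * d₀ + (0ℚ + - r) * (d₁ * d₁)) + (d₀ * d₀ + (0ℚ + - r) * (d₁ * d₁)) ≡ o + g →
               (d₀ * d₁ + d₁ * d₀) + (d₀ * d₁ + d₁ * d₀) ≡ 0ℚ + g₁ →
               let e = d₀ + d₀ in e * e * (e * e) + o′ ≡ g * g + 2ℚ * (e * e) * (o + g)
    quartic₂ q₃ q₄ = trans (cong (e * e * (e * e) +_) (trans (l₀ o′) (sym q₁))) (trans (cong (λ z → e * e * (e * e) + (g * g + (0ℚ + - r) * (z * z))) (trans (l₁ g₁) (sym q₄)))
                       (trans (l₂ d₀ d₁ r g) (cong (λ z → g * g + 2ℚ * (e * e) * z) q₃)))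
      where
      e : ℚ
      e = d₀ + d₀
      l₀ : ∀ o → o ≡ o + - 0ℚ
      l₀ = solve-∀ ℚ-ring
      l₁ : ∀ g → g ≡ 0ℚ + g
      l₁ = solve-∀ ℚ-ring
      l₂ : ∀ d₀ d₁ r g → (d₀ + d₀) * (d₀ + d₀) * ((d₀ + d₀) * (d₀ + d₀)) + (g * g + (0ℚ + - r) * (((d₀ * d₁ + d₁ * d₀) + (d₀ * d₁ + d₁ * d₀)) * ((d₀ * d₁ + d₁ * d₀) + (d₀ * d₁ + d₁ * d₀))))
          ≡ g * g + 2ℚ * ((d₀ + d₀) * (d₀ + d₀)) * ((d₀ * d₀ + (0ℚ + - r) * (d₁ * d₁)) + (d₀ * d₀ + (0ℚ + - r) * (d₁ * d₁)))
      l₂ = solve-∀ ℚ-ring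

  -- The hypotheses express (a + bx₁)² = x₁ - r. Eliminating a by 2ab = 1 leaves 4b⁴ - 4b² = c.
  special-quartic : ∀ {r c a b} → r * c ≡ 1ℚ → a * a + (0ℚ + - r) * (b * b) ≡ 0ℚ + - r → a * b + b * a ≡ 1ℚ + - 0ℚ →
                    let B = b + b in B * B * (B * B) ≡ 4ℚ * (B * B) + 4ℚ * c
  special-quartic {r} {c} {a} {b} rc q₁ q₂ = trans (l₁ ((b + b) * (b + b))) (trans (cong (λ z → (b + b) * (b + b) * ((b + b) * (b + b)) * z) (sym rc))
      (trans (l₂ a b r c) (trans (cong₂ (λ u v → 4ℚ * c * (u * u) + - (4ℚ * ((b + b) * (b + b)) * c * v)) q₂ q₁) (trans (l₃ r c ((b + b) * (b + b))) (trans (cong (λ z → 4ℚ * c + 4ℚ * ((b + b) * (b + b)) * z) rc) (l₄ c ((b + b) * (b + b))))))))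
    where
    l₁ : ∀ z → z * z ≡ z * z * 1ℚ
    l₁ = solve-∀ ℚ-ring
    l₂ : ∀ a b r c → (b + b) * (b + b) * ((b + b) * (b + b)) * (r * c)
        ≡ 4ℚ * c * ((a * b + b * a) * (a * b + b * a)) + - (4ℚ * ((b + b) * (b + b)) * c * (a * a + (0ℚ + - r) * (b * b)))
    l₂ = solve-∀ ℚ-ring
    l₃ : ∀ r c z → 4ℚ * c * ((1ℚ + - 0ℚ) * (1ℚ + - 0ℚ)) + - (4ℚ * z * c * (0ℚ + - r)) ≡ 4ℚ * c + 4ℚ * z * (r * c)
    l₃ = solve-∀ ℚ-ring
    l₄ : ∀ c z → 4ℚ * c + 4ℚ * z * 1ℚ ≡ 4ℚ * z + 4ℚ * c
    l₄ = solve-∀ ℚ-ring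

  -- The quartic relations in terms of α = g Q and ν = e S, where Q = S² clears the denominators.
  scale₁ : ∀ {r g o′ Q a n} → 4ℚ * (g * g) * (g * g) ≡ r + 4ℚ * (g * g) * o′ → o′ * (Q * Q) ≡ a → r * (Q * Q * (Q * Q)) ≡ n →
           let β = (g + g) * Q in β * β * (β * β) ≡ 4ℚ * a * (β * β) + 4ℚ * n
  scale₁ {r} {g} {o′} {Q} {a} {n} q e e′ = trans (l g Q) (trans (cong (λ z → 4ℚ * z * (Q * Q * (Q * Q))) q) (trans (l′ r g o′ Q) (cong₂ (λ u v → 4ℚ * u * ((g + g) * Q * ((g + g) * Q)) + 4ℚ * v) e e′)))
    where
    l : ∀ g Q → (g + g) * Q * ((g + g) * Q) * ((g + g) * Q * ((g + g) * Q)) ≡ 4ℚ * (4ℚ * (g * g) * (g * g)) * (Q * Q * (Q * Q))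
    l = solve-∀ ℚ-ring
    l′ : ∀ r g o Q → 4ℚ * (r + 4ℚ * (g * g) * o) * (Q * Q * (Q * Q))
        ≡ 4ℚ * (o * (Q * Q)) * ((g + g) * Q * ((g + g) * Q)) + 4ℚ * (r * (Q * Q * (Q * Q)))
    l′ = solve-∀ ℚ-ring

  scale₂ : ∀ {g o o′ e S a A α} → e * e * (e * e) + o′ ≡ g * g + 2ℚ * (e * e) * (o + g) → o′ * (S * S * (S * S)) ≡ a → o * (S * S) ≡ A → g * (S * S) ≡ α →
           let ν = e * S in ν * ν * (ν * ν) + a ≡ α * α + 2ℚ * (A + α) * (ν * ν)
  scale₂ {g} {o} {o′} {e} {S} {a} {A} {α} q ea eA eα = trans (cong (e * S * (e * S) * (e * S * (e * S)) +_) (sym ea)) (trans (l e S o′) (trans (cong (_* (S * S * (S * S))) q)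
      (trans (l′ g e o S) (cong₂ (λ u v → u * u + 2ℚ * (v + u) * (e * S * (e * S))) eα eA))))
    where
    l : ∀ e S o → e * S * (e * S) * (e * S * (e * S)) + o * (S * S * (S * S)) ≡ (e * e * (e * e) + o) * (S * S * (S * S))
    l = solve-∀ ℚ-ring
    l′ : ∀ g e o S → (g * g + 2ℚ * (e * e) * (o + g)) * (S * S * (S * S)) ≡ g * (S * S) * (g * (S * S)) + 2ℚ * (o * (S * S) + g * (S * S)) * (e * S * (e * S))
    l′ = solve-∀ ℚ-ring

  orbit-step : ∀ {r o Q A n} → o * Q ≡ A → r * (Q * Q) ≡ n → (o * o + r) * (Q * Q) ≡ A * A + n
  orbit-step {r} {o} {Q} e e′ = trans (l r o Q) (cong₂ (λ u v → u * u + v) e e′)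
    where
    l : ∀ r o Q → (o * o + r) * (Q * Q) ≡ o * Q * (o * Q) + r * (Q * Q)
    l = solve-∀ ℚ-ring

-- From rational to integral data, for negative and for positive c

module RationalOrbits where

  open CriticalSequence using (IsSq; E; A; ^-E-suc)
  open Fields
  open RootTower
  open RationalIdentities
  open import Defs using (IsSquare; SpecialForm)
  open IntegerDivisibility using (abs-∣; ∣-abs; euclid-sq)
  open LargeParameter using (system)
  open LocalAnalysis using (System)
  open import Data.Integer as ℤ using (ℤ; +_)
  import Data.Integer.Properties as ℤₚ
  open import Data.Integer.Divisibility.Signed using () renaming (_∣_ to infix 4 _∣ᶻ_; divides to dividesᶻ)
  import Data.Integer.Tactic.RingSolver as ℤ-Solver
  open import Data.Nat as ℕ using (ℕ; zero; suc; s≤s; z≤n)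
  import Data.Nat.Properties as ℕₚ
  import Data.Nat.Divisibility as ℕ∣
  open import Data.Nat.Coprimality as Cop using (Coprime)
  open import Data.Nat.Primality using (prime[2])
  open import Data.Product using (∃; _×_; _,_; proj₁; proj₂)
  open import Data.Rational as ℚ using (ℚ; mkℚ; 0ℚ; 1ℚ; ½; _+_; _*_; -_; _≤_; _<_)
  import Data.Rational.Properties as ℚₚ
  open import Data.Rational.Unnormalised as ℚᵘ using (*≡*)
  import Data.Rational.Unnormalised.Properties as ℚᵘₚ
  open import Data.Sum using ([_,_]′)
  open import Relation.Binary.PropositionalEquality
  open import Relation.Nullary using (¬_)
  open import Tactic.RingSolver using (solve-∀)

  ι : ℤ → ℚ
  ι z = mkℚ z 0 (Cop.sym (Cop.1-coprimeTo ℤ.∣ z ∣))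

  ι-+ : ∀ a b → ι (a ℤ.+ b) ≡ ι a + ι b
  ι-+ a b = ℚₚ.toℚᵘ-injective (ℚᵘₚ.≃-trans (*≡* (l a b)) (ℚᵘₚ.≃-sym (ℚₚ.toℚᵘ-homo-+ (ι a) (ι b))))
    where
    l : ∀ a b → (a ℤ.+ b) ℤ.* + 1 ≡ (a ℤ.* + 1 ℤ.+ b ℤ.* + 1) ℤ.* + 1
    l = ℤ-Solver.solve-∀

  ι-* : ∀ a b → ι (a ℤ.* b) ≡ ι a * ι b
  ι-* a b = ℚₚ.toℚᵘ-injective (ℚᵘₚ.≃-trans (*≡* refl) (ℚᵘₚ.≃-sym (ℚₚ.toℚᵘ-homo-* (ι a) (ι b))))

  ι-injective : ∀ {a b} → ι a ≡ ι b → a ≡ b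
  ι-injective = cong ℚ.numerator

  numerator-* : ∀ a d .(cop : Coprime ℤ.∣ a ∣ (suc d)) → mkℚ a d cop * ι (+ suc d) ≡ ι a
  numerator-* a d cop = ℚₚ.toℚᵘ-injective (ℚᵘₚ.≃-trans (ℚₚ.toℚᵘ-homo-* (mkℚ a d cop) (ι (+ suc d)))
    (*≡* (trans (ℤₚ.*-identityʳ (a ℤ.* + suc d)) (cong (λ z → a ℤ.* + suc z) (sym (ℕₚ.*-identityʳ d))))))

  ι-quartic : ∀ a s t n → ι (a ℤ.* a ℤ.* (a ℤ.* a)) ≡ ι s * (ι a * ι a) * (ι n * ι n) + ι t * (ι n * ι n * (ι n * ι n)) →
              a ℤ.* a ℤ.* (a ℤ.* a) ≡ s ℤ.* (a ℤ.* a) ℤ.* (n ℤ.* n) ℤ.+ t ℤ.* (n ℤ.* n ℤ.* (n ℤ.* n))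
  ι-quartic a s t n e = ι-injective (trans e (sym (trans (ι-+ (s ℤ.* (a ℤ.* a) ℤ.* (n ℤ.* n)) (t ℤ.* (n ℤ.* n ℤ.* (n ℤ.* n)))) (cong₂ _+_
      (trans (ι-* (s ℤ.* (a ℤ.* a)) (n ℤ.* n)) (cong₂ _*_ (trans (ι-* s (a ℤ.* a)) (cong (ι s *_) (ι-* a a))) (ι-* n n)))
      (trans (ι-* t (n ℤ.* n ℤ.* (n ℤ.* n))) (cong (ι t *_) (trans (ι-* (n ℤ.* n) (n ℤ.* n)) (cong₂ _*_ (ι-* n n) (ι-* n n)))))))))

  -- The denominator of a root of x⁴ = s x² + t divides the fourth power of its numerator.
  integral-root : ∀ q s t → q * q * (q * q) ≡ ι s * (q * q) + ι t → ∃ λ z → q ≡ ι z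
  integral-root (mkℚ a d cop) s t e = a , same d cop (ℕₚ.suc-injective (cop₀ (n∣a , ℕ∣.∣-refl)))
    where
    n : ℕ
    n = suc d
    q : ℚ
    q = mkℚ a d cop
    cop₀ : Coprime ℤ.∣ a ∣ n
    cop₀ = Cop.recompute cop
    l₁ : ∀ q n → q * n * (q * n) * (q * n * (q * n)) ≡ q * q * (q * q) * (n * n * (n * n))
    l₁ = solve-∀ ℚ-ring
    l₂ : ∀ q n s t → (s * (q * q) + t) * (n * n * (n * n)) ≡ s * (q * n * (q * n)) * (n * n) + t * (n * n * (n * n))
    l₂ = solve-∀ ℚ-ring
    quartic : a ℤ.* a ℤ.* (a ℤ.* a) ≡ s ℤ.* (a ℤ.* a) ℤ.* (+ n ℤ.* + n) ℤ.+ t ℤ.* (+ n ℤ.* + n ℤ.* (+ n ℤ.* + n))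
    quartic = ι-quartic a s t (+ n) (trans (trans (ι-* (a ℤ.* a) (a ℤ.* a)) (cong₂ _*_ (ι-* a a) (ι-* a a)))
        (trans (cong (λ z → z * z * (z * z)) (sym (numerator-* a d cop))) (trans (l₁ q (ι (+ n))) (trans (cong (_* (ι (+ n) * ι (+ n) * (ι (+ n) * ι (+ n)))) e)
        (trans (l₂ q (ι (+ n)) (ι s) (ι t)) (cong (λ z → ι s * (z * z) * (ι (+ n) * ι (+ n)) + ι t * (ι (+ n) * ι (+ n) * (ι (+ n) * ι (+ n)))) (numerator-* a d cop)))))))
    l₃ : ∀ a s t n → s ℤ.* (a ℤ.* a) ℤ.* (n ℤ.* n) ℤ.+ t ℤ.* (n ℤ.* n ℤ.* (n ℤ.* n)) ≡ (s ℤ.* (a ℤ.* a) ℤ.* n ℤ.+ t ℤ.* (n ℤ.* n ℤ.* n)) ℤ.* n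
    l₃ = ℤ-Solver.solve-∀
    n∣a⁴ : n ℕ∣.∣ ℤ.∣ a ∣ ℕ.* ℤ.∣ a ∣ ℕ.* (ℤ.∣ a ∣ ℕ.* ℤ.∣ a ∣)
    n∣a⁴ = subst (n ℕ∣.∣_) (trans (ℤₚ.abs-* (a ℤ.* a) (a ℤ.* a)) (cong₂ ℕ._*_ (ℤₚ.abs-* a a) (ℤₚ.abs-* a a)))
             (abs-∣ {n} {a ℤ.* a ℤ.* (a ℤ.* a)} (dividesᶻ (s ℤ.* (a ℤ.* a) ℤ.* + n ℤ.+ t ℤ.* (+ n ℤ.* + n ℤ.* + n)) (trans quartic (l₃ a s t (+ n)))))
    n∣a : n ℕ∣.∣ ℤ.∣ a ∣
    n∣a = drop (drop (drop (subst (n ℕ∣.∣_) (trans (ℕₚ.*-assoc ℤ.∣ a ∣ ℤ.∣ a ∣ (ℤ.∣ a ∣ ℕ.* ℤ.∣ a ∣)) refl) n∣a⁴)))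
      where
      drop : ∀ {z} → n ℕ∣.∣ ℤ.∣ a ∣ ℕ.* z → n ℕ∣.∣ z
      drop = Cop.coprime-divisor (Cop.sym cop₀)
    same : ∀ d .(cop : Coprime ℤ.∣ a ∣ (suc d)) → d ≡ 0 → mkℚ a d cop ≡ ι a
    same .0 cop refl = refl

  integral-square : ∀ q t → q * q ≡ ι t → ∃ λ z → t ≡ z ℤ.* z
  integral-square q t e = go (integral-root q t (+ 0) (trans (cong (_* (q * q)) e) (l (ι t * (q * q)))))
    where
    l : ∀ z → z ≡ z + 0ℚ
    l = solve-∀ ℚ-ring
    go : (∃ λ z → q ≡ ι z) → ∃ λ z → t ≡ z ℤ.* z
    go (z , refl) = z , ι-injective (trans (sym e) (sym (ι-* z z)))

  natural-square : ∀ m → (∃ λ z → + m ≡ z ℤ.* z) → IsSq m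
  natural-square m (z , e) = ℤ.∣ z ∣ , trans (cong ℤ.∣_∣ e) (ℤₚ.abs-* z z)

  half-unique : ∀ x y → x + x ≡ y + y → x ≡ y
  half-unique x y e = trans (sym (l x)) (trans (cong (½ *_) e) (l y))
    where
    l : ∀ x → ½ * (x + x) ≡ x
    l = solve-∀ ℚ-ring

  +-cancelʳ : ∀ z x y → x + z ≡ y + z → x ≡ y
  +-cancelʳ z x y e = trans (l x z) (trans (cong (_+ - z) e) (sym (l y z)))
    where
    l : ∀ x z → x ≡ x + z + - z
    l = solve-∀ ℚ-ring

  square≥0 : ∀ q → 0ℚ ≤ q * q
  square≥0 q = [ (λ 0≤q → subst (_≤ q * q) (ℚₚ.*-zeroʳ q) (ℚₚ.*-monoˡ-≤-nonNeg q {{ℚ.nonNegative 0≤q}} 0≤q))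
               , (λ q≤0 → subst (_≤ q * q) (ℚₚ.*-zeroʳ q) (ℚₚ.*-monoˡ-≤-nonPos q {{ℚ.nonPositive q≤0}} q≤0)) ]′ (ℚₚ.≤-total 0ℚ q)

  <⇒≱ : ∀ {p q} → p < q → ¬ (q ≤ p)
  <⇒≱ p<q q≤p = ℚₚ.<-irrefl refl (ℚₚ.<-≤-trans p<q q≤p)

  reciprocal : ∀ n → ℚ
  reciprocal n = mkℚ (+ 1) n (Cop.1-coprimeTo (suc n))

  recip≡ : ∀ n → (+ 1) ℚ./ suc n ≡ reciprocal n
  recip≡ n = ℚₚ.fromℚᵘ-toℚᵘ (reciprocal n)

  reciprocal-* : ∀ n → reciprocal n * ι (+ suc n) ≡ 1ℚ
  reciprocal-* n = numerator-* (+ 1) n (Cop.1-coprimeTo (suc n))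

  reciprocal>0 : ∀ n → 0ℚ < reciprocal n
  reciprocal>0 n = ℚₚ.positive⁻¹ (reciprocal n)

  module Negative (n : ℕ) where

    private
      ρ r : ℚ
      ρ = reciprocal (suc n)
      r = - ρ

    open Tower r

    private
      ρ<1 : ρ < 1ℚ
      ρ<1 = ℚ.*<* (ℤ.+<+ (s≤s (s≤s z≤n)))

      r≤0 : r ≤ 0ℚ
      r≤0 = ℚₚ.neg-antimono-≤ (ℚₚ.<⇒≤ (reciprocal>0 (suc n)))

      -- As 0 < ρ < 1, a point o of [r, 0] has o² ≤ r² = ρ² < ρ, so o² + r is again in the interval
      -- and negative.
      in-interval : ∀ o → r ≤ o → o ≤ 0ℚ → r ≤ o * o + r × o * o + r < 0ℚ
      in-interval o r≤o o≤0 = subst (_≤ o * o + r) (ℚₚ.+-identityˡ r) (ℚₚ.+-monoˡ-≤ r (square≥0 o))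
                            , subst (o * o + r <_) (ℚₚ.+-inverseʳ ρ) (ℚₚ.+-monoˡ-< r o²<ρ)
        where
        l : ∀ ρ → - ρ * - ρ ≡ ρ * ρ
        l = solve-∀ ℚ-ring
        o²≤ : o * o ≤ r * r
        o²≤ = ℚₚ.≤-trans (ℚₚ.*-monoʳ-≤-nonPos o {{ℚ.nonPositive o≤0}} r≤o) (ℚₚ.*-monoˡ-≤-nonPos r {{ℚ.nonPositive r≤0}} r≤o)
        o²<ρ : o * o < ρ
        o²<ρ = ℚₚ.≤-<-trans o²≤ (subst₂ _<_ (sym (l ρ)) (ℚₚ.*-identityʳ ρ) (ℚₚ.*-monoʳ-<-pos ρ {{ℚ.positive (reciprocal>0 (suc n))}} ρ<1))

      orbit-interval : ∀ m → r ≤ orbit (suc m) × orbit (suc m) < 0ℚ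
      orbit-interval zero    = in-interval 0ℚ r≤0 ℚₚ.≤-refl
      orbit-interval (suc m) = in-interval (orbit (suc m)) (proj₁ (orbit-interval m)) (ℚₚ.<⇒≤ (proj₂ (orbit-interval m)))

    orbit-nonsquare : ∀ m → ¬ (∃ λ q → q * q ≡ orbit (suc m))
    orbit-nonsquare m (q , e) = <⇒≱ (proj₂ (orbit-interval m)) (subst (0ℚ ≤_) e (square≥0 q))

    first-nonsquare : ¬ IsSquare (+ suc (suc n)) → ¬ Level.NextSquare level₀
    first-nonsquare nsq (q , e) = nsq (integral-square (q * C) (+ suc (suc n)) (trans (l q C) (trans (cong (λ z → z * C * C) e) (trans (l′ ρ C) (trans (cong (_* C) (reciprocal-* (suc n))) (ℚₚ.*-identityˡ C))))))
      where
      C : ℚ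
      C = ι (+ suc (suc n))
      l : ∀ q c → q * c * (q * c) ≡ q * q * c * c
      l = solve-∀ ℚ-ring
      l′ : ∀ ρ c → (0ℚ + - - ρ) * c * c ≡ ρ * c * c
      l′ = solve-∀ ℚ-ring

  module Positive (n : ℕ) where

    private
      c : ℕ
      c = suc n
      r : ℚ
      r = reciprocal n

    open Tower r

    private
      rc : r * ι (+ c) ≡ 1ℚ
      rc = reciprocal-* n

      -- This is c^(2^k), the denominator of f^(k+1)(0).
      Q : ℕ → ℕ
      Q zero    = c
      Q (suc k) = Q k ℕ.* Q k

      Q-suc : ∀ k → Q (suc k) ≡ c ℕ.* c ℕ.^ E k
      Q-suc zero    = cong (c ℕ.*_) (sym (ℕₚ.*-identityʳ c))
      Q-suc (suc k) = trans (cong₂ ℕ._*_ (Q-suc k) (Q-suc k)) (trans (l c (c ℕ.^ E k)) (cong (c ℕ.*_) (sym (^-E-suc c k))))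
        where
        open import Data.Nat.Tactic.RingSolver renaming (solve-∀ to solveℕ)
        l : ∀ c e → c ℕ.* e ℕ.* (c ℕ.* e) ≡ c ℕ.* (c ℕ.* (e ℕ.* e))
        l = solveℕ

      ι-*ℕ : ∀ a b → ι (+ (a ℕ.* b)) ≡ ι (+ a) * ι (+ b)
      ι-*ℕ a b = trans (cong ι (ℤₚ.pos-* a b)) (ι-* (+ a) (+ b))

      rQ : ∀ k → r * (ι (+ Q k) * ι (+ Q k)) ≡ ι (+ (c ℕ.^ E k))
      rQ k = trans (cong (r *_) (trans (sym (ι-*ℕ (Q k) (Q k))) (trans (cong (λ z → ι (+ z)) (Q-suc k)) (ι-*ℕ c (c ℕ.^ E k)))))
               (trans (sym (ℚₚ.*-assoc r (ι (+ c)) (ι (+ (c ℕ.^ E k))))) (trans (cong (_* ι (+ (c ℕ.^ E k))) rc) (ℚₚ.*-identityˡ _)))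

      orbit-scaled : ∀ k → orbit (suc k) * ι (+ Q k) ≡ ι (+ A c k)
      orbit-scaled zero    = trans (l r (ι (+ c))) rc
        where
        l : ∀ r c → (0ℚ * 0ℚ + r) * c ≡ r * c
        l = solve-∀ ℚ-ring
      orbit-scaled (suc k) = trans (cong (orbit (suc (suc k)) *_) (ι-*ℕ (Q k) (Q k))) (trans (orbit-step {r} {orbit (suc k)} {ι (+ Q k)} {ι (+ A c k)} {ι (+ (c ℕ.^ E k))} (orbit-scaled k) (rQ k))
          (trans (cong (_+ ι (+ (c ℕ.^ E k))) (sym (ι-*ℕ (A c k) (A c k)))) (sym (ι-+ (+ (A c k ℕ.* A c k)) (+ (c ℕ.^ E k))))))

    orbit-square : ∀ k → (∃ λ q → q * q ≡ orbit (suc (suc k))) → IsSq (A c (suc k))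
    orbit-square k (q , e) = natural-square (A c (suc k)) (integral-square (q * ι (+ Q k)) (+ A c (suc k))
        (trans (l q (ι (+ Q k))) (trans (cong₂ _*_ e (sym (ι-*ℕ (Q k) (Q k)))) (orbit-scaled (suc k)))))
      where
      l : ∀ q s → q * s * (q * s) ≡ q * q * (s * s)
      l = solve-∀ ℚ-ring

    nsq₀ : ¬ Level.NextSquare level₀
    nsq₀ (q , e) = <⇒≱ (subst (_< 0ℚ) (sym (ℚₚ.+-identityˡ (- r))) (ℚₚ.neg-antimono-< (reciprocal>0 n))) (subst (0ℚ ≤_) e (square≥0 q))

    private
      2∣⁴ : ∀ z w → z ℤ.* z ℤ.* (z ℤ.* z) ≡ w ℤ.* + 2 → (+ 2) ∣ᶻ z
      2∣⁴ z w e = euclid-sq z prime[2] (euclid-sq (z ℤ.* z) prime[2] (dividesᶻ w e))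

      ι-quartic′ : ∀ z s t → ι z * ι z * (ι z * ι z) ≡ ι s * (ι z * ι z) + ι t → z ℤ.* z ℤ.* (z ℤ.* z) ≡ s ℤ.* (z ℤ.* z) ℤ.+ t
      ι-quartic′ z s t e = ι-injective (trans (trans (ι-* (z ℤ.* z) (z ℤ.* z)) (cong₂ _*_ (ι-* z z) (ι-* z z))) (trans e (sym (trans (ι-+ (s ℤ.* (z ℤ.* z)) t)
          (cong (_+ ι t) (trans (ι-* s (z ℤ.* z)) (cong (ι s *_) (ι-* z z))))))))

    -- B = 2b is a rational root of X⁴ = 4X² + 4c, hence an integer, and it is even; B = 2m gives c
    -- = 4m²(m² - 1).
    special : Level.NextSquare (level₁ nsq₀) → SpecialForm (+ c)
    special ((a , b) , e) = go (integral-root B (+ 4) (+ 4 ℤ.* + c) quartic)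
      where
      B : ℚ
      B = b + b
      quartic : B * B * (B * B) ≡ ι (+ 4) * (B * B) + ι (+ 4 ℤ.* + c)
      quartic = trans (special-quartic {r} {ι (+ c)} {a} {b} rc (cong proj₁ e) (cong proj₂ e)) (cong (λ z → 4ℚ * (B * B) + z) (sym (ι-* (+ 4) (+ c))))
      go : (∃ λ z → B ≡ ι z) → SpecialForm (+ c)
      go (z , eB) = even (2∣⁴ z (+ 2 ℤ.* (z ℤ.* z) ℤ.+ + 2 ℤ.* + c) (trans z⁴ (l (z ℤ.* z) (+ c))))
        where
        z⁴ : z ℤ.* z ℤ.* (z ℤ.* z) ≡ + 4 ℤ.* (z ℤ.* z) ℤ.+ + 4 ℤ.* + c
        z⁴ = ι-quartic′ z (+ 4) (+ 4 ℤ.* + c) (subst (λ x → x * x * (x * x) ≡ ι (+ 4) * (x * x) + ι (+ 4 ℤ.* + c)) eB quartic)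
        l : ∀ w c → + 4 ℤ.* w ℤ.+ + 4 ℤ.* c ≡ (+ 2 ℤ.* w ℤ.+ + 2 ℤ.* c) ℤ.* + 2
        l = ℤ-Solver.solve-∀
        even : (+ 2) ∣ᶻ z → SpecialForm (+ c)
        even (dividesᶻ m em) = m , ℤₚ.*-cancelˡ-≡ (+ 4) _ _ (trans (l₁ (z ℤ.* z) (+ c)) (trans (cong (λ x → x ℤ.- + 4 ℤ.* (z ℤ.* z)) (sym z⁴)) (trans (cong (λ x → x ℤ.* x ℤ.* (x ℤ.* x) ℤ.- + 4 ℤ.* (x ℤ.* x)) em) (l₂ m))))
          where
          l₁ : ∀ w c → + 4 ℤ.* c ≡ + 4 ℤ.* w ℤ.+ + 4 ℤ.* c ℤ.- + 4 ℤ.* w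
          l₁ = ℤ-Solver.solve-∀
          l₂ : ∀ m → m ℤ.* + 2 ℤ.* (m ℤ.* + 2) ℤ.* (m ℤ.* + 2 ℤ.* (m ℤ.* + 2)) ℤ.- + 4 ℤ.* (m ℤ.* + 2 ℤ.* (m ℤ.* + 2)) ≡ + 4 ℤ.* (+ 4 ℤ.* (m ℤ.* m) ℤ.* (m ℤ.* m ℤ.- + 1))
          l₂ = ℤ-Solver.solve-∀

    module _ (nsq₁ : ¬ Level.NextSquare (level₁ nsq₀)) (j : ℕ) where

      private
        k M a : ℕ
        k = suc j
        M = E k
        a = A c (suc k)
        S o o′ : ℚ
        S  = ι (+ Q j)
        o  = orbit (suc k)
        o′ = orbit (suc (suc k))

        o-scaled : o * (S * S) ≡ ι (+ A c k)
        o-scaled = trans (cong (o *_) (sym (ι-*ℕ (Q j) (Q j)))) (orbit-scaled k)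

        S⁴ : ι (+ Q (suc k)) ≡ S * S * (S * S)
        S⁴ = trans (ι-*ℕ (Q k) (Q k)) (cong₂ _*_ (ι-*ℕ (Q j) (Q j)) (ι-*ℕ (Q j) (Q j)))

        o′-scaled : o′ * (S * S * (S * S)) ≡ ι (+ a)
        o′-scaled = trans (cong (o′ *_) (sym S⁴)) (orbit-scaled (suc k))

        r-scaled : r * (S * S * (S * S) * (S * S * (S * S))) ≡ ι (+ (c ℕ.^ suc (M ℕ.+ M)))
        r-scaled = trans (cong (λ z → r * (z * z)) (sym S⁴)) (rQ (suc k))

      -- Let u + v x₂ be the square root and γ = g + g₁x₁ its norm. The denominator of o =
      -- f^(k+1)(0) is a square S² because k ≥ 1. Both 2gS² and 2d₀S are roots of monic integral
      -- quartics; the first is moreover even, so α = gS² and ν = 2d₀S are integers.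
      square⇒system : Level.OrbitSquare (level₂ nsq₀ nsq₁) (suc k) → System c (A c k) (E k)
      square⇒system ((u@(d₀ , d₁) , v) , e) = first (integral-root β (+ 4 ℤ.* + a) (+ 4 ℤ.* + n₄) β-quartic)
        where
        module L = Level (level₁ nsq₀)
        δ : L.Carrier
        δ = L.x L.+ L.- L.ι r
        γ : ∃ λ γ → γ L.* γ ≡ L.ι o′ L.+ L.- L.x
        γ = orbitSquare-down (level₁ nsq₀) nsq₁ (suc k) ((u , v) , e)
        g g₁ : ℚ
        g  = proj₁ (proj₁ γ)
        g₁ = proj₂ (proj₁ γ)
        n₄ : ℕ
        n₄ = c ℕ.^ suc (M ℕ.+ M)
        -- the sum of u² + δ v² = o and the norm γ = u² - δ v²
        doubled : u L.* u L.+ u L.* u ≡ L.ι o L.+ proj₁ γ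
        doubled = trans (cong (λ z → u L.* u L.+ z) (sym (trans (cong (λ z → u L.* u L.+ z) (L.-‿inverseʳ w)) (L.+-identityʳ (u L.* u)))))
          (trans (rearrange (u L.* u) w (L.- w)) (cong (L._+ proj₁ γ) (trans (cong proj₁ e) (trans (cong (L.ι o L.+_) -0≡0) (L.+-identityʳ (L.ι o))))))
          where
          w : L.Carrier
          w = δ L.* (v L.* v)
          -0≡0 : L.- L.0# ≡ L.0#
          -0≡0 = trans (sym (L.+-identityˡ (L.- L.0#))) (L.-‿inverseʳ L.0#)
          rearrange : ∀ x y z → x L.+ (x L.+ (y L.+ z)) ≡ x L.+ y L.+ (x L.+ z)
          rearrange x y z = trans (cong (x L.+_) (trans (sym (L.+-assoc x y z)) (trans (cong (L._+ z) (L.+-comm x y)) (L.+-assoc y x z)))) (sym (L.+-assoc x y (x L.+ z)))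
        q₁ : g * g + (0ℚ + - r) * (g₁ * g₁) ≡ o′ + - 0ℚ
        q₁ = cong proj₁ (proj₂ γ)
        q₂ : g * g₁ + g₁ * g ≡ 0ℚ + - 1ℚ
        q₂ = cong proj₂ (proj₂ γ)
        ε β ν : ℚ
        ε = d₀ + d₀
        β = (g + g) * (S * S)
        ν = ε * S
        β-quartic : β * β * (β * β) ≡ ι (+ 4 ℤ.* + a) * (β * β) + ι (+ 4 ℤ.* + n₄)
        β-quartic = trans (scale₁ {r} {g} {o′} {S * S} {ι (+ a)} {ι (+ n₄)} (quartic₁ {r} {o} {o′} {g} {g₁} {d₀} {d₁} q₁ q₂) o′-scaled r-scaled)
                      (cong₂ (λ x y → x * (β * β) + y) (sym (ι-* (+ 4) (+ a))) (sym (ι-* (+ 4) (+ n₄))))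
        first : (∃ λ z → β ≡ ι z) → System c (A c k) (E k)
        first (z , eβ) = halve (2∣⁴ z (+ 2 ℤ.* + a ℤ.* (z ℤ.* z) ℤ.+ + 2 ℤ.* + n₄) (trans z⁴ (l (+ a) (z ℤ.* z) (+ n₄))))
          where
          z⁴ : z ℤ.* z ℤ.* (z ℤ.* z) ≡ + 4 ℤ.* + a ℤ.* (z ℤ.* z) ℤ.+ + 4 ℤ.* + n₄
          z⁴ = ι-quartic′ z (+ 4 ℤ.* + a) (+ 4 ℤ.* + n₄) (subst (λ x → x * x * (x * x) ≡ ι (+ 4 ℤ.* + a) * (x * x) + ι (+ 4 ℤ.* + n₄)) eβ β-quartic)
          l : ∀ a w n → + 4 ℤ.* a ℤ.* w ℤ.+ + 4 ℤ.* n ≡ (+ 2 ℤ.* a ℤ.* w ℤ.+ + 2 ℤ.* n) ℤ.* + 2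
          l = ℤ-Solver.solve-∀
          halve : (+ 2) ∣ᶻ z → System c (A c k) (E k)
          halve (dividesᶻ w ew) = second (integral-root ν (+ 2 ℤ.* (+ A c k ℤ.+ w)) (w ℤ.* w ℤ.- + a) ν-quartic′)
            where
            α≡ : g * (S * S) ≡ ι w
            α≡ = half-unique (g * (S * S)) (ι w) (trans (sym (ℚₚ.*-distribʳ-+ (S * S) g g)) (trans eβ (trans (cong ι (trans ew (l₁ w))) (ι-+ w w))))
              where
              l₁ : ∀ w → w ℤ.* + 2 ≡ w ℤ.+ w
              l₁ = ℤ-Solver.solve-∀
            e₁ : + 4 ℤ.* (w ℤ.* w) ℤ.* (w ℤ.* w ℤ.- + a) ≡ + n₄
            e₁ = ℤₚ.*-cancelˡ-≡ (+ 4) _ _ (trans (l₁ w (+ a)) (trans (cong (λ x → x ℤ.* x ℤ.* (x ℤ.* x) ℤ.- + 4 ℤ.* + a ℤ.* (x ℤ.* x)) (sym ew))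
                   (trans (cong (λ x → x ℤ.- + 4 ℤ.* + a ℤ.* (z ℤ.* z)) z⁴) (l₂ (+ 4 ℤ.* + a ℤ.* (z ℤ.* z)) (+ n₄)))))
              where
              l₁ : ∀ w a → + 4 ℤ.* (+ 4 ℤ.* (w ℤ.* w) ℤ.* (w ℤ.* w ℤ.- a)) ≡ w ℤ.* + 2 ℤ.* (w ℤ.* + 2) ℤ.* (w ℤ.* + 2 ℤ.* (w ℤ.* + 2)) ℤ.- + 4 ℤ.* a ℤ.* (w ℤ.* + 2 ℤ.* (w ℤ.* + 2))
              l₁ = ℤ-Solver.solve-∀
              l₂ : ∀ x n → x ℤ.+ + 4 ℤ.* n ℤ.- x ≡ + 4 ℤ.* n
              l₂ = ℤ-Solver.solve-∀
            ν-quartic : ν * ν * (ν * ν) + ι (+ a) ≡ ι w * ι w + 2ℚ * (ι (+ A c k) + ι w) * (ν * ν)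
            ν-quartic = scale₂ {g} {o} {o′} {ε} {S} {ι (+ a)} {ι (+ A c k)} {ι w} (quartic₂ {r} {o} {o′} {g} {g₁} {d₀} {d₁} q₁ q₂ (cong proj₁ doubled) (cong proj₂ doubled)) o′-scaled o-scaled α≡
            t : ℤ
            t = w ℤ.* w ℤ.- + a
            t+a : ι t + ι (+ a) ≡ ι w * ι w
            t+a = trans (sym (ι-+ t (+ a))) (trans (cong ι (l₁ (w ℤ.* w) (+ a))) (ι-* w w))
              where
              l₁ : ∀ x a → x ℤ.- a ℤ.+ a ≡ x
              l₁ = ℤ-Solver.solve-∀
            ν-quartic′ : ν * ν * (ν * ν) ≡ ι (+ 2 ℤ.* (+ A c k ℤ.+ w)) * (ν * ν) + ι t
            ν-quartic′ = +-cancelʳ (ι (+ a)) (ν * ν * (ν * ν)) (ι (+ 2 ℤ.* (+ A c k ℤ.+ w)) * (ν * ν) + ι t) (trans ν-quartic (trans (cong (λ z → z + 2ℚ * (ι (+ A c k) + ι w) * (ν * ν)) (sym t+a))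
                (trans (l₁ (ι t) (ι (+ a)) (2ℚ * (ι (+ A c k) + ι w)) (ν * ν)) (cong (λ x → x * (ν * ν) + ι t + ι (+ a)) (sym (trans (ι-* (+ 2) (+ A c k ℤ.+ w)) (cong (2ℚ *_) (ι-+ (+ A c k) w))))))))
              where
              l₁ : ∀ t a s n → t + a + s * n ≡ s * n + t + a
              l₁ = solve-∀ ℚ-ring
            second : (∃ λ y → ν ≡ ι y) → System c (A c k) (E k)
            second (y , eν) = system c (A c k) (E k) (s≤s z≤n) w y e₁ (trans (l₁ (y ℤ.* y) (+ 2 ℤ.* (+ A c k ℤ.+ w)))
                (trans (cong (λ z → z ℤ.- + 2 ℤ.* (+ A c k ℤ.+ w) ℤ.* (y ℤ.* y)) (ι-quartic′ y (+ 2 ℤ.* (+ A c k ℤ.+ w)) t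
                  (subst (λ x → x * x * (x * x) ≡ ι (+ 2 ℤ.* (+ A c k ℤ.+ w)) * (x * x) + ι t) eν ν-quartic′))) (l₂ (+ 2 ℤ.* (+ A c k ℤ.+ w) ℤ.* (y ℤ.* y)) t)))
              where
              l₁ : ∀ n s → n ℤ.* (n ℤ.- s) ≡ n ℤ.* n ℤ.- s ℤ.* n
              l₁ = ℤ-Solver.solve-∀
              l₂ : ∀ x t → x ℤ.+ t ℤ.- x ≡ t
              l₂ = ℤ-Solver.solve-∀

-- The theorem from the conditions on c

open import Defs
open CriticalSequence
open OddParameter using (odd-nonsquare)
open BoundedRange using (bounded-nonsquare)
open ThirdIterate using (third-nonsquare)
open QuadraticResidues
open LocalAnalysis using (System)
open LargeParameter
open RootTower
open RationalOrbits hiding (<⇒≱; +-cancelʳ; ι)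
open import Data.Empty using (⊥; ⊥-elim)
open import Data.Integer as ℤ using (ℤ; +_; -[1+_]; 0ℤ; -1ℤ; ∣_∣)
import Data.Integer.Properties as ℤₚ
open import Data.Integer.Divisibility using () renaming (_∣_ to _∣ℤ_)
import Data.Integer.Tactic.RingSolver as ℤ-Solver
open import Data.Bool using (true)
open import Data.List using (_∷_)
open import Data.List.Relation.Unary.Any using (Any; here; there)
open import Data.Nat
open import Data.Nat.Properties
open import Data.Nat.Divisibility
open import Data.Nat.DivMod
open import Data.Nat.Tactic.RingSolver using (solve-∀)
open import Data.Product using (∃; _×_; _,_; proj₁; proj₂)
open import Data.Rational using () renaming (-_ to -ℚ_)
open import Data.Sum using (_⊎_; inj₁; inj₂; [_,_]′)
open import Relation.Binary.PropositionalEquality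
open import Relation.Nullary using (¬_; contradiction)
open import Relation.Nullary.Decidable using (toSum)

Conditions : ℤ → Set
Conditions c = Cond1 c ⊎ Cond2 c ⊎ Cond3 c ⊎ Cond4 c ⊎ Cond5 c ⊎ Cond6 c ⊎ Cond7 c

negative-square : ∀ n k → -[1+ n ] ≢ k ℤ.* k
negative-square n (+ k) e = contradiction (trans e (sym (ℤₚ.pos-* k k))) λ ()
negative-square n -[1+ k ] ()

negative-nonsquare : ∀ n → Conditions -[1+ n ] → ¬ IsSquare (+ suc n)
negative-nonsquare n (inj₁ (nsq , _)) = nsq
negative-nonsquare n (inj₂ (inj₁ (nsq , _))) = nsq
negative-nonsquare n (inj₂ (inj₂ (inj₁ (nsq , _)))) = nsq
negative-nonsquare n (inj₂ (inj₂ (inj₂ (inj₁ (nsq , _))))) = nsq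
negative-nonsquare n (inj₂ (inj₂ (inj₂ (inj₂ (inj₁ (nsq , _)))))) = nsq
negative-nonsquare n (inj₂ (inj₂ (inj₂ (inj₂ (inj₂ (inj₁ ((k , _ , e) , _))))))) = ⊥-elim (negative-square n k e)
negative-nonsquare n (inj₂ (inj₂ (inj₂ (inj₂ (inj₂ (inj₂ (_ , () , _)))))))

negative-case : ∀ n → ¬ IsSquare (+ suc (suc n)) → ∀ m → Irreducible (iterF (-ℚ reciprocal (suc n)) m)
negative-case n nsq = all-irreducible nsq₀ nsq₁ (λ s → orbit-nonsquare 2 (nextSquare-level₂-down nsq₀ nsq₁ s))
    (λ m s → orbit-nonsquare (3 + m) (orbitSquare-level₂-down nsq₀ nsq₁ (2 + m) s))
  where
  open Negative n
  open Tower (-ℚ reciprocal (suc n))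
  nsq₀ : ¬ Level.NextSquare level₀
  nsq₀ = first-nonsquare nsq
  nsq₁ : ¬ Level.NextSquare (level₁ nsq₀)
  nsq₁ s = orbit-nonsquare 1 (nextSquare-level₁-down nsq₀ s)

-- The fields exclude squares at level 1, at level 2 and above. `later` is given both the square
-- term and the system, so that either can be contradicted.
record Obstructed (c : ℕ) : Set where
  field
    not-special : ¬ SpecialForm (+ c)
    third       : ¬ IsSq (A c 2)
    later       : ∀ j → IsSq (A c (3 + j)) → System c (A c (suc j)) (E (suc j)) → ⊥

positive-case : ∀ n → Obstructed (suc n) → ∀ m → Irreducible (iterF (reciprocal n) m)
positive-case n ob = all-irreducible nsq₀ nsq₁ (λ s → third (orbit-square 1 (nextSquare-level₂-down nsq₀ nsq₁ s)))
    (λ j s → later j (orbit-square (2 + j) (orbitSquare-level₂-down nsq₀ nsq₁ (2 + j) s)) (square⇒system nsq₁ j s))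
  where
  open Obstructed ob
  open Positive n
  open Tower (reciprocal n)
  nsq₁ : ¬ Level.NextSquare (level₁ nsq₀)
  nsq₁ s = not-special (special s)

all-nonsquare : ∀ c → ¬ SpecialForm (+ c) → (∀ j → ¬ IsSq (A c (2 + j))) → Obstructed c
all-nonsquare c ns nsq = record { not-special = ns ; third = nsq 0 ; later = λ j sq _ → nsq (suc j) sq }

special-even : ∀ c → SpecialForm (+ c) → 2 ∣ c
special-even c (m , e) = subst (2 ∣_) (sym (trans (cong ∣_∣ (trans e (l (m ℤ.* m)))) (ℤₚ.abs-* (+ 2) (+ 2 ℤ.* (m ℤ.* m) ℤ.* (m ℤ.* m ℤ.- + 1))))) (m∣m*n ∣ + 2 ℤ.* (m ℤ.* m) ℤ.* (m ℤ.* m ℤ.- + 1) ∣)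
  where
  l : ∀ w → + 4 ℤ.* w ℤ.* (w ℤ.- + 1) ≡ + 2 ℤ.* (+ 2 ℤ.* w ℤ.* (w ℤ.- + 1))
  l = ℤ-Solver.solve-∀

special-square : ∀ c → SpecialForm (+ c) → IsSquare (+ c ℤ.+ ℤ.1ℤ)
special-square c (m , e) = + 2 ℤ.* (m ℤ.* m) ℤ.- + 1 , trans (cong (ℤ._+ + 1) e) (l (m ℤ.* m))
  where
  l : ∀ w → + 4 ℤ.* w ℤ.* (w ℤ.- + 1) ℤ.+ + 1 ≡ (+ 2 ℤ.* w ℤ.- + 1) ℤ.* (+ 2 ℤ.* w ℤ.- + 1)
  l = ℤ-Solver.solve-∀

sq⇒square : ∀ c → IsSq (A c 1) → IsSquare (+ c ℤ.+ ℤ.1ℤ)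
sq⇒square c (b , e) = + b , trans (cong +_ (trans (+-comm c 1) (trans (cong suc (sym (*-identityʳ c))) e))) (ℤₚ.pos-* b b)

consecutive-squares : ∀ k b → 0 < k → k * k + 1 ≢ b * b
consecutive-squares k b 0<k e = [ (λ b≤k → <⇒≱ (≤-reflexive (trans (+-comm 1 (k * k)) e)) (*-mono-≤ b≤k b≤k))
                               , (λ k<b → <⇒≱ below (≤-trans (*-mono-≤ k<b k<b) (≤-reflexive (sym e)))) ]′ (≤-<-connex b k)
  where
  l : ∀ k → suc (k * k + 1) + (k + k) ≡ suc k * suc k + 1
  l = solve-∀
  below : k * k + 1 < suc k * suc k
  below = +-cancelʳ-≤ 1 _ _ (≤-trans (+-monoʳ-≤ (suc (k * k + 1)) (≤-trans 0<k (m≤m+n k k))) (≤-reflexive (l k)))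

-- The size estimates start at c = 6. For c = 2 the prime 3 divides c + 1, and c = 4 is the residue
-- 1 modulo 3.
small-nonsquare : ∀ c → 2 ∣ c → 0 < c → c ≤ 10 ^ 1000 → ∀ j → ¬ IsSq (A c (2 + j))
small-nonsquare 1 d _ _ = contradiction (∣⇒≤ d) λ { (s≤s ()) }
small-nonsquare 2 _ _ _ = residue₂-nonsquare 2 3 three-nonsquare refl ∣-refl
  where
  three-nonsquare : ¬ IsSq 3
  three-nonsquare (0 , ())
  three-nonsquare (1 , ())
  three-nonsquare (suc (suc b) , e) = contradiction (subst (4 ≤_) (sym e) (*-mono-≤ {2} {2 + b} {2} {2 + b} (s≤s (s≤s z≤n)) (s≤s (s≤s z≤n)))) λ { (s≤s (s≤s (s≤s ()))) }
small-nonsquare 3 d _ _ = contradiction d (2∣∧2∤ 1)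
small-nonsquare 4 d 0<c _ = residue₃-nonsquare 4 five-nonsquare (third-nonsquare 4 d 0<c) 3 1 refl refl
  where
  five-nonsquare : ¬ IsSq 5
  five-nonsquare (0 , ())
  five-nonsquare (1 , ())
  five-nonsquare (2 , ())
  five-nonsquare (suc (suc (suc b)) , e) = contradiction (subst (9 ≤_) (sym e) (*-mono-≤ {3} {3 + b} {3} {3 + b} (s≤s (s≤s (s≤s z≤n))) (s≤s (s≤s (s≤s z≤n))))) λ { (s≤s (s≤s (s≤s (s≤s (s≤s ()))))) }
small-nonsquare 5 d _ _ = contradiction d (2∣∧2∤ 2)
small-nonsquare c@(suc (suc (suc (suc (suc (suc _)))))) d 0<c le = bounded-nonsquare c d (s≤s (s≤s (s≤s (s≤s (s≤s (s≤s z≤n)))))) le (third-nonsquare c d 0<c)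

residues-agree : ∀ c a m .{{_ : NonZero m}} → m ∣ ∣ + c ℤ.- + a ∣ → c % m ≡ a % m
residues-agree c a m d = [ above , below ]′ (≤-total a c)
  where
  above : a ≤ c → c % m ≡ a % m
  above a≤c with m≤n⇒∃[o]m+o≡n a≤c
  ... | e , refl = %-remove-+ʳ a (subst (m ∣_) (cong ∣_∣ (l (+ a) (+ e))) d)
    where
    l : ∀ a e → a ℤ.+ e ℤ.- a ≡ e
    l = ℤ-Solver.solve-∀
  below : c ≤ a → c % m ≡ a % m
  below c≤a with m≤n⇒∃[o]m+o≡n c≤a
  ... | e , refl = sym (%-remove-+ʳ c (subst (m ∣_) (trans (cong ∣_∣ (l (+ c) (+ e))) (ℤₚ.∣-i∣≡∣i∣ (+ e))) d))
    where
    l : ∀ c e → c ℤ.- (c ℤ.+ e) ≡ ℤ.- e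
    l = ℤ-Solver.solve-∀

table-nonsquare : ∀ c t → checkTable t ≡ true → ¬ IsSq (A c 1) → ¬ IsSq (A c 2) →
                  Any (λ { (m , rs) → Any (λ a → (+ m) ∣ℤ (+ c ℤ.- + a)) rs }) t → ∀ j → ¬ IsSq (A c (2 + j))
table-nonsquare c ((m , rs) ∷ t) ok nsq₁ nsq₂ (here h) = at (any-residue m rs (proj₁ (∧-true {checkResidues m rs} ok)) h)
  where
  at : (∃ λ a → checkEntry m a ≡ true × (+ m) ∣ℤ (+ c ℤ.- + a)) → ∀ j → ¬ IsSq (A c (2 + j))
  at (a , chk , d) = residue₃-nonsquare c nsq₁ nsq₂ m a chk (residues-agree c a m d)
table-nonsquare c ((m , rs) ∷ t) ok nsq₁ nsq₂ (there h) = table-nonsquare c t (proj₂ (∧-true {checkResidues m rs} ok)) nsq₁ nsq₂ h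

bounded-or-large : ∀ c → 2 ∣ c → 0 < c → ¬ SpecialForm (+ c) → (∀ j → 10 ^ 1000 < c → System c (A c (suc j)) (E (suc j)) → ⊥) → Obstructed c
bounded-or-large c 2∣c 0<c ns large = [ (λ le → all-nonsquare c ns (small-nonsquare c 2∣c 0<c le))
  , (λ lt → record { not-special = ns ; third = third-nonsquare c 2∣c 0<c ; later = λ j _ S → large j lt S }) ]′ (≤-<-connex c (10 ^ 1000))

even-obstructed : ∀ n → let c = suc n in 2 ∣ c → Conditions (+ c) → Obstructed c
even-obstructed n 2∣c (inj₁ (_ , ℤ.+<+ ()))
even-obstructed n 2∣c (inj₂ (inj₁ (_ , nsq , p , _ , p≡3 , d))) =
  all-nonsquare (suc n) (λ s → nsq (special-square (suc n) s)) (residue₂-nonsquare (suc n) p (λ s → nsq (sq⇒square (suc n) s)) p≡3 d)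
even-obstructed n 2∣c (inj₂ (inj₂ (inj₁ (_ , nsq , t)))) =
  all-nonsquare (suc n) (λ s → nsq (special-square (suc n) s))
    (table-nonsquare (suc n) table table-checked (λ s → nsq (sq⇒square (suc n) s)) (third-nonsquare (suc n) 2∣c (s≤s z≤n)) t)
even-obstructed n 2∣c (inj₂ (inj₂ (inj₂ (inj₁ (_ , 2∤c))))) = contradiction 2∣c 2∤c
even-obstructed n 2∣c (inj₂ (inj₂ (inj₂ (inj₂ (inj₁ (_ , ns , ratio)))))) =
  bounded-or-large (suc n) 2∣c (s≤s z≤n) ns λ j lt S → odd-part-contradiction (suc n) j lt S ratio
even-obstructed n 2∣c (inj₂ (inj₂ (inj₂ (inj₂ (inj₂ (inj₁ ((k , _ , e) , ratio))))))) =
  bounded-or-large (suc n) 2∣c (s≤s z≤n) not-special λ j lt S → square-part-contradiction (suc n) j lt S ∣ k ∣ c≡ ratio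
  where
  c≡ : suc n ≡ ∣ k ∣ * ∣ k ∣
  c≡ = trans (cong ∣_∣ e) (ℤₚ.abs-* k k)
  -- The special form would make c + 1 a square right after the positive square c.
  not-special : ¬ SpecialForm (+ suc n)
  not-special s = go (special-square (suc n) s)
    where
    go : IsSquare (+ suc n ℤ.+ ℤ.1ℤ) → ⊥
    go (b , eb) = consecutive-squares ∣ k ∣ ∣ b ∣ (n≢0⇒n>0 λ z → 1+n≢0 (trans c≡ (cong (λ w → w * w) z)))
      (trans (cong (_+ 1) (sym c≡)) (trans (cong ∣_∣ eb) (ℤₚ.abs-* b b)))
even-obstructed n 2∣c (inj₂ (inj₂ (inj₂ (inj₂ (inj₂ (inj₂ (ns , _ , ℤ.+≤+ le))))))) =
  all-nonsquare (suc n) ns (small-nonsquare (suc n) 2∣c (s≤s z≤n) le)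

obstructed : ∀ n → Conditions (+ suc n) → Obstructed (suc n)
obstructed n conds = [ (λ 2∣c → even-obstructed n 2∣c conds)
  , (λ 2∤c → all-nonsquare (suc n) (λ s → 2∤c (special-even (suc n) s)) (λ j → odd-nonsquare (suc n) j 2∤c)) ]′ (toSum (2 ∣? suc n))

theorem1p2 : (c : ℤ) → c ≢ 0ℤ → c ≢ -1ℤ
           → Cond1 c ⊎ Cond2 c ⊎ Cond3 c ⊎ Cond4 c ⊎ Cond5 c ⊎ Cond6 c ⊎ Cond7 c
           → (n : ℕ) → 1 ≤ n → Irreducible (iterF (recip c) n)
theorem1p2 (+ zero)        c≢0 _ _ = contradiction refl c≢0
theorem1p2 (+ suc m)       _ _ conds n _ = subst (λ r → Irreducible (iterF r n)) (sym (recip≡ m)) (positive-case m (obstructed m conds) n)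
theorem1p2 -[1+ zero ]     _ c≢-1 _ = contradiction refl c≢-1
theorem1p2 -[1+ suc m ]    _ _ conds n _ = subst (λ r → Irreducible (iterF r n)) (cong -ℚ_ (sym (recip≡ (suc m)))) (negative-case m (negative-nonsquare (suc m) conds) n)
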